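{- For every $\varepsilon>0$ there is a constant $C_\varepsilon>0$ such that for every prime $p$ we have $F(p)\le C_\varepsilon\, p^{1/8+\varepsilon}$.
   Context: Let $p$ be a prime and $\mathbb{F}_p$ the field with $p$ elements. For a positive integer $d$, a Hilbert cube of dimension $d$ in $\mathbb{F}_p$ is a set of the form $\mathcal{H}(a_0;a_1,\dots,a_d)=\{a_0+n_1a_1+\cdots+n_da_d : n_1,\dots,n_d\in\{0,1\}\}$, where $a_0,a_1,\dots,a_d\in\mathbb{F}_p$ and $a_1,\dots,a_d$ are pairwise distinct. A primitive root modulo $p$ is a generator of the cyclic group $\mathbb{F}_p^\times$. $F(p)$ denotes the largest positive integer $d$ such that there exists a Hilbert cube of dimension $d$ in $\mathbb{F}_p$ containing no primitive root modulo $p$. -}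

module Defs where

open import Data.Nat using (ℕ; zero; suc; _+_; _*_; _^_; _<_; NonZero)
open import Data.Nat.DivMod using (_%_)
open import Data.Nat.Primality using (Prime; prime⇒nonZero)
open import Data.Fin using (Fin)
import Data.Fin as F
open import Data.Bool using (Bool; if_then_else_)
open import Data.Product using (Σ; _×_; ∃-syntax)
open import Data.Empty using (⊥)
open import Function.Definitions using (Injective)
open import Relation.Binary.PropositionalEquality using (_≡_)
open import Relation.Nullary using (¬_)

-- Elements of 𝔽_p are represented by natural numbers < p (residues mod p).

sumFin : (d : ℕ) → (Fin d → ℕ) → ℕ
sumFin zero    f = 0
sumFin (suc d) f = f F.zero + sumFin d (λ i → f (F.suc i))

module _ (p : ℕ) .{{_ : NonZero p}} where

  IsPrimitiveRoot : ℕ → Set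
  IsPrimitiveRoot g =
    (0 < g) × (g < p) × (∀ x → 0 < x → x < p → ∃[ k ] (g ^ k % p ≡ x))

  InCube : (d : ℕ) → ℕ → (Fin d → ℕ) → ℕ → Set
  InCube d a0 a x =
    Σ (Fin d → Bool) λ n → x ≡ (a0 + sumFin d (λ i → if n i then a i else 0)) % p

  CubeWithoutPrimitiveRoot : ℕ → Set
  CubeWithoutPrimitiveRoot d =
    Σ ℕ λ a0 → Σ (Fin d → ℕ) λ a →
      (a0 < p) × (∀ i → a i < p) × Injective _≡_ _≡_ a ×
      (∀ x → InCube d a0 a x → ¬ IsPrimitiveRoot x)

CubeWithoutPR : (p : ℕ) → Prime p → ℕ → Set
CubeWithoutPR p pp d = CubeWithoutPrimitiveRoot p {{prime⇒nonZero pp}} d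

-- Call u ∈ 𝔽_p exceptional if for some squarefree e ∣ p − 1 the points u + b (0 ≤ b < B) are unevenly
-- distributed among the cosets of the e-th powers.  If u is not exceptional, Legendre's sieve yields for every
-- a ≠ 0 a primitive root among the a(u + b).  A high moment as in Burgess' method, evaluated by Stepanov's
-- polynomial method instead of Weil's bound, shows that for B = p^{o(1)} only p^{1/2+o(1)} elements u are
-- exceptional.
--
-- Adding generators of the cube greedily gives a subset S of the cube that is almost invariant under translation
-- by each of d/2 unused generators X, hence under every a in the iterated sumset A = ℓX with ℓ = d p^{−o(1)}.
-- So for a ∈ A and most x ∈ S the progression x, x + a, …, x + (B−1)a lies in the cube, and if the cube contains
-- no primitive root then all these ratios x/a are exceptional.  On the other hand, for fixed u the fibre of
-- (x, a) ↦ x/a over u can be translated by A × A, which bounds its size by the size of A − uA; an average of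
-- additive energies over u, with the Cauchy–Davenport inequality for A and for A − uA, shows that there are at
-- least d⁴ p^{−o(1)} ratios.  Hence d ≤ p^{1/8+o(1)}.
module Submission where

open import Defs
open import Data.Nat using (ℕ; suc; _+_; _*_; _^_; _≤_; _<_)
open import Data.Nat.Primality using (Prime)
open import Data.Product using (Σ; _×_)
open import Data.Nat as ℕ using (zero; z≤n; s≤s; NonZero; _∸_; _%_; _/_; _⊔_; _≤?_; _<?_)
import Data.Nat.Properties as ℕₚ
open import Data.Nat.Tactic.RingSolver using (solve-∀)
open import Data.Bool as Bool using (Bool; true; false; _∧_; _∨_; not; if_then_else_)
open import Data.Fin as Fin using (Fin; zero; suc; toℕ; fromℕ<; finToFun; funToFin)
import Data.Fin.Properties as Finₚ
open import Data.List using (List; []; _∷_; length; map; _++_; replicate)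
import Data.List.Relation.Unary.All as All
open All using (All; []; _∷_)
import Data.List.Relation.Unary.AllPairs as AllPairs
open AllPairs using (AllPairs; []; _∷_)
open import Data.Product using (_,_; proj₁; proj₂; ∃)
open import Data.Sum as Sum using (_⊎_; inj₁; inj₂)
open import Data.Empty using (⊥; ⊥-elim)
open import Function using (_∘_; Injective)
open import Relation.Nullary using (¬_; Dec; yes; no; does)
open import Relation.Nullary.Decidable using (_×-dec_; ¬?; decidable-stable)
open import Relation.Binary.PropositionalEquality hiding ([_]; J)
open import Algebra.Bundles using (CommutativeRing)

-- Two requirements shape the proof. The moment bound subtracts the expected number of collisions
-- from the actual one, so the Stepanov count must have main term exactly `m = n / e` with an error
-- near √p; a bound off by a constant factor would be useless. No characters occur: unevenness is
-- measured by collisions of coset labels, and repeated squaring of the deviation leads to tuples of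
-- 2^(i+1) points read as iterated quotients. The independence argument needs a simple zero, hence a
-- point occurring exactly once in the tuple; tuples without one are rare. The set A must have small
-- doubling, and yet A - uA must outweigh the cube of the doubling constant. Small doubling comes
-- from a search among the scales k i₀ 2^j, since no sumset exceeds p. The gain comes from using two
-- levels: energy is averaged over u for iX only, and Cauchy-Davenport applied to iX - u·iX then
-- multiplies the size by about k, a fixed power of z. With p near z^(R²) and B = z^R, every loss is
-- a power of z with exponent linear in R, negligible against R².

-- Finite sums of natural numbers and cardinalities of decidable sets.

module FiniteSums where

  open import Data.Nat
  open import Data.Nat.Properties
  open import Data.List.Properties using (length-map)
  import Data.List.Relation.Unary.All.Properties as Allₚ
  import Data.List.Relation.Unary.AllPairs.Properties as AllPairsₚ
  import Algebra.Properties.Semiring.Sum +-*-semiring as S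
  open import Data.Fin.Permutation using (Permutation; _⟨$⟩ʳ_)

  abstract
    sum : ∀ {n} → (Fin n → ℕ) → ℕ
    sum = S.sum

    sum-empty : (f : Fin 0 → ℕ) → sum f ≡ 0
    sum-empty f = refl

    sum-suc : ∀ {n} (f : Fin (suc n) → ℕ) → sum f ≡ f zero + sum (λ i → f (suc i))
    sum-suc f = refl

    sum-cong-≗ : ∀ {n} {f g : Fin n → ℕ} → (∀ i → f i ≡ g i) → sum f ≡ sum g
    sum-cong-≗ = S.sum-cong-≗

    ∑-distrib-+ : ∀ {n} (f g : Fin n → ℕ) → sum (λ i → f i + g i) ≡ sum f + sum g
    ∑-distrib-+ = S.∑-distrib-+

    ∑-swap : ∀ {m n} (f : Fin m → Fin n → ℕ) → sum (λ i → sum (f i)) ≡ sum (λ j → sum (λ i → f i j))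
    ∑-swap f = S.∑-comm f

    sum-permute : ∀ {m n} (f : Fin n → ℕ) (π : Permutation m n) → sum f ≡ sum (λ i → f (π ⟨$⟩ʳ i))
    sum-permute = S.sum-permute

    ∑-*ˡ : ∀ {n} c (f : Fin n → ℕ) → sum (λ i → c * f i) ≡ c * sum f
    ∑-*ˡ c f = sym (S.*-distribˡ-sum c f)

    ∑-*ʳ : ∀ {n} c (f : Fin n → ℕ) → sum (λ i → f i * c) ≡ sum f * c
    ∑-*ʳ c f = sym (S.*-distribʳ-sum c f)

    ∑-mono : ∀ {n} {f g : Fin n → ℕ} → (∀ i → f i ≤ g i) → sum f ≤ sum g
    ∑-mono {zero} h = z≤n
    ∑-mono {suc n} h = +-mono-≤ (h zero) (∑-mono (h ∘ suc))

    ∑-const : ∀ n c → sum {n} (λ _ → c) ≡ n * c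
    ∑-const zero c = refl
    ∑-const (suc n) c = cong (c +_) (∑-const n c)

    ∑-≥ : ∀ {n} (f : Fin n → ℕ) i → f i ≤ sum f
    ∑-≥ f zero = m≤m+n _ _
    ∑-≥ f (suc i) = ≤-trans (∑-≥ (f ∘ suc) i) (m≤n+m _ _)

  ∑-zero : ∀ n → sum {n} (λ _ → 0) ≡ 0
  ∑-zero n = trans (∑-const n 0) (*-zeroʳ n)

  ∑-bound : ∀ {n} {f : Fin n → ℕ} {c} → (∀ i → f i ≤ c) → sum f ≤ n * c
  ∑-bound {n} {f} {c} h = ≤-trans (∑-mono h) (≤-reflexive (∑-const n c))

  ∑-single : ∀ {n} (f : Fin n → ℕ) i → (∀ j → j ≢ i → f j ≡ 0) → sum f ≡ f i
  ∑-single {suc n} f zero h = trans (sum-suc f) (trans (cong (f zero +_) (trans (sum-cong-≗ (λ j → h (suc j) λ ())) (∑-zero n))) (+-identityʳ _))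
  ∑-single {suc n} f (suc i) h = trans (sum-suc f) (trans (cong (_+ sum (f ∘ suc)) (h zero λ ())) (∑-single (f ∘ suc) i (λ j j≢i → h (suc j) (j≢i ∘ Finₚ.suc-injective))))

  ⟦_⟧ : Bool → ℕ
  ⟦ true ⟧ = 1
  ⟦ false ⟧ = 0

  ⟦⟧≤1 : ∀ b → ⟦ b ⟧ ≤ 1
  ⟦⟧≤1 true = ≤-refl
  ⟦⟧≤1 false = z≤n

  ⟦∧⟧ : ∀ a b → ⟦ a ∧ b ⟧ ≡ ⟦ a ⟧ * ⟦ b ⟧
  ⟦∧⟧ true b = sym (+-identityʳ _)
  ⟦∧⟧ false b = refl

  ⟦⟧-split : ∀ a b → ⟦ a ⟧ ≡ ⟦ a ∧ b ⟧ + ⟦ a ∧ not b ⟧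
  ⟦⟧-split true true = refl
  ⟦⟧-split true false = refl
  ⟦⟧-split false b = refl

  ⟦⟧-mono : ∀ {a b} → (a ≡ true → b ≡ true) → ⟦ a ⟧ ≤ ⟦ b ⟧
  ⟦⟧-mono {true} h rewrite h refl = ≤-refl
  ⟦⟧-mono {false} h = z≤n

  ⟦⟧*-≤ : ∀ a {x y} → (a ≡ true → x ≤ y) → ⟦ a ⟧ * x ≤ ⟦ a ⟧ * y
  ⟦⟧*-≤ true h = *-monoʳ-≤ 1 (h refl)
  ⟦⟧*-≤ false h = z≤n

  dec-true : ∀ {p} {P : Set p} (d : Dec P) → P → does d ≡ true
  dec-true (yes _) _ = refl
  dec-true (no ¬p) p = ⊥-elim (¬p p)

  dec-false : ∀ {p} {P : Set p} (d : Dec P) → ¬ P → does d ≡ false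
  dec-false (yes p) ¬p = ⊥-elim (¬p p)
  dec-false (no _) _ = refl

  true-dec : ∀ {p} {P : Set p} (d : Dec P) → does d ≡ true → P
  true-dec (yes p) _ = p

  false-dec : ∀ {p} {P : Set p} (d : Dec P) → does d ≡ false → ¬ P
  false-dec (no ¬p) _ = ¬p

  false≢true : false ≢ true
  false≢true ()

  ∣_∣ : ∀ {n} → (Fin n → Bool) → ℕ
  ∣ A ∣ = sum (λ x → ⟦ A x ⟧)

  infix 4 _∈_ _⊆_
  _∈_ : ∀ {n} → Fin n → (Fin n → Bool) → Set
  x ∈ A = A x ≡ true

  _⊆_ : ∀ {n} → (Fin n → Bool) → (Fin n → Bool) → Set
  A ⊆ B = ∀ x → x ∈ A → x ∈ B

  ∣∣-mono : ∀ {n} {A B : Fin n → Bool} → A ⊆ B → ∣ A ∣ ≤ ∣ B ∣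
  ∣∣-mono h = ∑-mono (λ x → ⟦⟧-mono (h x))

  ∣∣≤ : ∀ {n} (A : Fin n → Bool) → ∣ A ∣ ≤ n
  ∣∣≤ {n} A = ≤-trans (∑-bound (λ x → ⟦⟧≤1 (A x))) (≤-reflexive (*-identityʳ n))

  ∣∣-pos : ∀ {n} {A : Fin n → Bool} x → x ∈ A → 1 ≤ ∣ A ∣
  ∣∣-pos {A = A} x h = ≤-trans (≤-reflexive (sym (cong ⟦_⟧ h))) (∑-≥ (λ x → ⟦ A x ⟧) x)

  abstract
    ∑-fibre≤1 : ∀ {m n} (A : Fin m → Bool) (f : Fin m → Fin n) →
      (∀ i j → i ∈ A → j ∈ A → f i ≡ f j → i ≡ j) → ∀ y →
      sum (λ i → ⟦ A i ∧ does (f i Finₚ.≟ y) ⟧) ≤ 1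
    ∑-fibre≤1 {zero} A f inj y = z≤n
    ∑-fibre≤1 {suc m} A f inj y with A zero in eq | f zero Finₚ.≟ y
    ... | false | _ = ∑-fibre≤1 (A ∘ suc) (f ∘ suc) (λ i j a b e → Finₚ.suc-injective (inj _ _ a b e)) y
    ... | true | no _ = ∑-fibre≤1 (A ∘ suc) (f ∘ suc) (λ i j a b e → Finₚ.suc-injective (inj _ _ a b e)) y
    ... | true | yes f0 = s≤s (≤-reflexive (trans (sum-cong-≗ z) (∑-zero m)))
      where
      z : ∀ i → ⟦ A (suc i) ∧ does (f (suc i) Finₚ.≟ y) ⟧ ≡ 0
      z i with A (suc i) in eq' | f (suc i) Finₚ.≟ y
      ... | false | _ = refl
      ... | true | no _ = refl
      ... | true | yes e with inj zero (suc i) eq eq' (trans f0 (sym e))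
      ...   | ()

  ∣∣-injection : ∀ {m n} {A : Fin m → Bool} {B : Fin n → Bool} (f : Fin m → Fin n) →
    (∀ i → i ∈ A → f i ∈ B) →
    (∀ i j → i ∈ A → j ∈ A → f i ≡ f j → i ≡ j) → ∣ A ∣ ≤ ∣ B ∣
  ∣∣-injection {m} {n} {A} {B} f into inj = begin
    sum (λ i → ⟦ A i ⟧) ≡⟨ sum-cong-≗ (λ i → sym (step i)) ⟩
    sum (λ i → sum (λ y → ⟦ A i ∧ does (f i Finₚ.≟ y) ⟧)) ≡⟨ ∑-swap _ ⟩
    sum (λ y → sum (λ i → ⟦ A i ∧ does (f i Finₚ.≟ y) ⟧)) ≤⟨ ∑-mono le ⟩
    sum (λ y → ⟦ B y ⟧) ∎
    where
    open ≤-Reasoning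
    step : ∀ i → sum (λ y → ⟦ A i ∧ does (f i Finₚ.≟ y) ⟧) ≡ ⟦ A i ⟧
    step i = trans (∑-single _ (f i) λ j ne → off j ne) on
      where
      off : ∀ j → j ≢ f i → ⟦ A i ∧ does (f i Finₚ.≟ j) ⟧ ≡ 0
      off j ne rewrite dec-false (f i Finₚ.≟ j) (ne ∘ sym) with A i
      ... | true = refl
      ... | false = refl
      on : ⟦ A i ∧ does (f i Finₚ.≟ f i) ⟧ ≡ ⟦ A i ⟧
      on rewrite dec-true (f i Finₚ.≟ f i) refl with A i
      ... | true = refl
      ... | false = refl
    le : ∀ y → sum (λ i → ⟦ A i ∧ does (f i Finₚ.≟ y) ⟧) ≤ ⟦ B y ⟧
    le y with B y in eq
    ... | true = ∑-fibre≤1 A f inj y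
    ... | false = ≤-reflexive (trans (sum-cong-≗ z) (∑-zero m))
      where
      z : ∀ i → ⟦ A i ∧ does (f i Finₚ.≟ y) ⟧ ≡ 0
      z i with A i in eqi | f i Finₚ.≟ y
      ... | false | _ = refl
      ... | true | no _ = refl
      ... | true | yes refl with trans (sym eq) (into i eqi)
      ...   | ()

  2ab≤a²+b²-ordered : ∀ a b → a ≤ b → 2 * (a * b) ≤ a * a + b * b
  2ab≤a²+b²-ordered a b a≤b with m≤n⇒∃[o]m+o≡n a≤b
  ... | c , refl = ≤-trans (m≤m+n _ (c * c)) (≤-reflexive (lem a c))
    where
    lem : ∀ a c → 2 * (a * (a + c)) + c * c ≡ a * a + (a + c) * (a + c)
    lem = solve-∀

  2ab≤a²+b² : ∀ a b → 2 * (a * b) ≤ a * a + b * b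
  2ab≤a²+b² a b with ≤-total a b
  ... | inj₁ a≤b = 2ab≤a²+b²-ordered a b a≤b
  ... | inj₂ b≤a = subst₂ _≤_ (cong (2 *_) (*-comm b a)) (+-comm (b * b) (a * a)) (2ab≤a²+b²-ordered b a b≤a)

  ∑*∑ : ∀ {m n} (f : Fin m → ℕ) (g : Fin n → ℕ) → sum f * sum g ≡ sum (λ i → sum (λ j → f i * g j))
  ∑*∑ f g = trans (sym (∑-*ʳ (sum g) f)) (sum-cong-≗ (λ i → sym (∑-*ˡ (f i) g)))

  -- Cauchy-Schwarz from `2ab ≤ a² + b²` on pairs. As `f` vanishes off `Q`, the square of `f v` may
  -- be weighted by the indicator of `Q w` and vice versa; each of the two double sums is then
  -- `∣ Q ∣` times the sum of squares.
  cauchy-support : ∀ {n} (Q : Fin n → Bool) (f : Fin n → ℕ) →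
    (∀ v → ¬ (v ∈ Q) → f v ≡ 0) → sum f * sum f ≤ ∣ Q ∣ * sum (λ v → f v * f v)
  cauchy-support {n} Q f supp = *-cancelˡ-≤ 2 (begin
    2 * (sum f * sum f) ≡⟨ cong (2 *_) (∑*∑ f f) ⟩
    2 * sum (λ v → sum (λ w → f v * f w)) ≡⟨ ∑-*ˡ 2 (λ v → sum (λ w → f v * f w)) ⟨
    sum (λ v → 2 * sum (λ w → f v * f w)) ≡⟨ sum-cong-≗ (λ v → sym (∑-*ˡ 2 (λ w → f v * f w))) ⟩
    sum (λ v → sum (λ w → 2 * (f v * f w))) ≤⟨ ∑-mono (λ v → ∑-mono (λ w → pt v w)) ⟩
    sum (λ v → sum (λ w → ⟦ Q w ⟧ * (f v * f v) + ⟦ Q v ⟧ * (f w * f w))) ≡⟨ sum-cong-≗ (λ v → ∑-distrib-+ (λ w → ⟦ Q w ⟧ * (f v * f v)) (λ w → ⟦ Q v ⟧ * (f w * f w))) ⟩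
    sum (λ v → sum (λ w → ⟦ Q w ⟧ * (f v * f v)) + sum (λ w → ⟦ Q v ⟧ * (f w * f w))) ≡⟨ ∑-distrib-+ (λ v → sum (λ w → ⟦ Q w ⟧ * (f v * f v))) (λ v → sum (λ w → ⟦ Q v ⟧ * (f w * f w))) ⟩
    sum (λ v → sum (λ w → ⟦ Q w ⟧ * (f v * f v))) + sum (λ v → sum (λ w → ⟦ Q v ⟧ * (f w * f w))) ≡⟨ cong (_+ sum (λ v → sum (λ w → ⟦ Q v ⟧ * (f w * f w)))) (∑-swap (λ v w → ⟦ Q w ⟧ * (f v * f v))) ⟩
    sum (λ v → sum (λ w → ⟦ Q v ⟧ * (f w * f w))) + sum (λ v → sum (λ w → ⟦ Q v ⟧ * (f w * f w))) ≡⟨ cong₂ _+_ (sym (∑*∑ (λ v → ⟦ Q v ⟧) g)) (sym (∑*∑ (λ v → ⟦ Q v ⟧) g)) ⟩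
    X + X ≡⟨ cong (X +_) (sym (+-identityʳ X)) ⟩
    2 * X ∎)
    where
    open ≤-Reasoning
    g : Fin n → ℕ
    g v = f v * f v
    X = ∣ Q ∣ * sum g
    pt : ∀ v w → 2 * (f v * f w) ≤ ⟦ Q w ⟧ * (f v * f v) + ⟦ Q v ⟧ * (f w * f w)
    pt v w with Q v in ev | Q w in ew
    ... | true | true = ≤-trans (2ab≤a²+b² (f v) (f w)) (+-mono-≤ (≤-reflexive (sym (+-identityʳ (f v * f v)))) (≤-reflexive (sym (+-identityʳ (f w * f w)))))
    ... | false | _ rewrite supp v (λ e → false≢true (trans (sym ev) e)) = z≤n
    ... | true | false rewrite supp w (λ e → false≢true (trans (sym ew) e)) = ≤-trans (≤-reflexive (cong (2 *_) (*-zeroʳ (f v)))) z≤n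

  enumerate : ∀ {n} (A : Fin n → Bool) → ∃ λ xs → AllPairs _≢_ xs × All (_∈ A) xs × length xs ≡ ∣ A ∣
  enumerate {zero} A = [] , [] , [] , sym (sum-empty _)
  enumerate {suc n} A with enumerate (A ∘ suc) | A zero in eq
  ... | xs , uniq , mem , len | b = prepend b eq
    where
    xs′ = map suc xs
    uniq′ : AllPairs _≢_ xs′
    uniq′ = AllPairsₚ.map⁺ (AllPairs.map (λ ne e → ne (Finₚ.suc-injective e)) uniq)
    mem′ : All (_∈ A) xs′
    mem′ = Allₚ.map⁺ mem
    prepend : ∀ b → A zero ≡ b → ∃ λ xs → AllPairs _≢_ xs × All (_∈ A) xs × length xs ≡ ∣ A ∣
    prepend true e = zero ∷ xs′ , (Allₚ.map⁺ (All.map (λ _ ()) mem) ∷ uniq′) , (e ∷ mem′) ,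
      trans (cong suc (trans (length-map suc xs) len)) (sym (trans (sum-suc _) (cong (λ c → ⟦ c ⟧ + ∣ A ∘ suc ∣) e)))
    prepend false e = xs′ , uniq′ , mem′ ,
      trans (trans (length-map suc xs) len) (sym (trans (sum-suc _) (cong (λ c → ⟦ c ⟧ + ∣ A ∘ suc ∣) e)))

-- Arithmetic of the prime field.

module Fp (n : ℕ) (pr : Prime (suc n)) where

  open import Data.Nat.DivMod
  open import Data.Nat.GCD using (module Bézout)
  open import Data.Nat.Coprimality using (prime⇒coprime; coprime-Bézout)
  open import Data.Nat.Primality using (¬prime[0]; ¬prime[1])
  open import Data.Fin.Permutation using (Permutation; permutation)

  p : ℕ
  p = suc n

  F : Set
  F = Fin p

  infixl 6 _⊕_
  infixl 7 _⊗_
  infix 8 ⊖_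

  abstract
    [_] : ℕ → F
    [ m ] = fromℕ< (m%n<n m p)

    toℕ[] : ∀ m → toℕ [ m ] ≡ m % p
    toℕ[] m = Finₚ.toℕ-fromℕ< _

  []-cong% : ∀ {a b} → a % p ≡ b % p → [ a ] ≡ [ b ]
  []-cong% {a} {b} e = Finₚ.toℕ-injective (trans (toℕ[] a) (trans e (sym (toℕ[] b))))

  [toℕ] : ∀ x → [ toℕ x ] ≡ x
  [toℕ] x = Finₚ.toℕ-injective (trans (toℕ[] _) (m<n⇒m%n≡m (Finₚ.toℕ<n x)))

  abstract
    _⊕_ _⊗_ : F → F → F
    x ⊕ y = [ toℕ x ℕ.+ toℕ y ]
    x ⊗ y = [ toℕ x ℕ.* toℕ y ]

    ⊖_ : F → F
    ⊖ x = [ p ∸ toℕ x ]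

    []-+ : ∀ a b → [ a ℕ.+ b ] ≡ [ a ] ⊕ [ b ]
    []-+ a b = []-cong% {a ℕ.+ b} {toℕ [ a ] ℕ.+ toℕ [ b ]} (trans (%-distribˡ-+ a b p) (cong₂ (λ s t → (s ℕ.+ t) % p) (sym (toℕ[] a)) (sym (toℕ[] b))))

    []-* : ∀ a b → [ a ℕ.* b ] ≡ [ a ] ⊗ [ b ]
    []-* a b = []-cong% {a ℕ.* b} {toℕ [ a ] ℕ.* toℕ [ b ]} (trans (%-distribˡ-* a b p) (cong₂ (λ s t → (s ℕ.* t) % p) (sym (toℕ[] a)) (sym (toℕ[] b))))

    ⊕-def : ∀ x y → x ⊕ y ≡ [ toℕ x ℕ.+ toℕ y ]
    ⊕-def x y = refl

    ⊗-def : ∀ x y → x ⊗ y ≡ [ toℕ x ℕ.* toℕ y ]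
    ⊗-def x y = refl

    ⊖-def : ∀ x → ⊖ x ≡ [ p ∸ toℕ x ]
    ⊖-def x = refl

  𝟘 𝟙 : F
  𝟘 = zero
  𝟙 = [ 1 ]

  [0] : [ 0 ] ≡ 𝟘
  [0] = Finₚ.toℕ-injective (toℕ[] 0)

  [p] : [ p ] ≡ 𝟘
  [p] = Finₚ.toℕ-injective (trans (toℕ[] p) (n%n≡0 p))

  ⊕-comm : ∀ x y → x ⊕ y ≡ y ⊕ x
  ⊕-comm x y = trans (⊕-def x y) (trans (cong [_] (ℕₚ.+-comm (toℕ x) (toℕ y))) (sym (⊕-def y x)))

  ⊗-comm : ∀ x y → x ⊗ y ≡ y ⊗ x
  ⊗-comm x y = trans (⊗-def x y) (trans (cong [_] (ℕₚ.*-comm (toℕ x) (toℕ y))) (sym (⊗-def y x)))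

  -- Each law is transported along the surjection [_].
  private
    lift1 : (P : F → Set) → (∀ a → P [ a ]) → ∀ x → P x
    lift1 P h x = subst P ([toℕ] x) (h (toℕ x))

  ⊕-assoc : ∀ x y z → (x ⊕ y) ⊕ z ≡ x ⊕ (y ⊕ z)
  ⊕-assoc = lift1 _ λ a → lift1 _ λ b → lift1 _ λ c →
    trans (cong (_⊕ [ c ]) (sym ([]-+ a b))) (trans (sym ([]-+ (a ℕ.+ b) c)) (trans (cong [_] (ℕₚ.+-assoc a b c)) (trans ([]-+ a (b ℕ.+ c)) (cong ([ a ] ⊕_) ([]-+ b c)))))

  ⊗-assoc : ∀ x y z → (x ⊗ y) ⊗ z ≡ x ⊗ (y ⊗ z)
  ⊗-assoc = lift1 _ λ a → lift1 _ λ b → lift1 _ λ c →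
    trans (cong (_⊗ [ c ]) (sym ([]-* a b))) (trans (sym ([]-* (a ℕ.* b) c)) (trans (cong [_] (ℕₚ.*-assoc a b c)) (trans ([]-* a (b ℕ.* c)) (cong ([ a ] ⊗_) ([]-* b c)))))

  ⊗-distribˡ : ∀ x y z → x ⊗ (y ⊕ z) ≡ x ⊗ y ⊕ x ⊗ z
  ⊗-distribˡ = lift1 _ λ a → lift1 _ λ b → lift1 _ λ c →
    trans (cong ([ a ] ⊗_) (sym ([]-+ b c))) (trans (sym ([]-* a (b ℕ.+ c))) (trans (cong [_] (ℕₚ.*-distribˡ-+ a b c)) (trans ([]-+ (a ℕ.* b) (a ℕ.* c)) (cong₂ _⊕_ ([]-* a b) ([]-* a c)))))

  ⊕-identityʳ : ∀ x → x ⊕ 𝟘 ≡ x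
  ⊕-identityʳ x = trans (⊕-def x 𝟘) (trans (cong [_] (ℕₚ.+-identityʳ (toℕ x))) ([toℕ] x))

  ⊗-identityʳ : ∀ x → x ⊗ 𝟙 ≡ x
  ⊗-identityʳ = lift1 _ λ a → trans (sym ([]-* a 1)) (cong [_] (ℕₚ.*-identityʳ a))

  ⊖-inverseʳ : ∀ x → x ⊕ (⊖ x) ≡ 𝟘
  ⊖-inverseʳ x = trans (cong (x ⊕_) (⊖-def x)) (trans (cong (_⊕ [ p ∸ toℕ x ]) (sym ([toℕ] x))) (trans (sym ([]-+ (toℕ x) (p ∸ toℕ x))) (trans (cong [_] (ℕₚ.m+[n∸m]≡n (ℕₚ.<⇒≤ (Finₚ.toℕ<n x)))) [p])))

  private
    comm-idʳ⇒id : ∀ (_∙_ : F → F → F) e → (∀ x y → x ∙ y ≡ y ∙ x) → (∀ x → x ∙ e ≡ x) → (∀ x → e ∙ x ≡ x) × (∀ x → x ∙ e ≡ x)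
    comm-idʳ⇒id _∙_ e c i = (λ x → trans (c e x) (i x)) , i

  ring : CommutativeRing _ _
  ring = record
    { Carrier = F ; _≈_ = _≡_ ; _+_ = _⊕_ ; _*_ = _⊗_ ; -_ = ⊖_ ; 0# = 𝟘 ; 1# = 𝟙
    ; isCommutativeRing = record
      { isRing = record
        { +-isAbelianGroup = record
          { isGroup = record
            { isMonoid = record
              { isSemigroup = record
                { isMagma = record { isEquivalence = isEquivalence ; ∙-cong = cong₂ _⊕_ }
                ; assoc = ⊕-assoc }
              ; identity = comm-idʳ⇒id _⊕_ 𝟘 ⊕-comm ⊕-identityʳ }
            ; inverse = (λ x → trans (⊕-comm (⊖ x) x) (⊖-inverseʳ x)) , ⊖-inverseʳ
            ; ⁻¹-cong = cong ⊖_ }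
          ; comm = ⊕-comm }
        ; *-cong = cong₂ _⊗_
        ; *-assoc = ⊗-assoc
        ; *-identity = comm-idʳ⇒id _⊗_ 𝟙 ⊗-comm ⊗-identityʳ
        ; distrib = ⊗-distribˡ , λ x y z → trans (⊗-comm _ x) (trans (⊗-distribˡ x y z) (cong₂ _⊕_ (⊗-comm x y) (⊗-comm x z))) }
      ; *-comm = ⊗-comm } }

  open CommutativeRing ring public
    using (commutativeSemiring; semiring; *-commutativeMonoid; +-commutativeMonoid)
    renaming (distribʳ to ⊗-distribʳ; +-identityˡ to ⊕-identityˡ; *-identityˡ to ⊗-identityˡ; zeroˡ to ⊗-zeroˡ; zeroʳ to ⊗-zeroʳ; -‿inverseˡ to ⊖-inverseˡ)
  open import Algebra.Properties.Ring (CommutativeRing.ring ring) public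
    using () renaming (-‿distribˡ-* to ⊖-distribˡ-⊗; -‿distribʳ-* to ⊖-distribʳ-⊗; -‿involutive to ⊖-involutive; -‿+-comm to ⊖-⊕-comm; +-cancelˡ to ⊕-cancelˡ; +-cancelʳ to ⊕-cancelʳ)
  open import Algebra.Properties.CommutativeSemiring.Exp commutativeSemiring public
    using () renaming (_^_ to _↑_; ^-homo-* to ↑-+; ^-assocʳ to ↑-*; ^-distrib-* to ↑-⊗)

  a⊕b⊖b : ∀ a b → (a ⊕ b) ⊕ ⊖ b ≡ a
  a⊕b⊖b a b = trans (⊕-assoc a b (⊖ b)) (trans (cong (a ⊕_) (⊖-inverseʳ b)) (⊕-identityʳ a))

  a⊖b⊕b : ∀ a b → (a ⊕ ⊖ b) ⊕ b ≡ a
  a⊖b⊕b a b = trans (⊕-assoc a (⊖ b) b) (trans (cong (a ⊕_) (⊖-inverseˡ b)) (⊕-identityʳ a))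

  ⊖-unique : ∀ {a b} → a ⊕ b ≡ 𝟘 → b ≡ ⊖ a
  ⊖-unique {a} {b} e = ⊕-cancelˡ a b (⊖ a) (trans e (sym (⊖-inverseʳ a)))

  a⊖b≡0⇒a≡b : ∀ {a b} → a ⊕ ⊖ b ≡ 𝟘 → a ≡ b
  a⊖b≡0⇒a≡b {a} {b} e = trans (sym (a⊖b⊕b a b)) (trans (cong (_⊕ b) e) (⊕-identityˡ b))

  1<p : 1 < p
  1<p = prime>1 pr
    where
    prime>1 : ∀ {m} → Prime m → 1 < m
    prime>1 {zero} q = ⊥-elim (¬prime[0] q)
    prime>1 {suc zero} q = ⊥-elim (¬prime[1] q)
    prime>1 {suc (suc m)} q = s≤s (s≤s z≤n)

  𝟙≢𝟘 : 𝟙 ≢ 𝟘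
  𝟙≢𝟘 e with trans (sym (m<n⇒m%n≡m 1<p)) (trans (sym (toℕ[] 1)) (cong toℕ e))
  ... | ()

  private
    inverse-exists : ∀ x → x ≢ 𝟘 → ∃ λ y → y ⊗ x ≡ 𝟙
    inverse-exists x x≢0 = go (coprime-Bézout (prime⇒coprime pr {{nz}} (Finₚ.toℕ<n x)))
      where
      nz : NonZero (toℕ x)
      nz = ℕ.≢-nonZero (λ e → x≢0 (Finₚ.toℕ-injective e))
      [*p] : ∀ a → [ a ℕ.* p ] ≡ 𝟘
      [*p] a = trans ([]-* a p) (trans (cong ([ a ] ⊗_) [p]) (⊗-zeroʳ _))
      []⊗ : ∀ b → [ b ℕ.* toℕ x ] ≡ [ b ] ⊗ x
      []⊗ b = trans ([]-* b (toℕ x)) (cong ([ b ] ⊗_) ([toℕ] x))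
      go : Bézout.Identity 1 p (toℕ x) → ∃ λ y → y ⊗ x ≡ 𝟙
      go (Bézout.+- a b eq) = ⊖ [ b ] , trans (sym (⊖-distribˡ-⊗ [ b ] x)) (sym (⊖-unique {[ b ] ⊗ x}
        (trans (⊕-comm _ _) (trans (cong (𝟙 ⊕_) (sym ([]⊗ b))) (trans (sym ([]-+ 1 _)) (trans (cong [_] eq) ([*p] a)))))))
      go (Bézout.-+ a b eq) = [ b ] , trans (sym ([]⊗ b)) (trans (cong [_] (sym eq)) (trans ([]-+ 1 _) (trans (cong (𝟙 ⊕_) ([*p] a)) (⊕-identityʳ 𝟙))))

  abstract
    inv : F → F
    inv x with x Finₚ.≟ 𝟘
    ... | yes _ = 𝟘
    ... | no x≢0 = proj₁ (inverse-exists x x≢0)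

    inv-inverseˡ : ∀ {x} → x ≢ 𝟘 → inv x ⊗ x ≡ 𝟙
    inv-inverseˡ {x} x≢0 with x Finₚ.≟ 𝟘
    ... | yes e = ⊥-elim (x≢0 e)
    ... | no ne = proj₂ (inverse-exists x ne)

  inv-inverseʳ : ∀ {x} → x ≢ 𝟘 → x ⊗ inv x ≡ 𝟙
  inv-inverseʳ x≢0 = trans (⊗-comm _ _) (inv-inverseˡ x≢0)

  ⊗-cancelˡ : ∀ {a x y} → a ≢ 𝟘 → a ⊗ x ≡ a ⊗ y → x ≡ y
  ⊗-cancelˡ {a} {x} {y} a≢0 e = trans (sym (red x)) (trans (cong (inv a ⊗_) e) (red y))
    where
    red : ∀ z → inv a ⊗ (a ⊗ z) ≡ z
    red z = trans (sym (⊗-assoc _ _ _)) (trans (cong (_⊗ z) (inv-inverseˡ a≢0)) (⊗-identityˡ z))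

  ⊗-cancelʳ : ∀ {a x y} → a ≢ 𝟘 → x ⊗ a ≡ y ⊗ a → x ≡ y
  ⊗-cancelʳ {a} {x} {y} a≢0 e = ⊗-cancelˡ a≢0 (trans (⊗-comm a x) (trans e (⊗-comm y a)))

  ⊗-nonzero : ∀ {x y} → x ≢ 𝟘 → y ≢ 𝟘 → x ⊗ y ≢ 𝟘
  ⊗-nonzero {x} {y} x≢0 y≢0 e = y≢0 (⊗-cancelˡ x≢0 (trans e (sym (⊗-zeroʳ x))))

  ⊗-zero : ∀ {x y} → x ⊗ y ≡ 𝟘 → x ≡ 𝟘 ⊎ y ≡ 𝟘
  ⊗-zero {x} {y} e with x Finₚ.≟ 𝟘 | y Finₚ.≟ 𝟘
  ... | yes x0 | _ = inj₁ x0
  ... | no _ | yes y0 = inj₂ y0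
  ... | no x≢0 | no y≢0 = ⊥-elim (⊗-nonzero x≢0 y≢0 e)

  ↑-nonzero : ∀ {x} k → x ≢ 𝟘 → x ↑ k ≢ 𝟘
  ↑-nonzero zero x≢0 = 𝟙≢𝟘
  ↑-nonzero (suc k) x≢0 = ⊗-nonzero x≢0 (↑-nonzero k x≢0)

  inv-nonzero : ∀ {x} → x ≢ 𝟘 → inv x ≢ 𝟘
  inv-nonzero {x} x≢0 e = 𝟙≢𝟘 (trans (sym (inv-inverseˡ x≢0)) (trans (cong (_⊗ x) e) (⊗-zeroˡ x)))

  𝟙↑ : ∀ k → 𝟙 ↑ k ≡ 𝟙
  𝟙↑ zero = refl
  𝟙↑ (suc k) = trans (⊗-identityˡ _) (𝟙↑ k)

  shiftPerm : F → Permutation p p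
  shiftPerm c = permutation (_⊕ c) (_⊕ ⊖ c) ((λ x → a⊖b⊕b x c)) ((λ x → a⊕b⊖b x c))

  dilatePerm : ∀ c → c ≢ 𝟘 → Permutation p p
  dilatePerm c c≢0 = permutation (_⊗ c) (_⊗ inv c) (λ x → trans (⊗-assoc x (inv c) c) (trans (cong (x ⊗_) (inv-inverseˡ c≢0)) (⊗-identityʳ x)))
    (λ x → trans (⊗-assoc x c (inv c)) (trans (cong (x ⊗_) (inv-inverseʳ c≢0)) (⊗-identityʳ x)))

  open FiniteSums

  ∑-shift : ∀ (f : F → ℕ) c → sum (λ x → f (x ⊕ c)) ≡ sum f
  ∑-shift f c = sym (sum-permute f (shiftPerm c))

  ∑-shift′ : ∀ (f : F → ℕ) c → sum (λ x → f (c ⊕ x)) ≡ sum f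
  ∑-shift′ f c = trans (sum-cong-≗ (λ x → cong f (⊕-comm c x))) (∑-shift f c)

  ∑-dilate : ∀ (f : F → ℕ) {c} → c ≢ 𝟘 → sum (λ x → f (x ⊗ c)) ≡ sum f
  ∑-dilate f c≢0 = sym (sum-permute f (dilatePerm _ c≢0))

  private
    open import Algebra.Properties.CommutativeMonoid.Sum *-commutativeMonoid as Π using () renaming (sum to ∏)

    -- Replacing 0 by 1 lets the product of the nonzero residues run over all of `F`, on which
    -- multiplication by `a` is a permutation.
    nz : F → F
    nz zero = 𝟙
    nz x@(suc _) = x

    nz≢0 : ∀ x → nz x ≢ 𝟘
    nz≢0 zero = 𝟙≢𝟘
    nz≢0 (suc _) ()

    ∏≢0 : ∀ {k} (f : Fin k → F) → (∀ i → f i ≢ 𝟘) → ∏ f ≢ 𝟘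
    ∏≢0 {zero} f h = 𝟙≢𝟘
    ∏≢0 {suc k} f h = ⊗-nonzero (h zero) (∏≢0 (f ∘ suc) (h ∘ suc))

    nz-≢0 : ∀ x → x ≢ 𝟘 → nz x ≡ x
    nz-≢0 zero h = ⊥-elim (h refl)
    nz-≢0 (suc _) h = refl

  -- Fermat: multiplying by a permutes the nonzero residues, hence fixes their product.
  fermat : ∀ {a} → a ≢ 𝟘 → a ↑ n ≡ 𝟙
  fermat {a} a≢0 = ⊗-cancelˡ {∏ nz} (∏≢0 nz nz≢0) (begin
    ∏ nz ⊗ a ↑ n ≡⟨ cong₂ _⊗_ (⊗-identityˡ _) (sym (∏const n)) ⟩
    ∏ (λ i → nz (suc i)) ⊗ ∏ {n} (λ _ → a) ≡⟨ sym (Π.∑-distrib-+ (λ i → nz (suc i)) (λ _ → a)) ⟩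
    ∏ {n} (λ i → suc i ⊗ a) ≡⟨ sym (⊗-identityˡ _) ⟩
    𝟙 ⊗ ∏ {n} (λ i → suc i ⊗ a) ≡⟨ cong₂ _⊗_ (cong nz (sym (⊗-zeroˡ a))) (Π.sum-cong-≗ (λ i → sym (nz-≢0 (suc i ⊗ a) (⊗-nonzero {suc i} (λ ()) a≢0)))) ⟩
    ∏ (λ x → nz (x ⊗ a)) ≡⟨ sym (Π.sum-permute nz (dilatePerm a a≢0)) ⟩
    ∏ nz ≡⟨ sym (⊗-identityʳ _) ⟩
    ∏ nz ⊗ 𝟙 ∎)
    where
    open ≡-Reasoning
    ∏const : ∀ k → ∏ {k} (λ _ → a) ≡ a ↑ k
    ∏const zero = refl
    ∏const (suc k) = cong (a ⊗_) (∏const k)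

  fermat-p : ∀ a → a ↑ p ≡ a
  fermat-p a with a Finₚ.≟ 𝟘
  ... | yes refl = ⊗-zeroˡ _
  ... | no a≢0 = trans (cong (a ⊗_) (fermat a≢0)) (⊗-identityʳ a)

  []≢𝟘 : ∀ {m} → 0 < m → m < p → [ m ] ≢ 𝟘
  []≢𝟘 {m} 0<m m<p e = ℕₚ.<⇒≢ 0<m (sym (trans (sym (m<n⇒m%n≡m m<p)) (trans (sym (toℕ[] m)) (cong toℕ e))))

  []-injective : ∀ {a b} → a < p → b < p → [ a ] ≡ [ b ] → a ≡ b
  []-injective {a} {b} a<p b<p e = trans (sym (m<n⇒m%n≡m a<p)) (trans (sym (toℕ[] a)) (trans (cong toℕ e) (trans (toℕ[] b) (m<n⇒m%n≡m b<p))))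

-- Ring identities, proved generically so that the solver never meets the arithmetic of polynomials.

module RingIdentities {c ℓ} (R : CommutativeRing c ℓ) where

  open CommutativeRing R using (_≈_; commutativeSemiring) renaming (_+_ to infixl 6 _∔_; _*_ to infixl 7 _∙_; refl to ≈-refl)
  open import Algebra.Solver.Ring.NaturalCoefficients.Default commutativeSemiring

  id₁ : ∀ s a b c → s ∔ (a ∔ (b ∔ c)) ≈ (a ∔ b) ∔ (s ∔ c)
  id₁ = solve 4 (λ s a b c → s :+ (a :+ (b :+ c)) := (a :+ b) :+ (s :+ c)) ≈-refl

  id₂ : ∀ w f g a b → w ∙ (a ∙ g ∔ f ∙ b) ≈ (w ∙ a) ∙ g ∔ f ∙ (w ∙ b)
  id₂ = solve 5 (λ w f g a b → w :* (a :* g :+ f :* b) := (w :* a) :* g :+ f :* (w :* b)) ≈-refl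

  id₃ : ∀ w x y g v d → w ∙ (x ∙ y ∙ g) ∔ x ∙ (y ∙ (v ∙ g ∔ x ∙ d)) ≈ x ∙ y ∙ ((w ∔ v) ∙ g ∔ x ∙ d)
  id₃ = solve 6 (λ w x y g v d → w :* (x :* y :* g) :+ x :* (y :* (v :* g :+ x :* d)) := x :* y :* ((w :+ v) :* g :+ x :* d)) ≈-refl

  id₄ : ∀ y x q → y ∙ (x ∙ q) ≈ x ∙ y ∙ q
  id₄ = solve 3 (λ y x q → y :* (x :* q) := x :* y :* q) ≈-refl

  id₅ : ∀ v y q → v ∙ (y ∙ q) ≈ y ∙ (v ∙ q)
  id₅ = solve 3 (λ v y q → v :* (y :* q) := y :* (v :* q)) ≈-refl

  id₆ : ∀ c d e g → (c ∙ e) ∙ g ∔ e ∙ (d ∙ g) ≈ (c ∔ d) ∙ (e ∙ g)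
  id₆ = solve 4 (λ c d e g → (c :* e) :* g :+ e :* (d :* g) := (c :+ d) :* (e :* g)) ≈-refl

  id₇ : ∀ d e k c → d ∙ e ∔ k ∙ (c ∙ e) ≈ (d ∔ c ∙ k) ∙ e
  id₇ = solve 4 (λ d e k c → d :* e :+ k :* (c :* e) := (d :+ c :* k) :* e) ≈-refl

  id₈ : ∀ a b d → (a ∙ b) ∙ d ≈ (b ∙ d) ∙ a
  id₈ = solve 3 (λ a b d → (a :* b) :* d := (b :* d) :* a) ≈-refl

  id₉ : ∀ a b d → (a ∙ b) ∙ d ≈ (a ∙ d) ∙ b
  id₉ = solve 3 (λ a b d → (a :* b) :* d := (a :* d) :* b) ≈-refl

-- Polynomials over the field: derivations, orders at 0, zeros with multiplicity.

module Polynomials (n : ℕ) (pr : Prime (suc n)) where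

  open import Data.List.Properties using (length-map)
  open Fp n pr

  Poly : Set
  Poly = List F

  coef : Poly → ℕ → F
  coef [] k = 𝟘
  coef (a ∷ f) zero = a
  coef (a ∷ f) (suc k) = coef f k

  infix 4 _≈_
  -- Coefficient lists may end in zeros, so equality is coefficientwise and degrees are only ever
  -- bounded, through the length of a list.
  record _≈_ (f g : Poly) : Set where
    constructor mk≈
    field at : ∀ k → coef f k ≡ coef g k
  open _≈_ public

  ≈-refl : ∀ {f} → f ≈ f
  ≈-refl = mk≈ λ _ → refl

  ≈-sym : ∀ {f g} → f ≈ g → g ≈ f
  ≈-sym e = mk≈ λ k → sym (at e k)

  ≈-trans : ∀ {f g h} → f ≈ g → g ≈ h → f ≈ h
  ≈-trans d e = mk≈ λ k → trans (at d k) (at e k)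

  infixl 6 _+P_
  infixl 7 _*P_

  abstract
    _+P_ : Poly → Poly → Poly
    [] +P g = g
    (a ∷ f) +P [] = a ∷ f
    (a ∷ f) +P (b ∷ g) = (a ⊕ b) ∷ (f +P g)

    scal : F → Poly → Poly
    scal c = map (c ⊗_)

    _*P_ : Poly → Poly → Poly
    [] *P g = []
    (a ∷ f) *P g = scal a g +P (𝟘 ∷ (f *P g))

    -P_ : Poly → Poly
    -P_ = map ⊖_

    ⊖𝟘 : ⊖ 𝟘 ≡ 𝟘
    ⊖𝟘 = sym (⊖-unique (⊕-identityˡ 𝟘))

    coef-[] : ∀ k → coef [] k ≡ 𝟘
    coef-[] k = refl

    coef-+ : ∀ f g k → coef (f +P g) k ≡ coef f k ⊕ coef g k
    coef-+ [] g k = sym (⊕-identityˡ _)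
    coef-+ (a ∷ f) [] k = sym (⊕-identityʳ _)
    coef-+ (a ∷ f) (b ∷ g) zero = refl
    coef-+ (a ∷ f) (b ∷ g) (suc k) = coef-+ f g k

    coef-scal : ∀ c f k → coef (scal c f) k ≡ c ⊗ coef f k
    coef-scal c [] k = sym (⊗-zeroʳ c)
    coef-scal c (a ∷ f) zero = refl
    coef-scal c (a ∷ f) (suc k) = coef-scal c f k

    coef-neg : ∀ f k → coef (-P f) k ≡ ⊖ coef f k
    coef-neg [] k = sym ⊖𝟘
    coef-neg (a ∷ f) zero = refl
    coef-neg (a ∷ f) (suc k) = coef-neg f k

    +-cong : ∀ {f f′ g g′} → f ≈ f′ → g ≈ g′ → f +P g ≈ f′ +P g′
    +-cong {f} {f′} {g} {g′} d e = mk≈ λ k → trans (coef-+ f g k) (trans (cong₂ _⊕_ (at d k) (at e k)) (sym (coef-+ f′ g′ k)))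

    scal-cong : ∀ c {f g} → f ≈ g → scal c f ≈ scal c g
    scal-cong c {f} {g} e = mk≈ λ k → trans (coef-scal c f k) (trans (cong (c ⊗_) (at e k)) (sym (coef-scal c g k)))

    ∷-cong : ∀ {a b f g} → a ≡ b → f ≈ g → a ∷ f ≈ b ∷ g
    ∷-cong d e = mk≈ λ { zero → d ; (suc k) → at e k }

    +-assoc : ∀ f g h → (f +P g) +P h ≈ f +P (g +P h)
    +-assoc f g h = mk≈ λ k → trans (coef-+ (f +P g) h k) (trans (cong (_⊕ coef h k) (coef-+ f g k))
      (trans (⊕-assoc _ _ _) (sym (trans (coef-+ f (g +P h) k) (cong (coef f k ⊕_) (coef-+ g h k))))))

    +-comm : ∀ f g → f +P g ≈ g +P f
    +-comm f g = mk≈ λ k → trans (coef-+ f g k) (trans (⊕-comm _ _) (sym (coef-+ g f k)))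

    +-identityʳ : ∀ f → f +P [] ≈ f
    +-identityʳ f = mk≈ λ k → trans (coef-+ f [] k) (⊕-identityʳ _)

    +-identityˡ : ∀ f → [] +P f ≈ f
    +-identityˡ f = ≈-refl

    +-inverseʳ : ∀ f → f +P (-P f) ≈ []
    +-inverseʳ f = mk≈ λ k → trans (coef-+ f (-P f) k) (trans (cong (coef f k ⊕_) (coef-neg f k)) (⊖-inverseʳ _))

    scal-+ : ∀ c f g → scal c (f +P g) ≈ scal c f +P scal c g
    scal-+ c f g = mk≈ λ k → trans (coef-scal c (f +P g) k) (trans (cong (c ⊗_) (coef-+ f g k)) (trans (⊗-distribˡ c _ _)
      (sym (trans (coef-+ (scal c f) (scal c g) k) (cong₂ _⊕_ (coef-scal c f k) (coef-scal c g k))))))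

    scal-⊕ : ∀ c d f → scal (c ⊕ d) f ≈ scal c f +P scal d f
    scal-⊕ c d f = mk≈ λ k → trans (coef-scal (c ⊕ d) f k) (trans (⊗-distribʳ _ c d)
      (sym (trans (coef-+ (scal c f) (scal d f) k) (cong₂ _⊕_ (coef-scal c f k) (coef-scal d f k)))))

    scal-scal : ∀ c d f → scal c (scal d f) ≈ scal (c ⊗ d) f
    scal-scal c d f = mk≈ λ k → trans (coef-scal c (scal d f) k) (trans (cong (c ⊗_) (coef-scal d f k)) (trans (sym (⊗-assoc _ _ _)) (sym (coef-scal (c ⊗ d) f k))))

    scal-𝟘 : ∀ f → scal 𝟘 f ≈ []
    scal-𝟘 f = mk≈ λ k → trans (coef-scal 𝟘 f k) (⊗-zeroˡ _)

    scal-𝟙 : ∀ f → scal 𝟙 f ≈ f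
    scal-𝟙 f = mk≈ λ k → trans (coef-scal 𝟙 f k) (⊗-identityˡ _)

    𝟘∷[] : 𝟘 ∷ [] ≈ []
    𝟘∷[] = mk≈ λ { zero → refl ; (suc k) → refl }

    shift-+ : ∀ f g → 𝟘 ∷ (f +P g) ≈ (𝟘 ∷ f) +P (𝟘 ∷ g)
    shift-+ f g = ∷-cong (sym (⊕-identityʳ 𝟘)) ≈-refl

    shift-scal : ∀ c f → scal c (𝟘 ∷ f) ≈ 𝟘 ∷ scal c f
    shift-scal c f = ∷-cong (⊗-zeroʳ c) ≈-refl

    +-middle : ∀ a b c d → (a +P b) +P (c +P d) ≈ (a +P c) +P (b +P d)
    +-middle a b c d = ≈-trans (+-assoc a b _) (≈-trans (+-cong (≈-refl {a}) (≈-trans (≈-sym (+-assoc b c d)) (≈-trans (+-cong (+-comm b c) ≈-refl) (+-assoc c b d)))) (≈-sym (+-assoc a c _)))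

    *-congˡ : ∀ f {g h} → g ≈ h → f *P g ≈ f *P h
    *-congˡ [] e = ≈-refl
    *-congˡ (a ∷ f) e = +-cong (scal-cong a e) (∷-cong refl (*-congˡ f e))

    *-zeroʳ : ∀ f → f *P [] ≈ []
    *-zeroʳ [] = ≈-refl
    *-zeroʳ (a ∷ f) = ≈-trans (∷-cong refl (*-zeroʳ f)) 𝟘∷[]

    *-distribʳ : ∀ h f g → (f +P g) *P h ≈ f *P h +P g *P h
    *-distribʳ h [] g = ≈-refl
    *-distribʳ h (a ∷ f) [] = ≈-sym (+-identityʳ _)
    *-distribʳ h (a ∷ f) (b ∷ g) = ≈-trans (+-cong (scal-⊕ a b h) (≈-trans (∷-cong refl (*-distribʳ h f g)) (shift-+ (f *P h) (g *P h))))
      (+-middle (scal a h) (scal b h) _ _)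

    *-∷ : ∀ f b g → f *P (b ∷ g) ≈ scal b f +P (𝟘 ∷ (f *P g))
    *-∷ [] b g = ≈-sym 𝟘∷[]
    *-∷ (a ∷ f) b g = ∷-cong (cong₂ _⊕_ (⊗-comm a b) refl) (≈-trans (+-cong (≈-refl {scal a g}) (*-∷ f b g))
      (≈-trans (≈-sym (+-assoc (scal a g) (scal b f) _)) (≈-trans (+-cong (+-comm (scal a g) (scal b f)) ≈-refl) (+-assoc (scal b f) (scal a g) _))))

    *-comm : ∀ f g → f *P g ≈ g *P f
    *-comm [] g = ≈-sym (*-zeroʳ g)
    *-comm (a ∷ f) g = ≈-trans (+-cong (≈-refl {scal a g}) (∷-cong refl (*-comm f g))) (≈-sym (*-∷ g a f))

    *-cong : ∀ {f f′ g g′} → f ≈ f′ → g ≈ g′ → f *P g ≈ f′ *P g′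
    *-cong {f} {f′} {g} {g′} d e = ≈-trans (*-congˡ f e) (≈-trans (*-comm f g′) (≈-trans (*-congˡ g′ d) (*-comm g′ f′)))

    scal-* : ∀ c f g → scal c f *P g ≈ scal c (f *P g)
    scal-* c [] g = ≈-refl
    scal-* c (a ∷ f) g = ≈-trans (+-cong (≈-sym (scal-scal c a g)) (≈-trans (∷-cong refl (scal-* c f g)) (≈-sym (shift-scal c (f *P g))))) (≈-sym (scal-+ c (scal a g) _))

    shift-* : ∀ f g → (𝟘 ∷ f) *P g ≈ 𝟘 ∷ (f *P g)
    shift-* f g = +-cong (scal-𝟘 g) ≈-refl

    *-assoc : ∀ f g h → (f *P g) *P h ≈ f *P (g *P h)
    *-assoc [] g h = ≈-refl
    *-assoc (a ∷ f) g h = ≈-trans (*-distribʳ h (scal a g) (𝟘 ∷ (f *P g))) (+-cong (scal-* a g h) (≈-trans (shift-* (f *P g) h) (∷-cong refl (*-assoc f g h))))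

    1P : Poly
    1P = 𝟙 ∷ []

    coef-1P : coef 1P 0 ≡ 𝟙
    coef-1P = refl

    length-1P : length 1P ≡ 1
    length-1P = refl

    *-identityˡ : ∀ f → 1P *P f ≈ f
    *-identityˡ f = ≈-trans (+-cong (scal-𝟙 f) 𝟘∷[]) (+-identityʳ f)

  polyRing : CommutativeRing _ _
  polyRing = record
    { Carrier = Poly ; _≈_ = _≈_ ; _+_ = _+P_ ; _*_ = _*P_ ; -_ = -P_ ; 0# = [] ; 1# = 1P
    ; isCommutativeRing = record
      { isRing = record
        { +-isAbelianGroup = record
          { isGroup = record
            { isMonoid = record
              { isSemigroup = record
                { isMagma = record { isEquivalence = record { refl = ≈-refl ; sym = ≈-sym ; trans = ≈-trans } ; ∙-cong = +-cong }
                ; assoc = +-assoc }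
              ; identity = +-identityˡ , +-identityʳ }
            ; inverse = (λ f → ≈-trans (+-comm (-P f) f) (+-inverseʳ f)) , +-inverseʳ
            ; ⁻¹-cong = λ {f} {g} e → mk≈ λ k → trans (coef-neg f k) (trans (cong ⊖_ (at e k)) (sym (coef-neg g k))) }
          ; comm = +-comm }
        ; *-cong = *-cong
        ; *-assoc = *-assoc
        ; *-identity = *-identityˡ , λ f → ≈-trans (*-comm f 1P) (*-identityˡ f)
        ; distrib = (λ f g h → ≈-trans (*-comm f (g +P h)) (≈-trans (*-distribʳ f g h) (+-cong (*-comm g f) (*-comm h f)))) , *-distribʳ }
      ; *-comm = *-comm } }

  open CommutativeRing polyRing public
    using () renaming (commutativeSemiring to polySemiring; setoid to polySetoid; distribˡ to *-distribˡ; *-identityʳ to *-identityʳ)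
  open import Algebra.Properties.CommutativeSemiring.Exp polySemiring public
    using () renaming (_^_ to _^P_; ^-homo-* to ^P-+)
  open RingIdentities polyRing public

  abstract
    eval : Poly → F → F
    eval [] u = 𝟘
    eval (a ∷ f) u = a ⊕ u ⊗ eval f u

    eval-≈[] : ∀ f u → f ≈ [] → eval f u ≡ 𝟘
    eval-≈[] [] u e = refl
    eval-≈[] (a ∷ f) u e = trans (cong₂ _⊕_ (at e 0) (trans (cong (u ⊗_) (eval-≈[] f u (mk≈ λ k → at e (suc k)))) (⊗-zeroʳ u))) (⊕-identityʳ 𝟘)

    eval-cong : ∀ {f g} u → f ≈ g → eval f u ≡ eval g u
    eval-cong {[]} {g} u e = sym (eval-≈[] g u (≈-sym e))
    eval-cong {a ∷ f} {[]} u e = eval-≈[] (a ∷ f) u e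
    eval-cong {a ∷ f} {b ∷ g} u e = cong₂ (λ s t → s ⊕ u ⊗ t) (at e 0) (eval-cong {f} {g} u (mk≈ λ k → at e (suc k)))

    ⊕-middle : ∀ a b c d → (a ⊕ b) ⊕ (c ⊕ d) ≡ (a ⊕ c) ⊕ (b ⊕ d)
    ⊕-middle a b c d = trans (⊕-assoc a b _) (trans (cong (a ⊕_) (trans (sym (⊕-assoc b c d)) (trans (cong (_⊕ d) (⊕-comm b c)) (⊕-assoc c b d)))) (sym (⊕-assoc a c _)))

    eval-+ : ∀ f g u → eval (f +P g) u ≡ eval f u ⊕ eval g u
    eval-+ [] g u = sym (⊕-identityˡ _)
    eval-+ (a ∷ f) [] u = sym (⊕-identityʳ _)
    eval-+ (a ∷ f) (b ∷ g) u = trans (cong (λ z → (a ⊕ b) ⊕ u ⊗ z) (eval-+ f g u)) (trans (cong ((a ⊕ b) ⊕_) (⊗-distribˡ u _ _)) (⊕-middle a b _ _))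

    eval-scal : ∀ c f u → eval (scal c f) u ≡ c ⊗ eval f u
    eval-scal c [] u = sym (⊗-zeroʳ c)
    eval-scal c (a ∷ f) u = trans (cong (λ z → c ⊗ a ⊕ u ⊗ z) (eval-scal c f u)) (trans (cong (c ⊗ a ⊕_) (trans (sym (⊗-assoc u c _)) (trans (cong (_⊗ eval f u) (⊗-comm u c)) (⊗-assoc c u _)))) (sym (⊗-distribˡ c a _)))

    eval-* : ∀ f g u → eval (f *P g) u ≡ eval f u ⊗ eval g u
    eval-* [] g u = sym (⊗-zeroˡ _)
    eval-* (a ∷ f) g u = trans (eval-+ (scal a g) (𝟘 ∷ (f *P g)) u) (trans (cong₂ _⊕_ (eval-scal a g u) (trans (⊕-identityˡ _) (trans (cong (u ⊗_) (eval-* f g u)) (sym (⊗-assoc u _ _))))) (sym (⊗-distribʳ (eval g u) a _)))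

    eval-1P : ∀ u → eval 1P u ≡ 𝟙
    eval-1P u = trans (cong (𝟙 ⊕_) (⊗-zeroʳ u)) (⊕-identityʳ 𝟙)

    eval-^ : ∀ f k u → eval (f ^P k) u ≡ eval f u ↑ k
    eval-^ f zero u = eval-1P u
    eval-^ f (suc k) u = trans (eval-* f (f ^P k) u) (cong (eval f u ⊗_) (eval-^ f k u))

    -- The product rule for a + x f.
    D : Poly → Poly
    D [] = []
    D (a ∷ f) = f +P (𝟘 ∷ D f)

    [suc] : ∀ k → [ suc k ] ≡ 𝟙 ⊕ [ k ]
    [suc] k = []-+ 1 k

    coef-D : ∀ f k → coef (D f) k ≡ [ suc k ] ⊗ coef f (suc k)
    coef-D [] k = sym (⊗-zeroʳ _)
    coef-D (a ∷ f) zero = trans (coef-+ f (𝟘 ∷ D f) 0) (trans (⊕-identityʳ _) (sym (⊗-identityˡ _)))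
    coef-D (a ∷ f) (suc k) = trans (coef-+ f (𝟘 ∷ D f) (suc k)) (trans (cong (coef f (suc k) ⊕_) (coef-D f k))
      (sym (trans (cong (_⊗ coef f (suc k)) ([suc] (suc k))) (trans (⊗-distribʳ _ 𝟙 _) (cong (_⊕ [ suc k ] ⊗ coef f (suc k)) (⊗-identityˡ _))))))

    D-[] : D [] ≈ []
    D-[] = ≈-refl

    D-1P : D 1P ≈ []
    D-1P = 𝟘∷[]

    D-cong : ∀ {f g} → f ≈ g → D f ≈ D g
    D-cong {f} {g} e = mk≈ λ k → trans (coef-D f k) (trans (cong ([ suc k ] ⊗_) (at e (suc k))) (sym (coef-D g k)))

    D-+ : ∀ f g → D (f +P g) ≈ D f +P D g
    D-+ f g = mk≈ λ k → trans (coef-D (f +P g) k) (trans (cong ([ suc k ] ⊗_) (coef-+ f g (suc k))) (trans (⊗-distribˡ [ suc k ] _ _)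
      (sym (trans (coef-+ (D f) (D g) k) (cong₂ _⊕_ (coef-D f k) (coef-D g k))))))

    D-scal : ∀ c f → D (scal c f) ≈ scal c (D f)
    D-scal c f = mk≈ λ k → trans (coef-D (scal c f) k) (trans (cong ([ suc k ] ⊗_) (coef-scal c f (suc k)))
      (trans (sym (⊗-assoc _ _ _)) (trans (cong (_⊗ coef f (suc k)) (⊗-comm _ c)) (trans (⊗-assoc _ _ _)
      (sym (trans (coef-scal c (D f) k) (cong (c ⊗_) (coef-D f k))))))))

    leibniz : ∀ f g → D (f *P g) ≈ D f *P g +P f *P D g
    leibniz [] g = ≈-refl
    leibniz (a ∷ f) g = ≈-trans (D-+ (scal a g) (𝟘 ∷ (f *P g)))
      (≈-trans (+-cong (D-scal a g) (+-cong (≈-refl {f *P g}) (≈-trans (∷-cong refl (leibniz f g)) (shift-+ (D f *P g) (f *P D g)))))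
      (≈-trans (re (scal a (D g)) (f *P g) (𝟘 ∷ (D f *P g)) (𝟘 ∷ (f *P D g)))
        (+-cong (≈-trans (+-cong (≈-refl {f *P g}) (≈-sym (shift-* (D f) g))) (≈-sym (*-distribʳ g f (𝟘 ∷ D f)))) ≈-refl)))
      where
      re : ∀ s a b c → s +P (a +P (b +P c)) ≈ (a +P b) +P (s +P c)
      re = id₁

  infix 4 _deg≤_
  _deg≤_ : Poly → ℕ → Set
  f deg≤ d = length f ≤ suc d

  abstract
    length-+P : ∀ f g → length (f +P g) ≤ length f ⊔ length g
    length-+P [] g = ℕₚ.≤-refl
    length-+P (a ∷ f) [] = ℕₚ.≤-refl
    length-+P (a ∷ f) (b ∷ g) = s≤s (length-+P f g)

    length-+P≤ : ∀ f g {d} → length f ≤ d → length g ≤ d → length (f +P g) ≤ d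
    length-+P≤ f g a b = ℕₚ.≤-trans (length-+P f g) (ℕₚ.⊔-lub a b)

    length-scal : ∀ c f {d} → length f ≤ d → length (scal c f) ≤ d
    length-scal c f h = ℕₚ.≤-trans (ℕₚ.≤-reflexive (length-map (c ⊗_) f)) h

    deg-* : ∀ f g {a b} → f deg≤ a → g deg≤ b → f *P g deg≤ a ℕ.+ b
    deg-* [] g _ _ = z≤n
    deg-* (x ∷ []) g {a} {b} _ h = length-+P≤ (scal x g) (𝟘 ∷ []) (length-scal x g (ℕₚ.≤-trans h (s≤s (ℕₚ.m≤n+m b a)))) (s≤s z≤n)
    deg-* (x ∷ f@(_ ∷ _)) g {suc a} {b} (s≤s h₁) h = length-+P≤ (scal x g) (𝟘 ∷ (f *P g)) (length-scal x g (ℕₚ.≤-trans h (s≤s (ℕₚ.m≤n+m b (suc a))))) (s≤s (deg-* f g h₁ h))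

    deg-^ : ∀ f k {a} → f deg≤ a → f ^P k deg≤ k ℕ.* a
    deg-^ f zero h = ℕₚ.≤-refl
    deg-^ f (suc k) h = deg-* f (f ^P k) h (deg-^ f k h)

    length-D : ∀ f → length (D f) ≤ length f
    length-D [] = z≤n
    length-D (a ∷ f) = length-+P≤ f (𝟘 ∷ D f) (ℕₚ.n≤1+n _) (s≤s (length-D f))

    coef-beyond : ∀ f k → length f ≤ k → coef f k ≡ 𝟘
    coef-beyond [] k _ = refl
    coef-beyond (a ∷ f) (suc k) (s≤s h) = coef-beyond f k h

    shiftN : ℕ → Poly → Poly
    shiftN v f = replicate v 𝟘 ++ f

    length-shiftN : ∀ v f → length (shiftN v f) ≡ v ℕ.+ length f
    length-shiftN zero f = refl
    length-shiftN (suc v) f = cong suc (length-shiftN v f)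

    coef-shiftN-< : ∀ v f k → k < v → coef (shiftN v f) k ≡ 𝟘
    coef-shiftN-< (suc v) f zero _ = refl
    coef-shiftN-< (suc v) f (suc k) (s≤s h) = coef-shiftN-< v f k h

    coef-shiftN-+ : ∀ v f k → coef (shiftN v f) (v ℕ.+ k) ≡ coef f k
    coef-shiftN-+ zero f k = refl
    coef-shiftN-+ (suc v) f k = coef-shiftN-+ v f k

    shiftN-cong : ∀ v {f g} → f ≈ g → shiftN v f ≈ shiftN v g
    shiftN-cong zero e = e
    shiftN-cong (suc v) e = ∷-cong refl (shiftN-cong v e)

    shiftN-* : ∀ v f g → shiftN v f *P g ≈ shiftN v (f *P g)
    shiftN-* zero f g = ≈-refl
    shiftN-* (suc v) f g = ≈-trans (shift-* (shiftN v f) g) (∷-cong refl (shiftN-* v f g))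

    eval-shiftN : ∀ v f u → eval (shiftN v f) u ≡ u ↑ v ⊗ eval f u
    eval-shiftN zero f u = sym (⊗-identityˡ _)
    eval-shiftN (suc v) f u = trans (⊕-identityˡ _) (trans (cong (u ⊗_) (eval-shiftN v f u)) (sym (⊗-assoc u _ _)))

    shiftN-+ : ∀ v w f → shiftN v (shiftN w f) ≡ shiftN (v ℕ.+ w) f
    shiftN-+ zero w f = refl
    shiftN-+ (suc v) w f = cong (𝟘 ∷_) (shiftN-+ v w f)

  -- The exact order of vanishing at 0. Orders add under products and distinct orders imply
  -- independence, which replaces any comparison of leading terms.
  Ord : ℕ → Poly → Set
  Ord v f = ∃ λ g → f ≈ shiftN v g × coef g 0 ≢ 𝟘

  abstract
    coef-*-0 : ∀ f g → coef (f *P g) 0 ≡ coef f 0 ⊗ coef g 0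
    coef-*-0 [] g = sym (⊗-zeroˡ _)
    coef-*-0 (a ∷ f) g = trans (coef-+ (scal a g) (𝟘 ∷ (f *P g)) 0) (trans (⊕-identityʳ _) (coef-scal a g 0))

    Ord-* : ∀ {v w f g} → Ord v f → Ord w g → Ord (v ℕ.+ w) (f *P g)
    Ord-* {v} {w} {f} {g} (f′ , ef , nf) (g′ , eg , ng) = f′ *P g′ ,
      ≈-trans (*-cong ef eg) (≈-trans (shiftN-* v f′ (shiftN w g′)) (≈-trans (shiftN-cong v (≈-trans (*-comm f′ (shiftN w g′)) (≈-trans (shiftN-* w g′ f′) (shiftN-cong w (*-comm g′ f′))))) (subst (shiftN v (shiftN w (f′ *P g′)) ≈_) (shiftN-+ v w _) ≈-refl))) ,
      λ e → ⊗-nonzero nf ng (trans (sym (coef-*-0 f′ g′)) e)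

    Ord-0 : ∀ {f} → coef f 0 ≢ 𝟘 → Ord 0 f
    Ord-0 {f} h = f , ≈-refl , h

    Ord-^ : ∀ {v f} k → Ord v f → Ord (k ℕ.* v) (f ^P k)
    Ord-^ zero o = Ord-0 𝟙≢𝟘
    Ord-^ {v} {f} (suc k) o = Ord-* {v} {k ℕ.* v} {f} {f ^P k} o (Ord-^ k o)

    Ord-X : ∀ v → Ord v (shiftN v 1P)
    Ord-X v = 1P , ≈-refl , 𝟙≢𝟘

    Lin : F → Poly
    Lin c = c ∷ 𝟙 ∷ []

    eval-Lin : ∀ c u → eval (Lin c) u ≡ u ⊕ c
    eval-Lin c u = trans (cong (λ z → c ⊕ u ⊗ z) (eval-1P u)) (trans (cong (c ⊕_) (⊗-identityʳ u)) (⊕-comm c u))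

    -- Horner's scheme: the coefficients of the quotient by x - u are the values at `u` of the
    -- successive tails.
    quo : F → Poly → Poly
    quo u [] = []
    quo u (a ∷ []) = []
    quo u (a ∷ f@(_ ∷ _)) = eval f u ∷ quo u f

    length-quo : ∀ u f → length (quo u f) ≤ length f ∸ 1
    length-quo u [] = z≤n
    length-quo u (a ∷ []) = z≤n
    length-quo u (a ∷ f@(_ ∷ _)) = s≤s (length-quo u f)

    quo-step : ∀ u a f q → f ≈ Lin (⊖ u) *P q +P (eval f u ∷ []) →
      a ∷ f ≈ Lin (⊖ u) *P (eval f u ∷ q) +P ((a ⊕ u ⊗ eval f u) ∷ [])
    quo-step u a f q ih = ≈-sym (≈-trans (+-cong (*-∷ (Lin (⊖ u)) (eval f u) q) (≈-refl {(a ⊕ u ⊗ eval f u) ∷ []})) (∷-cong hd tl))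
      where
      hd : ((eval f u ⊗ ⊖ u) ⊕ 𝟘) ⊕ (a ⊕ u ⊗ eval f u) ≡ a
      hd = trans (cong₂ _⊕_ (trans (⊕-identityʳ _) (trans (⊗-comm _ _) (sym (⊖-distribˡ-⊗ u (eval f u))))) (⊕-comm a _))
         (trans (sym (⊕-assoc _ _ _)) (trans (cong (_⊕ a) (⊖-inverseˡ _)) (⊕-identityˡ a)))
      tl : (((eval f u ⊗ 𝟙) ∷ []) +P (Lin (⊖ u) *P q)) +P [] ≈ f
      tl = ≈-trans (+-identityʳ _) (≈-trans (+-cong (∷-cong {f = []} (⊗-identityʳ (eval f u)) ≈-refl) (≈-refl {Lin (⊖ u) *P q})) (≈-trans (+-comm (eval f u ∷ []) _) (≈-sym ih)))

    quo-spec : ∀ u f → f ≈ Lin (⊖ u) *P quo u f +P (eval f u ∷ [])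
    quo-spec u [] = ≈-trans (≈-sym 𝟘∷[]) (≈-trans (≈-sym (≈-refl {[] +P (𝟘 ∷ [])})) (+-cong (≈-sym (*-zeroʳ (Lin (⊖ u)))) ≈-refl))
    quo-spec u (a ∷ []) = ≈-trans (∷-cong (sym (trans (cong (a ⊕_) (⊗-zeroʳ u)) (⊕-identityʳ a))) ≈-refl) (+-cong {[]} (≈-sym (*-zeroʳ (Lin (⊖ u)))) ≈-refl)
    quo-spec u (a ∷ f@(_ ∷ _)) = quo-step u a f (quo u f) (quo-spec u f)

    length-Lin : ∀ {c} → length (Lin c) ≡ 2
    length-Lin = refl

    coef-Lin : ∀ {c} → coef (Lin c) 0 ≡ c
    coef-Lin = refl

    Ord-Lin𝟘 : Ord 1 (Lin 𝟘)
    Ord-Lin𝟘 = 1P , ≈-refl , 𝟙≢𝟘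

    D-Lin : ∀ c → D (Lin c) ≈ 1P
    D-Lin c = mk≈ λ { zero → ⊕-identityʳ 𝟙 ; (suc zero) → refl ; (suc (suc k)) → refl }

    root-factor : ∀ u f → eval f u ≡ 𝟘 → f ≈ Lin (⊖ u) *P quo u f
    root-factor u f e = ≈-trans (quo-spec u f) (≈-trans (+-cong (≈-refl {Lin (⊖ u) *P quo u f}) (≈-trans (∷-cong {f = []} e ≈-refl) 𝟘∷[])) (+-identityʳ _))

  abstract
    coef-X-≢ : ∀ v k → v ≢ k → coef (shiftN v 1P) k ≡ 𝟘
    coef-X-≢ zero zero h = ⊥-elim (h refl)
    coef-X-≢ zero (suc k) h = refl
    coef-X-≢ (suc v) zero h = refl
    coef-X-≢ (suc v) (suc k) h = coef-X-≢ v k (h ∘ cong suc)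

  -- Differentiation multiplies the only nonzero coefficient by its exponent pj, which is 0 in the
  -- field.
  D-Xᵖ : ∀ j → D (shiftN (p ℕ.* j) 1P) ≈ []
  D-Xᵖ j = mk≈ λ k → trans (coef-D (shiftN (p ℕ.* j) 1P) k) (trans (vanish k) (sym (coef-[] k)))
    where
    vanish : ∀ k → [ suc k ] ⊗ coef (shiftN (p ℕ.* j) 1P) (suc k) ≡ 𝟘
    vanish k with p ℕ.* j ℕₚ.≟ suc k
    ... | yes e = trans (cong (_⊗ coef (shiftN (p ℕ.* j) 1P) (suc k)) (trans (cong [_] (sym e)) (trans ([]-* p j) (trans (cong (_⊗ [ j ]) [p]) (⊗-zeroˡ _))))) (⊗-zeroˡ _)
    ... | no ne = trans (cong ([ suc k ] ⊗_) (coef-X-≢ (p ℕ.* j) (suc k) ne)) (⊗-zeroʳ _)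

  module Derivation (W : Poly) where

    -- The factor `W` clears the denominators of logarithmic derivatives: for `W = P₁ *P P₂` both
    -- factors satisfy δP = cP with a polynomial c. Where `W` does not vanish, `δ` detects
    -- multiplicities as well as `D` does.
    δ : Poly → Poly
    δ f = W *P D f

    δ^ : ℕ → Poly → Poly
    δ^ zero f = f
    δ^ (suc m) f = δ^ m (δ f)

    δ-cong : ∀ {f g} → f ≈ g → δ f ≈ δ g
    δ-cong e = *-congˡ W (D-cong e)

    δ^-cong : ∀ m {f g} → f ≈ g → δ^ m f ≈ δ^ m g
    δ^-cong zero e = e
    δ^-cong (suc m) e = δ^-cong m (δ-cong e)

    δ-* : ∀ f g → δ (f *P g) ≈ δ f *P g +P f *P δ g
    δ-* f g = ≈-trans (*-congˡ W (leibniz f g)) (id₂ W f g (D f) (D g))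

    δ-+ : ∀ f g → δ (f +P g) ≈ δ f +P δ g
    δ-+ f g = ≈-trans (*-congˡ W (D-+ f g)) (*-distribˡ W _ _)

    δ-scal : ∀ c f → δ (scal c f) ≈ scal c (δ f)
    δ-scal c f = ≈-trans (*-congˡ W (D-scal c f)) (≈-trans (*-comm W _) (≈-trans (scal-* c (D f) W) (scal-cong c (*-comm (D f) W))))

    δ-Lin : ∀ c → δ (Lin c) ≈ W
    δ-Lin c = ≈-trans (*-congˡ W (D-Lin c)) (*-identityʳ W)

    δ-Lin^ : ∀ c s G → δ (Lin c ^P suc s *P G) ≈ Lin c ^P s *P (scal [ suc s ] W *P G +P Lin c *P δ G)
    δ-Lin^ c zero G = ≈-trans (δ-cong {Lin c ^P 1 *P G} {Lin c *P G} (*-cong (*-identityʳ (Lin c)) ≈-refl)) (≈-trans (δ-* (Lin c) G)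
      (≈-trans (+-cong (*-cong (≈-trans (δ-Lin c) (≈-sym (scal-𝟙 W))) (≈-refl {G})) (≈-refl {Lin c *P δ G})) (≈-sym (*-identityˡ _))))
    δ-Lin^ c (suc s) G = ≈-trans (δ-cong (*-assoc (Lin c) (Lin c ^P suc s) G)) (≈-trans (δ-* (Lin c) (Lin c ^P suc s *P G))
      (≈-trans (+-cong (*-cong (δ-Lin c) ≈-refl) (*-congˡ (Lin c) (δ-Lin^ c s G)))
      (≈-trans (id₃ W (Lin c) (Lin c ^P s) G (scal [ suc s ] W) (δ G))
        (*-congˡ (Lin c ^P suc s) (+-cong (*-cong (≈-trans (+-cong (≈-sym (scal-𝟙 W)) ≈-refl) (≈-trans (≈-sym (scal-⊕ 𝟙 [ suc s ] W)) (subst (λ z → scal (𝟙 ⊕ [ suc s ]) W ≈ scal z W) (sym ([suc] (suc s))) ≈-refl))) (≈-refl {G})) ≈-refl)))))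

    eval-Lin-root : ∀ u → eval (Lin (⊖ u)) u ≡ 𝟘
    eval-Lin-root u = trans (eval-Lin (⊖ u) u) (⊖-inverseʳ u)

    -- Each `δ` removes one factor x - u; the value at `u` that is left after all of them is s!
    -- W(u)^s G(u), and s! is invertible because `s < p`.
    δ^-detects : ∀ u → eval W u ≢ 𝟘 → ∀ s → s < p → ∀ G → eval (δ^ s (Lin (⊖ u) ^P s *P G)) u ≡ 𝟘 → eval G u ≡ 𝟘
    δ^-detects u wu zero _ G e = trans (eval-cong u (≈-sym (*-identityˡ G))) e
    δ^-detects u wu (suc s) s<p G e with ⊗-zero {[ suc s ] ⊗ eval W u} {eval G u} (trans (sym ev) z)
      where
      G′ = scal [ suc s ] W *P G +P Lin (⊖ u) *P δ G
      z : eval G′ u ≡ 𝟘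
      z = δ^-detects u wu s (ℕₚ.<-trans (ℕₚ.n<1+n s) s<p) G′ (trans (sym (eval-cong u (δ^-cong s (δ-Lin^ (⊖ u) s G)))) e)
      ev : eval G′ u ≡ [ suc s ] ⊗ eval W u ⊗ eval G u
      ev = trans (eval-+ (scal [ suc s ] W *P G) (Lin (⊖ u) *P δ G) u) (trans (cong₂ _⊕_ (trans (eval-* (scal [ suc s ] W) G u) (cong (_⊗ eval G u) (eval-scal [ suc s ] W u)))
         (trans (eval-* (Lin (⊖ u)) (δ G) u) (trans (cong (_⊗ eval (δ G) u) (eval-Lin-root u)) (⊗-zeroˡ _)))) (⊕-identityʳ _))
    ... | inj₁ z = ⊥-elim (⊗-nonzero ([]≢𝟘 (s≤s z≤n) s<p) wu z)
    ... | inj₂ z = z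

    -- `V` collects the factors already split off at other points. It does not vanish at `u`, so the
    -- zero found by `δ^-detects` belongs to the cofactor, which is shortened by each division.
    factor-power : ∀ u → eval W u ≢ 𝟘 → ∀ M → M ≤ p → ∀ Φ V Ψ → Φ ≈ V *P Ψ → eval V u ≢ 𝟘 →
      (∀ m → m < M → eval (δ^ m Φ) u ≡ 𝟘) → ∀ s → s ≤ M →
      ∃ λ Ψ′ → Φ ≈ V *P (Lin (⊖ u) ^P s *P Ψ′) × length Ψ′ ≤ length Ψ ∸ s
    factor-power u wu M M≤p Φ V Ψ e vu h zero _ = Ψ , ≈-trans e (*-congˡ V (≈-sym (*-identityˡ Ψ))) , ℕₚ.≤-refl
    factor-power u wu M M≤p Φ V Ψ e vu h (suc s) s<M with factor-power u wu M M≤p Φ V Ψ e vu h s (ℕₚ.<⇒≤ s<M)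
    ... | Ψ₁ , e₁ , l₁ = quo u Ψ₁ , ≈-trans e₁ (*-congˡ V (≈-trans (*-congˡ (X ^P s) (root-factor u Ψ₁ root)) re)) ,
          ℕₚ.≤-trans (length-quo u Ψ₁) (ℕₚ.≤-trans (ℕₚ.∸-monoˡ-≤ 1 l₁) (ℕₚ.≤-reflexive (trans (ℕₚ.∸-+-assoc (length Ψ) s 1) (cong (length Ψ ∸_) (ℕₚ.+-comm s 1)))))
      where
      X = Lin (⊖ u)
      re : X ^P s *P (X *P quo u Ψ₁) ≈ X ^P suc s *P quo u Ψ₁
      re = id₄ (X ^P s) X (quo u Ψ₁)
      com : V *P (X ^P s *P Ψ₁) ≈ X ^P s *P (V *P Ψ₁)
      com = id₅ V (X ^P s) Ψ₁
      z : eval (V *P Ψ₁) u ≡ 𝟘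
      z = δ^-detects u wu s (ℕₚ.<-≤-trans s<M M≤p) (V *P Ψ₁) (trans (eval-cong u (δ^-cong s (≈-sym (≈-trans e₁ com)))) (h s s<M))
      root : eval Ψ₁ u ≡ 𝟘
      root with ⊗-zero (trans (sym (eval-* V Ψ₁ u)) z)
      ... | inj₁ v0 = ⊥-elim (vu v0)
      ... | inj₂ r = r

    -- Every point takes `M` off the length of the cofactor `Ψ`, which is empty by the time all
    -- points have been used.
    vanishing : ∀ M → M ≤ p → ∀ Φ us → AllPairs _≢_ us → All (λ u → eval W u ≢ 𝟘 × (∀ m → m < M → eval (δ^ m Φ) u ≡ 𝟘)) us →
      ∀ V Ψ → Φ ≈ V *P Ψ → All (λ u → eval V u ≢ 𝟘) us → length Ψ ≤ length us ℕ.* M → Φ ≈ []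
    vanishing M M≤p Φ [] _ _ V [] e _ _ = ≈-trans e (*-zeroʳ V)
    vanishing M M≤p Φ (u ∷ us) (u≢ ∷ uniq) ((wu , h) ∷ hs) V Ψ e (vu ∷ vus) len
      with factor-power u wu M M≤p Φ V Ψ e vu h M ℕₚ.≤-refl
    ... | Ψ′ , e′ , l′ = vanishing M M≤p Φ us uniq hs (V *P X ^P M) Ψ′ (≈-trans e′ (≈-sym (*-assoc V (X ^P M) Ψ′)))
          (All.zipWith (λ (ne , v) → nz ne v) (u≢ , vus))
          (ℕₚ.≤-trans l′ (ℕₚ.≤-trans (ℕₚ.∸-monoˡ-≤ M len) (ℕₚ.≤-reflexive (ℕₚ.m+n∸m≡n M (length us ℕ.* M)))))
      where
      X = Lin (⊖ u)
      nz : ∀ {w} → u ≢ w → eval V w ≢ 𝟘 → eval (V *P X ^P M) w ≢ 𝟘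
      nz {w} ne v z = ⊗-nonzero v (↑-nonzero M (λ x0 → ne (sym (a⊖b≡0⇒a≡b (trans (sym (eval-Lin (⊖ u) w)) x0)))))
        (trans (cong (eval V w ⊗_) (sym (eval-^ X M w))) (trans (sym (eval-* V (X ^P M) w)) z))

    multiplicity-bound : ∀ M → M ≤ p → ∀ Φ us → AllPairs _≢_ us → All (λ u → eval W u ≢ 𝟘 × (∀ m → m < M → eval (δ^ m Φ) u ≡ 𝟘)) us →
      length Φ ≤ length us ℕ.* M → Φ ≈ []
    multiplicity-bound M M≤p Φ us uniq hs len = vanishing M M≤p Φ us uniq hs 1P Φ (≈-sym (*-identityˡ Φ)) (All.map (λ {u} _ z → 𝟙≢𝟘 (trans (sym (eval-1P u)) z)) hs) len

-- Stepanov's auxiliary polynomial.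

module Stepanov (n : ℕ) (pr : Prime (suc n)) where

  open import Data.Nat.DivMod using (_/_; _%_; m≡m%n+[m/n]*n; m%n<n; m%n≤m; m<n*o⇒m/o<n; /-monoˡ-≤; m*n/n≡m)
  open Fp n pr
  open Polynomials n pr

  LC : ∀ {T} → (Fin T → F) → (Fin T → Poly) → Poly
  LC {zero} κ Θ = []
  LC {suc T} κ Θ = scal (κ zero) (Θ zero) +P LC (κ ∘ suc) (Θ ∘ suc)

  coef-LC-suc : ∀ {T} (κ : Fin (suc T) → F) Θ k → coef (LC κ Θ) k ≡ κ zero ⊗ coef (Θ zero) k ⊕ coef (LC (κ ∘ suc) (Θ ∘ suc)) k
  coef-LC-suc κ Θ k = trans (coef-+ (scal (κ zero) (Θ zero)) (LC (κ ∘ suc) (Θ ∘ suc)) k) (cong (_⊕ coef (LC (κ ∘ suc) (Θ ∘ suc)) k) (coef-scal (κ zero) (Θ zero) k))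

  coef-LC-zero : ∀ {T} (κ : Fin T → F) Θ k → (∀ t → coef (Θ t) k ≡ 𝟘) → coef (LC κ Θ) k ≡ 𝟘
  coef-LC-zero {zero} κ Θ k h = coef-[] k
  coef-LC-zero {suc T} κ Θ k h = trans (coef-LC-suc κ Θ k) (trans (cong₂ _⊕_ (trans (cong (κ zero ⊗_) (h zero)) (⊗-zeroʳ _)) (coef-LC-zero (κ ∘ suc) (Θ ∘ suc) k (h ∘ suc))) (⊕-identityʳ 𝟘))

  length-LC : ∀ {T} (κ : Fin T → F) Θ {d} → (∀ t → length (Θ t) ≤ d) → length (LC κ Θ) ≤ d
  length-LC {zero} κ Θ h = z≤n
  length-LC {suc T} κ Θ h = length-+P≤ (scal (κ zero) (Θ zero)) (LC (κ ∘ suc) (Θ ∘ suc)) (length-scal (κ zero) (Θ zero) (h zero)) (length-LC (κ ∘ suc) (Θ ∘ suc) (h ∘ suc))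

  coef-LC-⊖ : ∀ {T} (κ μ : Fin T → F) Θ k → coef (LC (λ t → κ t ⊕ ⊖ μ t) Θ) k ≡ coef (LC κ Θ) k ⊕ ⊖ coef (LC μ Θ) k
  coef-LC-⊖ {zero} κ μ Θ k = sym (⊖-inverseʳ _)
  coef-LC-⊖ {suc T} κ μ Θ k = trans (coef-LC-suc (λ t → κ t ⊕ ⊖ μ t) Θ k) (trans (cong₂ _⊕_
      (trans (⊗-distribʳ c (κ zero) (⊖ μ zero)) (cong (κ zero ⊗ c ⊕_) (sym (⊖-distribˡ-⊗ (μ zero) c)))) (coef-LC-⊖ (κ ∘ suc) (μ ∘ suc) (Θ ∘ suc) k))
    (trans (⊕-middle (κ zero ⊗ c) (⊖ (μ zero ⊗ c)) K (⊖ L)) (cong₂ _⊕_ (sym (coef-LC-suc κ Θ k)) (trans (⊖-⊕-comm (μ zero ⊗ c) L) (cong ⊖_ (sym (coef-LC-suc μ Θ k)))))))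
    where
    c K L : F
    c = coef (Θ zero) k
    K = coef (LC (κ ∘ suc) (Θ ∘ suc)) k
    L = coef (LC (μ ∘ suc) (Θ ∘ suc)) k

  eval-LC-scale : ∀ {T} (κ : Fin T → F) Θ Θ′ u w → (∀ t → eval (Θ t) u ≡ w ⊗ eval (Θ′ t) u) → eval (LC κ Θ) u ≡ w ⊗ eval (LC κ Θ′) u
  eval-LC-scale {zero} κ Θ Θ′ u w h = trans (eval-≈[] [] u ≈-refl) (sym (trans (cong (w ⊗_) (eval-≈[] [] u ≈-refl)) (⊗-zeroʳ w)))
  eval-LC-scale {suc T} κ Θ Θ′ u w h = trans (eval-+ (scal (κ zero) (Θ zero)) _ u) (trans (cong₂ _⊕_
     (trans (eval-scal (κ zero) (Θ zero) u) (trans (cong (κ zero ⊗_) (h zero)) (trans (sym (⊗-assoc _ w _)) (trans (cong (_⊗ eval (Θ′ zero) u) (⊗-comm _ w)) (trans (⊗-assoc w _ _) (cong (w ⊗_) (sym (eval-scal (κ zero) (Θ′ zero) u))))))))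
     (eval-LC-scale (κ ∘ suc) (Θ ∘ suc) (Θ′ ∘ suc) u w (h ∘ suc)))
    (trans (sym (⊗-distribˡ w _ _)) (cong (w ⊗_) (sym (eval-+ (scal (κ zero) (Θ′ zero)) _ u)))))

  -- At exponent `v` only the first polynomial has a nonzero coefficient, so its scalar is 0; the
  -- others have the same shape starting from order `suc v`.
  LC-independent : ∀ {T} (κ : Fin T → F) Θ v → (∀ t → Ord (v ℕ.+ toℕ t) (Θ t)) → LC κ Θ ≈ [] → ∀ t → κ t ≡ 𝟘
  LC-independent {suc T} κ Θ v o e = λ { zero → κ0 ; (suc t) → LC-independent (κ ∘ suc) (Θ ∘ suc) (suc v) (λ t → subst (λ z → Ord z (Θ (suc t))) (ℕₚ.+-suc v (toℕ t)) (o (suc t))) rest t }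
    where
    g = proj₁ (o zero)
    coef₀ : coef (Θ zero) v ≡ coef g 0
    coef₀ = trans (at (proj₁ (proj₂ (o zero))) v) (trans (cong (λ z → coef (shiftN z g) v) (ℕₚ.+-identityʳ v)) (trans (cong (coef (shiftN v g)) (sym (ℕₚ.+-identityʳ v))) (coef-shiftN-+ v g 0)))
    lower : ∀ t → coef (Θ (suc t)) v ≡ 𝟘
    lower t = trans (at (proj₁ (proj₂ (o (suc t)))) v) (coef-shiftN-< _ _ v (ℕₚ.m<m+n v (s≤s z≤n)))
    κ0 : κ zero ≡ 𝟘
    κ0 with ⊗-zero (trans (sym (trans (coef-LC-suc κ Θ v) (trans (cong (κ zero ⊗ coef (Θ zero) v ⊕_) (coef-LC-zero (κ ∘ suc) (Θ ∘ suc) v lower)) (⊕-identityʳ _)))) (trans (at e v) (coef-[] v)))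
    ... | inj₁ z = z
    ... | inj₂ z = ⊥-elim (proj₂ (proj₂ (o zero)) (trans (sym coef₀) z))
    rest : LC (κ ∘ suc) (Θ ∘ suc) ≈ []
    rest = ≈-trans (≈-sym (≈-trans (+-cong (≈-trans (subst (λ z → scal (κ zero) (Θ zero) ≈ scal z (Θ zero)) κ0 ≈-refl) (scal-𝟘 (Θ zero))) (≈-refl {LC (κ ∘ suc) (Θ ∘ suc)})) (+-identityˡ _))) e

  funToFin-cong : ∀ {m k} {f g : Fin m → Fin k} → (∀ i → f i ≡ g i) → funToFin f ≡ funToFin g
  funToFin-cong {zero} h = refl
  funToFin-cong {suc m} h = cong₂ Fin.combine (h zero) (funToFin-cong (h ∘ suc))

  -- Siegel's lemma by counting: the p^T vectors of scalars yield at most p^(VM) systems of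
  -- coefficients, so two of them agree, and their difference is a nontrivial solution.
  siegel : ∀ {T M V} → V ℕ.* M < T → (Θ : Fin M → Fin T → Poly) → (∀ m t → length (Θ m t) ≤ V) →
    ∃ λ κ → (∃ λ t → κ t ≢ 𝟘) × (∀ m → LC κ (Θ m) ≈ [])
  siegel {T} {M} {V} lt Θ len with Finₚ.pigeonhole {(p ℕ.^ V) ℕ.^ M} {p ℕ.^ T} pow< img
    where
    pow< : (p ℕ.^ V) ℕ.^ M < p ℕ.^ T
    pow< = subst (_< p ℕ.^ T) (sym (ℕₚ.^-*-assoc p V M)) (ℕₚ.^-monoʳ-< p 1<p lt)
    img : Fin (p ℕ.^ T) → Fin ((p ℕ.^ V) ℕ.^ M)
    img x = funToFin {M} (λ m → funToFin {V} (λ k → coef (LC (finToFun {p} {T} x) (Θ m)) (toℕ k)))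
  ... | x , y , x<y , eq = κ , nonzero , λ m → mk≈ (zero-coef m)
    where
    κx κy κ : Fin T → F
    κx = finToFun {p} {T} x
    κy = finToFun {p} {T} y
    κ t = κx t ⊕ ⊖ κy t
    nonzero : ∃ λ t → κ t ≢ 𝟘
    nonzero with Finₚ.any? (λ t → ¬? (κx t Finₚ.≟ κy t))
    ... | yes (t , ne) = t , λ z → ne (a⊖b≡0⇒a≡b z)
    ... | no h = ⊥-elim (ℕₚ.<-irrefl (cong toℕ x≡y) x<y)
      where
      x≡y : x ≡ y
      x≡y = trans (sym (Finₚ.funToFin-finToFin {T} {p} x)) (trans (funToFin-cong (λ t → decidable-stable (κx t Finₚ.≟ κy t) (λ ne → h (t , ne)))) (Finₚ.funToFin-finToFin {T} {p} y))
    same : ∀ m (k : Fin V) → coef (LC κx (Θ m)) (toℕ k) ≡ coef (LC κy (Θ m)) (toℕ k)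
    same m k = trans (sym (Finₚ.finToFun-funToFin (λ k → coef (LC κx (Θ m)) (toℕ k)) k)) (trans (cong (λ z → finToFun {p} {V} z k)
       (trans (sym (Finₚ.finToFun-funToFin {M} (λ m → funToFin {V} (λ k → coef (LC κx (Θ m)) (toℕ k))) m)) (trans (cong (λ z → finToFun {p ℕ.^ V} {M} z m) eq) (Finₚ.finToFun-funToFin {M} (λ m → funToFin {V} (λ k → coef (LC κy (Θ m)) (toℕ k))) m))))
       (Finₚ.finToFun-funToFin (λ k → coef (LC κy (Θ m)) (toℕ k)) k))
    zero-coef : ∀ m k → coef (LC κ (Θ m)) k ≡ coef [] k
    zero-coef m k with k ℕₚ.<? V
    ... | yes k<V = trans (coef-LC-⊖ κx κy (Θ m) k) (trans (cong (_⊕ ⊖ coef (LC κy (Θ m)) k) (subst (λ z → coef (LC κx (Θ m)) z ≡ coef (LC κy (Θ m)) z) (Finₚ.toℕ-fromℕ< k<V) (same m (Fin.fromℕ< k<V)))) (trans (⊖-inverseʳ _) (sym (coef-[] k))))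
    ... | no k≮V = trans (coef-beyond (LC κ (Θ m)) k (ℕₚ.≤-trans (length-LC κ (Θ m) (len m)) (ℕₚ.≮⇒≥ k≮V))) (sym (coef-[] k))

  module Eigen (W : Poly) where
    open Derivation W public

    δ-[] : δ [] ≈ []
    δ-[] = ≈-trans (*-congˡ W D-[]) (*-zeroʳ W)

    LC-δ : ∀ {T} (κ : Fin T → F) Θ → δ (LC κ Θ) ≈ LC κ (δ ∘ Θ)
    LC-δ {zero} κ Θ = δ-[]
    LC-δ {suc T} κ Θ = ≈-trans (δ-+ (scal (κ zero) (Θ zero)) (LC (κ ∘ suc) (Θ ∘ suc))) (+-cong (δ-scal (κ zero) (Θ zero)) (LC-δ (κ ∘ suc) (Θ ∘ suc)))

    LC-δ^ : ∀ {T} m (κ : Fin T → F) Θ → δ^ m (LC κ Θ) ≈ LC κ (δ^ m ∘ Θ)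
    LC-δ^ zero κ Θ = ≈-refl
    LC-δ^ (suc m) κ Θ = ≈-trans (δ^-cong m (LC-δ κ Θ)) (LC-δ^ m κ (δ ∘ Θ))

    -- `c` is a logarithmic derivative. It adds over products and is only scaled by powers, so its
    -- degree stays bounded however large the exponents in `E` are.
    Eig : Poly → Poly → Set
    Eig c E = δ E ≈ c *P E

    Eig-* : ∀ {c d E G} → Eig c E → Eig d G → Eig (c +P d) (E *P G)
    Eig-* {c} {d} {E} {G} h k = ≈-trans (δ-* E G) (≈-trans (+-cong (*-cong h (≈-refl {G})) (*-congˡ E k)) (id₆ c d E G))

    Eig-^ : ∀ {c E} k → Eig c E → Eig (scal [ k ] c) (E ^P k)
    Eig-^ {c} {E} zero h = ≈-trans (*-congˡ W D-1P) (≈-trans (*-zeroʳ W) (≈-sym (≈-trans (*-cong (≈-trans (subst (λ z → scal z c ≈ scal 𝟘 c) (sym [0]) ≈-refl) (scal-𝟘 c)) (≈-refl {1P})) (≈-trans (*-comm [] 1P) (*-zeroʳ 1P)))))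
    Eig-^ {c} {E} (suc k) h = ≈-trans (Eig-* {c} {scal [ k ] c} {E} {E ^P k} h (Eig-^ {c} {E} k h))
      (*-cong (≈-trans (+-cong (≈-sym (scal-𝟙 c)) (≈-refl {scal [ k ] c})) (≈-trans (≈-sym (scal-⊕ 𝟙 [ k ] c)) (subst (λ z → scal (𝟙 ⊕ [ k ]) c ≈ scal z c) (sym ([suc] k)) ≈-refl))) (≈-refl {E ^P suc k}))

    Eig-Xᵖ : ∀ j → Eig [] (shiftN (p ℕ.* j) 1P)
    Eig-Xᵖ j = ≈-trans (*-congˡ W (D-Xᵖ j)) (≈-trans (*-zeroʳ W) (≈-sym (≈-trans (*-comm [] (shiftN (p ℕ.* j) 1P)) (*-zeroʳ _))))

    step : Poly → Poly → Poly
    step c k = δ k +P c *P k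

    iter : Poly → ℕ → Poly → Poly
    iter c zero k = k
    iter c (suc m) k = iter c m (step c k)

    -- The factor `E`, of large degree in the application, survives every derivative; only the
    -- cofactor changes, and by `deg-iter` it grows by a bounded degree per step.
    δ^-Eig : ∀ {c E} → Eig c E → ∀ m k → δ^ m (k *P E) ≈ iter c m k *P E
    δ^-Eig h zero k = ≈-refl
    δ^-Eig {c} {E} h (suc m) k = ≈-trans (δ^-cong m (≈-trans (δ-* k E) (≈-trans (+-cong (≈-refl {δ k *P E}) (*-congˡ k h)) (id₇ (δ k) E k c)))) (δ^-Eig {c} {E} h m (step c k))

    deg-step : ∀ {c k q d} → W deg≤ q → c deg≤ q → k deg≤ d → step c k deg≤ q ℕ.+ d
    deg-step {c} {k} w h g = length-+P≤ (δ k) (c *P k) (deg-* W (D k) w (ℕₚ.≤-trans (length-D k) g)) (deg-* c k h g)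

    deg-iter : ∀ {c q} m {k d} → W deg≤ q → c deg≤ q → k deg≤ d → iter c m k deg≤ m ℕ.* q ℕ.+ d
    deg-iter zero w h g = g
    deg-iter {c} {q} (suc m) {k} {d} w h g = ℕₚ.≤-trans (deg-iter {c} {q} m {step c k} {q ℕ.+ d} w h (deg-step {c} {k} w h g)) (ℕₚ.≤-reflexive (cong suc (lem m q d)))
      where
      lem : ∀ m q d → m ℕ.* q ℕ.+ (q ℕ.+ d) ≡ q ℕ.+ m ℕ.* q ℕ.+ d
      lem = solve-∀

  -- Stepanov's method: the auxiliary polynomial Σ κ_t Θ_t with Θ_t = xˡ P₁^{mi} P₂^{m(e−i)} x^{pj}, where
  -- t = pj + mi + l.  Since P₁ has a simple zero at 0 and P₂ none, Θ_t vanishes at 0 to order exactly t,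
  -- so the Θ_t are linearly independent; at a solution P₁^m = P₂^m and x^p = x, which is what makes the
  -- derivatives of the auxiliary polynomial collapse to polynomials of small degree.
  module Auxiliary (e m : ℕ) .{{_ : NonZero m}} (em≡n : e ℕ.* m ≡ n) (r : ℕ) (P₁ P₂ : Poly)
    (d₁ : P₁ deg≤ r) (d₂ : P₂ deg≤ r) (o₁ : Ord 1 P₁) (o₂ : Ord 0 P₂)
    (J M : ℕ) (M≤p : M ≤ p) (size : (m ℕ.+ J ℕ.+ 2 ℕ.* r ℕ.* M) ℕ.* M < p ℕ.* J) where

    W : Poly
    W = P₁ *P P₂
    open Eigen W

    -- `T` counts the unknown scalars and `V` the coefficients to be annulled for one derivative, so
    -- that `size` is the condition V M < T of `siegel`.
    T = p ℕ.* J
    V = m ℕ.+ J ℕ.+ 2 ℕ.* r ℕ.* M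

    jj ss ii ll : Fin T → ℕ
    jj t = toℕ t / p
    ss t = toℕ t % p
    ii t = ss t / m
    ll t = ss t % m

    ii≤e : ∀ t → ii t ≤ e
    ii≤e t = ℕₚ.≤-trans (/-monoˡ-≤ m (ℕₚ.≤-pred (m%n<n (toℕ t) p))) (ℕₚ.≤-reflexive (trans (cong (_/ m) (sym em≡n)) (m*n/n≡m e m)))

    c₁ c₂ : Poly
    c₁ = P₂ *P D P₁
    c₂ = P₁ *P D P₂

    eig₁ : Eig c₁ P₁
    eig₁ = id₈ P₁ P₂ (D P₁)

    eig₂ : Eig c₂ P₂
    eig₂ = id₉ P₁ P₂ (D P₂)

    k₁ k₂ : Fin T → ℕ
    k₁ t = ii t ℕ.* m
    k₂ t = (e ∸ ii t) ℕ.* m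

    E cc : Fin T → Poly
    E t = (P₁ ^P k₁ t *P P₂ ^P k₂ t) *P shiftN (p ℕ.* jj t) 1P
    cc t = (scal [ k₁ t ] c₁ +P scal [ k₂ t ] c₂) +P []

    eigE : ∀ t → Eig (cc t) (E t)
    eigE t = Eig-* {_} {[]} {P₁ ^P k₁ t *P P₂ ^P k₂ t} (Eig-* {_} {_} {P₁ ^P k₁ t} {P₂ ^P k₂ t} (Eig-^ {c₁} {P₁} (k₁ t) eig₁) (Eig-^ {c₂} {P₂} (k₂ t) eig₂)) (Eig-Xᵖ (jj t))

    Θ : Fin T → Poly
    Θ t = shiftN (ll t) 1P *P E t

    k₁+k₂ : ∀ t → k₁ t ℕ.+ k₂ t ≡ n
    k₁+k₂ t = trans (sym (ℕₚ.*-distribʳ-+ m (ii t) (e ∸ ii t))) (trans (cong (ℕ._* m) (ℕₚ.m+[n∸m]≡n (ii≤e t))) em≡n)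

    index : ∀ t → ll t ℕ.+ (k₁ t ℕ.* 1 ℕ.+ k₂ t ℕ.* 0 ℕ.+ p ℕ.* jj t) ≡ toℕ t
    index t = trans (lem (ll t) (k₁ t) (k₂ t) p (jj t)) (trans (cong (ℕ._+ jj t ℕ.* p) (sym (m≡m%n+[m/n]*n (ss t) m))) (sym (m≡m%n+[m/n]*n (toℕ t) p)))
      where
      lem : ∀ l a b q j → l ℕ.+ (a ℕ.* 1 ℕ.+ b ℕ.* 0 ℕ.+ q ℕ.* j) ≡ (l ℕ.+ a) ℕ.+ j ℕ.* q
      lem = solve-∀

    ordΘ : ∀ t → Ord (toℕ t) (Θ t)
    ordΘ t = subst (λ z → Ord z (Θ t)) (index t)
      (Ord-* {ll t} {_} {shiftN (ll t) 1P} {E t} (Ord-X (ll t))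
        (Ord-* {_} {p ℕ.* jj t} {P₁ ^P k₁ t *P P₂ ^P k₂ t} {shiftN (p ℕ.* jj t) 1P}
          (Ord-* {_} {_} {P₁ ^P k₁ t} {P₂ ^P k₂ t} (Ord-^ {1} {P₁} (k₁ t) o₁) (Ord-^ {0} {P₂} (k₂ t) o₂)) (Ord-X (p ℕ.* jj t))))

    deg-X : ∀ v → shiftN v 1P deg≤ v
    deg-X v = ℕₚ.≤-reflexive (trans (length-shiftN v 1P) (trans (cong (v ℕ.+_) length-1P) (ℕₚ.+-comm v 1)))

    jj<J : ∀ t → jj t < J
    jj<J t = m<n*o⇒m/o<n (subst (toℕ t <_) (ℕₚ.*-comm p J) (Finₚ.toℕ<n t))

    lengthΘ : ∀ t → length (Θ t) ≤ p ℕ.* (J ℕ.+ r)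
    lengthΘ t = ℕₚ.≤-trans (deg-* (shiftN (ll t) 1P) (E t) (deg-X (ll t))
        (deg-* (P₁ ^P k₁ t *P P₂ ^P k₂ t) (shiftN (p ℕ.* jj t) 1P) (deg-* (P₁ ^P k₁ t) (P₂ ^P k₂ t) (deg-^ P₁ (k₁ t) d₁) (deg-^ P₂ (k₂ t) d₂)) (deg-X (p ℕ.* jj t)))) (begin
      suc (ll t) ℕ.+ (k₁ t ℕ.* r ℕ.+ k₂ t ℕ.* r ℕ.+ p ℕ.* jj t) ≡⟨ cong (λ z → suc (ll t) ℕ.+ (z ℕ.+ p ℕ.* jj t)) (trans (sym (ℕₚ.*-distribʳ-+ r (k₁ t) (k₂ t))) (cong (ℕ._* r) (k₁+k₂ t))) ⟩
      suc (ll t) ℕ.+ (n ℕ.* r ℕ.+ p ℕ.* jj t) ≤⟨ ℕₚ.+-mono-≤ (ℕₚ.≤-trans (s≤s (m%n≤m (ss t) m)) (m%n<n (toℕ t) p)) (ℕₚ.+-monoˡ-≤ (p ℕ.* jj t) (ℕₚ.*-monoˡ-≤ r (ℕₚ.n≤1+n n))) ⟩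
      p ℕ.+ (p ℕ.* r ℕ.+ p ℕ.* jj t) ≡⟨ lem p r (jj t) ⟩
      p ℕ.* (suc (jj t) ℕ.+ r) ≤⟨ ℕₚ.*-monoʳ-≤ p (ℕₚ.+-monoˡ-≤ r (jj<J t)) ⟩
      p ℕ.* (J ℕ.+ r) ∎)
      where
      open ℕₚ.≤-Reasoning
      lem : ∀ q r j → q ℕ.+ (q ℕ.* r ℕ.+ q ℕ.* j) ≡ q ℕ.* (suc j ℕ.+ r)
      lem = solve-∀

    θ : ℕ → Fin T → Poly
    θ q t = iter (cc t) q (shiftN (ll t) 1P)

    C : ℕ → Fin T → Poly
    C q t = shiftN (jj t) (θ q t)

    degW : W deg≤ r ℕ.+ r
    degW = deg-* P₁ P₂ d₁ d₂

    degcc : ∀ t → cc t deg≤ r ℕ.+ r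
    degcc t = length-+P≤ (scal [ k₁ t ] c₁ +P scal [ k₂ t ] c₂) [] (length-+P≤ (scal [ k₁ t ] c₁) (scal [ k₂ t ] c₂)
       (length-scal [ k₁ t ] c₁ (deg-* P₂ (D P₁) d₂ (ℕₚ.≤-trans (length-D P₁) d₁))) (length-scal [ k₂ t ] c₂ (deg-* P₁ (D P₂) d₁ (ℕₚ.≤-trans (length-D P₂) d₂)))) z≤n

    lengthC : ∀ q → q ≤ M → ∀ t → length (C q t) ≤ V
    lengthC q q≤M t = begin
      length (C q t) ≡⟨ length-shiftN (jj t) (θ q t) ⟩
      jj t ℕ.+ length (θ q t) ≤⟨ ℕₚ.+-mono-≤ (ℕₚ.<⇒≤ (jj<J t)) (deg-iter {cc t} q {shiftN (ll t) 1P} degW (degcc t) (deg-X (ll t))) ⟩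
      J ℕ.+ suc (q ℕ.* (r ℕ.+ r) ℕ.+ ll t) ≡⟨ lem J q r (ll t) ⟩
      suc (ll t) ℕ.+ J ℕ.+ 2 ℕ.* r ℕ.* q ≤⟨ ℕₚ.+-mono-≤ (ℕₚ.+-monoˡ-≤ J (m%n<n (ss t) m)) (ℕₚ.*-monoʳ-≤ (2 ℕ.* r) q≤M) ⟩
      V ∎
      where
      open ℕₚ.≤-Reasoning
      lem : ∀ J q r l → J ℕ.+ suc (q ℕ.* (r ℕ.+ r) ℕ.+ l) ≡ suc l ℕ.+ J ℕ.+ 2 ℕ.* r ℕ.* q
      lem = solve-∀

    Solution : F → Set
    Solution u = eval P₁ u ↑ m ≡ eval P₂ u ↑ m × eval P₁ u ≢ 𝟘

    ↑-zero-base : ∀ {x} k .{{_ : NonZero k}} → x ≡ 𝟘 → x ↑ k ≡ 𝟘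
    ↑-zero-base (suc k) refl = ⊗-zeroˡ _

    eval-W≢𝟘 : ∀ {u} → Solution u → eval W u ≢ 𝟘
    eval-W≢𝟘 {u} (eq , nz) z with ⊗-zero (trans (sym (eval-* P₁ P₂ u)) z)
    ... | inj₁ z₁ = nz z₁
    ... | inj₂ z₂ = ↑-nonzero m nz (trans eq (↑-zero-base m z₂))

    ↑p* : ∀ u j → u ↑ (p ℕ.* j) ≡ u ↑ j
    ↑p* u j = trans (sym (↑-* u p j)) (cong (_↑ j) (fermat-p u))

    -- The exponents of `P₁` and `P₂` in `Θ t` are multiples of `m` with sum `n`, so at a solution
    -- both powers together give P₁(u)^n. Being the same for all `t`, this factor comes out of the
    -- linear combination.
    collapse : ∀ {u} → Solution u → ∀ q t → eval (δ^ q (Θ t)) u ≡ (eval P₁ u ↑ n) ⊗ eval (C q t) u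
    collapse {u} (eq , nz) q t = trans (eval-cong u (δ^-Eig {cc t} {E t} (eigE t) q (shiftN (ll t) 1P)))
      (trans (eval-* (θ q t) (E t) u) (trans (cong (eval (θ q t) u ⊗_) evE) (trans (re (eval (θ q t) u) w (u ↑ jj t)) (cong (w ⊗_) (sym (eval-shiftN (jj t) (θ q t) u))))))
      where
      w = eval P₁ u ↑ n
      re : ∀ a b c → a ⊗ (b ⊗ c) ≡ b ⊗ (c ⊗ a)
      re a b c = trans (⊗-comm a _) (⊗-assoc b c a)
      pw : eval P₂ u ↑ k₂ t ≡ eval P₁ u ↑ k₂ t
      pw = trans (cong (eval P₂ u ↑_) (ℕₚ.*-comm (e ∸ ii t) m)) (trans (sym (↑-* _ m (e ∸ ii t))) (trans (cong (_↑ (e ∸ ii t)) (sym eq)) (trans (↑-* _ m (e ∸ ii t)) (cong (eval P₁ u ↑_) (ℕₚ.*-comm m (e ∸ ii t))))))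
      evE : eval (E t) u ≡ w ⊗ (u ↑ jj t)
      evE = trans (eval-* (P₁ ^P k₁ t *P P₂ ^P k₂ t) (shiftN (p ℕ.* jj t) 1P) u) (cong₂ _⊗_
        (trans (eval-* (P₁ ^P k₁ t) (P₂ ^P k₂ t) u) (trans (cong₂ _⊗_ (eval-^ P₁ (k₁ t) u) (trans (eval-^ P₂ (k₂ t) u) pw)) (trans (sym (↑-+ (eval P₁ u) (k₁ t) (k₂ t))) (cong (eval P₁ u ↑_) (k₁+k₂ t)))))
        (trans (eval-shiftN (p ℕ.* jj t) 1P u) (trans (cong ((u ↑ (p ℕ.* jj t)) ⊗_) (eval-1P u)) (trans (⊗-identityʳ _) (↑p* u (jj t))))))

    -- With more solutions, the combination supplied by `siegel` would have as many zeros, each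
    -- counted `M` times, as its length; it would vanish, against `LC-independent`.
    bound : ∀ us → AllPairs _≢_ us → All Solution us → length us ℕ.* M < p ℕ.* (J ℕ.+ r)
    bound us uniq sols with length us ℕ.* M ℕₚ.<? p ℕ.* (J ℕ.+ r)
    ... | yes lt = lt
    ... | no ≮ with siegel {T} {M} {V} size (λ q t → C (toℕ q) t) (λ q t → lengthC (toℕ q) (ℕₚ.<⇒≤ (Finₚ.toℕ<n q)) t)
    ...   | κ , (t , κt≢0) , vanish = ⊥-elim (κt≢0 (LC-independent κ Θ 0 ordΘ zeroΦ t))
      where
      Φ = LC κ Θ
      root : ∀ {u} → Solution u → ∀ q → q < M → eval (δ^ q Φ) u ≡ 𝟘
      root {u} s q q<M = trans (eval-cong u (LC-δ^ q κ Θ)) (trans (eval-LC-scale κ (δ^ q ∘ Θ) (C q) u (eval P₁ u ↑ n) (collapse s q))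
        (trans (cong ((eval P₁ u ↑ n) ⊗_) (eval-≈[] (LC κ (C q)) u (subst (λ z → LC κ (C z) ≈ []) (Finₚ.toℕ-fromℕ< q<M) (vanish (Fin.fromℕ< q<M))))) (⊗-zeroʳ _)))
      zeroΦ : Φ ≈ []
      zeroΦ = multiplicity-bound M M≤p Φ us uniq (All.map (λ s → eval-W≢𝟘 s , root s) sols)
        (ℕₚ.≤-trans (length-LC κ Θ lengthΘ) (ℕₚ.≮⇒≥ ≮))

-- Tuples arranged as binary trees, and their repetitions.

module Trees where

  open import Data.Nat
  open import Data.Nat.Properties
  open import Data.List.Properties using (length-++; ++-assoc; ++-identityʳ)
  open FiniteSums

  occ : ∀ {k} → Fin k → List (Fin k) → ℕ
  occ x [] = 0
  occ x (y ∷ ys) = ⟦ does (x Finₚ.≟ y) ⟧ + occ x ys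

  occ-++ : ∀ {k} (x : Fin k) xs ys → occ x (xs ++ ys) ≡ occ x xs + occ x ys
  occ-++ x [] ys = refl
  occ-++ x (y ∷ xs) ys = trans (cong (⟦ does (x Finₚ.≟ y) ⟧ +_) (occ-++ x xs ys)) (sym (+-assoc ⟦ does (x Finₚ.≟ y) ⟧ _ _))

  ∑-pick : ∀ {k} (x : Fin k) (g : Fin k → ℕ) → sum (λ c → ⟦ does (x Finₚ.≟ c) ⟧ * g c) ≡ g x
  ∑-pick x g = trans (∑-single _ x (λ j ne → cong (λ b → ⟦ b ⟧ * g j) (dec-false (x Finₚ.≟ j) (ne ∘ sym)))) (trans (cong (λ b → ⟦ b ⟧ * g x) (dec-true (x Finₚ.≟ x) refl)) (+-identityʳ _))

  ∑-pick′ : ∀ {k} (x : Fin k) → sum (λ c → ⟦ does (c Finₚ.≟ x) ⟧) ≡ 1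
  ∑-pick′ x = trans (∑-single _ x (λ j ne → cong ⟦_⟧ (dec-false (j Finₚ.≟ x) ne))) (cong ⟦_⟧ (dec-true (x Finₚ.≟ x) refl))

  positive : ℕ → Bool
  positive zero = false
  positive (suc _) = true

  -- The length minus the number of distinct entries.
  repeats : ∀ {k} → List (Fin k) → ℕ
  repeats [] = 0
  repeats (x ∷ xs) = ⟦ positive (occ x xs) ⟧ + repeats xs

  singles : ∀ {k} → List (Fin k) → ℕ
  singles xs = sum (λ y → ⟦ does (occ y xs ≟ 1) ⟧)

  -- A value of multiplicity v ≥ 2 accounts for v - 1 ≥ v/2 repeats. In the induction, a recurring
  -- head adds a repeat and destroys at most one single; a fresh head adds a single.
  length≤repeats : ∀ {k} (xs : List (Fin k)) → length xs ≤ 2 * repeats xs + singles xs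
  length≤repeats [] = z≤n
  length≤repeats {k} (x ∷ xs) with occ x xs in occ0
  ... | suc _ = begin
    suc (length xs) ≤⟨ s≤s (length≤repeats xs) ⟩
    suc (2 * repeats xs + singles xs) ≤⟨ s≤s (+-monoʳ-≤ (2 * repeats xs) drop) ⟩
    suc (2 * repeats xs + (singles (x ∷ xs) + 1)) ≡⟨ lem (repeats xs) (singles (x ∷ xs)) ⟩
    2 * (1 + repeats xs) + singles (x ∷ xs) ∎
    where
    open ≤-Reasoning
    lem : ∀ r s → suc (2 * r + (s + 1)) ≡ 2 * (1 + r) + s
    lem = solve-∀
    pt : ∀ y → ⟦ does (occ y xs ≟ 1) ⟧ ≤ ⟦ does (occ y (x ∷ xs) ≟ 1) ⟧ + ⟦ does (y Finₚ.≟ x) ⟧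
    pt y with y Finₚ.≟ x
    ... | yes _ = ≤-trans (⟦⟧≤1 _) (m≤n+m 1 _)
    ... | no _ = m≤m+n _ 0
    drop : singles xs ≤ singles (x ∷ xs) + 1
    drop = ≤-trans (∑-mono pt) (≤-reflexive (trans (∑-distrib-+ (λ y → ⟦ does (occ y (x ∷ xs) ≟ 1) ⟧) (λ y → ⟦ does (y Finₚ.≟ x) ⟧)) (cong (singles (x ∷ xs) +_) (∑-pick′ x))))
  ... | zero = begin
    suc (length xs) ≤⟨ s≤s (length≤repeats xs) ⟩
    suc (2 * repeats xs + singles xs) ≡⟨ lem (repeats xs) (singles xs) ⟩
    2 * repeats xs + (singles xs + 1) ≤⟨ +-monoʳ-≤ (2 * repeats xs) gain ⟩
    2 * repeats xs + singles (x ∷ xs) ∎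
    where
    open ≤-Reasoning
    lem : ∀ r s → suc (2 * r + s) ≡ 2 * r + (s + 1)
    lem = solve-∀
    pt : ∀ y → ⟦ does (occ y xs ≟ 1) ⟧ + ⟦ does (y Finₚ.≟ x) ⟧ ≤ ⟦ does (occ y (x ∷ xs) ≟ 1) ⟧
    pt y with y Finₚ.≟ x
    ... | yes refl rewrite occ0 = ≤-refl
    ... | no _ = ≤-reflexive (+-identityʳ _)
    gain : singles xs + 1 ≤ singles (x ∷ xs)
    gain = ≤-trans (≤-reflexive (sym (trans (∑-distrib-+ (λ y → ⟦ does (occ y xs ≟ 1) ⟧) (λ y → ⟦ does (y Finₚ.≟ x) ⟧)) (cong (singles xs +_) (∑-pick′ x))))) (∑-mono pt)

  -- A value occurring once supplies the simple zero for Stepanov's method. The alternative, that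
  -- repeats make up half of the length, is rare by `bad-count`.
  single-or-repeats : ∀ {k} (xs : List (Fin k)) → (∃ λ b → occ b xs ≡ 1) ⊎ (length xs ≤ 2 * repeats xs)
  single-or-repeats xs with Finₚ.any? (λ b → occ b xs ≟ 1)
  ... | yes s = inj₁ s
  ... | no none = inj₂ (subst (length xs ≤_) (trans (cong (2 * repeats xs +_) zero-singles) (+-identityʳ _)) (length≤repeats xs))
    where
    zero-singles : singles xs ≡ 0
    zero-singles = trans (sum-cong-≗ (λ b → cong ⟦_⟧ (dec-false (occ b xs ≟ 1) (λ e → none (b , e))))) (∑-zero _)

  module Tree (B : ℕ) where

    T : ℕ → Set
    T zero = Fin B
    T (suc i) = T i × T i

    ∑T : ∀ i → (T i → ℕ) → ℕ
    ∑T zero f = sum f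
    ∑T (suc i) f = ∑T i λ τ → ∑T i λ τ′ → f (τ , τ′)

    ∑T-mono : ∀ i {f g : T i → ℕ} → (∀ τ → f τ ≤ g τ) → ∑T i f ≤ ∑T i g
    ∑T-mono zero h = ∑-mono h
    ∑T-mono (suc i) h = ∑T-mono i λ τ → ∑T-mono i λ τ′ → h (τ , τ′)

    ∑T-cong : ∀ i {f g : T i → ℕ} → (∀ τ → f τ ≡ g τ) → ∑T i f ≡ ∑T i g
    ∑T-cong zero h = sum-cong-≗ h
    ∑T-cong (suc i) h = ∑T-cong i λ τ → ∑T-cong i λ τ′ → h (τ , τ′)

    ∑T-+ : ∀ i (f g : T i → ℕ) → ∑T i (λ τ → f τ + g τ) ≡ ∑T i f + ∑T i g
    ∑T-+ zero f g = ∑-distrib-+ f g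
    ∑T-+ (suc i) f g = trans (∑T-cong i (λ τ → ∑T-+ i (λ τ′ → f (τ , τ′)) (λ τ′ → g (τ , τ′)))) (∑T-+ i _ _)

    ∑T-*ˡ : ∀ i c (f : T i → ℕ) → ∑T i (λ τ → c * f τ) ≡ c * ∑T i f
    ∑T-*ˡ zero c f = ∑-*ˡ c f
    ∑T-*ˡ (suc i) c f = trans (∑T-cong i (λ τ → ∑T-*ˡ i c (λ τ′ → f (τ , τ′)))) (∑T-*ˡ i c _)

    ∑T-*ʳ : ∀ i c (f : T i → ℕ) → ∑T i (λ τ → f τ * c) ≡ ∑T i f * c
    ∑T-*ʳ i c f = trans (∑T-cong i (λ τ → *-comm (f τ) c)) (trans (∑T-*ˡ i c f) (*-comm c _))

    ∑T-swap : ∀ i {k} (f : T i → Fin k → ℕ) → ∑T i (λ τ → sum (f τ)) ≡ sum (λ c → ∑T i (λ τ → f τ c))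
    ∑T-swap zero f = ∑-swap f
    ∑T-swap (suc i) f = trans (∑T-cong i (λ τ → ∑T-swap i (λ τ′ → f (τ , τ′)))) (∑T-swap i _)

    size : ℕ → ℕ
    size zero = B
    size (suc i) = size i * size i

    size≡ : ∀ i → size i ≡ B ^ (2 ^ i)
    size≡ zero = sym (^-identityʳ B)
    size≡ (suc i) = trans (cong₂ _*_ (size≡ i) (size≡ i)) (trans (sym (^-distribˡ-+-* B (2 ^ i) (2 ^ i))) (cong (λ q → B ^ (2 ^ i + q)) (sym (+-identityʳ (2 ^ i)))))

    ∑T-const : ∀ i c → ∑T i (λ _ → c) ≡ size i * c
    ∑T-const zero c = ∑-const B c
    ∑T-const (suc i) c = trans (∑T-cong i (λ _ → ∑T-const i c)) (trans (∑T-const i (size i * c)) (sym (*-assoc (size i) (size i) c)))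

    -- The leaves entering with exponent +1 and −1 when (τ , τ′) is read as the quotient τ′ / τ.
    leaves nums dens : ∀ i → T i → List (Fin B)
    leaves zero b = b ∷ []
    leaves (suc i) (τ , τ′) = leaves i τ ++ leaves i τ′
    nums zero b = b ∷ []
    nums (suc i) (τ , τ′) = nums i τ′ ++ dens i τ
    dens zero b = []
    dens (suc i) (τ , τ′) = dens i τ′ ++ nums i τ

    length-leaves : ∀ i τ → length (leaves i τ) ≡ 2 ^ i
    length-leaves zero b = refl
    length-leaves (suc i) (τ , τ′) = trans (length-++ (leaves i τ)) (cong₂ _+_ (length-leaves i τ) (trans (length-leaves i τ′) (sym (+-identityʳ _))))

    length-nums≤ : ∀ i τ → length (nums i τ) + length (dens i τ) ≤ 2 ^ i
    length-nums≤ zero b = ≤-refl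
    length-nums≤ (suc i) (τ , τ′) = begin
      length (nums i τ′ ++ dens i τ) + length (dens i τ′ ++ nums i τ) ≡⟨ cong₂ _+_ (length-++ (nums i τ′)) (length-++ (dens i τ′)) ⟩
      length (nums i τ′) + length (dens i τ) + (length (dens i τ′) + length (nums i τ)) ≡⟨ lem (length (nums i τ′)) (length (dens i τ)) (length (dens i τ′)) (length (nums i τ)) ⟩
      (length (nums i τ) + length (dens i τ)) + ((length (nums i τ′) + length (dens i τ′)) + 0) ≤⟨ +-mono-≤ (length-nums≤ i τ) (+-monoˡ-≤ 0 (length-nums≤ i τ′)) ⟩
      2 ^ suc i ∎
      where
      open ≤-Reasoning
      lem : ∀ a b c d → a + b + (c + d) ≡ (d + b) + ((a + c) + 0)
      lem = solve-∀

    occ-leaves : ∀ i τ b → occ b (nums i τ) + occ b (dens i τ) ≡ occ b (leaves i τ)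
    occ-leaves zero c b = +-identityʳ _
    occ-leaves (suc i) (τ , τ′) b = begin
      occ b (nums i τ′ ++ dens i τ) + occ b (dens i τ′ ++ nums i τ) ≡⟨ cong₂ _+_ (occ-++ b (nums i τ′) (dens i τ)) (occ-++ b (dens i τ′) (nums i τ)) ⟩
      occ b (nums i τ′) + occ b (dens i τ) + (occ b (dens i τ′) + occ b (nums i τ)) ≡⟨ lem (occ b (nums i τ′)) (occ b (dens i τ)) (occ b (dens i τ′)) (occ b (nums i τ)) ⟩
      (occ b (nums i τ) + occ b (dens i τ)) + (occ b (nums i τ′) + occ b (dens i τ′)) ≡⟨ cong₂ _+_ (occ-leaves i τ b) (occ-leaves i τ′ b) ⟩
      occ b (leaves i τ) + occ b (leaves i τ′) ≡⟨ sym (occ-++ b (leaves i τ) (leaves i τ′)) ⟩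
      occ b (leaves i τ ++ leaves i τ′) ∎
      where
      open ≡-Reasoning
      lem : ∀ a b c d → a + b + (c + d) ≡ (d + b) + (a + c)
      lem = solve-∀

    B^⟦⟧ : ∀ (c : Bool) → B ^ ⟦ c ⟧ ≤ 1 + ⟦ c ⟧ * B
    B^⟦⟧ true = ≤-trans (≤-reflexive (trans (*-identityʳ B) (sym (+-identityʳ B)))) (n≤1+n _)
    B^⟦⟧ false = ≤-refl

    member-count : ∀ (ys : List (Fin B)) → sum (λ b → ⟦ positive (occ b ys) ⟧) ≤ length ys
    member-count [] = ≤-reflexive (∑-zero B)
    member-count (y ∷ ys) = ≤-trans (∑-mono pt) (≤-trans (≤-reflexive (∑-distrib-+ (λ b → ⟦ does (b Finₚ.≟ y) ⟧) (λ b → ⟦ positive (occ b ys) ⟧))) (+-mono-≤ (≤-reflexive (∑-pick′ y)) (member-count ys)))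
      where
      pt : ∀ b → ⟦ positive (occ b (y ∷ ys)) ⟧ ≤ ⟦ does (b Finₚ.≟ y) ⟧ + ⟦ positive (occ b ys) ⟧
      pt b with b Finₚ.≟ y
      ... | yes _ = ≤-trans (⟦⟧≤1 _) (m≤m+n 1 _)
      ... | no _ = ≤-refl

    -- A generating function for the number of repeats: by Markov's inequality few tuples have many repeats.
    repeats-gf : ∀ L i ys → 2 ^ i + length ys ≤ L → ∑T i (λ τ → B ^ repeats (leaves i τ ++ ys)) ≤ L ^ (2 ^ i) * size i * B ^ repeats ys
    repeats-gf L zero ys le = begin
      sum (λ b → B ^ (⟦ positive (occ b ys) ⟧ + repeats ys)) ≡⟨ sum-cong-≗ (λ b → ^-distribˡ-+-* B ⟦ positive (occ b ys) ⟧ (repeats ys)) ⟩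
      sum (λ b → B ^ ⟦ positive (occ b ys) ⟧ * B ^ repeats ys) ≡⟨ ∑-*ʳ (B ^ repeats ys) (λ b → B ^ ⟦ positive (occ b ys) ⟧) ⟩
      sum (λ b → B ^ ⟦ positive (occ b ys) ⟧) * B ^ repeats ys ≤⟨ *-monoˡ-≤ (B ^ repeats ys) (begin
        sum (λ b → B ^ ⟦ positive (occ b ys) ⟧) ≤⟨ ∑-mono (λ b → B^⟦⟧ (positive (occ b ys))) ⟩
        sum (λ b → 1 + ⟦ positive (occ b ys) ⟧ * B) ≡⟨ ∑-distrib-+ (λ _ → 1) (λ b → ⟦ positive (occ b ys) ⟧ * B) ⟩
        sum {B} (λ _ → 1) + sum (λ b → ⟦ positive (occ b ys) ⟧ * B) ≡⟨ cong₂ _+_ (trans (∑-const B 1) (*-identityʳ B)) (∑-*ʳ B (λ b → ⟦ positive (occ b ys) ⟧)) ⟩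
        B + sum (λ b → ⟦ positive (occ b ys) ⟧) * B ≤⟨ +-monoʳ-≤ B (*-monoˡ-≤ B (member-count ys)) ⟩
        suc (length ys) * B ≤⟨ *-monoˡ-≤ B le ⟩
        L * B ≡⟨ cong (_* B) (sym (^-identityʳ L)) ⟩
        L ^ 1 * B ∎) ⟩
      L ^ 1 * B * B ^ repeats ys ∎
      where open ≤-Reasoning
    repeats-gf L (suc i) ys le = begin
      ∑T i (λ τ → ∑T i λ τ′ → B ^ repeats ((leaves i τ ++ leaves i τ′) ++ ys)) ≡⟨ ∑T-cong i (λ τ → ∑T-cong i (λ τ′ → cong (λ q → B ^ repeats q) (++-assoc (leaves i τ) (leaves i τ′) ys))) ⟩
      -- The sums are exchanged so that the induction hypothesis applies to the first tree with the
      -- leaves of the second as a fixed tail.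
      ∑T i (λ τ → ∑T i λ τ′ → B ^ repeats (leaves i τ ++ (leaves i τ′ ++ ys))) ≡⟨ swapTT i i _ ⟩
      ∑T i (λ τ′ → ∑T i λ τ → B ^ repeats (leaves i τ ++ (leaves i τ′ ++ ys))) ≤⟨ ∑T-mono i (λ τ′ → repeats-gf L i (leaves i τ′ ++ ys) (le′ τ′)) ⟩
      ∑T i (λ τ′ → C * B ^ repeats (leaves i τ′ ++ ys)) ≡⟨ ∑T-*ˡ i C _ ⟩
      C * ∑T i (λ τ′ → B ^ repeats (leaves i τ′ ++ ys)) ≤⟨ *-monoʳ-≤ C (repeats-gf L i ys (≤-trans (+-monoˡ-≤ (length ys) (m≤m+n (2 ^ i) _)) le)) ⟩
      C * (C * B ^ repeats ys) ≡⟨ lem (L ^ (2 ^ i)) (size i) (B ^ repeats ys) ⟩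
      L ^ (2 ^ i) * L ^ (2 ^ i) * (size i * size i) * B ^ repeats ys ≡⟨ cong (λ q → q * (size i * size i) * B ^ repeats ys) (trans (sym (^-distribˡ-+-* L (2 ^ i) (2 ^ i))) (cong (λ q → L ^ (2 ^ i + q)) (sym (+-identityʳ (2 ^ i))))) ⟩
      L ^ (2 ^ suc i) * size (suc i) * B ^ repeats ys ∎
      where
      open ≤-Reasoning
      C = L ^ (2 ^ i) * size i
      lem : ∀ a s b → (a * s) * ((a * s) * b) ≡ a * a * (s * s) * b
      lem = solve-∀
      swapTT : ∀ i j (f : T i → T j → ℕ) → ∑T i (λ τ → ∑T j (f τ)) ≡ ∑T j (λ τ′ → ∑T i (λ τ → f τ τ′))
      swapTT i zero f = ∑T-swap i f
      swapTT i (suc j) f = trans (swapTT i j (λ τ σ → ∑T j λ σ′ → f τ (σ , σ′))) (∑T-cong j (λ σ → swapTT i j (λ τ σ′ → f τ (σ , σ′))))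
      le′ : ∀ τ′ → 2 ^ i + length (leaves i τ′ ++ ys) ≤ L
      le′ τ′ = ≤-trans (≤-reflexive (trans (cong (2 ^ i +_) (trans (length-++ (leaves i τ′)) (cong (_+ length ys) (length-leaves i τ′)))) (trans (sym (+-assoc (2 ^ i) (2 ^ i) _)) (cong (λ q → 2 ^ i + q + length ys) (sym (+-identityʳ (2 ^ i))))))) le

    bad : ∀ i → T i → Bool
    bad i τ = does (length (leaves i τ) ≤? 2 * repeats (leaves i τ))

    -- Markov's inequality: a bad tree has at least half of its 2^(s+1) leaves as repeats, hence
    -- contributes at least B^(2^s), which is `size s`, to the generating function.
    bad-count : .{{_ : NonZero B}} → ∀ s → ∑T (suc s) (λ τ → ⟦ bad (suc s) τ ⟧) * size s ≤ (2 ^ suc s) ^ (2 ^ suc s) * size (suc s)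
    bad-count s = begin
      ∑T (suc s) (λ τ → ⟦ bad (suc s) τ ⟧) * size s ≡⟨ sym (∑T-*ʳ (suc s) (size s) (λ τ → ⟦ bad (suc s) τ ⟧)) ⟩
      ∑T (suc s) (λ τ → ⟦ bad (suc s) τ ⟧ * size s) ≤⟨ ∑T-mono (suc s) pt ⟩
      ∑T (suc s) (λ τ → B ^ repeats (leaves (suc s) τ ++ [])) ≤⟨ repeats-gf (2 ^ suc s) (suc s) [] (≤-reflexive (+-identityʳ _)) ⟩
      (2 ^ suc s) ^ (2 ^ suc s) * size (suc s) * 1 ≡⟨ *-identityʳ _ ⟩
      (2 ^ suc s) ^ (2 ^ suc s) * size (suc s) ∎
      where
      open ≤-Reasoning
      pt : ∀ τ → ⟦ bad (suc s) τ ⟧ * size s ≤ B ^ repeats (leaves (suc s) τ ++ [])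
      pt τ with bad (suc s) τ in isBad
      ... | false = z≤n
      ... | true = ≤-trans (≤-reflexive (trans (+-identityʳ _) (size≡ s))) (^-monoʳ-≤ B (subst (λ q → 2 ^ s ≤ repeats q) (sym (++-identityʳ (leaves (suc s) τ))) (*-cancelˡ-≤ 2 (subst (_≤ 2 * repeats (leaves (suc s) τ)) (length-leaves (suc s) τ) (true-dec (length (leaves (suc s) τ) ≤? 2 * repeats (leaves (suc s) τ)) isBad)))))

-- Counting the solutions of P₁^m = P₂^m.

module SolutionCount (n : ℕ) (pr : Prime (suc n)) where

  open import Data.Nat.DivMod using (_/_; m/n*n≤m; m≡m%n+[m/n]*n; m%n<n)
  open FiniteSums
  open Trees using (occ)
  open Fp n pr
  open Polynomials n pr
  open Stepanov n pr

  δ^-0 : ∀ W Φ {u} → eval Φ u ≡ 𝟘 → ∀ m → m < 1 → eval (Derivation.δ^ W m Φ) u ≡ 𝟘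
  δ^-0 W Φ e zero _ = e
  δ^-0 W Φ e (suc m) (s≤s ())

  1≤p : 1 ≤ p
  1≤p = s≤s z≤n

  root-count : ∀ Φ d k → Φ deg≤ d → coef Φ k ≢ 𝟘 → (A : F → Bool) → (∀ u → u ∈ A → eval Φ u ≡ 𝟘) → ∣ A ∣ ≤ d
  root-count Φ d k deg nz A roots with ∣ A ∣ ℕₚ.≤? d
  ... | yes le = le
  ... | no ≰ with enumerate A
  ...   | us , uniq , mem , len = ⊥-elim (nz (trans (at zeroΦ k) (coef-[] k)))
    where
    zeroΦ : Φ ≈ []
    zeroΦ = Derivation.multiplicity-bound 1P 1 1≤p Φ us uniq
      (All.map (λ {u} i → (λ z → 𝟙≢𝟘 (trans (sym (eval-1P u)) z)) , δ^-0 1P Φ (roots u i)) mem)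
      (ℕₚ.≤-trans deg (subst (suc d ≤_) (sym (trans (ℕₚ.*-identityʳ _) len)) (ℕₚ.≰⇒> ≰)))

  roots-of-unity : ∀ e .{{_ : NonZero e}} (A : F → Bool) → (∀ c → c ∈ A → c ↑ e ≡ 𝟙) → ∣ A ∣ ≤ e
  roots-of-unity e A h = root-count Φ e 0 degΦ nz A λ c c∈A → trans (eval-+ (shiftN e 1P) (scal (⊖ 𝟙) 1P) c)
      (trans (cong₂ _⊕_ (trans (eval-shiftN e 1P c) (trans (cong₂ _⊗_ (h c c∈A) (eval-1P c)) (⊗-identityʳ 𝟙)))
        (trans (eval-scal (⊖ 𝟙) 1P c) (trans (cong ((⊖ 𝟙) ⊗_) (eval-1P c)) (⊗-identityʳ _)))) (⊖-inverseʳ 𝟙))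
    where
    Φ = shiftN e 1P +P scal (⊖ 𝟙) 1P
    degΦ : Φ deg≤ e
    degΦ = length-+P≤ (shiftN e 1P) (scal (⊖ 𝟙) 1P) (ℕₚ.≤-reflexive (trans (length-shiftN e 1P) (trans (cong (e +_) length-1P) (ℕₚ.+-comm e 1))))
      (length-scal (⊖ 𝟙) 1P (ℕₚ.≤-trans (ℕₚ.≤-reflexive length-1P) (s≤s z≤n)))
    nz : coef Φ 0 ≢ 𝟘
    nz z = 𝟙≢𝟘 (trans (sym (⊖-involutive 𝟙)) (trans (cong ⊖_ (trans (sym c0) z)) ⊖𝟘))
      where
      c0 : coef Φ 0 ≡ ⊖ 𝟙
      c0 = trans (coef-+ (shiftN e 1P) (scal (⊖ 𝟙) 1P) 0) (trans (cong₂ _⊕_ (coef-shiftN-< e 1P 0 (ℕ.>-nonZero⁻¹ e)) (trans (coef-scal (⊖ 𝟙) 1P 0) (trans (cong ((⊖ 𝟙) ⊗_) (coef-1P)) (⊗-identityʳ _)))) (⊕-identityˡ _))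

  linProd : List F → F → F
  linProd [] u = 𝟙
  linProd (c ∷ cs) u = (u ⊕ c) ⊗ linProd cs u

  -- The product of the x + c, translated so that the zero -b moves to 0; its order there is the
  -- multiplicity of `b` in `cs`.
  prodLin : F → List F → Poly
  prodLin b [] = 1P
  prodLin b (c ∷ cs) = Lin (c ⊕ ⊖ b) *P prodLin b cs

  eval-prodLin : ∀ b cs u → eval (prodLin b cs) u ≡ linProd cs (u ⊕ ⊖ b)
  eval-prodLin b [] u = eval-1P u
  eval-prodLin b (c ∷ cs) u = trans (eval-* (Lin (c ⊕ ⊖ b)) (prodLin b cs) u) (cong₂ _⊗_ (trans (eval-Lin (c ⊕ ⊖ b) u) re) (eval-prodLin b cs u))
    where
    re : u ⊕ (c ⊕ ⊖ b) ≡ (u ⊕ ⊖ b) ⊕ c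
    re = trans (cong (u ⊕_) (⊕-comm c (⊖ b))) (sym (⊕-assoc u (⊖ b) c))

  deg-prodLin : ∀ b cs → prodLin b cs deg≤ length cs
  deg-prodLin b [] = ℕₚ.≤-reflexive length-1P
  deg-prodLin b (c ∷ cs) = deg-* (Lin (c ⊕ ⊖ b)) (prodLin b cs) {1} (ℕₚ.≤-reflexive length-Lin) (deg-prodLin b cs)

  Ord-Lin : ∀ b c → Ord ⟦ does (b Finₚ.≟ c) ⟧ (Lin (c ⊕ ⊖ b))
  Ord-Lin b c with b Finₚ.≟ c
  ... | yes refl = subst (Ord 1) (cong Lin (sym (⊖-inverseʳ b))) Ord-Lin𝟘
  ... | no ne = Ord-0 (λ z → ne (sym (a⊖b≡0⇒a≡b (trans (sym coef-Lin) z))))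

  Ord-prodLin : ∀ b cs → Ord (occ b cs) (prodLin b cs)
  Ord-prodLin b [] = Ord-0 (λ z → 𝟙≢𝟘 (trans (sym coef-1P) z))
  Ord-prodLin b (c ∷ cs) = Ord-* {_} {_} {Lin (c ⊕ ⊖ b)} {prodLin b cs} (Ord-Lin b c) (Ord-prodLin b cs)

  -- J = ⌊h/e⌋ and M = e(J − c) balance the error terms in Auxiliary.bound; if J < 2c, then e is so large
  -- that the degree of P₁^m − P₂^m suffices.
  module _ (e m : ℕ) .{{_ : NonZero e}} .{{_ : NonZero m}} (em≡n : e * m ≡ n) (r : ℕ) (P₁ P₂ : Poly)
    (d₁ : P₁ deg≤ r) (d₂ : P₂ deg≤ r) (o₁ : Ord 1 P₁) (o₂ : Ord 0 P₂)
    (h z : ℕ) (0<h : 0 < h) (h²≤p : h * h ≤ p) (p≤h²z : p ≤ h * h * z)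
    (A : F → Bool) (sol : ∀ u → u ∈ A → eval P₁ u ↑ m ≡ eval P₂ u ↑ m × eval P₁ u ≢ 𝟘) where

    private
      -- In `size` the error (J + 2rM)M is at most (2r + 1)p; one further p makes the inequality
      -- strict.
      c = 2 * r + 2
      -- The sum of what the two cases require: 4r² + 4r in `smallJ` and 12r + 12 in `largeJ`.
      κ = 4 * r * r + 16 * r + 12
      J = h / e

      N : ℕ
      N = ∣ A ∣

      coef₀ : ∀ {v f} → Ord v f → 0 < v → coef f 0 ≡ 𝟘
      coef₀ {v} (g , eq , _) 0<v = trans (at eq 0) (coef-shiftN-< v g 0 0<v)

      coef₀≢ : ∀ {f} → Ord 0 f → coef f 0 ≢ 𝟘
      coef₀≢ (g , eq , nz) z = nz (trans (sym (trans (at eq 0) (coef-shiftN-+ 0 g 0))) z)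

      -- `P₁` vanishes at 0 and `P₂` does not, so P₁^m - P₂^m has a nonzero constant coefficient and
      -- its degree bounds the number of solutions.
      trivial : N ≤ m * r
      trivial = root-count Φ (m * r) 0 degΦ nz A root
        where
        Φ = P₁ ^P m +P scal (⊖ 𝟙) (P₂ ^P m)
        degΦ : Φ deg≤ m * r
        degΦ = length-+P≤ (P₁ ^P m) (scal (⊖ 𝟙) (P₂ ^P m)) (deg-^ P₁ m d₁) (length-scal (⊖ 𝟙) (P₂ ^P m) (deg-^ P₂ m d₂))
        root : ∀ u → u ∈ A → eval Φ u ≡ 𝟘
        root u i = trans (eval-+ (P₁ ^P m) (scal (⊖ 𝟙) (P₂ ^P m)) u) (trans (cong₂ _⊕_ (trans (eval-^ P₁ m u) (proj₁ (sol u i)))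
          (trans (eval-scal (⊖ 𝟙) (P₂ ^P m) u) (trans (sym (⊖-distribˡ-⊗ 𝟙 _)) (cong ⊖_ (trans (⊗-identityˡ _) (eval-^ P₂ m u)))))) (⊖-inverseʳ _))
        o₁ᵐ : Ord (m * 1) (P₁ ^P m)
        o₁ᵐ = Ord-^ {1} {P₁} m o₁
        o₂ᵐ : Ord 0 (P₂ ^P m)
        o₂ᵐ = subst (λ v → Ord v (P₂ ^P m)) (ℕₚ.*-zeroʳ m) (Ord-^ {0} {P₂} m o₂)
        nz : coef Φ 0 ≢ 𝟘
        nz z = coef₀≢ {P₂ ^P m} o₂ᵐ (trans (sym (⊖-involutive _)) (trans (cong ⊖_ (trans (sym c0) z)) ⊖𝟘))
          where
          c0 : coef Φ 0 ≡ ⊖ coef (P₂ ^P m) 0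
          c0 = trans (coef-+ (P₁ ^P m) (scal (⊖ 𝟙) (P₂ ^P m)) 0) (trans (cong₂ _⊕_ (coef₀ {m * 1} {P₁ ^P m} o₁ᵐ (subst (0 <_) (sym (ℕₚ.*-identityʳ m)) (ℕ.>-nonZero⁻¹ m)))
            (trans (coef-scal (⊖ 𝟙) (P₂ ^P m) 0) (trans (sym (⊖-distribˡ-⊗ 𝟙 _)) (cong ⊖_ (⊗-identityˡ _))))) (⊕-identityˡ _))

      eJ≤h : e * J ≤ h
      eJ≤h = subst (_≤ h) (ℕₚ.*-comm J e) (m/n*n≤m h e)

      h<e[J+1] : h < e * suc J
      h<e[J+1] = subst₂ _<_ (sym (m≡m%n+[m/n]*n h e)) (ℕₚ.*-comm (suc J) e) (ℕₚ.+-monoˡ-< (J * e) (m%n<n h e))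

      1≤e : 1 ≤ e
      1≤e = ℕ.>-nonZero⁻¹ e

      J≤h : J ≤ h
      J≤h = ℕₚ.≤-trans (ℕₚ.≤-trans (ℕₚ.≤-reflexive (sym (ℕₚ.*-identityˡ J))) (ℕₚ.*-monoˡ-≤ J 1≤e)) eJ≤h

      h≤p : h ≤ p
      h≤p = ℕₚ.≤-trans (ℕₚ.≤-trans (ℕₚ.≤-reflexive (sym (ℕₚ.*-identityˡ h))) (ℕₚ.*-monoˡ-≤ h 0<h)) h²≤p

      smallJ : J < c + c → N ≤ m + h * z * κ
      smallJ J< = ℕₚ.≤-trans trivial (ℕₚ.≤-trans (ℕₚ.*-monoˡ-≤ r m≤) (ℕₚ.≤-trans (ℕₚ.≤-reflexive (l₁ r (h * z))) (ℕₚ.≤-trans (ℕₚ.*-monoʳ-≤ (h * z) (ℕₚ.≤-trans (ℕₚ.m≤m+n _ (12 * r + 12)) (ℕₚ.≤-reflexive (l₂ r)))) (ℕₚ.m≤n+m _ m))))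
        where
        l₁ : ∀ r q → (2 * (2 * r + 2)) * q * r ≡ q * (4 * r * r + 4 * r)
        l₁ = solve-∀
        l₂ : ∀ r → 4 * r * r + 4 * r + (12 * r + 12) ≡ 4 * r * r + 16 * r + 12
        l₂ = solve-∀
        l₃ : ∀ m e c → m * (e * (c + c)) ≡ (2 * c) * (e * m)
        l₃ = solve-∀
        l₄ : ∀ c h z → (2 * c) * (h * h * z) ≡ (2 * c) * (h * z) * h
        l₄ = solve-∀
        m≤ : m ≤ (2 * c) * (h * z)
        m≤ = ℕₚ.*-cancelʳ-≤ m _ h {{ℕ.>-nonZero 0<h}} (begin
          m * h ≤⟨ ℕₚ.*-monoʳ-≤ m (ℕₚ.≤-trans (ℕₚ.<⇒≤ h<e[J+1]) (ℕₚ.*-monoʳ-≤ e J<)) ⟩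
          m * (e * (c + c)) ≡⟨ l₃ m e c ⟩
          (2 * c) * (e * m) ≤⟨ ℕₚ.*-monoʳ-≤ (2 * c) (ℕₚ.≤-trans (ℕₚ.≤-reflexive em≡n) (ℕₚ.≤-trans (ℕₚ.n≤1+n n) p≤h²z)) ⟩
          (2 * c) * (h * h * z) ≡⟨ l₄ c h z ⟩
          (2 * c) * (h * z) * h ∎)
          where open ℕₚ.≤-Reasoning

      largeJ : ∀ g → J ≡ c + g → c ≤ g → N ≤ m + h * z * κ
      largeJ g J≡ c≤g with N ℕₚ.≤? m + h * z * κ
      ... | yes le = le
      ... | no ≰ with enumerate A
      ...   | us , uniq , mem , len = ⊥-elim (ℕₚ.<-irrefl refl (ℕₚ.<-≤-trans upper lower))
        where
        open ℕₚ.≤-Reasoning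
        M = e * g
        K = h * z * κ
        g≤J : g ≤ J
        g≤J = subst (g ≤_) (sym J≡) (ℕₚ.m≤n+m g c)
        M≤h : M ≤ h
        M≤h = ℕₚ.≤-trans (ℕₚ.*-monoʳ-≤ e g≤J) eJ≤h
        l₁ : ∀ m e g J r → (m + J + 2 * r * (e * g)) * (e * g) ≡ (e * m) * g + (J + 2 * r * (e * g)) * (e * g)
        l₁ = solve-∀
        l₂ : ∀ h r → (h + 2 * r * h) * h ≡ h * h * (2 * r + 1)
        l₂ = solve-∀
        l₃ : ∀ n g r → n * g + suc n * (2 * r + 1) + (g + suc n) ≡ suc n * (2 * r + 2 + g)
        l₃ = solve-∀
        size : (m + J + 2 * r * M) * M < p * J
        size = begin-strict
          (m + J + 2 * r * M) * M ≡⟨ l₁ m e g J r ⟩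
          (e * m) * g + (J + 2 * r * M) * M ≤⟨ ℕₚ.+-mono-≤ (ℕₚ.≤-reflexive (cong (_* g) em≡n)) (ℕₚ.*-mono-≤ (ℕₚ.+-mono-≤ J≤h (ℕₚ.*-monoʳ-≤ (2 * r) M≤h)) M≤h) ⟩
          n * g + (h + 2 * r * h) * h ≡⟨ cong (n * g +_) (l₂ h r) ⟩
          n * g + h * h * (2 * r + 1) ≤⟨ ℕₚ.+-monoʳ-≤ (n * g) (ℕₚ.*-monoˡ-≤ (2 * r + 1) h²≤p) ⟩
          n * g + p * (2 * r + 1) <⟨ ℕₚ.m<m+n _ (ℕₚ.≤-trans (s≤s z≤n) (ℕₚ.m≤n+m p g)) ⟩
          n * g + p * (2 * r + 1) + (g + p) ≡⟨ l₃ n g r ⟩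
          p * (c + g) ≡⟨ cong (p *_) (sym J≡) ⟩
          p * J ∎
        upper : N * M < p * (J + r)
        upper = subst (λ q → q * M < p * (J + r)) len (Auxiliary.bound e m em≡n r P₁ P₂ d₁ d₂ o₁ o₂ J M (ℕₚ.≤-trans M≤h h≤p) size us uniq (All.map (λ {u} → sol u) mem))
        1≤J : 1 ≤ J
        1≤J = subst (1 ≤_) (sym J≡) (ℕₚ.≤-trans (ℕₚ.m≤n+m 1 _) (ℕₚ.≤-trans (ℕₚ.≤-reflexive (l₀ r)) (ℕₚ.m≤m+n c g)))
          where
          l₀ : ∀ r → (2 * r + 1) + 1 ≡ 2 * r + 2
          l₀ = solve-∀
        h≤4M : h ≤ 4 * M
        h≤4M = begin
          h ≤⟨ ℕₚ.<⇒≤ h<e[J+1] ⟩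
          e * suc J ≤⟨ ℕₚ.*-monoʳ-≤ e (ℕₚ.+-mono-≤ 1≤J ℕₚ.≤-refl) ⟩
          e * (J + J) ≡⟨ cong (λ j → e * (j + j)) J≡ ⟩
          e * ((c + g) + (c + g)) ≤⟨ ℕₚ.*-monoʳ-≤ e (ℕₚ.+-mono-≤ (ℕₚ.+-monoˡ-≤ g c≤g) (ℕₚ.+-monoˡ-≤ g c≤g)) ⟩
          e * ((g + g) + (g + g)) ≡⟨ l₅ e g ⟩
          4 * M ∎
          where
          l₅ : ∀ e g → e * ((g + g) + (g + g)) ≡ 4 * (e * g)
          l₅ = solve-∀
        big : g + p * (c + r) ≤ K * M
        big = ℕₚ.*-cancelˡ-≤ 4 (begin
          4 * (g + p * (c + r)) ≤⟨ ℕₚ.*-monoʳ-≤ 4 (ℕₚ.+-monoˡ-≤ (p * (c + r)) (ℕₚ.≤-trans g≤J (ℕₚ.≤-trans J≤h h≤p))) ⟩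
          4 * (p + p * (c + r)) ≡⟨ l₆ p r ⟩
          p * (12 * r + 12) ≤⟨ ℕₚ.*-mono-≤ p≤h²z (ℕₚ.≤-trans (ℕₚ.m≤m+n _ (4 * r * r + 4 * r)) (ℕₚ.≤-reflexive (l₇ r))) ⟩
          h * h * z * κ ≡⟨ l₈ h z κ ⟩
          K * h ≤⟨ ℕₚ.*-monoʳ-≤ K h≤4M ⟩
          K * (4 * M) ≡⟨ l₉ K M ⟩
          4 * (K * M) ∎)
          where
          l₆ : ∀ p r → 4 * (p + p * ((2 * r + 2) + r)) ≡ p * (12 * r + 12)
          l₆ = solve-∀
          l₇ : ∀ r → 12 * r + 12 + (4 * r * r + 4 * r) ≡ 4 * r * r + 16 * r + 12
          l₇ = solve-∀
          l₈ : ∀ h z k → h * h * z * k ≡ h * z * k * h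
          l₈ = solve-∀
          l₉ : ∀ K M → K * (4 * M) ≡ 4 * (K * M)
          l₉ = solve-∀
        -- The main terms match exactly, n g = m M, which gives `m` the coefficient one. The
        -- remainder is absorbed by K M because h ≤ 4M.
        lower : p * (J + r) ≤ N * M
        lower = begin
          p * (J + r) ≡⟨ cong (λ j → p * (j + r)) J≡ ⟩
          p * (c + g + r) ≡⟨ l n c g r ⟩
          n * g + (g + p * (c + r)) ≤⟨ ℕₚ.+-mono-≤ (ℕₚ.≤-reflexive (trans (cong (_* g) (sym em≡n)) (l₁₀ e m g))) big ⟩
          m * M + K * M ≡⟨ sym (ℕₚ.*-distribʳ-+ M m K) ⟩
          (m + K) * M ≤⟨ ℕₚ.*-monoˡ-≤ M (ℕₚ.<⇒≤ (ℕₚ.≰⇒> ≰)) ⟩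
          N * M ∎
          where
          l : ∀ n c g r → suc n * (c + g + r) ≡ n * g + (g + suc n * (c + r))
          l = solve-∀
          l₁₀ : ∀ e m g → e * m * g ≡ m * (e * g)
          l₁₀ = solve-∀

    stepanov-count : N ≤ m + h * z * κ
    stepanov-count with J ℕₚ.<? c + c
    ... | yes lt = smallJ lt
    ... | no ≮ with ℕₚ.m≤n⇒∃[o]m+o≡n (ℕₚ.≮⇒≥ ≮)
    ...   | o , eq = largeJ (c + o) (trans (sym eq) (ℕₚ.+-assoc c c o)) (ℕₚ.m≤m+n c o)

  -- After the translation by `b` exactly one of the two products vanishes at 0, and to first order.
  -- The equation is symmetric, so that product can be taken as `P₁`.
  collision-count : ∀ (e m : ℕ) .{{_ : NonZero e}} .{{_ : NonZero m}} → e * m ≡ n → ∀ r cs ds → length cs ≤ r → length ds ≤ r →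
    ∀ b → occ b cs + occ b ds ≡ 1 → ∀ h z → 0 < h → h * h ≤ p → p ≤ h * h * z → (A : F → Bool) →
    (∀ u → u ∈ A → linProd cs u ↑ m ≡ linProd ds u ↑ m × linProd cs u ≢ 𝟘 × linProd ds u ≢ 𝟘) → ∣ A ∣ ≤ m + h * z * (4 * r * r + 16 * r + 12)
  collision-count e m em≡n r cs ds lc ld b once h z 0<h h1 h2 A sol = subst (_≤ m + h * z * (4 * r * r + 16 * r + 12)) (∑-shift (λ u → ⟦ A u ⟧) (⊖ b)) (go (occ b cs) (occ b ds) refl refl once)
    where
    A′ : F → Bool
    A′ u = A (u ⊕ ⊖ b)
    d₁ : prodLin b cs deg≤ r
    d₁ = ℕₚ.≤-trans (deg-prodLin b cs) (s≤s lc)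
    d₂ : prodLin b ds deg≤ r
    d₂ = ℕₚ.≤-trans (deg-prodLin b ds) (s≤s ld)
    go : ∀ x y → occ b cs ≡ x → occ b ds ≡ y → x + y ≡ 1 → ∣ A′ ∣ ≤ m + h * z * (4 * r * r + 16 * r + 12)
    go 1 0 ex ey _ = stepanov-count e m em≡n r (prodLin b cs) (prodLin b ds) d₁ d₂ (subst (λ v → Ord v (prodLin b cs)) ex (Ord-prodLin b cs)) (subst (λ v → Ord v (prodLin b ds)) ey (Ord-prodLin b ds)) h z 0<h h1 h2 A′
      λ u i → trans (cong (_↑ m) (eval-prodLin b cs u)) (trans (proj₁ (sol _ i)) (cong (_↑ m) (sym (eval-prodLin b ds u)))) , λ q → proj₁ (proj₂ (sol _ i)) (trans (sym (eval-prodLin b cs u)) q)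
    go 0 1 ex ey _ = stepanov-count e m em≡n r (prodLin b ds) (prodLin b cs) d₂ d₁ (subst (λ v → Ord v (prodLin b ds)) ey (Ord-prodLin b ds)) (subst (λ v → Ord v (prodLin b cs)) ex (Ord-prodLin b cs)) h z 0<h h1 h2 A′
      λ u i → trans (cong (_↑ m) (eval-prodLin b ds u)) (trans (sym (proj₁ (sol _ i))) (cong (_↑ m) (sym (eval-prodLin b cs u)))) , λ q → proj₂ (proj₂ (sol _ i)) (trans (sym (eval-prodLin b ds u)) q)

-- High moments of the distribution among the cosets of the e-th powers.

module Moments (n : ℕ) (pr : Prime (suc n)) (B : ℕ) .{{B≢0 : NonZero B}} (B≤p : B ≤ suc n) where

  open import Data.Nat using () renaming (∣_-_∣ to dist)
  open import Data.List.Properties using (length-map; map-++)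
  open FiniteSums
  open Trees
  open Fp n pr
  open SolutionCount n pr
  open Tree B public

  dist² : ∀ a b → dist a b * dist a b + 2 * (a * b) ≡ a * a + b * b
  dist² a b with ℕₚ.≤-total a b
  ... | inj₁ a≤b with ℕₚ.m≤n⇒∃[o]m+o≡n a≤b
  ...   | o , refl = trans (cong (λ d → d * d + 2 * (a * (a + o))) (ℕₚ.∣m-m+n∣≡n a o)) (lem a o)
    where
    lem : ∀ a o → o * o + 2 * (a * (a + o)) ≡ a * a + (a + o) * (a + o)
    lem = solve-∀
  dist² a b | inj₂ b≤a with ℕₚ.m≤n⇒∃[o]m+o≡n b≤a
  ...   | o , refl = trans (cong (λ d → d * d + 2 * ((b + o) * b)) (trans (ℕₚ.∣-∣-comm (b + o) b) (ℕₚ.∣m-m+n∣≡n b o))) (lem b o)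
    where
    lem : ∀ b o → o * o + 2 * ((b + o) * b) ≡ (b + o) * (b + o) + b * b
    lem = solve-∀

  does-⇔ : ∀ {k l} {x y : Fin k} {x′ y′ : Fin l} → (x ≡ y → x′ ≡ y′) → (x′ ≡ y′ → x ≡ y) → does (x Finₚ.≟ y) ≡ does (x′ Finₚ.≟ y′)
  does-⇔ {x = x} {y} {x′} {y′} f g with x Finₚ.≟ y
  ... | yes e = sym (dec-true (x′ Finₚ.≟ y′) (f e))
  ... | no ne = sym (dec-false (x′ Finₚ.≟ y′) (ne ∘ g))

  module Labels (i e : ℕ) (φ : T i → F) (μ : F → Bool) (∣μ∣≤e : ∣ μ ∣ ≤ e) (φ∈μ : ∀ τ → φ τ ∈ μ) where

    hits : F → ℕ
    hits c = ∑T i (λ τ → ⟦ does (φ τ Finₚ.≟ c) ⟧)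

    sz = size i

    coll : ℕ
    coll = sum (λ c → hits c * hits c)

    hits-weighted : ∀ (g : F → ℕ) → sum (λ c → hits c * g c) ≡ ∑T i (λ τ → g (φ τ))
    hits-weighted g = begin
      sum (λ c → hits c * g c) ≡⟨ sum-cong-≗ (λ c → sym (∑T-*ʳ i (g c) (λ τ → ⟦ does (φ τ Finₚ.≟ c) ⟧))) ⟩
      sum (λ c → ∑T i (λ τ → ⟦ does (φ τ Finₚ.≟ c) ⟧ * g c)) ≡⟨ sym (∑T-swap i (λ τ c → ⟦ does (φ τ Finₚ.≟ c) ⟧ * g c)) ⟩
      ∑T i (λ τ → sum (λ c → ⟦ does (φ τ Finₚ.≟ c) ⟧ * g c)) ≡⟨ ∑T-cong i (λ τ → ∑-pick (φ τ) g) ⟩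
      ∑T i (λ τ → g (φ τ)) ∎
      where open ≡-Reasoning

    ∑μhits : sum (λ c → ⟦ μ c ⟧ * hits c) ≡ sz
    ∑μhits = trans (sum-cong-≗ (λ c → ℕₚ.*-comm ⟦ μ c ⟧ (hits c))) (trans (hits-weighted (λ c → ⟦ μ c ⟧))
      (trans (∑T-cong i (λ τ → cong ⟦_⟧ (φ∈μ τ))) (trans (∑T-const i 1) (ℕₚ.*-identityʳ sz))))

    coll≡ : coll ≡ ∑T i (λ τ → ∑T i (λ τ′ → ⟦ does (φ τ′ Finₚ.≟ φ τ) ⟧))
    coll≡ = hits-weighted hits

    -- The mean of hits over the at most e labels is sz / e; everything is scaled by e to stay in ℕ.
    variance : ∀ c₀ → c₀ ∈ μ → dist (e * hits c₀) sz * dist (e * hits c₀) sz + e * (sz * sz) ≤ e * (e * coll)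
    variance c₀ c₀∈μ = ℕₚ.+-cancelʳ-≤ (e * (sz * sz)) _ _ (begin
      d c₀ * d c₀ + e * (sz * sz) + e * (sz * sz) ≡⟨ l₁ (d c₀ * d c₀) (e * (sz * sz)) ⟩
      d c₀ * d c₀ + 2 * (e * (sz * sz)) ≤⟨ ℕₚ.+-monoˡ-≤ (2 * (e * (sz * sz))) (ℕₚ.≤-trans (ℕₚ.≤-reflexive (trans (sym (ℕₚ.+-identityʳ _)) (cong (λ b → ⟦ b ⟧ * (d c₀ * d c₀)) (sym c₀∈μ)))) (∑-≥ (λ c → ⟦ μ c ⟧ * (d c * d c)) c₀)) ⟩
      sum (λ c → ⟦ μ c ⟧ * (d c * d c)) + 2 * (e * (sz * sz)) ≡⟨ cong (sum (λ c → ⟦ μ c ⟧ * (d c * d c)) +_) (sym cross) ⟩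
      sum (λ c → ⟦ μ c ⟧ * (d c * d c)) + sum (λ c → ⟦ μ c ⟧ * (2 * (e * hits c * sz))) ≡⟨ sym (∑-distrib-+ (λ c → ⟦ μ c ⟧ * (d c * d c)) (λ c → ⟦ μ c ⟧ * (2 * (e * hits c * sz)))) ⟩
      sum (λ c → ⟦ μ c ⟧ * (d c * d c) + ⟦ μ c ⟧ * (2 * (e * hits c * sz))) ≡⟨ sum-cong-≗ (λ c → trans (sym (ℕₚ.*-distribˡ-+ ⟦ μ c ⟧ (d c * d c) _)) (cong (⟦ μ c ⟧ *_) (dist² (e * hits c) sz))) ⟩
      sum (λ c → ⟦ μ c ⟧ * (e * hits c * (e * hits c) + sz * sz)) ≤⟨ ∑-mono (λ c → ℕₚ.≤-trans (ℕₚ.≤-reflexive (ℕₚ.*-distribˡ-+ ⟦ μ c ⟧ _ _)) (ℕₚ.+-monoˡ-≤ (⟦ μ c ⟧ * (sz * sz)) (ℕₚ.≤-trans (ℕₚ.*-monoˡ-≤ _ (⟦⟧≤1 (μ c))) (ℕₚ.≤-reflexive (ℕₚ.*-identityˡ _))))) ⟩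
      sum (λ c → e * hits c * (e * hits c) + ⟦ μ c ⟧ * (sz * sz)) ≡⟨ ∑-distrib-+ (λ c → e * hits c * (e * hits c)) (λ c → ⟦ μ c ⟧ * (sz * sz)) ⟩
      sum (λ c → e * hits c * (e * hits c)) + sum (λ c → ⟦ μ c ⟧ * (sz * sz)) ≡⟨ cong₂ _+_ (trans (sum-cong-≗ (λ c → l₂ e (hits c))) (trans (∑-*ˡ (e * e) (λ c → hits c * hits c)) (ℕₚ.*-assoc e e coll))) (∑-*ʳ (sz * sz) (λ c → ⟦ μ c ⟧)) ⟩
      e * (e * coll) + ∣ μ ∣ * (sz * sz) ≤⟨ ℕₚ.+-monoʳ-≤ (e * (e * coll)) (ℕₚ.*-monoˡ-≤ (sz * sz) ∣μ∣≤e) ⟩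
      e * (e * coll) + e * (sz * sz) ∎)
      where
      open ℕₚ.≤-Reasoning
      d : F → ℕ
      d c = dist (e * hits c) sz
      l₁ : ∀ a b → a + b + b ≡ a + 2 * b
      l₁ = solve-∀
      l₂ : ∀ e h → e * h * (e * h) ≡ e * e * (h * h)
      l₂ = solve-∀
      l₃ : ∀ e h s m → m * (2 * (e * h * s)) ≡ (m * h) * (2 * (e * s))
      l₃ = solve-∀
      l₄ : ∀ e s → s * (2 * (e * s)) ≡ 2 * (e * (s * s))
      l₄ = solve-∀
      cross : sum (λ c → ⟦ μ c ⟧ * (2 * (e * hits c * sz))) ≡ 2 * (e * (sz * sz))
      cross = trans (sum-cong-≗ (λ c → l₃ e (hits c) sz ⟦ μ c ⟧)) (trans (∑-*ʳ (2 * (e * sz)) (λ c → ⟦ μ c ⟧ * hits c)) (trans (cong (_* (2 * (e * sz))) ∑μhits) (l₄ e sz)))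

  val : Fin B → F
  val b = [ toℕ b ]

  val-injective : ∀ {b b′} → val b ≡ val b′ → b ≡ b′
  val-injective {b} {b′} eq = Finₚ.toℕ-injective ([]-injective (ℕₚ.<-≤-trans (Finₚ.toℕ<n b) B≤p) (ℕₚ.<-≤-trans (Finₚ.toℕ<n b′) B≤p) eq)

  occ-val : ∀ b xs → occ (val b) (map val xs) ≡ occ b xs
  occ-val b [] = refl
  occ-val b (x ∷ xs) = cong₂ _+_ (cong ⟦_⟧ (does-⇔ val-injective (cong val))) (occ-val b xs)

  linProd-++ : ∀ xs ys u → linProd (xs ++ ys) u ≡ linProd xs u ⊗ linProd ys u
  linProd-++ [] ys u = sym (⊗-identityˡ _)
  linProd-++ (x ∷ xs) ys u = trans (cong ((u ⊕ x) ⊗_) (linProd-++ xs ys u)) (sym (⊗-assoc _ _ _))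

  Regular : F → Set
  Regular u = ∀ b → u ⊕ val b ≢ 𝟘

  linProd≢𝟘 : ∀ {u} → Regular u → ∀ xs → linProd (map val xs) u ≢ 𝟘
  linProd≢𝟘 reg [] = 𝟙≢𝟘
  linProd≢𝟘 reg (x ∷ xs) = ⊗-nonzero (reg x) (linProd≢𝟘 reg xs)

  regular : F → Bool
  regular u = does (Finₚ.all? (λ b → ¬? (u ⊕ val b Finₚ.≟ 𝟘)))

  regular⇒Regular : ∀ u → u ∈ regular → Regular u
  regular⇒Regular u h = true-dec (Finₚ.all? (λ b → ¬? (u ⊕ val b Finₚ.≟ 𝟘))) h

  irregular-witness : ∀ u → regular u ≡ false → ∃ λ b → u ⊕ val b ≡ 𝟘
  irregular-witness u h with Finₚ.any? (λ b → u ⊕ val b Finₚ.≟ 𝟘)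
  ... | yes w = w
  ... | no none = ⊥-elim (false-dec (Finₚ.all? (λ b → ¬? (u ⊕ val b Finₚ.≟ 𝟘))) h (λ b e → none (b , e)))

  regular-count : p ≤ ∣ regular ∣ + B
  regular-count = begin
    p ≡⟨ sym (trans (∑-const p 1) (ℕₚ.*-identityʳ p)) ⟩
    sum {p} (λ _ → 1) ≤⟨ ∑-mono pt ⟩
    sum (λ u → ⟦ regular u ⟧ + sum (λ b → ⟦ does (u ⊕ val b Finₚ.≟ 𝟘) ⟧)) ≡⟨ ∑-distrib-+ (λ u → ⟦ regular u ⟧) _ ⟩
    ∣ regular ∣ + sum (λ u → sum (λ b → ⟦ does (u ⊕ val b Finₚ.≟ 𝟘) ⟧)) ≡⟨ cong (∣ regular ∣ +_) (trans (∑-swap (λ u b → ⟦ does (u ⊕ val b Finₚ.≟ 𝟘) ⟧)) (trans (sum-cong-≗ (λ b → trans (∑-shift (λ v → ⟦ does (v Finₚ.≟ 𝟘) ⟧) (val b)) (∑-pick′ 𝟘))) (trans (∑-const B 1) (ℕₚ.*-identityʳ B)))) ⟩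
    ∣ regular ∣ + B ∎
    where
    open ℕₚ.≤-Reasoning
    pt : ∀ u → 1 ≤ ⟦ regular u ⟧ + sum (λ b → ⟦ does (u ⊕ val b Finₚ.≟ 𝟘) ⟧)
    pt u with regular u in eq
    ... | true = s≤s z≤n
    ... | false with irregular-witness u eq
    ...   | b , e = ℕₚ.≤-trans (ℕₚ.≤-reflexive (sym (cong ⟦_⟧ (dec-true (u ⊕ val b Finₚ.≟ 𝟘) e)))) (∑-≥ (λ b → ⟦ does (u ⊕ val b Finₚ.≟ 𝟘) ⟧) b)

  sq : ℕ → ℕ → ℕ
  sq z zero = z * z
  sq z (suc i) = sq z i * sq z i

  sq≡ : ∀ z i → sq z i ≡ z ^ (2 ^ suc i)
  sq≡ z zero = cong (z *_) (sym (ℕₚ.*-identityʳ z))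
  sq≡ z (suc i) = trans (cong₂ _*_ (sq≡ z i) (sq≡ z i)) (trans (sym (ℕₚ.^-distribˡ-+-* z (2 ^ suc i) (2 ^ suc i))) (cong (λ q → z ^ (2 ^ suc i + q)) (sym (ℕₚ.+-identityʳ (2 ^ suc i)))))

  module Residues (e m : ℕ) .{{_ : NonZero e}} .{{_ : NonZero m}} (em≡n : e * m ≡ n) where

    -- The m-th power map identifies the cosets of the e-th powers with the e-th roots of unity.
    -- Labelling a pair by a quotient turns pairs with equal labels at one level into trees of label
    -- 1 at the next.
    label : F → ∀ i → T i → F
    label u zero b = (u ⊕ val b) ↑ m
    label u (suc i) (τ , τ′) = label u i τ′ ⊗ inv (label u i τ)

    μ : F → Bool
    μ c = does (c ↑ e Finₚ.≟ 𝟙)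

    ∣μ∣≤e : ∣ μ ∣ ≤ e
    ∣μ∣≤e = roots-of-unity e μ (λ c h → true-dec (c ↑ e Finₚ.≟ 𝟙) h)

    𝟙∈μ : 𝟙 ∈ μ
    𝟙∈μ = dec-true (𝟙 ↑ e Finₚ.≟ 𝟙) (𝟙↑ e)

    power∈μ : ∀ {a} → a ≢ 𝟘 → a ↑ m ∈ μ
    power∈μ {a} a≢0 = dec-true ((a ↑ m) ↑ e Finₚ.≟ 𝟙) (trans (↑-* a m e) (trans (cong (a ↑_) (trans (ℕₚ.*-comm m e) em≡n)) (fermat a≢0)))

    label≢𝟘 : ∀ {u} → Regular u → ∀ i τ → label u i τ ≢ 𝟘
    label≢𝟘 reg zero b = ↑-nonzero m (reg b)
    label≢𝟘 reg (suc i) (τ , τ′) = ⊗-nonzero (label≢𝟘 reg i τ′) (inv-nonzero (label≢𝟘 reg i τ))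

    inv-root : ∀ {x} → x ≢ 𝟘 → x ↑ e ≡ 𝟙 → inv x ↑ e ≡ 𝟙
    inv-root {x} x≢0 h = trans (sym (⊗-identityʳ _)) (trans (cong (inv x ↑ e ⊗_) (sym h)) (trans (sym (↑-⊗ (inv x) x e)) (trans (cong (_↑ e) (inv-inverseˡ x≢0)) (𝟙↑ e))))

    label-root : ∀ {u} → Regular u → ∀ i τ → label u i τ ↑ e ≡ 𝟙
    label-root {u} reg zero b = true-dec (((u ⊕ val b) ↑ m) ↑ e Finₚ.≟ 𝟙) (power∈μ (reg b))
    label-root {u} reg (suc i) (τ , τ′) = trans (↑-⊗ (label u i τ′) (inv (label u i τ)) e) (trans (cong₂ _⊗_ (label-root reg i τ′) (inv-root (label≢𝟘 reg i τ) (label-root reg i τ))) (⊗-identityˡ 𝟙))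

    label∈μ : ∀ {u} → Regular u → ∀ i τ → label u i τ ∈ μ
    label∈μ {u} reg i τ = dec-true (label u i τ ↑ e Finₚ.≟ 𝟙) (label-root reg i τ)

    -- Clears denominators: label 1 becomes an equality of m-th powers of two products of linear
    -- factors, the equation treated by Stepanov's method.
    label-linProd : ∀ {u} → Regular u → ∀ i τ → label u i τ ⊗ linProd (map val (dens i τ)) u ↑ m ≡ linProd (map val (nums i τ)) u ↑ m
    label-linProd {u} reg zero b = trans (cong ((u ⊕ val b) ↑ m ⊗_) (𝟙↑ m)) (trans (⊗-identityʳ _) (cong (_↑ m) (sym (⊗-identityʳ (u ⊕ val b)))))
    label-linProd {u} reg (suc i) (τ , τ′) = begin
      (L′ ⊗ inv L) ⊗ linProd (map val (dens i τ′ ++ nums i τ)) u ↑ m ≡⟨ cong ((L′ ⊗ inv L) ⊗_) (split (dens i τ′) (nums i τ)) ⟩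
      (L′ ⊗ inv L) ⊗ (D′ ⊗ N) ≡⟨ cong (λ z → (L′ ⊗ inv L) ⊗ (D′ ⊗ z)) (sym (label-linProd reg i τ)) ⟩
      (L′ ⊗ inv L) ⊗ (D′ ⊗ (L ⊗ D)) ≡⟨ re L′ (inv L) D′ L D ⟩
      (L′ ⊗ D′) ⊗ ((inv L ⊗ L) ⊗ D) ≡⟨ cong₂ _⊗_ (label-linProd reg i τ′) (trans (cong (_⊗ D) (inv-inverseˡ (label≢𝟘 reg i τ))) (⊗-identityˡ D)) ⟩
      N′ ⊗ D ≡⟨ sym (split (nums i τ′) (dens i τ)) ⟩
      linProd (map val (nums i τ′ ++ dens i τ)) u ↑ m ∎
      where
      open ≡-Reasoning
      L = label u i τ
      L′ = label u i τ′
      P : List (Fin B) → F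
      P xs = linProd (map val xs) u ↑ m
      D = P (dens i τ)
      D′ = P (dens i τ′)
      N = P (nums i τ)
      N′ = P (nums i τ′)
      split : ∀ xs ys → P (xs ++ ys) ≡ P xs ⊗ P ys
      split xs ys = trans (cong (λ zs → linProd zs u ↑ m) (map-++ val xs ys)) (trans (cong (_↑ m) (linProd-++ (map val xs) (map val ys) u)) (↑-⊗ (linProd (map val xs) u) (linProd (map val ys) u) m))
      re : ∀ a b c d f → (a ⊗ b) ⊗ (c ⊗ (d ⊗ f)) ≡ (a ⊗ c) ⊗ ((b ⊗ d) ⊗ f)
      re a b c d f = trans (⊗-assoc a b _) (trans (cong (a ⊗_) (trans (sym (⊗-assoc b c _)) (trans (cong (_⊗ (d ⊗ f)) (⊗-comm b c)) (trans (⊗-assoc c b _) (cong (c ⊗_) (sym (⊗-assoc b d f))))))) (sym (⊗-assoc a c _)))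

    coll : F → ℕ → ℕ
    coll u i = ∑T (suc i) (λ τ → ⟦ does (label u (suc i) τ Finₚ.≟ 𝟙) ⟧)

    dev : F → ℕ → ℕ
    dev u i = dist (e * coll u i) (size (suc i))

    module L {u} (reg : Regular u) i = Labels i e (label u i) μ ∣μ∣≤e (label∈μ reg i)

    coll≡ : ∀ {u} (reg : Regular u) i → L.coll reg i ≡ coll u i
    coll≡ {u} reg i = trans (L.coll≡ reg i) (∑T-cong i (λ τ → ∑T-cong i (λ τ′ → cong ⟦_⟧ (does-⇔ (fw τ τ′) (bw τ τ′)))))
      where
      fw : ∀ τ τ′ → label u i τ′ ≡ label u i τ → label u i τ′ ⊗ inv (label u i τ) ≡ 𝟙
      fw τ τ′ eq = trans (cong (_⊗ inv (label u i τ)) eq) (inv-inverseʳ (label≢𝟘 reg i τ))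
      bw : ∀ τ τ′ → label u i τ′ ⊗ inv (label u i τ) ≡ 𝟙 → label u i τ′ ≡ label u i τ
      bw τ τ′ eq = ⊗-cancelʳ (inv-nonzero (label≢𝟘 reg i τ)) (trans eq (sym (inv-inverseʳ (label≢𝟘 reg i τ))))

    variance : ∀ {u} (reg : Regular u) i c₀ → c₀ ∈ μ →
      dist (e * L.hits reg i c₀) (size i) * dist (e * L.hits reg i c₀) (size i) + e * size (suc i) ≤ e * (e * coll u i)
    variance reg i c₀ h = subst (λ q → dist (e * L.hits reg i c₀) (size i) * dist (e * L.hits reg i c₀) (size i) + e * size (suc i) ≤ e * (e * q)) (coll≡ reg i) (L.variance reg i c₀ h)

    variance⇒ : ∀ X Y Z → X + e * Y ≤ e * Z → Y ≤ Z × X ≤ e * dist Z Y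
    variance⇒ X Y Z h with ℕₚ.m≤n⇒∃[o]m+o≡n Y≤Z
      where
      Y≤Z : Y ≤ Z
      Y≤Z = ℕₚ.*-cancelˡ-≤ e (ℕₚ.≤-trans (ℕₚ.m≤n+m _ X) h)
    ... | o , refl = ℕₚ.m≤m+n Y o , subst (λ d → X ≤ e * d) (sym (trans (ℕₚ.∣-∣-comm (Y + o) Y) (ℕₚ.∣m-m+n∣≡n Y o)))
          (ℕₚ.+-cancelʳ-≤ (e * Y) X (e * o) (ℕₚ.≤-trans h (ℕₚ.≤-reflexive (trans (ℕₚ.*-distribˡ-+ e Y o) (ℕₚ.+-comm (e * Y) (e * o))))))

    dev-first : ∀ {u} (reg : Regular u) c₀ → c₀ ∈ μ → dist (e * L.hits reg 0 c₀) B * dist (e * L.hits reg 0 c₀) B ≤ e * dev u 0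
    dev-first reg c₀ h = proj₂ (variance⇒ _ _ _ (variance reg 0 c₀ h))

    -- At level `suc i` the label 𝟙 is hit `coll u i` times by definition, so the variance bound at
    -- 𝟙 passes to the next level and squares the deviation.
    dev-step : ∀ {u} (reg : Regular u) i → dev u i * dev u i ≤ e * dev u (suc i)
    dev-step reg i = proj₂ (variance⇒ _ _ _ (variance reg (suc i) 𝟙 𝟙∈μ))

    coll≥ : ∀ {u} (reg : Regular u) i → size (suc i) ≤ e * coll u i
    coll≥ reg i = proj₁ (variance⇒ _ _ _ (variance reg i 𝟙 𝟙∈μ))

    -- By `coll≥` the collisions never fall below their average, so deviations are plain differences
    -- and can be summed over `u` without absolute values.
    coll-dev : ∀ {u} (reg : Regular u) i → e * coll u i ≡ size (suc i) + dev u i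
    coll-dev {u} reg i with ℕₚ.m≤n⇒∃[o]m+o≡n (coll≥ reg i)
    ... | o , eq = trans (sym eq) (cong (size (suc i) +_) (sym (trans (cong (λ q → dist q (size (suc i))) (sym eq)) (trans (ℕₚ.∣-∣-comm (size (suc i) + o) (size (suc i))) (ℕₚ.∣m-m+n∣≡n (size (suc i)) o)))))

    -- Raising to the power 2^(i+1) keeps a relative deviation 1/z visible as 1/z^(2^(i+1)).
    deviation-propagates : ∀ {u} (reg : Regular u) z c₀ → c₀ ∈ μ → e * B ≤ z * dist (e * L.hits reg 0 c₀) B →
      ∀ i → e * size (suc i) ≤ sq z i * dev u i
    deviation-propagates {u} reg z c₀ c₀∈ h zero = ℕₚ.*-cancelˡ-≤ e (begin
      e * (e * (B * B)) ≡⟨ l₁ e B ⟩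
      e * B * (e * B) ≤⟨ ℕₚ.*-mono-≤ h h ⟩
      z * d * (z * d) ≡⟨ l₂ z d ⟩
      z * z * (d * d) ≤⟨ ℕₚ.*-monoʳ-≤ (z * z) (dev-first reg c₀ c₀∈) ⟩
      z * z * (e * dev u 0) ≡⟨ l₃ (z * z) e (dev u 0) ⟩
      e * (z * z * dev u 0) ∎)
      where
      open ℕₚ.≤-Reasoning
      d = dist (e * L.hits reg 0 c₀) B
      l₁ : ∀ e b → e * (e * (b * b)) ≡ e * b * (e * b)
      l₁ = solve-∀
      l₂ : ∀ z d → z * d * (z * d) ≡ z * z * (d * d)
      l₂ = solve-∀
      l₃ : ∀ z e d → z * (e * d) ≡ e * (z * d)
      l₃ = solve-∀
    deviation-propagates {u} reg z c₀ c₀∈ h (suc i) = ℕₚ.*-cancelˡ-≤ e (begin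
      e * (e * (s * s)) ≡⟨ l₁ e s ⟩
      e * s * (e * s) ≤⟨ ℕₚ.*-mono-≤ ih ih ⟩
      sq z i * d * (sq z i * d) ≡⟨ l₂ (sq z i) d ⟩
      sq z (suc i) * (d * d) ≤⟨ ℕₚ.*-monoʳ-≤ (sq z (suc i)) (dev-step reg i) ⟩
      sq z (suc i) * (e * dev u (suc i)) ≡⟨ l₃ (sq z (suc i)) e (dev u (suc i)) ⟩
      e * (sq z (suc i) * dev u (suc i)) ∎)
      where
      open ℕₚ.≤-Reasoning
      s = size (suc i)
      d = dev u i
      ih : e * s ≤ sq z i * d
      ih = deviation-propagates reg z c₀ c₀∈ h i
      l₁ : ∀ e b → e * (e * (b * b)) ≡ e * b * (e * b)
      l₁ = solve-∀
      l₂ : ∀ z d → z * d * (z * d) ≡ z * z * (d * d)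
      l₂ = solve-∀
      l₃ : ∀ z e d → z * (e * d) ≡ e * (z * d)
      l₃ = solve-∀

    -- The threshold is the conclusion of `deviation-propagates`: a regular `u` for which the count
    -- of some coset is off by B/z or more is exceptional.
    exceptional : ℕ → ℕ → F → Bool
    exceptional z s u = regular u ∧ does (e * size (suc s) ≤? sq z s * dev u s)

    module _ (h z : ℕ) (0<h : 0 < h) (h²≤p : h * h ≤ p) (p≤h²z : p ≤ h * h * z) (s : ℕ) where

      r = 2 ^ suc s
      K = h * z * (4 * r * r + 16 * r + 12)

      solutions : T (suc s) → F → Bool
      solutions τ u = regular u ∧ does (label u (suc s) τ Finₚ.≟ 𝟙)

      count-per-tree : ∀ τ → ∣ solutions τ ∣ ≤ (m + K) + ⟦ bad (suc s) τ ⟧ * p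
      count-per-tree τ with single-or-repeats (leaves (suc s) τ)
      ... | inj₂ rep = ℕₚ.≤-trans (∣∣≤ (solutions τ)) (ℕₚ.≤-trans (ℕₚ.≤-reflexive (trans (sym (ℕₚ.+-identityʳ p)) (cong (λ b → ⟦ b ⟧ * p) (sym (dec-true (length (leaves (suc s) τ) ≤? 2 * repeats (leaves (suc s) τ)) rep))))) (ℕₚ.m≤n+m _ (m + K)))
      ... | inj₁ (b , once) = ℕₚ.≤-trans (collision-count e m em≡n r cs ds
              (ℕₚ.≤-trans (ℕₚ.≤-reflexive (length-map val (nums (suc s) τ))) (ℕₚ.m+n≤o⇒m≤o (length (nums (suc s) τ)) (length-nums≤ (suc s) τ)))
              (ℕₚ.≤-trans (ℕₚ.≤-reflexive (length-map val (dens (suc s) τ))) (ℕₚ.m+n≤o⇒n≤o (length (nums (suc s) τ)) (length-nums≤ (suc s) τ)))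
              (val b) (trans (cong₂ _+_ (occ-val b (nums (suc s) τ)) (occ-val b (dens (suc s) τ))) (trans (occ-leaves (suc s) τ b) once))
              h z 0<h h²≤p p≤h²z (solutions τ) sol) (ℕₚ.m≤m+n _ _)
        where
        cs = map val (nums (suc s) τ)
        ds = map val (dens (suc s) τ)
        sol : ∀ u → u ∈ solutions τ → linProd cs u ↑ m ≡ linProd ds u ↑ m × linProd cs u ≢ 𝟘 × linProd ds u ≢ 𝟘
        sol u i with regular u in eq
        sol u i | true = sym (trans (sym (⊗-identityˡ _)) (trans (cong (_⊗ linProd ds u ↑ m) (sym (true-dec (label u (suc s) τ Finₚ.≟ 𝟙) i))) (label-linProd reg (suc s) τ))) ,
            linProd≢𝟘 reg (nums (suc s) τ) , linProd≢𝟘 reg (dens (suc s) τ)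
          where reg = regular⇒Regular u eq

      bads : ℕ
      bads = ∑T (suc s) (λ τ → ⟦ bad (suc s) τ ⟧)

      total-collisions : sum (λ u → ⟦ regular u ⟧ * coll u s) ≤ (m + K) * size (suc s) + bads * p
      total-collisions = begin
        sum (λ u → ⟦ regular u ⟧ * coll u s) ≡⟨ sum-cong-≗ (λ u → trans (sym (∑T-*ˡ (suc s) ⟦ regular u ⟧ (λ τ → ⟦ does (label u (suc s) τ Finₚ.≟ 𝟙) ⟧))) (∑T-cong (suc s) (λ τ → sym (⟦∧⟧ (regular u) _)))) ⟩
        sum (λ u → ∑T (suc s) (λ τ → ⟦ solutions τ u ⟧)) ≡⟨ sym (∑T-swap (suc s) (λ τ u → ⟦ solutions τ u ⟧)) ⟩
        ∑T (suc s) (λ τ → ∣ solutions τ ∣) ≤⟨ ∑T-mono (suc s) count-per-tree ⟩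
        ∑T (suc s) (λ τ → (m + K) + ⟦ bad (suc s) τ ⟧ * p) ≡⟨ ∑T-+ (suc s) (λ _ → m + K) (λ τ → ⟦ bad (suc s) τ ⟧ * p) ⟩
        ∑T (suc s) (λ _ → m + K) + ∑T (suc s) (λ τ → ⟦ bad (suc s) τ ⟧ * p) ≡⟨ cong₂ _+_ (trans (∑T-const (suc s) (m + K)) (ℕₚ.*-comm (size (suc s)) (m + K))) (∑T-*ʳ (suc s) p (λ τ → ⟦ bad (suc s) τ ⟧)) ⟩
        (m + K) * size (suc s) + bads * p ∎
        where open ℕₚ.≤-Reasoning

      private
        X = size (suc s)
        Y = size s
        DV = sum (λ u → ⟦ regular u ⟧ * dev u s)
        U = ∣ exceptional z s ∣
        Lr = r ^ r

      regular-dev : ∀ u → ⟦ regular u ⟧ * (e * coll u s) ≡ ⟦ regular u ⟧ * X + ⟦ regular u ⟧ * dev u s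
      regular-dev u with regular u in eq
      ... | false = refl
      ... | true = trans (ℕₚ.+-identityʳ _) (trans (coll-dev (regular⇒Regular u eq) s) (sym (cong₂ _+_ (ℕₚ.+-identityʳ X) (ℕₚ.+-identityʳ (dev u s)))))

      -- The expected collisions cancel: e m X from the Stepanov count is at most p X, the share of
      -- all elements, and passing from these to the regular ones costs only B X.
      total-deviation : DV ≤ e * (B * X + K * X + bads * p)
      total-deviation = ℕₚ.+-cancelˡ-≤ (p * X) DV _ (begin
        p * X + DV ≤⟨ ℕₚ.+-monoˡ-≤ DV (ℕₚ.*-monoˡ-≤ X regular-count) ⟩
        (∣ regular ∣ + B) * X + DV ≡⟨ l₁ ∣ regular ∣ B X DV ⟩
        (∣ regular ∣ * X + DV) + B * X ≡⟨ cong (_+ B * X) (trans (cong (_+ DV) (sym (∑-*ʳ X (λ u → ⟦ regular u ⟧)))) (trans (sym (∑-distrib-+ (λ u → ⟦ regular u ⟧ * X) (λ u → ⟦ regular u ⟧ * dev u s))) (trans (sum-cong-≗ (λ u → trans (sym (regular-dev u)) (l₂ ⟦ regular u ⟧ e (coll u s)))) (∑-*ˡ e (λ u → ⟦ regular u ⟧ * coll u s))))) ⟩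
        e * sum (λ u → ⟦ regular u ⟧ * coll u s) + B * X ≤⟨ ℕₚ.+-mono-≤ (ℕₚ.*-monoʳ-≤ e total-collisions) (ℕₚ.≤-trans (ℕₚ.≤-reflexive (sym (ℕₚ.*-identityˡ _))) (ℕₚ.*-monoˡ-≤ (B * X) (ℕ.>-nonZero⁻¹ e))) ⟩
        e * ((m + K) * X + bads * p) + e * (B * X) ≡⟨ l₃ e m K X (bads * p) (B * X) ⟩
        (e * m) * X + e * (B * X + K * X + bads * p) ≤⟨ ℕₚ.+-monoˡ-≤ _ (ℕₚ.*-monoˡ-≤ X (ℕₚ.≤-trans (ℕₚ.≤-reflexive em≡n) (ℕₚ.n≤1+n n))) ⟩
        p * X + e * (B * X + K * X + bads * p) ∎)
        where
        open ℕₚ.≤-Reasoning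
        l₁ : ∀ r b x d → (r + b) * x + d ≡ (r * x + d) + b * x
        l₁ = solve-∀
        l₂ : ∀ a e c → a * (e * c) ≡ e * (a * c)
        l₂ = solve-∀
        l₃ : ∀ e m k x q b → e * ((m + k) * x + q) + e * b ≡ (e * m) * x + e * (b + k * x + q)
        l₃ = solve-∀

      exceptional-dev : e * X * U ≤ sq z s * DV
      exceptional-dev = begin
        e * X * U ≡⟨ sym (∑-*ˡ (e * X) (λ u → ⟦ exceptional z s u ⟧)) ⟩
        sum (λ u → e * X * ⟦ exceptional z s u ⟧) ≤⟨ ∑-mono pt ⟩
        sum (λ u → sq z s * (⟦ regular u ⟧ * dev u s)) ≡⟨ ∑-*ˡ (sq z s) (λ u → ⟦ regular u ⟧ * dev u s) ⟩
        sq z s * DV ∎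
        where
        open ℕₚ.≤-Reasoning
        pt : ∀ u → e * X * ⟦ exceptional z s u ⟧ ≤ sq z s * (⟦ regular u ⟧ * dev u s)
        pt u with regular u
        ... | false = ℕₚ.≤-trans (ℕₚ.≤-reflexive (ℕₚ.*-zeroʳ (e * X))) z≤n
        ... | true with does (e * size (suc s) ≤? sq z s * dev u s) in eq
        ...   | false = ℕₚ.≤-trans (ℕₚ.≤-reflexive (ℕₚ.*-zeroʳ (e * X))) z≤n
        ...   | true = ℕₚ.≤-trans (ℕₚ.≤-reflexive (ℕₚ.*-identityʳ (e * X))) (ℕₚ.≤-trans (true-dec (e * size (suc s) ≤? sq z s * dev u s) eq) (ℕₚ.≤-reflexive (cong (sq z s *_) (sym (ℕₚ.+-identityʳ (dev u s))))))

      -- There are at most Lr X / Y bad trees, each charged the trivial `p` solutions; since p ≤ z Y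
      -- they cost at most Lr z X altogether.
      exceptional-count : p ≤ z * size s → ∣ exceptional z s ∣ ≤ sq z s * (B + K + r ^ r * z)
      exceptional-count p≤zY = ℕₚ.*-cancelˡ-≤ (e * (X * Y)) {{ℕ.>-nonZero pos}} (begin
        e * (X * Y) * U ≡⟨ l₁ e X Y U ⟩
        e * X * U * Y ≤⟨ ℕₚ.*-monoˡ-≤ Y (ℕₚ.≤-trans exceptional-dev (ℕₚ.*-monoʳ-≤ (sq z s) total-deviation)) ⟩
        sq z s * (e * (B * X + K * X + bads * p)) * Y ≡⟨ l₂ (sq z s) e (B * X + K * X) (bads * p) Y ⟩
        sq z s * e * ((B * X + K * X) * Y + bads * p * Y) ≤⟨ ℕₚ.*-monoʳ-≤ (sq z s * e) (ℕₚ.+-monoʳ-≤ ((B * X + K * X) * Y) (begin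
           bads * p * Y ≡⟨ l₃ bads p Y ⟩
           bads * Y * p ≤⟨ ℕₚ.*-mono-≤ (bad-count s) p≤zY ⟩
           Lr * X * (z * Y) ∎)) ⟩
        sq z s * e * ((B * X + K * X) * Y + Lr * X * (z * Y)) ≡⟨ l₄ (sq z s) e B K X Y Lr z ⟩
        e * (X * Y) * (sq z s * (B + K + Lr * z)) ∎)
        where
        open ℕₚ.≤-Reasoning
        posSize : ∀ i → 0 < size i
        posSize zero = ℕ.>-nonZero⁻¹ B
        posSize (suc i) = ℕₚ.*-mono-< (posSize i) (posSize i)
        pos : 0 < e * (X * Y)
        pos = ℕₚ.*-mono-< (ℕ.>-nonZero⁻¹ e) (ℕₚ.*-mono-< (posSize (suc s)) (posSize s))
        l₁ : ∀ e x y u → e * (x * y) * u ≡ e * x * u * y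
        l₁ = solve-∀
        l₂ : ∀ q e a b y → q * (e * (a + b)) * y ≡ q * e * (a * y + b * y)
        l₂ = solve-∀
        l₃ : ∀ b p y → b * p * y ≡ b * y * p
        l₃ = solve-∀
        l₄ : ∀ q e B K X Y L z → q * e * ((B * X + K * X) * Y + L * X * (z * Y)) ≡ e * (X * Y) * (q * (B + K + L * z))
        l₄ = solve-∀

-- Sumsets, Cauchy-Davenport, and additive energy.

module Sumset (n : ℕ) (pr : Prime (suc n)) where

  open FiniteSums
  open Trees using (∑-pick; ∑-pick′)
  open Fp n pr

  FSet : Set
  FSet = F → Bool

  member? : ∀ (A : FSet) x → Dec (x ∈ A)
  member? A x = A x Bool.≟ true

  abstract
    infixl 6 _⊞_
    _⊞_ : FSet → FSet → FSet
    (A ⊞ C) x = does (Finₚ.any? (λ y → member? A y ×-dec member? C (x ⊕ ⊖ y)))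

    ⊞-intro : ∀ {A C a c} → a ∈ A → c ∈ C → a ⊕ c ∈ A ⊞ C
    ⊞-intro {A} {C} {a} {c} a∈ c∈ = dec-true (Finₚ.any? (λ y → member? A y ×-dec member? C ((a ⊕ c) ⊕ ⊖ y))) (a , a∈ , subst (_∈ C) (sym (trans (cong (_⊕ ⊖ a) (⊕-comm a c)) (a⊕b⊖b c a))) c∈)

    ⊞-elim : ∀ {A C x} → x ∈ A ⊞ C → ∃ λ a → ∃ λ c → a ∈ A × c ∈ C × x ≡ a ⊕ c
    ⊞-elim {A} {C} {x} h with true-dec (Finₚ.any? (λ y → member? A y ×-dec member? C (x ⊕ ⊖ y))) h
    ... | a , a∈ , c∈ = a , x ⊕ ⊖ a , a∈ , c∈ , sym (trans (⊕-comm a _) (a⊖b⊕b x a))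

  ⁅𝟘⁆ : FSet
  ⁅𝟘⁆ x = does (x Finₚ.≟ 𝟘)

  infixr 7 _·_
  _·_ : ℕ → FSet → FSet
  zero · A = ⁅𝟘⁆
  suc k · A = A ⊞ k · A

  𝟘∈⁅𝟘⁆ : 𝟘 ∈ ⁅𝟘⁆
  𝟘∈⁅𝟘⁆ = dec-true (𝟘 Finₚ.≟ 𝟘) refl

  ∈⁅𝟘⁆ : ∀ {x} → x ∈ ⁅𝟘⁆ → x ≡ 𝟘
  ∈⁅𝟘⁆ {x} h = true-dec (x Finₚ.≟ 𝟘) h

  𝟘∈· : ∀ k {A} → 𝟘 ∈ A → 𝟘 ∈ k · A
  𝟘∈· zero h = 𝟘∈⁅𝟘⁆
  𝟘∈· (suc k) {A} h = subst (_∈ suc k · A) (⊕-identityʳ 𝟘) (⊞-intro {A} {k · A} h (𝟘∈· k h))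

  ·-+ : ∀ k l {A x y} → x ∈ k · A → y ∈ l · A → x ⊕ y ∈ (k + l) · A
  ·-+ zero l {A} {x} {y} h g = subst (_∈ l · A) (sym (trans (cong (_⊕ y) (∈⁅𝟘⁆ h)) (⊕-identityˡ y))) g
  ·-+ (suc k) l {A} {x} {y} h g with ⊞-elim {A} {k · A} h
  ... | a , c , a∈ , c∈ , refl = subst (_∈ suc (k + l) · A) (sym (⊕-assoc a c y)) (⊞-intro {A} {(k + l) · A} a∈ (·-+ k l c∈ g))

  ⊞-identityʳ-⊆ : ∀ {A C} → 𝟘 ∈ C → A ⊆ A ⊞ C
  ⊞-identityʳ-⊆ {A} {C} h x x∈ = subst (_∈ A ⊞ C) (⊕-identityʳ x) (⊞-intro {A} {C} x∈ h)

  ⊞-identityˡ-⊆ : ∀ {A C} → 𝟘 ∈ A → C ⊆ A ⊞ C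
  ⊞-identityˡ-⊆ {A} {C} h x x∈ = subst (_∈ A ⊞ C) (⊕-identityˡ x) (⊞-intro {A} {C} h x∈)

  ∨-introˡ : ∀ {a b} → a ≡ true → a ∨ b ≡ true
  ∨-introˡ refl = refl

  ∨-introʳ : ∀ {a b} → b ≡ true → a ∨ b ≡ true
  ∨-introʳ {true} refl = refl
  ∨-introʳ {false} refl = refl

  ∨-elim : ∀ {a b} → a ∨ b ≡ true → a ≡ true ⊎ b ≡ true
  ∨-elim {true} _ = inj₁ refl
  ∨-elim {false} h = inj₂ h

  ∧-intro : ∀ {a b} → a ≡ true → b ≡ true → a ∧ b ≡ true
  ∧-intro refl refl = refl

  ∧-elimˡ : ∀ {a b} → a ∧ b ≡ true → a ≡ true
  ∧-elimˡ {true} _ = refl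

  ∧-elimʳ : ∀ {a b} → a ∧ b ≡ true → b ≡ true
  ∧-elimʳ {true} h = h

  -- The multiples of a nonzero `c` exhaust the additive group.
  translation-closed : ∀ {A a c} → a ∈ A → c ≢ 𝟘 → (∀ x → x ∈ A → x ⊕ c ∈ A) → ∀ x → x ∈ A
  translation-closed {A} {a} {c} a∈ c≢0 closed x = subst (_∈ A) reach (steps (toℕ t))
    where
    t = (x ⊕ ⊖ a) ⊗ inv c
    steps : ∀ k → a ⊕ [ k ] ⊗ c ∈ A
    steps zero = subst (_∈ A) (sym (trans (cong (a ⊕_) (trans (cong (_⊗ c) [0]) (⊗-zeroˡ c))) (⊕-identityʳ a))) a∈
    steps (suc k) = subst (_∈ A) (trans (⊕-assoc a _ c) (cong (a ⊕_) (trans (⊕-comm _ c) (trans (cong (_⊕ [ k ] ⊗ c) (sym (⊗-identityˡ c))) (trans (sym (⊗-distribʳ c 𝟙 [ k ])) (cong (_⊗ c) (sym ([]-+ 1 k)))))))) (closed _ (steps k))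
    reach : a ⊕ [ toℕ t ] ⊗ c ≡ x
    reach = trans (cong (λ z → a ⊕ z ⊗ c) ([toℕ] t)) (trans (cong (a ⊕_) (trans (⊗-assoc _ (inv c) c) (trans (cong ((x ⊕ ⊖ a) ⊗_) (inv-inverseˡ c≢0)) (⊗-identityʳ _)))) (trans (⊕-comm a _) (a⊖b⊕b x a)))

  full-card : ∀ {A : FSet} → (∀ x → x ∈ A) → p ≤ ∣ A ∣
  full-card {A} h = ℕₚ.≤-reflexive (sym (trans (sum-cong-≗ (λ x → cong ⟦_⟧ (h x))) (trans (∑-const p 1) (ℕₚ.*-identityʳ p))))

  ∣∣-split : ∀ (A C : FSet) → ∣ A ∣ ≡ ∣ (λ x → A x ∧ C x) ∣ + ∣ (λ x → A x ∧ not (C x)) ∣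
  ∣∣-split A C = trans (sum-cong-≗ (λ x → ⟦⟧-split (A x) (C x))) (∑-distrib-+ (λ x → ⟦ A x ∧ C x ⟧) (λ x → ⟦ A x ∧ not (C x) ⟧))

  ∣∣-∨ : ∀ (A C : FSet) → ∣ (λ x → A x ∨ C x) ∣ ≡ ∣ A ∣ + ∣ (λ x → C x ∧ not (A x)) ∣
  ∣∣-∨ A C = trans (sum-cong-≗ pt) (∑-distrib-+ (λ x → ⟦ A x ⟧) (λ x → ⟦ C x ∧ not (A x) ⟧))
    where
    pt : ∀ x → ⟦ A x ∨ C x ⟧ ≡ ⟦ A x ⟧ + ⟦ C x ∧ not (A x) ⟧
    pt x with A x | C x
    ... | true | true = refl
    ... | true | false = refl
    ... | false | true = refl
    ... | false | false = refl

  -- Cauchy–Davenport by Dyson's e-transform.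
  cauchy-davenport₀ : ∀ fuel A C → ∣ C ∣ ≤ fuel → (∃ λ a → a ∈ A) → 𝟘 ∈ C → p ≤ ∣ A ⊞ C ∣ ⊎ ∣ A ∣ + ∣ C ∣ ≤ suc ∣ A ⊞ C ∣
  cauchy-davenport₀ zero A C le _ 𝟘∈ = ⊥-elim (ℕₚ.<⇒≱ (∣∣-pos {A = C} 𝟘 𝟘∈) le)
  cauchy-davenport₀ (suc fuel) A C le (a , a∈) 𝟘∈
    with Finₚ.any? (λ e → member? A e ×-dec Finₚ.any? (λ c → member? C c ×-dec ¬? (member? A (e ⊕ c))))
  ... | yes (e , e∈ , c , c∈ , ec∉) = conclude (cauchy-davenport₀ fuel A′ C′ less (a , ∨-introˡ a∈) (∧-intro 𝟘∈ (subst (_∈ A) (sym (⊕-identityʳ e)) e∈)))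
    where
    -- The transform at `e`: the part of e + C outside `A` is handed over to `A` and its preimage is
    -- removed from `C`. The sum of the cardinalities is preserved, A′ + C′ stays inside A + C, and
    -- the witness `c` makes `C` shrink.
    A′ C′ : FSet
    A′ x = A x ∨ C (x ⊕ ⊖ e)
    C′ x = C x ∧ A (e ⊕ x)
    lost : ℕ
    lost = ∣ (λ x → C x ∧ not (A (e ⊕ x))) ∣
    splitC : ∣ C ∣ ≡ ∣ C′ ∣ + lost
    splitC = ∣∣-split C (λ x → A (e ⊕ x))
    splitA : ∣ A′ ∣ ≡ ∣ A ∣ + lost
    splitA = trans (∣∣-∨ A (λ x → C (x ⊕ ⊖ e))) (cong (∣ A ∣ +_) (trans (sym (∑-shift (λ x → ⟦ C (x ⊕ ⊖ e) ∧ not (A x) ⟧) e))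
      (sum-cong-≗ (λ x → cong₂ (λ s t → ⟦ C s ∧ not (A t) ⟧) (a⊕b⊖b x e) (⊕-comm x e)))))
    1≤lost : 1 ≤ lost
    1≤lost = ∣∣-pos {A = λ x → C x ∧ not (A (e ⊕ x))} c (∧-intro c∈ (cong not (lem (A (e ⊕ c)) ec∉)))
      where
      lem : ∀ b → b ≢ true → b ≡ false
      lem true h = ⊥-elim (h refl)
      lem false h = refl
    less : ∣ C′ ∣ ≤ fuel
    less = ℕₚ.≤-pred (ℕₚ.≤-trans (ℕₚ.≤-trans (ℕₚ.≤-reflexive (ℕₚ.+-comm 1 ∣ C′ ∣)) (ℕₚ.+-monoʳ-≤ ∣ C′ ∣ 1≤lost)) (ℕₚ.≤-trans (ℕₚ.≤-reflexive (sym splitC)) le))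
    sub : A′ ⊞ C′ ⊆ A ⊞ C
    sub x x∈ with ⊞-elim {A′} {C′} x∈
    ... | s , t , s∈ , t∈ , refl with ∨-elim {A s} s∈
    ...   | inj₁ sA = ⊞-intro {A} {C} sA (∧-elimˡ t∈)
    ...   | inj₂ sC = subst (_∈ A ⊞ C) re (⊞-intro {A} {C} (∧-elimʳ {C t} t∈) sC)
      where
      re : (e ⊕ t) ⊕ (s ⊕ ⊖ e) ≡ s ⊕ t
      re = trans (cong (_⊕ (s ⊕ ⊖ e)) (⊕-comm e t)) (trans (⊕-assoc t e _) (trans (cong (t ⊕_) (trans (⊕-comm e _) (a⊖b⊕b s e))) (⊕-comm t s)))
    conclude : p ≤ ∣ A′ ⊞ C′ ∣ ⊎ ∣ A′ ∣ + ∣ C′ ∣ ≤ suc ∣ A′ ⊞ C′ ∣ → p ≤ ∣ A ⊞ C ∣ ⊎ ∣ A ∣ + ∣ C ∣ ≤ suc ∣ A ⊞ C ∣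
    conclude (inj₁ h) = inj₁ (ℕₚ.≤-trans h (∣∣-mono sub))
    conclude (inj₂ h) = inj₂ (ℕₚ.≤-trans (ℕₚ.≤-reflexive eq) (ℕₚ.≤-trans h (s≤s (∣∣-mono sub))))
      where
      lem : ∀ a c l → a + (c + l) ≡ (a + l) + c
      lem = solve-∀
      eq : ∣ A ∣ + ∣ C ∣ ≡ ∣ A′ ∣ + ∣ C′ ∣
      eq = trans (cong (∣ A ∣ +_) splitC) (trans (lem ∣ A ∣ ∣ C′ ∣ lost) (cong (_+ ∣ C′ ∣) (sym splitA)))
  -- Now A + C ⊆ A: a nonzero element of `C` makes `A` the whole field, and otherwise C = {0}.
  ... | no none with Finₚ.any? (λ c → member? C c ×-dec ¬? (c Finₚ.≟ 𝟘))
  ...   | yes (c , c∈ , c≢0) = inj₁ (ℕₚ.≤-trans (full-card (translation-closed a∈ c≢0 closed)) (∣∣-mono (⊞-identityʳ-⊆ {A} {C} 𝟘∈)))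
    where
    closed : ∀ x → x ∈ A → x ⊕ c ∈ A
    closed x x∈ with A (x ⊕ c) in eq
    ... | true = refl
    ... | false = ⊥-elim (none (x , x∈ , c , c∈ , λ h → false≢true (trans (sym eq) h)))
  ...   | no none₀ = inj₂ (begin
    ∣ A ∣ + ∣ C ∣ ≤⟨ ℕₚ.+-mono-≤ (∣∣-mono (⊞-identityʳ-⊆ {A} {C} 𝟘∈)) C≤1 ⟩
    ∣ A ⊞ C ∣ + 1 ≡⟨ ℕₚ.+-comm _ 1 ⟩
    suc ∣ A ⊞ C ∣ ∎)
    where
    open ℕₚ.≤-Reasoning
    sub : C ⊆ ⁅𝟘⁆
    sub x x∈ with x Finₚ.≟ 𝟘
    ... | yes _ = refl
    ... | no ne = ⊥-elim (none₀ (x , x∈ , ne))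
    C≤1 : ∣ C ∣ ≤ 1
    C≤1 = ℕₚ.≤-trans (∣∣-mono sub) (ℕₚ.≤-reflexive (∑-pick′ 𝟘))

  iterated-cauchy-davenport : ∀ k A → 𝟘 ∈ A → p ≤ ∣ k · A ∣ ⊎ suc (k * ∣ A ∣) ≤ ∣ k · A ∣ + k
  iterated-cauchy-davenport zero A 𝟘∈ = inj₂ (ℕₚ.≤-reflexive (trans (sym (∑-pick′ 𝟘)) (sym (ℕₚ.+-identityʳ _))))
  iterated-cauchy-davenport (suc k) A 𝟘∈ with iterated-cauchy-davenport k A 𝟘∈ | cauchy-davenport₀ ∣ k · A ∣ A (k · A) ℕₚ.≤-refl (𝟘 , 𝟘∈) (𝟘∈· k 𝟘∈)
  ... | inj₁ h | _ = inj₁ (ℕₚ.≤-trans h (∣∣-mono (⊞-identityˡ-⊆ {A} {k · A} 𝟘∈)))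
  ... | inj₂ _ | inj₁ h = inj₁ h
  ... | inj₂ h | inj₂ g = inj₂ (begin
    suc (∣ A ∣ + k * ∣ A ∣) ≡⟨ sym (ℕₚ.+-suc ∣ A ∣ (k * ∣ A ∣)) ⟩
    ∣ A ∣ + suc (k * ∣ A ∣) ≤⟨ ℕₚ.+-monoʳ-≤ ∣ A ∣ h ⟩
    ∣ A ∣ + (∣ k · A ∣ + k) ≡⟨ sym (ℕₚ.+-assoc ∣ A ∣ _ k) ⟩
    ∣ A ∣ + ∣ k · A ∣ + k ≤⟨ ℕₚ.+-monoˡ-≤ k g ⟩
    suc ∣ suc k · A ∣ + k ≡⟨ sym (ℕₚ.+-suc _ k) ⟩
    ∣ suc k · A ∣ + suc k ∎)
    where open ℕₚ.≤-Reasoning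

  -- As `2 ≤ ∣ A ∣`, the loss `k` in Cauchy-Davenport is at most half of `k * ∣ A ∣`.
  iterated-growth : ∀ k A → 𝟘 ∈ A → 2 ≤ ∣ A ∣ → p ≤ ∣ k · A ∣ ⊎ k * ∣ A ∣ ≤ 2 * ∣ k · A ∣
  iterated-growth k A 𝟘∈ 2≤ with iterated-cauchy-davenport k A 𝟘∈
  ... | inj₁ h = inj₁ h
  ... | inj₂ h = inj₂ (ℕₚ.+-cancelʳ-≤ (k * ∣ A ∣) _ _ (begin
    k * ∣ A ∣ + k * ∣ A ∣ ≡⟨ l₁ (k * ∣ A ∣) ⟩
    2 * (k * ∣ A ∣) ≤⟨ ℕₚ.*-monoʳ-≤ 2 (ℕₚ.≤-trans (ℕₚ.n≤1+n _) h) ⟩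
    2 * (∣ k · A ∣ + k) ≡⟨ ℕₚ.*-distribˡ-+ 2 ∣ k · A ∣ k ⟩
    2 * ∣ k · A ∣ + 2 * k ≤⟨ ℕₚ.+-monoʳ-≤ (2 * ∣ k · A ∣) (ℕₚ.≤-trans (ℕₚ.≤-reflexive (ℕₚ.*-comm 2 k)) (ℕₚ.*-monoʳ-≤ k 2≤)) ⟩
    2 * ∣ k · A ∣ + k * ∣ A ∣ ∎))
    where
    open ℕₚ.≤-Reasoning
    l₁ : ∀ x → x + x ≡ 2 * x
    l₁ = solve-∀

  diff : F → FSet → FSet
  diff u A v = does (Finₚ.any? (λ s → member? A s ×-dec member? A (v ⊕ u ⊗ s)))

  diff-elim : ∀ u A v → v ∈ diff u A → ∃ λ s → s ∈ A × v ⊕ u ⊗ s ∈ A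
  diff-elim u A v h = true-dec (Finₚ.any? (λ s → member? A s ×-dec member? A (v ⊕ u ⊗ s))) h

  diff-intro : ∀ u A v s → s ∈ A → v ⊕ u ⊗ s ∈ A → v ∈ diff u A
  diff-intro u A v s h g = dec-true (Finₚ.any? (λ s → member? A s ×-dec member? A (v ⊕ u ⊗ s))) (s , h , g)

  ⊕⊗-middle : ∀ u v w s t → (v ⊕ w) ⊕ u ⊗ (s ⊕ t) ≡ (v ⊕ u ⊗ s) ⊕ (w ⊕ u ⊗ t)
  ⊕⊗-middle u v w s t = trans (cong ((v ⊕ w) ⊕_) (⊗-distribˡ u s t)) (trans (⊕-assoc v w _) (trans (cong (v ⊕_) (trans (sym (⊕-assoc w _ _)) (trans (cong (_⊕ u ⊗ t) (⊕-comm w _)) (⊕-assoc _ w _)))) (sym (⊕-assoc v _ _))))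

  -- Carries lower bounds from scale `i` to scale `k * i`: Cauchy-Davenport is applied to iX - u·iX,
  -- whose k-fold sum regroups into a difference at the larger scale.
  ·-diff : ∀ k i u {X} → k · diff u (i · X) ⊆ diff u ((k * i) · X)
  ·-diff zero i u {X} v h = diff-intro u ⁅𝟘⁆ v 𝟘 𝟘∈⁅𝟘⁆ (subst (_∈ ⁅𝟘⁆) (sym (trans (cong₂ _⊕_ (∈⁅𝟘⁆ h) (⊗-zeroʳ u)) (⊕-identityʳ 𝟘))) 𝟘∈⁅𝟘⁆)
  ·-diff (suc k) i u {X} v h with ⊞-elim {diff u (i · X)} {k · diff u (i · X)} h
  ... | a , c , a∈ , c∈ , refl with diff-elim u (i · X) a a∈ | diff-elim u ((k * i) · X) c (·-diff k i u c c∈)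
  ...   | s , s∈ , as∈ | t , t∈ , ct∈ = diff-intro u ((i + k * i) · X) (a ⊕ c) (s ⊕ t) (·-+ i (k * i) s∈ t∈)
    (subst (_∈ (i + k * i) · X) (sym (⊕⊗-middle u a c s t)) (·-+ i (k * i) as∈ ct∈))

  rep : F → FSet → F → ℕ
  rep u A v = sum (λ s → ⟦ A s ⟧ * ⟦ A (v ⊕ u ⊗ s) ⟧)

  ⟦⟧*⟦⟧-mono : ∀ {a b c d} → (a ≡ true → b ≡ true → c ≡ true × d ≡ true) → ⟦ a ⟧ * ⟦ b ⟧ ≤ ⟦ c ⟧ * ⟦ d ⟧
  ⟦⟧*⟦⟧-mono {true} {true} h with h refl refl
  ... | refl , refl = ℕₚ.≤-refl
  ⟦⟧*⟦⟧-mono {true} {false} h = z≤n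
  ⟦⟧*⟦⟧-mono {false} h = z≤n

  module Packing (u : F) (A A₂ : FSet) (A+A⊆A₂ : ∀ {x y} → x ∈ A → y ∈ A → x ⊕ y ∈ A₂) where

    R = diff u A

    -- The translates of the representations of v by the elements of R are disjoint inside A₂ × A₂.
    rep-bound : ∀ v → rep u A v * ∣ R ∣ ≤ ∣ A₂ ∣ * ∣ A₂ ∣
    rep-bound v = begin
      rep u A v * ∣ R ∣ ≡⟨ sym (∑-*ˡ (rep u A v) (λ w → ⟦ R w ⟧)) ⟩
      sum (λ w → rep u A v * ⟦ R w ⟧) ≤⟨ ∑-mono pt ⟩
      sum (λ w → sum (λ s → ⟦ A₂ s ⟧ * ⟦ A₂ ((v ⊕ w) ⊕ u ⊗ s) ⟧)) ≡⟨ ∑-swap (λ w s → ⟦ A₂ s ⟧ * ⟦ A₂ ((v ⊕ w) ⊕ u ⊗ s) ⟧) ⟩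
      sum (λ s → sum (λ w → ⟦ A₂ s ⟧ * ⟦ A₂ ((v ⊕ w) ⊕ u ⊗ s) ⟧)) ≡⟨ sum-cong-≗ (λ s → trans (∑-*ˡ ⟦ A₂ s ⟧ (λ w → ⟦ A₂ ((v ⊕ w) ⊕ u ⊗ s) ⟧)) (cong (⟦ A₂ s ⟧ *_) (inner s))) ⟩
      sum (λ s → ⟦ A₂ s ⟧ * ∣ A₂ ∣) ≡⟨ ∑-*ʳ ∣ A₂ ∣ (λ s → ⟦ A₂ s ⟧) ⟩
      ∣ A₂ ∣ * ∣ A₂ ∣ ∎
      where
      open ℕₚ.≤-Reasoning
      inner : ∀ s → sum (λ w → ⟦ A₂ ((v ⊕ w) ⊕ u ⊗ s) ⟧) ≡ ∣ A₂ ∣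
      inner s = trans (sum-cong-≗ (λ w → cong (λ x → ⟦ A₂ x ⟧) (trans (cong (_⊕ u ⊗ s) (⊕-comm v w)) (⊕-assoc w v _)))) (∑-shift (λ x → ⟦ A₂ x ⟧) (v ⊕ u ⊗ s))
      pt : ∀ w → rep u A v * ⟦ R w ⟧ ≤ sum (λ s → ⟦ A₂ s ⟧ * ⟦ A₂ ((v ⊕ w) ⊕ u ⊗ s) ⟧)
      pt w with R w in eq
      ... | false = ℕₚ.≤-trans (ℕₚ.≤-reflexive (ℕₚ.*-zeroʳ (rep u A v))) z≤n
      ... | true with diff-elim u A w eq
      ...   | t , t∈ , wt∈ = ℕₚ.≤-trans (ℕₚ.≤-reflexive (ℕₚ.*-identityʳ _)) (ℕₚ.≤-trans (∑-mono (λ s → ⟦⟧*⟦⟧-mono {A s} {A (v ⊕ u ⊗ s)} {A₂ (s ⊕ t)} {A₂ ((v ⊕ w) ⊕ u ⊗ (s ⊕ t))}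
            λ a b → A+A⊆A₂ a t∈ , subst (_∈ A₂) (sym (⊕⊗-middle u v w s t)) (A+A⊆A₂ b wt∈)))
            (ℕₚ.≤-reflexive (∑-shift (λ s → ⟦ A₂ s ⟧ * ⟦ A₂ ((v ⊕ w) ⊕ u ⊗ s) ⟧) t)))

    neg-shift : ∀ y c s → y ⊕ ⊖ (u ⊗ (c ⊕ ⊖ s)) ≡ (y ⊕ ⊖ (u ⊗ c)) ⊕ u ⊗ s
    neg-shift y c s = trans (cong (λ z → y ⊕ ⊖ z) (trans (⊗-distribˡ u c (⊖ s)) (cong (u ⊗ c ⊕_) (sym (⊖-distribʳ-⊗ u s)))))
      (trans (cong (y ⊕_) (trans (sym (⊖-⊕-comm (u ⊗ c) (⊖ (u ⊗ s)))) (cong (⊖ (u ⊗ c) ⊕_) (⊖-involutive (u ⊗ s))))) (sym (⊕-assoc y _ _)))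

    translates : FSet → F → ℕ
    translates S x = sum (λ t → ⟦ A t ⟧ * ⟦ S (x ⊕ t) ⟧)

    translates≡ : ∀ S x → translates S x ≡ sum (λ y → ⟦ S y ⟧ * ⟦ A (y ⊕ ⊖ x) ⟧)
    translates≡ S x = trans (sum-cong-≗ (λ t → trans (ℕₚ.*-comm ⟦ A t ⟧ _) (cong₂ (λ a b → ⟦ S a ⟧ * ⟦ A b ⟧) (⊕-comm x t) (sym (a⊕b⊖b t x))))) (∑-shift (λ y → ⟦ S y ⟧ * ⟦ A (y ⊕ ⊖ x) ⟧) x)

    -- Put c = a + s, an element of `A₂`. Then ua = uc - us, and a translate y = ua + t in `S` gives
    -- y - uc + us = t in `A`, so summing over `s` produces `rep` at y - uc. After `rep-bound` the
    -- variables c and y range freely over `A₂` and `S`.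
    fibre-bound : ∀ (S N : FSet) → (∀ a → a ∈ N → a ∈ A × ∣ A ∣ ≤ 2 * translates S (u ⊗ a)) →
      ∣ N ∣ * (∣ A ∣ * ∣ A ∣) * ∣ R ∣ ≤ 2 * (∣ S ∣ * (∣ A₂ ∣ * (∣ A₂ ∣ * ∣ A₂ ∣)))
    fibre-bound S N h = begin
      ∣ N ∣ * (∣ A ∣ * ∣ A ∣) * ∣ R ∣ ≤⟨ ℕₚ.*-monoˡ-≤ ∣ R ∣ step₁ ⟩
      2 * G * ∣ R ∣ ≡⟨ ℕₚ.*-assoc 2 G ∣ R ∣ ⟩
      2 * (G * ∣ R ∣) ≤⟨ ℕₚ.*-monoʳ-≤ 2 step₂ ⟩
      2 * (∣ S ∣ * (∣ A₂ ∣ * (∣ A₂ ∣ * ∣ A₂ ∣))) ∎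
      where
      open ℕₚ.≤-Reasoning
      G = sum (λ a → sum (λ s → (⟦ N a ⟧ * ⟦ A s ⟧) * translates S (u ⊗ a)))
      step₁ : ∣ N ∣ * (∣ A ∣ * ∣ A ∣) ≤ 2 * G
      step₁ = begin
        ∣ N ∣ * (∣ A ∣ * ∣ A ∣) ≡⟨ sym (∑-*ʳ (∣ A ∣ * ∣ A ∣) (λ a → ⟦ N a ⟧)) ⟩
        sum (λ a → ⟦ N a ⟧ * (∣ A ∣ * ∣ A ∣)) ≤⟨ ∑-mono (λ a → ⟦⟧*-≤ (N a) {∣ A ∣ * ∣ A ∣} {∣ A ∣ * (2 * translates S (u ⊗ a))} (λ a∈ → ℕₚ.*-monoʳ-≤ ∣ A ∣ (proj₂ (h a a∈)))) ⟩
        sum (λ a → ⟦ N a ⟧ * (∣ A ∣ * (2 * translates S (u ⊗ a)))) ≡⟨ sum-cong-≗ (λ a → trans (l₁ ⟦ N a ⟧ ∣ A ∣ (translates S (u ⊗ a))) (cong (2 *_) (trans (cong (_* translates S (u ⊗ a)) (sym (∑-*ˡ ⟦ N a ⟧ (λ s → ⟦ A s ⟧)))) (sym (∑-*ʳ (translates S (u ⊗ a)) (λ s → ⟦ N a ⟧ * ⟦ A s ⟧)))))) ⟩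
        sum (λ a → 2 * sum (λ s → (⟦ N a ⟧ * ⟦ A s ⟧) * translates S (u ⊗ a))) ≡⟨ ∑-*ˡ 2 (λ a → sum (λ s → (⟦ N a ⟧ * ⟦ A s ⟧) * translates S (u ⊗ a))) ⟩
        2 * G ∎
        where
        l₁ : ∀ n a t → n * (a * (2 * t)) ≡ 2 * (n * a * t)
        l₁ = solve-∀
      step₂ : G * ∣ R ∣ ≤ ∣ S ∣ * (∣ A₂ ∣ * (∣ A₂ ∣ * ∣ A₂ ∣))
      step₂ = begin
        G * ∣ R ∣ ≡⟨ cong (_* ∣ R ∣) (∑-swap (λ a s → (⟦ N a ⟧ * ⟦ A s ⟧) * translates S (u ⊗ a))) ⟩
        sum (λ s → sum (λ a → (⟦ N a ⟧ * ⟦ A s ⟧) * translates S (u ⊗ a))) * ∣ R ∣ ≡⟨ cong (_* ∣ R ∣) (sum-cong-≗ (λ s → sym (∑-shift (λ a → (⟦ N a ⟧ * ⟦ A s ⟧) * translates S (u ⊗ a)) (⊖ s)))) ⟩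
        sum (λ s → sum (λ c → (⟦ N (c ⊕ ⊖ s) ⟧ * ⟦ A s ⟧) * translates S (u ⊗ (c ⊕ ⊖ s)))) * ∣ R ∣ ≤⟨ ℕₚ.*-monoˡ-≤ ∣ R ∣ (∑-mono (λ s → ∑-mono (λ c → ℕₚ.*-monoˡ-≤ (translates S (u ⊗ (c ⊕ ⊖ s))) (⟦⟧*⟦⟧-mono {N (c ⊕ ⊖ s)} {A s} {A₂ c} {A s} (λ a b → subst (_∈ A₂) (a⊖b⊕b c s) (A+A⊆A₂ (proj₁ (h _ a)) b) , b))))) ⟩
        sum (λ s → sum (λ c → (⟦ A₂ c ⟧ * ⟦ A s ⟧) * translates S (u ⊗ (c ⊕ ⊖ s)))) * ∣ R ∣ ≡⟨ cong (_* ∣ R ∣) (trans (∑-swap (λ s c → (⟦ A₂ c ⟧ * ⟦ A s ⟧) * translates S (u ⊗ (c ⊕ ⊖ s)))) (sum-cong-≗ perC)) ⟩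
        sum (λ c → ⟦ A₂ c ⟧ * sum (λ y → ⟦ S y ⟧ * rep u A (y ⊕ ⊖ (u ⊗ c)))) * ∣ R ∣ ≡⟨ sym (∑-*ʳ ∣ R ∣ (λ c → ⟦ A₂ c ⟧ * sum (λ y → ⟦ S y ⟧ * rep u A (y ⊕ ⊖ (u ⊗ c))))) ⟩
        sum (λ c → ⟦ A₂ c ⟧ * sum (λ y → ⟦ S y ⟧ * rep u A (y ⊕ ⊖ (u ⊗ c))) * ∣ R ∣) ≤⟨ ∑-mono (λ c → ℕₚ.≤-trans (ℕₚ.≤-reflexive (trans (ℕₚ.*-assoc ⟦ A₂ c ⟧ _ ∣ R ∣) (cong (⟦ A₂ c ⟧ *_) (sym (∑-*ʳ ∣ R ∣ (λ y → ⟦ S y ⟧ * rep u A (y ⊕ ⊖ (u ⊗ c)))))))) (ℕₚ.*-monoʳ-≤ ⟦ A₂ c ⟧ (∑-mono (λ y → ℕₚ.≤-trans (ℕₚ.≤-reflexive (ℕₚ.*-assoc ⟦ S y ⟧ _ ∣ R ∣)) (ℕₚ.*-monoʳ-≤ ⟦ S y ⟧ (rep-bound (y ⊕ ⊖ (u ⊗ c)))))))) ⟩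
        sum (λ c → ⟦ A₂ c ⟧ * sum (λ y → ⟦ S y ⟧ * (∣ A₂ ∣ * ∣ A₂ ∣))) ≡⟨ trans (∑-*ʳ (sum (λ y → ⟦ S y ⟧ * (∣ A₂ ∣ * ∣ A₂ ∣))) (λ c → ⟦ A₂ c ⟧)) (cong (∣ A₂ ∣ *_) (∑-*ʳ (∣ A₂ ∣ * ∣ A₂ ∣) (λ y → ⟦ S y ⟧))) ⟩
        ∣ A₂ ∣ * (∣ S ∣ * (∣ A₂ ∣ * ∣ A₂ ∣)) ≡⟨ l₂ ∣ A₂ ∣ ∣ S ∣ (∣ A₂ ∣ * ∣ A₂ ∣) ⟩
        ∣ S ∣ * (∣ A₂ ∣ * (∣ A₂ ∣ * ∣ A₂ ∣)) ∎
        where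
        l₂ : ∀ a s b → a * (s * b) ≡ s * (a * b)
        l₂ = solve-∀
        l₃ : ∀ a s b → s * (a * b) ≡ a * (s * b)
        l₃ = solve-∀
        perC : ∀ c → sum (λ s → (⟦ A₂ c ⟧ * ⟦ A s ⟧) * translates S (u ⊗ (c ⊕ ⊖ s))) ≡ ⟦ A₂ c ⟧ * sum (λ y → ⟦ S y ⟧ * rep u A (y ⊕ ⊖ (u ⊗ c)))
        perC c = begin-equality
          sum (λ s → (⟦ A₂ c ⟧ * ⟦ A s ⟧) * translates S (u ⊗ (c ⊕ ⊖ s))) ≡⟨ trans (sum-cong-≗ (λ s → ℕₚ.*-assoc ⟦ A₂ c ⟧ ⟦ A s ⟧ _)) (∑-*ˡ ⟦ A₂ c ⟧ (λ s → ⟦ A s ⟧ * translates S (u ⊗ (c ⊕ ⊖ s)))) ⟩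
          ⟦ A₂ c ⟧ * sum (λ s → ⟦ A s ⟧ * translates S (u ⊗ (c ⊕ ⊖ s))) ≡⟨ cong (⟦ A₂ c ⟧ *_) (sum-cong-≗ (λ s → trans (cong (⟦ A s ⟧ *_) (translates≡ S (u ⊗ (c ⊕ ⊖ s)))) (sym (∑-*ˡ ⟦ A s ⟧ (λ y → ⟦ S y ⟧ * ⟦ A (y ⊕ ⊖ (u ⊗ (c ⊕ ⊖ s))) ⟧))))) ⟩
          ⟦ A₂ c ⟧ * sum (λ s → sum (λ y → ⟦ A s ⟧ * (⟦ S y ⟧ * ⟦ A (y ⊕ ⊖ (u ⊗ (c ⊕ ⊖ s))) ⟧))) ≡⟨ cong (⟦ A₂ c ⟧ *_) (trans (∑-swap (λ s y → ⟦ A s ⟧ * (⟦ S y ⟧ * ⟦ A (y ⊕ ⊖ (u ⊗ (c ⊕ ⊖ s))) ⟧))) (sum-cong-≗ (λ y → trans (sum-cong-≗ (λ s → trans (l₃ ⟦ S y ⟧ ⟦ A s ⟧ _) (cong (λ x → ⟦ S y ⟧ * (⟦ A s ⟧ * ⟦ A x ⟧)) (neg-shift y c s)))) (∑-*ˡ ⟦ S y ⟧ (λ s → ⟦ A s ⟧ * ⟦ A ((y ⊕ ⊖ (u ⊗ c)) ⊕ u ⊗ s) ⟧))))) ⟩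
          ⟦ A₂ c ⟧ * sum (λ y → ⟦ S y ⟧ * rep u A (y ⊕ ⊖ (u ⊗ c))) ∎

  energy : F → FSet → ℕ
  energy u A = sum (λ v → rep u A v * rep u A v)

  -- Cauchy-Schwarz for the ∣A∣² pairs distributed over A - uA: small energy forces a large
  -- difference set.
  energy-support : ∀ u A → (∣ A ∣ * ∣ A ∣) * (∣ A ∣ * ∣ A ∣) ≤ ∣ diff u A ∣ * energy u A
  energy-support u A = ℕₚ.≤-trans (ℕₚ.≤-reflexive (cong₂ _*_ (sym total) (sym total))) (cauchy-support (diff u A) (rep u A) supp)
    where
    total : sum (rep u A) ≡ ∣ A ∣ * ∣ A ∣
    total = trans (∑-swap (λ v s → ⟦ A s ⟧ * ⟦ A (v ⊕ u ⊗ s) ⟧)) (trans (sum-cong-≗ (λ s → trans (∑-*ˡ ⟦ A s ⟧ (λ v → ⟦ A (v ⊕ u ⊗ s) ⟧)) (cong (⟦ A s ⟧ *_) (∑-shift (λ v → ⟦ A v ⟧) (u ⊗ s))))) (∑-*ʳ ∣ A ∣ (λ s → ⟦ A s ⟧)))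
    supp : ∀ v → ¬ (v ∈ diff u A) → rep u A v ≡ 0
    supp v v∉ = trans (sum-cong-≗ pt) (∑-zero p)
      where
      pt : ∀ s → ⟦ A s ⟧ * ⟦ A (v ⊕ u ⊗ s) ⟧ ≡ 0
      pt s with A s in e₁ | A (v ⊕ u ⊗ s) in e₂
      ... | false | _ = refl
      ... | true | false = refl
      ... | true | true = ⊥-elim (v∉ (diff-intro u A v s e₁ e₂))

  -- For s ≠ s′ the collision v + us = t, v + us′ = t′ determines u, so summing over u costs nothing.
  energy-average : ∀ (U A : FSet) → sum (λ u → ⟦ U u ⟧ * energy u A) ≤ ∣ U ∣ * (∣ A ∣ * ∣ A ∣) + (∣ A ∣ * ∣ A ∣) * (∣ A ∣ * ∣ A ∣)
  energy-average U A = begin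
    sum (λ u → ⟦ U u ⟧ * energy u A) ≤⟨ ∑-mono perU ⟩
    sum (λ u → ⟦ U u ⟧ * (α * α) + off u) ≡⟨ ∑-distrib-+ (λ u → ⟦ U u ⟧ * (α * α)) off ⟩
    sum (λ u → ⟦ U u ⟧ * (α * α)) + sum off ≤⟨ ℕₚ.+-mono-≤ (ℕₚ.≤-reflexive (∑-*ʳ (α * α) (λ u → ⟦ U u ⟧))) offTotal ⟩
    ∣ U ∣ * (α * α) + (α * α) * (α * α) ∎
    where
    open ℕₚ.≤-Reasoning
    α = ∣ A ∣
    c : F → F → F → ℕ
    c u s s′ = sum (λ v → ⟦ A (v ⊕ u ⊗ s) ⟧ * ⟦ A (v ⊕ u ⊗ s′) ⟧)
    ne : F → F → ℕ
    ne s s′ = ⟦ not (does (s Finₚ.≟ s′)) ⟧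
    off : F → ℕ
    off u = sum (λ s → sum (λ s′ → (⟦ A s ⟧ * ⟦ A s′ ⟧) * (ne s s′ * c u s s′)))
    c≤α : ∀ u s s′ → c u s s′ ≤ α
    c≤α u s s′ = ℕₚ.≤-trans (∑-mono (λ v → ℕₚ.≤-trans (ℕₚ.*-monoʳ-≤ ⟦ A (v ⊕ u ⊗ s) ⟧ (⟦⟧≤1 _)) (ℕₚ.≤-reflexive (ℕₚ.*-identityʳ _)))) (ℕₚ.≤-reflexive (∑-shift (λ v → ⟦ A v ⟧) (u ⊗ s)))
    energy≡ : ∀ u → energy u A ≡ sum (λ s → sum (λ s′ → (⟦ A s ⟧ * ⟦ A s′ ⟧) * c u s s′))
    energy≡ u = begin-equality
      sum (λ v → rep u A v * rep u A v) ≡⟨ sum-cong-≗ (λ v → ∑*∑ (λ s → ⟦ A s ⟧ * ⟦ A (v ⊕ u ⊗ s) ⟧) (λ s → ⟦ A s ⟧ * ⟦ A (v ⊕ u ⊗ s) ⟧)) ⟩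
      sum (λ v → sum (λ s → sum (λ s′ → (⟦ A s ⟧ * ⟦ A (v ⊕ u ⊗ s) ⟧) * (⟦ A s′ ⟧ * ⟦ A (v ⊕ u ⊗ s′) ⟧)))) ≡⟨ ∑-swap _ ⟩
      sum (λ s → sum (λ v → sum (λ s′ → (⟦ A s ⟧ * ⟦ A (v ⊕ u ⊗ s) ⟧) * (⟦ A s′ ⟧ * ⟦ A (v ⊕ u ⊗ s′) ⟧)))) ≡⟨ sum-cong-≗ (λ s → trans (∑-swap (λ v s′ → (⟦ A s ⟧ * ⟦ A (v ⊕ u ⊗ s) ⟧) * (⟦ A s′ ⟧ * ⟦ A (v ⊕ u ⊗ s′) ⟧))) (sum-cong-≗ (λ s′ → trans (sum-cong-≗ (λ v → l₁ ⟦ A s ⟧ ⟦ A (v ⊕ u ⊗ s) ⟧ ⟦ A s′ ⟧ ⟦ A (v ⊕ u ⊗ s′) ⟧)) (∑-*ˡ (⟦ A s ⟧ * ⟦ A s′ ⟧) (λ v → ⟦ A (v ⊕ u ⊗ s) ⟧ * ⟦ A (v ⊕ u ⊗ s′) ⟧))))) ⟩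
      sum (λ s → sum (λ s′ → (⟦ A s ⟧ * ⟦ A s′ ⟧) * c u s s′)) ∎
      where
      l₁ : ∀ a b c d → (a * b) * (c * d) ≡ (a * c) * (b * d)
      l₁ = solve-∀
    pt : ∀ u s s′ → (⟦ A s ⟧ * ⟦ A s′ ⟧) * c u s s′ ≤ ⟦ does (s Finₚ.≟ s′) ⟧ * (⟦ A s′ ⟧ * α) + (⟦ A s ⟧ * ⟦ A s′ ⟧) * (ne s s′ * c u s s′)
    pt u s s′ with does (s Finₚ.≟ s′)
    ... | true = ℕₚ.≤-trans (ℕₚ.*-mono-≤ (ℕₚ.≤-trans (ℕₚ.*-monoˡ-≤ ⟦ A s′ ⟧ (⟦⟧≤1 (A s))) (ℕₚ.≤-reflexive (ℕₚ.*-identityˡ _))) (c≤α u s s′)) (ℕₚ.≤-trans (ℕₚ.≤-reflexive (sym (ℕₚ.+-identityʳ _))) (ℕₚ.m≤m+n _ _))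
    ... | false = ℕₚ.≤-reflexive (cong ((⟦ A s ⟧ * ⟦ A s′ ⟧) *_) (sym (ℕₚ.+-identityʳ (c u s s′))))
    diag : ∀ u → energy u A ≤ α * α + off u
    diag u = begin
      energy u A ≡⟨ energy≡ u ⟩
      sum (λ s → sum (λ s′ → (⟦ A s ⟧ * ⟦ A s′ ⟧) * c u s s′)) ≤⟨ ∑-mono (λ s → ∑-mono (pt u s)) ⟩
      sum (λ s → sum (λ s′ → ⟦ does (s Finₚ.≟ s′) ⟧ * (⟦ A s′ ⟧ * α) + (⟦ A s ⟧ * ⟦ A s′ ⟧) * (ne s s′ * c u s s′))) ≡⟨ sum-cong-≗ (λ s → trans (∑-distrib-+ (λ s′ → ⟦ does (s Finₚ.≟ s′) ⟧ * (⟦ A s′ ⟧ * α)) (λ s′ → (⟦ A s ⟧ * ⟦ A s′ ⟧) * (ne s s′ * c u s s′))) (cong (_+ sum (λ s′ → (⟦ A s ⟧ * ⟦ A s′ ⟧) * (ne s s′ * c u s s′))) (∑-pick s (λ s′ → ⟦ A s′ ⟧ * α)))) ⟩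
      sum (λ s → ⟦ A s ⟧ * α + sum (λ s′ → (⟦ A s ⟧ * ⟦ A s′ ⟧) * (ne s s′ * c u s s′))) ≡⟨ ∑-distrib-+ (λ s → ⟦ A s ⟧ * α) _ ⟩
      sum (λ s → ⟦ A s ⟧ * α) + off u ≡⟨ cong (_+ off u) (∑-*ʳ α (λ s → ⟦ A s ⟧)) ⟩
      α * α + off u ∎
    perU : ∀ u → ⟦ U u ⟧ * energy u A ≤ ⟦ U u ⟧ * (α * α) + off u
    perU u with U u
    ... | false = z≤n
    ... | true = ℕₚ.≤-trans (ℕₚ.≤-reflexive (ℕₚ.+-identityʳ _)) (ℕₚ.≤-trans (diag u) (ℕₚ.≤-reflexive (cong (_+ off u) (sym (ℕₚ.+-identityʳ (α * α))))))
    ∑c : ∀ s s′ → s ≢ s′ → sum (λ u → c u s s′) ≡ α * α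
    ∑c s s′ s≢s′ = begin-equality
      sum (λ u → c u s s′) ≡⟨ sum-cong-≗ (λ u → trans (sum-cong-≗ (λ v → cong (λ x → ⟦ A (v ⊕ u ⊗ s) ⟧ * ⟦ A x ⟧) (re u v))) (∑-shift (λ t → ⟦ A t ⟧ * ⟦ A (t ⊕ u ⊗ (s′ ⊕ ⊖ s)) ⟧) (u ⊗ s))) ⟩
      sum (λ u → sum (λ t → ⟦ A t ⟧ * ⟦ A (t ⊕ u ⊗ (s′ ⊕ ⊖ s)) ⟧)) ≡⟨ ∑-swap _ ⟩
      sum (λ t → sum (λ u → ⟦ A t ⟧ * ⟦ A (t ⊕ u ⊗ (s′ ⊕ ⊖ s)) ⟧)) ≡⟨ sum-cong-≗ (λ t → trans (∑-*ˡ ⟦ A t ⟧ (λ u → ⟦ A (t ⊕ u ⊗ (s′ ⊕ ⊖ s)) ⟧)) (cong (⟦ A t ⟧ *_) (trans (∑-dilate (λ x → ⟦ A (t ⊕ x) ⟧) (λ z → s≢s′ (sym (a⊖b≡0⇒a≡b z)))) (∑-shift′ (λ x → ⟦ A x ⟧) t)))) ⟩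
      sum (λ t → ⟦ A t ⟧ * α) ≡⟨ ∑-*ʳ α (λ t → ⟦ A t ⟧) ⟩
      α * α ∎
      where
      re : ∀ u v → v ⊕ u ⊗ s′ ≡ (v ⊕ u ⊗ s) ⊕ u ⊗ (s′ ⊕ ⊖ s)
      re u v = trans (cong (v ⊕_) (trans (cong (u ⊗_) (trans (sym (a⊖b⊕b s′ s)) (⊕-comm _ s))) (⊗-distribˡ u s _))) (sym (⊕-assoc v _ _))
    offTotal : sum off ≤ (α * α) * (α * α)
    offTotal = begin
      sum off ≡⟨ trans (∑-swap (λ u s → sum (λ s′ → (⟦ A s ⟧ * ⟦ A s′ ⟧) * (ne s s′ * c u s s′)))) (sum-cong-≗ (λ s → ∑-swap (λ u s′ → (⟦ A s ⟧ * ⟦ A s′ ⟧) * (ne s s′ * c u s s′)))) ⟩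
      sum (λ s → sum (λ s′ → sum (λ u → (⟦ A s ⟧ * ⟦ A s′ ⟧) * (ne s s′ * c u s s′)))) ≤⟨ ∑-mono (λ s → ∑-mono (λ s′ → ℕₚ.≤-trans (ℕₚ.≤-reflexive (∑-*ˡ (⟦ A s ⟧ * ⟦ A s′ ⟧) (λ u → ne s s′ * c u s s′))) (ℕₚ.*-monoʳ-≤ (⟦ A s ⟧ * ⟦ A s′ ⟧) (inner s s′)))) ⟩
      sum (λ s → sum (λ s′ → (⟦ A s ⟧ * ⟦ A s′ ⟧) * (α * α))) ≡⟨ trans (sum-cong-≗ (λ s → ∑-*ʳ (α * α) (λ s′ → ⟦ A s ⟧ * ⟦ A s′ ⟧))) (∑-*ʳ (α * α) (λ s → sum (λ s′ → ⟦ A s ⟧ * ⟦ A s′ ⟧))) ⟩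
      sum (λ s → sum (λ s′ → ⟦ A s ⟧ * ⟦ A s′ ⟧)) * (α * α) ≡⟨ cong (_* (α * α)) (sym (∑*∑ (λ s → ⟦ A s ⟧) (λ s → ⟦ A s ⟧))) ⟩
      (α * α) * (α * α) ∎
      where
      inner : ∀ s s′ → sum (λ u → ne s s′ * c u s s′) ≤ α * α
      inner s s′ with s Finₚ.≟ s′
      ... | yes _ = ℕₚ.≤-trans (ℕₚ.≤-reflexive (∑-zero p)) z≤n
      ... | no s≢s′ = ℕₚ.≤-reflexive (trans (sum-cong-≗ (λ u → ℕₚ.+-identityʳ (c u s s′))) (∑c s s′ s≢s′))

-- Almost invariant sets and their ratios.

module AlmostInvariance (n : ℕ) (pr : Prime (suc n)) where

  open FiniteSums
  open Trees using (∑-pick′)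
  open Fp n pr
  open Sumset n pr

  escape : FSet → F → ℕ
  escape S a = ∣ (λ x → S x ∧ not (S (x ⊕ a))) ∣

  ∧-not : ∀ b → ⟦ b ∧ not b ⟧ ≡ 0
  ∧-not true = refl
  ∧-not false = refl

  escape-𝟘 : ∀ S → escape S 𝟘 ≡ 0
  escape-𝟘 S = trans (sum-cong-≗ (λ x → trans (cong (λ y → ⟦ S x ∧ not (S y) ⟧) (⊕-identityʳ x)) (∧-not (S x)))) (∑-zero p)

  -- A point that leaves `S` under `a ⊕ b` leaves it in the first or in the second step.
  -- Subadditivity lets almost invariance under `X` pass to `j · X` with a loss linear in `j`.
  escape-⊕ : ∀ S a b → escape S (a ⊕ b) ≤ escape S a + escape S b
  escape-⊕ S a b = begin
    escape S (a ⊕ b) ≤⟨ ∑-mono pt ⟩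
    sum (λ x → ⟦ S x ∧ not (S (x ⊕ a)) ⟧ + ⟦ S (x ⊕ a) ∧ not (S ((x ⊕ a) ⊕ b)) ⟧) ≡⟨ ∑-distrib-+ (λ x → ⟦ S x ∧ not (S (x ⊕ a)) ⟧) _ ⟩
    escape S a + sum (λ x → ⟦ S (x ⊕ a) ∧ not (S ((x ⊕ a) ⊕ b)) ⟧) ≡⟨ cong (escape S a +_) (∑-shift (λ y → ⟦ S y ∧ not (S (y ⊕ b)) ⟧) a) ⟩
    escape S a + escape S b ∎
    where
    open ℕₚ.≤-Reasoning
    triangle : ∀ s m e → ⟦ s ∧ not e ⟧ ≤ ⟦ s ∧ not m ⟧ + ⟦ m ∧ not e ⟧
    triangle false m e = z≤n
    triangle true true e = ℕₚ.≤-refl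
    triangle true false e = ℕₚ.≤-trans (⟦⟧≤1 (not e)) (ℕₚ.m≤m+n 1 0)
    pt : ∀ x → ⟦ S x ∧ not (S (x ⊕ (a ⊕ b))) ⟧ ≤ ⟦ S x ∧ not (S (x ⊕ a)) ⟧ + ⟦ S (x ⊕ a) ∧ not (S ((x ⊕ a) ⊕ b)) ⟧
    pt x = subst (λ y → ⟦ S x ∧ not (S y) ⟧ ≤ ⟦ S x ∧ not (S (x ⊕ a)) ⟧ + ⟦ S (x ⊕ a) ∧ not (S ((x ⊕ a) ⊕ b)) ⟧) (⊕-assoc x a b) (triangle (S x) (S (x ⊕ a)) (S ((x ⊕ a) ⊕ b)))

  escape-multiple : ∀ S a k → escape S ([ k ] ⊗ a) ≤ k * escape S a
  escape-multiple S a zero = ℕₚ.≤-reflexive (trans (cong (escape S) (trans (cong (_⊗ a) [0]) (⊗-zeroˡ a))) (escape-𝟘 S))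
  escape-multiple S a (suc k) = ℕₚ.≤-trans (ℕₚ.≤-reflexive (cong (escape S) (trans (cong (_⊗ a) ([]-+ 1 k)) (trans (⊗-distribʳ a 𝟙 [ k ]) (cong (_⊕ [ k ] ⊗ a) (⊗-identityˡ a))))))
    (ℕₚ.≤-trans (escape-⊕ S a ([ k ] ⊗ a)) (ℕₚ.+-monoʳ-≤ (escape S a) (escape-multiple S a k)))

  escape-· : ∀ S X t → (∀ x → x ∈ X → t * escape S x ≤ ∣ S ∣) → ∀ j a → a ∈ j · X → t * escape S a ≤ j * ∣ S ∣
  escape-· S X t h zero a a∈ = ℕₚ.≤-reflexive (trans (cong (λ b → t * escape S b) (∈⁅𝟘⁆ a∈)) (trans (cong (t *_) (escape-𝟘 S)) (ℕₚ.*-zeroʳ t)))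
  escape-· S X t h (suc j) a a∈ with ⊞-elim {X} {j · X} a∈
  ... | b , c , b∈ , c∈ , refl = ℕₚ.≤-trans (ℕₚ.*-monoʳ-≤ t (escape-⊕ S b c)) (ℕₚ.≤-trans (ℕₚ.≤-reflexive (ℕₚ.*-distribˡ-+ t _ _)) (ℕₚ.+-mono-≤ (h b b∈) (escape-· S X t h j c c∈)))

  ·-mono : ∀ {j l X} → 𝟘 ∈ X → j ≤ l → j · X ⊆ l · X
  ·-mono {j} {l} {X} 𝟘∈ j≤l x x∈ with ℕₚ.m≤n⇒∃[o]m+o≡n j≤l
  ... | o , refl = subst (_∈ (j + o) · X) (⊕-identityʳ x) (·-+ j o x∈ (𝟘∈· o 𝟘∈))

  module Ratios (S X : FSet) (𝟘∈X : 𝟘 ∈ X) (t : ℕ) (0<t : 0 < t) (inv-X : ∀ x → x ∈ X → t * escape S x ≤ ∣ S ∣) (0<S : 0 < ∣ S ∣)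
    (B i k : ℕ) (small : 2 * (2 + B * B) * (k * i) ≤ t) (2≤Aᵢ : 2 ≤ ∣ i · X ∣) (0<k : 0 < k) where

    ℓ = k * i
    A A₂ Aᵢ : FSet
    A = ℓ · X
    A₂ = (ℓ + ℓ) · X
    Aᵢ = i · X

    A+A⊆A₂ : ∀ {x y} → x ∈ A → y ∈ A → x ⊕ y ∈ A₂
    A+A⊆A₂ = ·-+ ℓ ℓ

    val : Fin B → F
    val b = [ toℕ b ]

    progression : F → FSet
    progression a x = does (Finₚ.all? (λ b → member? S (x ⊕ val b ⊗ a)))

    translates : F → ℕ
    translates x = sum (λ t → ⟦ A t ⟧ * ⟦ S (x ⊕ t) ⟧)

    -- At least half of the translate x + A lies in `S`; this is the abundance that `fibre-bound`
    -- consumes.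
    good : FSet
    good x = does (∣ A ∣ ≤? 2 * translates x)

    G : F → FSet
    G a x = (S x ∧ progression a x) ∧ good x

    progression-fails : ∀ a → ∣ (λ x → S x ∧ not (progression a x)) ∣ ≤ B * (B * escape S a)
    progression-fails a = begin
      ∣ (λ x → S x ∧ not (progression a x)) ∣ ≤⟨ ∑-mono pt ⟩
      sum (λ x → sum (λ b → ⟦ S x ∧ not (S (x ⊕ val b ⊗ a)) ⟧)) ≡⟨ ∑-swap (λ x b → ⟦ S x ∧ not (S (x ⊕ val b ⊗ a)) ⟧) ⟩
      sum (λ b → escape S (val b ⊗ a)) ≤⟨ ∑-bound (λ b → ℕₚ.≤-trans (escape-multiple S a (toℕ b)) (ℕₚ.*-monoˡ-≤ (escape S a) (ℕₚ.<⇒≤ (Finₚ.toℕ<n b)))) ⟩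
      B * (B * escape S a) ∎
      where
      open ℕₚ.≤-Reasoning
      pt : ∀ x → ⟦ S x ∧ not (progression a x) ⟧ ≤ sum (λ b → ⟦ S x ∧ not (S (x ⊕ val b ⊗ a)) ⟧)
      pt x with S x | progression a x in eq
      ... | false | _ = z≤n
      ... | true | true = z≤n
      ... | true | false with Finₚ.any? (λ b → ¬? (member? S (x ⊕ val b ⊗ a)))
      ...   | no none = ⊥-elim (false-dec (Finₚ.all? (λ b → member? S (x ⊕ val b ⊗ a))) eq (λ b → dne (S (x ⊕ val b ⊗ a)) (λ h → none (b , h))))
        where
        dne : ∀ c → ¬ (c ≢ true) → c ≡ true
        dne true _ = refl
        dne false h = ⊥-elim (h (λ ()))
      ...   | yes (b , ne) = ℕₚ.≤-trans (ℕₚ.≤-reflexive (sym (cong (λ c → ⟦ not c ⟧) (Bool-false (S (x ⊕ val b ⊗ a)) ne)))) (∑-≥ (λ b → ⟦ not (S (x ⊕ val b ⊗ a)) ⟧) b)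
        where
        Bool-false : ∀ c → c ≢ true → c ≡ false
        Bool-false true h = ⊥-elim (h refl)
        Bool-false false _ = refl

    α = ∣ A ∣

    0<α : 0 < α
    0<α = ∣∣-pos {A = A} 𝟘 (𝟘∈· ℓ 𝟘∈X)

    -- Markov's inequality for the escapes summed over `A`: a point of `S` that is not good is moved
    -- out of `S` by more than half of `A`.
    good-fails : t * ∣ (λ x → S x ∧ not (good x)) ∣ ≤ 2 * (ℓ * ∣ S ∣)
    good-fails = ℕₚ.*-cancelˡ-≤ α {{ℕ.>-nonZero 0<α}} (begin
      α * (t * ∣ (λ x → S x ∧ not (good x)) ∣) ≡⟨ l₁ α t _ ⟩
      t * (α * ∣ (λ x → S x ∧ not (good x)) ∣) ≡⟨ cong (t *_) (sym (∑-*ˡ α (λ x → ⟦ S x ∧ not (good x) ⟧))) ⟩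
      t * sum (λ x → α * ⟦ S x ∧ not (good x) ⟧) ≤⟨ ℕₚ.*-monoʳ-≤ t (∑-mono pt) ⟩
      t * sum (λ x → 2 * sum (λ s → ⟦ A s ⟧ * ⟦ S x ∧ not (S (x ⊕ s)) ⟧)) ≡⟨ cong (t *_) (trans (∑-*ˡ 2 (λ x → sum (λ s → ⟦ A s ⟧ * ⟦ S x ∧ not (S (x ⊕ s)) ⟧))) (cong (2 *_) (trans (∑-swap (λ x s → ⟦ A s ⟧ * ⟦ S x ∧ not (S (x ⊕ s)) ⟧)) (sum-cong-≗ (λ s → ∑-*ˡ ⟦ A s ⟧ (λ x → ⟦ S x ∧ not (S (x ⊕ s)) ⟧)))))) ⟩
      t * (2 * sum (λ s → ⟦ A s ⟧ * escape S s)) ≡⟨ l₂ t _ ⟩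
      2 * (t * sum (λ s → ⟦ A s ⟧ * escape S s)) ≡⟨ cong (2 *_) (sym (∑-*ˡ t (λ s → ⟦ A s ⟧ * escape S s))) ⟩
      2 * sum (λ s → t * (⟦ A s ⟧ * escape S s)) ≤⟨ ℕₚ.*-monoʳ-≤ 2 (∑-mono (λ s → ℕₚ.≤-trans (ℕₚ.≤-reflexive (l₁ t ⟦ A s ⟧ (escape S s))) (⟦⟧*-≤ (A s) {t * escape S s} {ℓ * ∣ S ∣} (λ s∈ → escape-· S X t inv-X ℓ s s∈)))) ⟩
      2 * sum (λ s → ⟦ A s ⟧ * (ℓ * ∣ S ∣)) ≡⟨ cong (2 *_) (∑-*ʳ (ℓ * ∣ S ∣) (λ s → ⟦ A s ⟧)) ⟩
      2 * (α * (ℓ * ∣ S ∣)) ≡⟨ l₁ 2 α (ℓ * ∣ S ∣) ⟩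
      α * (2 * (ℓ * ∣ S ∣)) ∎)
      where
      open ℕₚ.≤-Reasoning
      l₁ : ∀ a t x → a * (t * x) ≡ t * (a * x)
      l₁ = solve-∀
      l₂ : ∀ t x → t * (2 * x) ≡ 2 * (t * x)
      l₂ = solve-∀
      l₃ : ∀ a b → 2 * (a + b) ≡ 2 * b + 2 * a
      l₃ = solve-∀
      pt : ∀ x → α * ⟦ S x ∧ not (good x) ⟧ ≤ 2 * sum (λ s → ⟦ A s ⟧ * ⟦ S x ∧ not (S (x ⊕ s)) ⟧)
      pt x with S x | good x in eq
      ... | false | _ = ℕₚ.≤-trans (ℕₚ.≤-reflexive (ℕₚ.*-zeroʳ α)) z≤n
      ... | true | true = ℕₚ.≤-trans (ℕₚ.≤-reflexive (ℕₚ.*-zeroʳ α)) z≤n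
      ... | true | false = ℕₚ.+-cancelʳ-≤ α _ _ (begin
        α * 1 + α ≡⟨ trans (cong (_+ α) (ℕₚ.*-identityʳ α)) (cong (α +_) (sym (ℕₚ.+-identityʳ α))) ⟩
        2 * α ≡⟨ cong (2 *_) (trans (sum-cong-≗ (λ s → splitA (A s) (S (x ⊕ s)))) (∑-distrib-+ (λ s → ⟦ A s ⟧ * ⟦ S (x ⊕ s) ⟧) (λ s → ⟦ A s ⟧ * ⟦ not (S (x ⊕ s)) ⟧))) ⟩
        2 * (translates x + sum (λ s → ⟦ A s ⟧ * ⟦ not (S (x ⊕ s)) ⟧)) ≡⟨ l₃ (translates x) _ ⟩
        2 * sum (λ s → ⟦ A s ⟧ * ⟦ not (S (x ⊕ s)) ⟧) + 2 * translates x ≤⟨ ℕₚ.+-monoʳ-≤ _ (ℕₚ.<⇒≤ (ℕₚ.≰⇒> (false-dec (∣ A ∣ ≤? 2 * translates x) eq))) ⟩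
        2 * sum (λ s → ⟦ A s ⟧ * ⟦ not (S (x ⊕ s)) ⟧) + α ∎)
        where
        splitA : ∀ a b → ⟦ a ⟧ ≡ ⟦ a ⟧ * ⟦ b ⟧ + ⟦ a ⟧ * ⟦ not b ⟧
        splitA true true = refl
        splitA true false = refl
        splitA false b = refl

    -- The two kinds of failure reject at most (B² + 2)ℓ/t of `S`, and `small` makes this at most
    -- one half.
    G-large : ∀ a → a ∈ A → ∣ S ∣ ≤ 2 * ∣ G a ∣
    G-large a a∈ = ℕₚ.*-cancelˡ-≤ t {{ℕ.>-nonZero 0<t}} (ℕₚ.+-cancelʳ-≤ (t * ∣ S ∣) _ _ (begin
      t * ∣ S ∣ + t * ∣ S ∣ ≡⟨ l₁ t ∣ S ∣ ⟩
      2 * (t * ∣ S ∣) ≤⟨ ℕₚ.*-monoʳ-≤ 2 (ℕₚ.*-monoʳ-≤ t cover) ⟩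
      2 * (t * (∣ G a ∣ + P + Q)) ≡⟨ l₂ t ∣ G a ∣ P Q ⟩
      t * (2 * ∣ G a ∣) + 2 * (t * P + t * Q) ≤⟨ ℕₚ.+-monoʳ-≤ (t * (2 * ∣ G a ∣)) (ℕₚ.*-monoʳ-≤ 2 (ℕₚ.+-mono-≤ tP good-fails)) ⟩
      t * (2 * ∣ G a ∣) + 2 * (B * B * (ℓ * ∣ S ∣) + 2 * (ℓ * ∣ S ∣)) ≡⟨ cong (t * (2 * ∣ G a ∣) +_) (l₃ B ℓ ∣ S ∣) ⟩
      t * (2 * ∣ G a ∣) + 2 * (2 + B * B) * ℓ * ∣ S ∣ ≤⟨ ℕₚ.+-monoʳ-≤ (t * (2 * ∣ G a ∣)) (ℕₚ.*-monoˡ-≤ ∣ S ∣ small) ⟩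
      t * (2 * ∣ G a ∣) + t * ∣ S ∣ ∎))
      where
      open ℕₚ.≤-Reasoning
      P = ∣ (λ x → S x ∧ not (progression a x)) ∣
      Q = ∣ (λ x → S x ∧ not (good x)) ∣
      l₁ : ∀ t s → t * s + t * s ≡ 2 * (t * s)
      l₁ = solve-∀
      l₂ : ∀ t g p q → 2 * (t * (g + p + q)) ≡ t * (2 * g) + 2 * (t * p + t * q)
      l₂ = solve-∀
      l₃ : ∀ b l s → 2 * (b * b * (l * s) + 2 * (l * s)) ≡ 2 * (2 + b * b) * l * s
      l₃ = solve-∀
      l₄ : ∀ t b e → t * (b * (b * e)) ≡ b * b * (t * e)
      l₄ = solve-∀
      tP : t * P ≤ B * B * (ℓ * ∣ S ∣)
      tP = ℕₚ.≤-trans (ℕₚ.*-monoʳ-≤ t (progression-fails a)) (ℕₚ.≤-trans (ℕₚ.≤-reflexive (l₄ t B (escape S a))) (ℕₚ.*-monoʳ-≤ (B * B) (escape-· S X t inv-X ℓ a a∈)))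
      bool : ∀ s p g → ⟦ s ⟧ ≤ ⟦ (s ∧ p) ∧ g ⟧ + ⟦ s ∧ not p ⟧ + ⟦ s ∧ not g ⟧
      bool false p g = z≤n
      bool true true true = s≤s z≤n
      bool true true false = s≤s z≤n
      bool true false g = s≤s z≤n
      cover : ∣ S ∣ ≤ ∣ G a ∣ + P + Q
      cover = ℕₚ.≤-trans (∑-mono (λ x → bool (S x) (progression a x) (good x))) (ℕₚ.≤-reflexive (trans (∑-distrib-+ (λ x → ⟦ G a x ⟧ + ⟦ S x ∧ not (progression a x) ⟧) _) (cong (_+ Q) (∑-distrib-+ (λ x → ⟦ G a x ⟧) _))))

    A⁺ : FSet
    A⁺ a = A a ∧ not (does (a Finₚ.≟ 𝟘))

    N : F → FSet
    N u a = A⁺ a ∧ G a (u ⊗ a)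

    A⁺-nonzero : ∀ {a} → a ∈ A⁺ → a ≢ 𝟘
    A⁺-nonzero {a} h refl = false≢true (trans (sym (trans (cong (λ c → A a ∧ not c) (dec-true (a Finₚ.≟ 𝟘) refl)) (∧-false (A a)))) h)
      where
      ∧-false : ∀ c → c ∧ false ≡ false
      ∧-false true = refl
      ∧-false false = refl

    Aᵢ⊆A : Aᵢ ⊆ A
    Aᵢ⊆A = ·-mono 𝟘∈X (ℕₚ.≤-trans (ℕₚ.≤-reflexive (sym (ℕₚ.*-identityˡ i))) (ℕₚ.*-monoˡ-≤ i 0<k))

    -- One factor 2 pays for discarding a = 0, the other for `G-large`. For a ≠ 0 every x is ua for
    -- exactly one u.
    total-ratios : α * ∣ S ∣ ≤ 4 * sum (λ u → ∣ N u ∣)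
    total-ratios = begin
      α * ∣ S ∣ ≤⟨ ℕₚ.*-monoˡ-≤ ∣ S ∣ α≤ ⟩
      2 * ∣ A⁺ ∣ * ∣ S ∣ ≡⟨ trans (ℕₚ.*-assoc 2 ∣ A⁺ ∣ ∣ S ∣) (cong (2 *_) (sym (∑-*ʳ ∣ S ∣ (λ a → ⟦ A⁺ a ⟧)))) ⟩
      2 * sum (λ a → ⟦ A⁺ a ⟧ * ∣ S ∣) ≤⟨ ℕₚ.*-monoʳ-≤ 2 (∑-mono (λ a → ⟦⟧*-≤ (A⁺ a) {∣ S ∣} {2 * ∣ G a ∣} (λ h → G-large a (∧-elimˡ h)))) ⟩
      2 * sum (λ a → ⟦ A⁺ a ⟧ * (2 * ∣ G a ∣)) ≡⟨ cong (2 *_) (trans (sum-cong-≗ (λ a → l₁ ⟦ A⁺ a ⟧ ∣ G a ∣)) (∑-*ˡ 2 (λ a → ⟦ A⁺ a ⟧ * ∣ G a ∣))) ⟩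
      2 * (2 * sum (λ a → ⟦ A⁺ a ⟧ * ∣ G a ∣)) ≡⟨ sym (ℕₚ.*-assoc 2 2 (sum (λ a → ⟦ A⁺ a ⟧ * ∣ G a ∣))) ⟩
      4 * sum (λ a → ⟦ A⁺ a ⟧ * ∣ G a ∣) ≡⟨ cong (4 *_) (sym count) ⟩
      4 * sum (λ u → ∣ N u ∣) ∎
      where
      open ℕₚ.≤-Reasoning
      l₁ : ∀ a g → a * (2 * g) ≡ 2 * (a * g)
      l₁ = solve-∀
      α≤1+ : α ≤ 1 + ∣ A⁺ ∣
      α≤1+ = ℕₚ.≤-trans (∑-mono (λ a → bool (A a) (does (a Finₚ.≟ 𝟘)))) (ℕₚ.≤-reflexive (trans (∑-distrib-+ (λ a → ⟦ does (a Finₚ.≟ 𝟘) ⟧) (λ a → ⟦ A⁺ a ⟧)) (cong (_+ ∣ A⁺ ∣) (∑-pick′ 𝟘))))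
        where
        bool : ∀ a z → ⟦ a ⟧ ≤ ⟦ z ⟧ + ⟦ a ∧ not z ⟧
        bool false z = z≤n
        bool true true = s≤s z≤n
        bool true false = s≤s z≤n
      1≤A⁺ : 1 ≤ ∣ A⁺ ∣
      1≤A⁺ = ℕₚ.≤-pred (ℕₚ.≤-trans (ℕₚ.≤-trans 2≤Aᵢ (∣∣-mono Aᵢ⊆A)) α≤1+)
      α≤ : α ≤ 2 * ∣ A⁺ ∣
      α≤ = ℕₚ.≤-trans α≤1+ (ℕₚ.≤-trans (ℕₚ.+-monoˡ-≤ ∣ A⁺ ∣ 1≤A⁺) (ℕₚ.≤-reflexive (cong (∣ A⁺ ∣ +_) (sym (ℕₚ.+-identityʳ _)))))
      count : sum (λ u → ∣ N u ∣) ≡ sum (λ a → ⟦ A⁺ a ⟧ * ∣ G a ∣)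
      count = trans (∑-swap (λ u a → ⟦ N u a ⟧)) (sum-cong-≗ per)
        where
        per : ∀ a → sum (λ u → ⟦ N u a ⟧) ≡ ⟦ A⁺ a ⟧ * ∣ G a ∣
        per a with A⁺ a in eq
        ... | false = ∑-zero p
        ... | true = trans (∑-dilate (λ x → ⟦ G a x ⟧) (A⁺-nonzero {a} eq)) (sym (ℕₚ.+-identityʳ _))

    α₄ = (∣ Aᵢ ∣ * ∣ Aᵢ ∣) * (∣ Aᵢ ∣ * ∣ Aᵢ ∣)

    -- Divided by p k α₄ the weight is 1/p + 2E/(k α₄), E being the energy. This bounds 1/∣A - uA∣
    -- in both outcomes of Cauchy-Davenport, the full field or growth by k/2, and it is linear in E,
    -- so it can be averaged over `u`.
    weight : F → ℕ
    weight u = k * α₄ + 2 * (p * energy u Aᵢ)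

    diff-large : ∀ u → p * (k * α₄) ≤ ∣ diff u A ∣ * weight u
    diff-large u with iterated-growth k Q 𝟘∈Q 2≤Q
      where
      Q = diff u Aᵢ
      Aᵢ⊆Q : Aᵢ ⊆ Q
      Aᵢ⊆Q v v∈ = diff-intro u Aᵢ v 𝟘 (𝟘∈· i 𝟘∈X) (subst (_∈ Aᵢ) (sym (trans (cong (v ⊕_) (⊗-zeroʳ u)) (⊕-identityʳ v))) v∈)
      𝟘∈Q : 𝟘 ∈ Q
      𝟘∈Q = Aᵢ⊆Q 𝟘 (𝟘∈· i 𝟘∈X)
      2≤Q : 2 ≤ ∣ Q ∣
      2≤Q = ℕₚ.≤-trans 2≤Aᵢ (∣∣-mono Aᵢ⊆Q)
    ... | inj₁ h = ℕₚ.*-mono-≤ (ℕₚ.≤-trans h (∣∣-mono (·-diff k i u {X}))) (ℕₚ.m≤m+n (k * α₄) _)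
    ... | inj₂ h = begin
      p * (k * α₄) ≤⟨ ℕₚ.*-monoʳ-≤ p (ℕₚ.*-monoʳ-≤ k (energy-support u Aᵢ)) ⟩
      p * (k * (∣ diff u Aᵢ ∣ * energy u Aᵢ)) ≡⟨ cong (p *_) (sym (ℕₚ.*-assoc k _ _)) ⟩
      p * (k * ∣ diff u Aᵢ ∣ * energy u Aᵢ) ≤⟨ ℕₚ.*-monoʳ-≤ p (ℕₚ.*-monoˡ-≤ (energy u Aᵢ) (ℕₚ.≤-trans h (ℕₚ.*-monoʳ-≤ 2 (∣∣-mono (·-diff k i u {X}))))) ⟩
      p * (2 * ∣ diff u A ∣ * energy u Aᵢ) ≡⟨ l₁ p ∣ diff u A ∣ (energy u Aᵢ) ⟩
      ∣ diff u A ∣ * (2 * (p * energy u Aᵢ)) ≤⟨ ℕₚ.*-monoʳ-≤ ∣ diff u A ∣ (ℕₚ.m≤n+m _ (k * α₄)) ⟩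
      ∣ diff u A ∣ * weight u ∎
      where
      open ℕₚ.≤-Reasoning
      l₁ : ∀ p r e → p * (2 * r * e) ≡ r * (2 * (p * e))
      l₁ = solve-∀

    private
      α₂³ = ∣ A₂ ∣ * (∣ A₂ ∣ * ∣ A₂ ∣)

    fibre : ∀ u → ∣ N u ∣ * ((α * α) * (p * (k * α₄))) ≤ 2 * (∣ S ∣ * α₂³) * weight u
    fibre u = begin
      ∣ N u ∣ * ((α * α) * (p * (k * α₄))) ≡⟨ sym (ℕₚ.*-assoc ∣ N u ∣ (α * α) _) ⟩
      ∣ N u ∣ * (α * α) * (p * (k * α₄)) ≤⟨ ℕₚ.*-monoʳ-≤ (∣ N u ∣ * (α * α)) (diff-large u) ⟩
      ∣ N u ∣ * (α * α) * (∣ diff u A ∣ * weight u) ≡⟨ sym (ℕₚ.*-assoc (∣ N u ∣ * (α * α)) _ _) ⟩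
      ∣ N u ∣ * (α * α) * ∣ diff u A ∣ * weight u ≤⟨ ℕₚ.*-monoˡ-≤ (weight u) (Packing.fibre-bound u A A₂ A+A⊆A₂ S (N u) N-good) ⟩
      2 * (∣ S ∣ * α₂³) * weight u ∎
      where
      open ℕₚ.≤-Reasoning
      N-good : ∀ a → a ∈ N u → a ∈ A × ∣ A ∣ ≤ 2 * Packing.translates u A A₂ A+A⊆A₂ S (u ⊗ a)
      N-good a h = ∧-elimˡ (∧-elimˡ {A⁺ a} h) , true-dec (∣ A ∣ ≤? 2 * translates (u ⊗ a)) (∧-elimʳ {S (u ⊗ a) ∧ progression a (u ⊗ a)} (∧-elimʳ {A⁺ a} h))

    -- Summing `fibre` over `U` compares `M` with 8z³ times the total weight, z³ being the cube of
    -- the doubling constant. The conditions `h₁`, `h₂`, `h₃` make each of the three resulting terms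
    -- at most M/4. The third term is the α₄ in `energy-average`, present however small `U` is; only
    -- the gain `k` defeats it.
    contradiction : ∀ (U : FSet) Z z → (∀ u a → a ≢ 𝟘 → (∀ b → u ⊗ a ⊕ val b ⊗ a ∈ S) → u ∈ U) → ∣ U ∣ ≤ Z →
      ∣ A₂ ∣ ≤ z * α → 32 * (z * z * z) * Z ≤ p → 64 * (z * z * z) * Z ≤ k * (∣ Aᵢ ∣ * ∣ Aᵢ ∣) → 64 * (z * z * z) ≤ k → ⊥
    contradiction U Z z captures ∣U∣≤Z doubling h₁ h₂ h₃ = ℕₚ.<-irrefl refl (ℕₚ.<-≤-trans 3<4 4≤3)
      where
      open ℕₚ.≤-Reasoning
      z³ = z * z * z
      a₂ = ∣ Aᵢ ∣ * ∣ Aᵢ ∣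
      M = p * (k * α₄)
      0<M : 0 < M
      0<M = ℕₚ.*-mono-< {0} {p} {0} {k * α₄} (s≤s z≤n) (ℕₚ.*-mono-< 0<k (ℕₚ.*-mono-< (ℕₚ.*-mono-< pos pos) (ℕₚ.*-mono-< pos pos)))
        where
        pos : 0 < ∣ Aᵢ ∣
        pos = ℕₚ.≤-trans (s≤s z≤n) 2≤Aᵢ
      3<4 : 3 * M < 4 * M
      3<4 = ℕₚ.*-monoˡ-< M {{ℕ.>-nonZero 0<M}} {3} {4} (s≤s (s≤s (s≤s (s≤s z≤n))))

      N⊆U : ∀ u → ∣ N u ∣ ≡ ⟦ U u ⟧ * ∣ N u ∣
      N⊆U u with U u in eq
      ... | true = sym (ℕₚ.+-identityʳ _)
      ... | false = trans (sum-cong-≗ none) (∑-zero p)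
        where
        none : ∀ a → ⟦ N u a ⟧ ≡ 0
        none a with N u a in eqN
        ... | false = refl
        ... | true = ⊥-elim (false≢true (trans (sym eq) (captures u a (A⁺-nonzero {a} (∧-elimˡ eqN))
          (true-dec (Finₚ.all? (λ b → member? S (u ⊗ a ⊕ val b ⊗ a))) (∧-elimʳ {S (u ⊗ a)} (∧-elimˡ {S (u ⊗ a) ∧ progression a (u ⊗ a)} (∧-elimʳ {A⁺ a} eqN)))))))

      total-weight : sum (λ u → ⟦ U u ⟧ * weight u) ≤ Z * (k * α₄) + 2 * (p * (Z * a₂ + α₄))
      total-weight = begin
        sum (λ u → ⟦ U u ⟧ * weight u) ≡⟨ sum-cong-≗ (λ u → l₁ ⟦ U u ⟧ (k * α₄) p (energy u Aᵢ)) ⟩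
        sum (λ u → ⟦ U u ⟧ * (k * α₄) + 2 * p * (⟦ U u ⟧ * energy u Aᵢ)) ≡⟨ trans (∑-distrib-+ (λ u → ⟦ U u ⟧ * (k * α₄)) (λ u → 2 * p * (⟦ U u ⟧ * energy u Aᵢ))) (cong₂ _+_ (∑-*ʳ (k * α₄) (λ u → ⟦ U u ⟧)) (∑-*ˡ (2 * p) (λ u → ⟦ U u ⟧ * energy u Aᵢ))) ⟩
        ∣ U ∣ * (k * α₄) + 2 * p * sum (λ u → ⟦ U u ⟧ * energy u Aᵢ) ≤⟨ ℕₚ.+-mono-≤ (ℕₚ.*-monoˡ-≤ (k * α₄) ∣U∣≤Z) (ℕₚ.*-monoʳ-≤ (2 * p) (ℕₚ.≤-trans (energy-average U Aᵢ) (ℕₚ.+-monoˡ-≤ α₄ (ℕₚ.*-monoˡ-≤ a₂ ∣U∣≤Z)))) ⟩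
        Z * (k * α₄) + 2 * p * (Z * a₂ + α₄) ≡⟨ cong (Z * (k * α₄) +_) (ℕₚ.*-assoc 2 p _) ⟩
        Z * (k * α₄) + 2 * (p * (Z * a₂ + α₄)) ∎
        where
        l₁ : ∀ u w p e → u * (w + 2 * (p * e)) ≡ u * w + 2 * p * (u * e)
        l₁ = solve-∀

      c = α * α * α * ∣ S ∣
      0<c : 0 < c
      0<c = ℕₚ.*-mono-< (ℕₚ.*-mono-< (ℕₚ.*-mono-< 0<α 0<α) 0<α) 0<S

      main : M ≤ 8 * z³ * (Z * (k * α₄) + 2 * (p * (Z * a₂ + α₄)))
      main = ℕₚ.*-cancelˡ-≤ c {{ℕ.>-nonZero 0<c}} (begin
        c * M ≡⟨ l₁ α ∣ S ∣ M ⟩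
        α * ∣ S ∣ * ((α * α) * M) ≤⟨ ℕₚ.*-monoˡ-≤ ((α * α) * M) total-ratios ⟩
        4 * sum (λ u → ∣ N u ∣) * ((α * α) * M) ≡⟨ trans (ℕₚ.*-assoc 4 (sum (λ u → ∣ N u ∣)) ((α * α) * M)) (cong (4 *_) (sym (∑-*ʳ ((α * α) * M) (λ u → ∣ N u ∣)))) ⟩
        4 * sum (λ u → ∣ N u ∣ * ((α * α) * M)) ≤⟨ ℕₚ.*-monoʳ-≤ 4 (∑-mono perU) ⟩
        4 * sum (λ u → 2 * (∣ S ∣ * α₂³) * (⟦ U u ⟧ * weight u)) ≡⟨ cong (4 *_) (∑-*ˡ (2 * (∣ S ∣ * α₂³)) (λ u → ⟦ U u ⟧ * weight u)) ⟩
        4 * (2 * (∣ S ∣ * α₂³) * sum (λ u → ⟦ U u ⟧ * weight u)) ≤⟨ ℕₚ.*-monoʳ-≤ 4 (ℕₚ.*-mono-≤ (ℕₚ.*-monoʳ-≤ 2 (ℕₚ.*-monoʳ-≤ ∣ S ∣ (ℕₚ.*-mono-≤ doubling (ℕₚ.*-mono-≤ doubling doubling)))) total-weight) ⟩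
        4 * (2 * (∣ S ∣ * ((z * α) * ((z * α) * (z * α)))) * TW) ≡⟨ l₂ ∣ S ∣ z α TW ⟩
        c * (8 * z³ * TW) ∎)
        where
        TW = Z * (k * α₄) + 2 * (p * (Z * a₂ + α₄))
        l₁ : ∀ a s m → a * a * a * s * m ≡ a * s * ((a * a) * m)
        l₁ = solve-∀
        l₂ : ∀ s z a w → 4 * (2 * (s * ((z * a) * ((z * a) * (z * a)))) * w) ≡ a * a * a * s * (8 * (z * z * z) * w)
        l₂ = solve-∀
        l₃ : ∀ u x w → u * (x * w) ≡ x * (u * w)
        l₃ = solve-∀
        perU : ∀ u → ∣ N u ∣ * ((α * α) * M) ≤ 2 * (∣ S ∣ * α₂³) * (⟦ U u ⟧ * weight u)
        perU u = begin
          ∣ N u ∣ * ((α * α) * M) ≡⟨ cong (_* ((α * α) * M)) (N⊆U u) ⟩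
          ⟦ U u ⟧ * ∣ N u ∣ * ((α * α) * M) ≡⟨ ℕₚ.*-assoc ⟦ U u ⟧ _ _ ⟩
          ⟦ U u ⟧ * (∣ N u ∣ * ((α * α) * M)) ≤⟨ ℕₚ.*-monoʳ-≤ ⟦ U u ⟧ (fibre u) ⟩
          ⟦ U u ⟧ * (2 * (∣ S ∣ * α₂³) * weight u) ≡⟨ l₃ ⟦ U u ⟧ (2 * (∣ S ∣ * α₂³)) (weight u) ⟩
          2 * (∣ S ∣ * α₂³) * (⟦ U u ⟧ * weight u) ∎

      4≤3 : 4 * M ≤ 3 * M
      4≤3 = begin
        4 * M ≤⟨ ℕₚ.*-monoʳ-≤ 4 main ⟩
        4 * (8 * z³ * (Z * (k * α₄) + 2 * (p * (Z * a₂ + α₄)))) ≡⟨ l₁ z³ Z k a₂ p ⟩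
        32 * z³ * Z * (k * (a₂ * a₂)) + 64 * z³ * Z * (p * a₂) + 64 * z³ * (p * (a₂ * a₂)) ≤⟨ ℕₚ.+-mono-≤ (ℕₚ.+-mono-≤ (ℕₚ.*-monoˡ-≤ (k * (a₂ * a₂)) h₁) (ℕₚ.*-monoˡ-≤ (p * a₂) h₂)) (ℕₚ.*-monoˡ-≤ (p * (a₂ * a₂)) h₃) ⟩
        p * (k * (a₂ * a₂)) + k * a₂ * (p * a₂) + k * (p * (a₂ * a₂)) ≡⟨ l₂ p k a₂ ⟩
        3 * M ∎
        where
        l₁ : ∀ c Z k a p → 4 * (8 * c * (Z * (k * (a * a)) + 2 * (p * (Z * a + a * a)))) ≡ 32 * c * Z * (k * (a * a)) + 64 * c * Z * (p * a) + 64 * c * (p * (a * a))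
        l₁ = solve-∀
        l₂ : ∀ p k a → p * (k * (a * a)) + k * a * (p * a) + k * (p * (a * a)) ≡ 3 * (p * (k * (a * a)))
        l₂ = solve-∀

-- Legendre's sieve and primitive roots.

module Sieve (n : ℕ) (pr : Prime (suc n)) where

  open import Data.Nat.Divisibility
  open import Data.Nat.GCD using (module Bézout; gcd; gcd[m,n]∣m; gcd[m,n]∣n; gcd-GCD)
  open import Data.Nat.Coprimality using (Coprime; coprime-Bézout)
  open import Data.Nat.Primality using (prime?; euclidsLemma; prime⇒irreducible; ¬prime[0]; ¬prime[1]; prime⇒nonZero)
  open import Data.Nat.Primality.Factorisation using (factorise)
  open import Data.Nat.ListAction using (product)
  import Data.List.Relation.Unary.All.Properties as Allₚ
  open import Relation.Binary.Definitions using (tri<; tri≈; tri>)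
  open import Data.Nat.DivMod using (m<n⇒m%n≡m)
  open FiniteSums
  open Fp n pr

  root-multiple : ∀ {x i} k → x ↑ i ≡ 𝟙 → x ↑ (k * i) ≡ 𝟙
  root-multiple {x} {i} k h = trans (cong (x ↑_) (ℕₚ.*-comm k i)) (trans (sym (↑-* x i k)) (trans (cong (_↑ k) h) (𝟙↑ k)))

  root-gcd : ∀ {x i j d} → Bézout.Identity d i j → x ↑ i ≡ 𝟙 → x ↑ j ≡ 𝟙 → x ↑ d ≡ 𝟙
  root-gcd {x} {i} {j} {d} (Bézout.+- a b eq) hi hj = trans (sym (⊗-identityʳ _)) (trans (cong (x ↑ d ⊗_) (sym (root-multiple b hj))) (trans (sym (↑-+ x d (b * j))) (trans (cong (x ↑_) eq) (root-multiple a hi))))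
  root-gcd {x} {i} {j} {d} (Bézout.-+ a b eq) hi hj = trans (sym (⊗-identityʳ _)) (trans (cong (x ↑ d ⊗_) (sym (root-multiple a hi))) (trans (sym (↑-+ x d (a * i))) (trans (cong (x ↑_) eq) (root-multiple b hj))))

  cofactor : ℕ → ℕ
  cofactor zero = 0
  cofactor q@(suc _) = n / q

  cofactor-spec : ∀ q → 0 < q → q ∣ n → q * cofactor q ≡ n
  cofactor-spec (suc q) _ q∣n = trans (cong (suc q *_) (n/m≡quotient q∣n)) (sym (m∣n⇒n≡m*quotient q∣n))

  prime>0 : ∀ {q} → Prime q → 0 < q
  prime>0 {zero} h = ⊥-elim (¬prime[0] h)
  prime>0 {suc q} _ = s≤s z≤n

  prime>1 : ∀ {q} → Prime q → 1 < q
  prime>1 {zero} h = ⊥-elim (¬prime[0] h)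
  prime>1 {suc zero} h = ⊥-elim (¬prime[1] h)
  prime>1 {suc (suc q)} _ = s≤s (s≤s z≤n)

  prime-∤⇒coprime : ∀ {q e} → Prime q → q ∤ e → Coprime q e
  prime-∤⇒coprime {q} {e} pq q∤e {d} (d∣q , d∣e) with prime⇒irreducible pq d∣q
  ... | inj₁ d≡1 = d≡1
  ... | inj₂ refl = ⊥-elim (q∤e d∣e)

  split-cofactor : ∀ {q e m} → Prime q → q ∣ n → q ∤ e → e * m ≡ n → ∃ λ m′ → m ≡ q * m′ × (e * q) * m′ ≡ n × cofactor q ≡ e * m′
  split-cofactor {q} {e} {m} pq q∣n q∤e em≡n with euclidsLemma e m pq (subst (q ∣_) (sym em≡n) q∣n)
  ... | inj₁ q∣e = ⊥-elim (q∤e q∣e)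
  ... | inj₂ (divides m′ refl) = m′ , ℕₚ.*-comm m′ q , eq , ℕₚ.*-cancelˡ-≡ _ _ q {{prime⇒nonZero pq}} (trans (cofactor-spec q (prime>0 pq) q∣n) (trans (sym eq) (l₁ e q m′)))
    where
    l₀ : ∀ e q m → (e * q) * m ≡ e * (m * q)
    l₀ = solve-∀
    l₁ : ∀ e q m → (e * q) * m ≡ q * (e * m)
    l₁ = solve-∀
    eq : (e * q) * m′ ≡ n
    eq = trans (l₀ e q m′) em≡n

  Divisors : List ℕ → Set
  Divisors = All (λ q → Prime q × q ∣ n)

  -- For primes this says that they are distinct, in the form in which coprimality is used.
  Independent : List ℕ → Set
  Independent = AllPairs (λ q q′ → q′ ∤ q)

  ∤-* : ∀ {q a b} → Prime q → q ∤ a → q ∤ b → q ∤ a * b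
  ∤-* {q} {a} {b} pq h g q∣ab with euclidsLemma a b pq q∣ab
  ... | inj₁ d = h d
  ... | inj₂ d = g d

  independent-tail : ∀ {q e qs} → Divisors qs → All (_∤ q) qs → All (_∤ e) qs → All (_∤ e * q) qs
  independent-tail [] [] [] = []
  independent-tail ((pq , _) ∷ ds) (h ∷ hs) (g ∷ gs) = ∤-* pq g h ∷ independent-tail ds hs gs

  product-divides : ∀ qs e m → Divisors qs → Independent qs → All (_∤ e) qs → e * m ≡ n → ∃ λ m′ → (e * product qs) * m′ ≡ n
  product-divides [] e m _ _ _ em≡n = m , trans (cong (_* m) (ℕₚ.*-identityʳ e)) em≡n
  product-divides (q ∷ qs) e m ((pq , q∣n) ∷ ds) (hq ∷ ind) (q∤e ∷ ∤e) em≡n with split-cofactor pq q∣n q∤e em≡n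
  ... | m′ , _ , eq , _ with product-divides qs (e * q) m′ ds ind (independent-tail ds hq ∤e) eq
  ...   | m″ , eq′ = m″ , trans (cong (_* m″) (sym (ℕₚ.*-assoc e q (product qs)))) eq′

  subproducts : List ℕ → List ℕ
  subproducts [] = 1 ∷ []
  subproducts (q ∷ qs) = subproducts qs ++ map (q *_) (subproducts qs)

  module Legendre (B : ℕ) (y : Fin B → F) (z : ℕ) where

    -- For x ≠ 0 and `e * m ≡ n`, x^m = 1 singles out the e-th powers; hence `avoids` excludes the
    -- q-th powers for every listed `q`.
    isRoot : ℕ → F → Bool
    isRoot m x = does (x ↑ m Finₚ.≟ 𝟙)

    avoids : List ℕ → F → Bool
    avoids [] x = true
    avoids (q ∷ qs) x = not (isRoot (cofactor q) x) ∧ avoids qs x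

    count : List ℕ → ℕ → ℕ
    count qs m = sum (λ b → ⟦ isRoot m (y b) ∧ avoids qs (y b) ⟧)

    -- ∣count - B/e∣ ≤ B/z with denominators cleared.
    Balanced : ℕ → ℕ → Set
    Balanced e m = z * (count [] m * e) ≤ z * B + e * B × z * B ≤ z * (count [] m * e) + e * B

    totients : List ℕ → ℕ
    totients [] = 1
    totients (q ∷ qs) = (q ∸ 1) * totients qs

    -- On the right, the order of `x ↑ m′` divides both `q` and `e`, which are coprime.
    isRoot-combine : ∀ {q e m′} x → Prime q → q ∤ e → isRoot m′ x ≡ isRoot (q * m′) x ∧ isRoot (e * m′) x
    isRoot-combine {q} {e} {m′} x pq q∤e with x ↑ m′ Finₚ.≟ 𝟙
    ... | yes h = sym (trans (cong₂ _∧_ (dec-true (x ↑ (q * m′) Finₚ.≟ 𝟙) (root-multiple q h)) (dec-true (x ↑ (e * m′) Finₚ.≟ 𝟙) (root-multiple e h))) refl)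
    ... | no ¬h with x ↑ (q * m′) Finₚ.≟ 𝟙 | x ↑ (e * m′) Finₚ.≟ 𝟙
    ...   | no _ | _ = refl
    ...   | yes _ | no _ = refl
    ...   | yes h | yes g = ⊥-elim (¬h (trans (sym (⊗-identityʳ _)) (root-gcd {x ↑ m′} (coprime-Bézout (prime-∤⇒coprime pq q∤e))
            (trans (↑-* x m′ q) (trans (cong (x ↑_) (ℕₚ.*-comm m′ q)) h)) (trans (↑-* x m′ e) (trans (cong (x ↑_) (ℕₚ.*-comm m′ e)) g)))))

    count-split : ∀ {q e m′} qs → Prime q → q ∤ e → cofactor q ≡ e * m′ → count (q ∷ qs) (q * m′) + count qs m′ ≡ count qs (q * m′)
    count-split {q} {e} {m′} qs pq q∤e c≡ = trans (sym (∑-distrib-+ (λ b → ⟦ isRoot (q * m′) (y b) ∧ avoids (q ∷ qs) (y b) ⟧) (λ b → ⟦ isRoot m′ (y b) ∧ avoids qs (y b) ⟧))) (sum-cong-≗ pt)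
      where
      bool : ∀ r c a → ⟦ r ∧ (not c ∧ a) ⟧ + ⟦ (r ∧ c) ∧ a ⟧ ≡ ⟦ r ∧ a ⟧
      bool true true a = refl
      bool true false a = ℕₚ.+-identityʳ _
      bool false c a = refl
      pt : ∀ b → ⟦ isRoot (q * m′) (y b) ∧ avoids (q ∷ qs) (y b) ⟧ + ⟦ isRoot m′ (y b) ∧ avoids qs (y b) ⟧ ≡ ⟦ isRoot (q * m′) (y b) ∧ avoids qs (y b) ⟧
      pt b = trans (cong₂ (λ c r → ⟦ isRoot (q * m′) (y b) ∧ (not c ∧ avoids qs (y b)) ⟧ + ⟦ r ∧ avoids qs (y b) ⟧) (cong (λ c → isRoot c (y b)) c≡) (isRoot-combine {q} {e} {m′} (y b) pq q∤e))
        (bool (isRoot (q * m′) (y b)) (isRoot (e * m′) (y b)) (avoids qs (y b)))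

    Sifted : List ℕ → ℕ → ℕ → Set
    Sifted qs e m = z * (count qs m * (e * product qs)) ≤ z * B * totients qs + 2 ^ length qs * (e * product qs * B)
                  × z * B * totients qs ≤ z * (count qs m * (e * product qs)) + 2 ^ length qs * (e * product qs * B)

    AllBalanced : List ℕ → ℕ → Set
    AllBalanced qs e = All (λ x → ∀ m → (e * x) * m ≡ n → Balanced (e * x) m) (subproducts qs)

    -- Legendre's sieve; the factor e · product qs clears the denominators of (B/e) ∏ (1 − 1/q).
    sift : ∀ qs e m → Divisors qs → Independent qs → All (_∤ e) qs → e * m ≡ n → AllBalanced qs e → Sifted qs e m
    sift [] e m _ _ _ em≡n (bal ∷ []) with bal m (trans (cong (_* m) (ℕₚ.*-identityʳ e)) em≡n)
    ... | up , lo = subst₂ _≤_ refl (l₁ z B (e * 1)) up , subst₂ _≤_ (sym (ℕₚ.*-identityʳ (z * B))) (cong (z * (count [] m * (e * 1)) +_) (sym (ℕₚ.+-identityʳ _))) lo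
      where
      l₁ : ∀ z B e → z * B + e * B ≡ z * B * 1 + (e * B + 0)
      l₁ = solve-∀
    sift (q ∷ qs) e m ((pq , q∣n) ∷ ds) (hq ∷ ind) (q∤e ∷ ∤e) em≡n bal with split-cofactor pq q∣n q∤e em≡n
    ... | m′ , refl , eq , c≡ with sift qs e (q * m′) ds ind ∤e em≡n (Allₚ.++⁻ˡ (subproducts qs) bal)
            | sift qs (e * q) m′ ds ind (independent-tail ds hq ∤e) eq (All.map (λ {x} h m e≡ → subst (λ w → Balanced w m) (sym (ℕₚ.*-assoc e q x)) (h m (trans (cong (_* m) (sym (ℕₚ.*-assoc e q x))) e≡))) (Allₚ.map⁻ (Allₚ.++⁻ʳ (subproducts qs) bal)))
    ...   | up₁ , lo₁ | up₂ , lo₂ = up , lo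
      where
      open ℕₚ.≤-Reasoning
      Q = product qs
      Φ = totients qs
      K = 2 ^ length qs
      c c₁ c₂ : ℕ
      c = count (q ∷ qs) (q * m′)
      c₁ = count qs (q * m′)
      c₂ = count qs m′
      -- The recursion subtracts, so each bound for `c` uses the opposite bound for `c₂`, and the
      -- two errors together double the constant.
      c+c₂ : c + c₂ ≡ c₁
      c+c₂ = count-split {q} {e} {m′} qs pq q∤e c≡
      q≡ : q ≡ suc (q ∸ 1)
      q≡ = sym (ℕₚ.m+[n∸m]≡n (prime>0 pq))
      main : ∀ w → q * w ≡ (q ∸ 1) * w + w
      main w = trans (cong (_* w) q≡) (ℕₚ.+-comm w _)
      l₁ : ∀ z c c₂ e q Q → z * (c * (e * (q * Q))) + z * (c₂ * (e * q * Q)) ≡ q * (z * ((c + c₂) * (e * Q)))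
      l₁ = solve-∀
      l₂ : ∀ z B Φ r → r * (z * B * Φ) ≡ z * B * (r * Φ)
      l₂ = solve-∀
      l₃ : ∀ w x q K E B → (w + x) + q * (K * (E * B)) ≡ x + (w + q * (K * (E * B)))
      l₃ = solve-∀
      l₄ : ∀ w q K e Q B → w + q * (K * (e * Q * B)) + K * (e * q * Q * B) ≡ w + 2 * K * (e * (q * Q) * B)
      l₄ = solve-∀
      lo : z * B * ((q ∸ 1) * Φ) ≤ z * (c * (e * (q * Q))) + 2 * K * (e * (q * Q) * B)
      lo = ℕₚ.+-cancelʳ-≤ (z * (c₂ * (e * q * Q)) + z * B * Φ) _ _ (begin
        z * B * ((q ∸ 1) * Φ) + (z * (c₂ * (e * q * Q)) + z * B * Φ) ≡⟨ l₅ (z * B * ((q ∸ 1) * Φ)) _ (z * B * Φ) ⟩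
        (z * B * ((q ∸ 1) * Φ) + z * B * Φ) + z * (c₂ * (e * q * Q)) ≡⟨ cong (_+ z * (c₂ * (e * q * Q))) (trans (cong (_+ z * B * Φ) (sym (l₂ z B Φ (q ∸ 1)))) (sym (main (z * B * Φ)))) ⟩
        q * (z * B * Φ) + z * (c₂ * (e * q * Q)) ≤⟨ ℕₚ.+-mono-≤ (ℕₚ.*-monoʳ-≤ q lo₁) up₂ ⟩
        q * (z * (c₁ * (e * Q)) + K * (e * Q * B)) + (z * B * Φ + K * (e * q * Q * B)) ≡⟨ cong (λ w → q * (z * (w * (e * Q)) + K * (e * Q * B)) + (z * B * Φ + K * (e * q * Q * B))) (sym c+c₂) ⟩
        q * (z * ((c + c₂) * (e * Q)) + K * (e * Q * B)) + (z * B * Φ + K * (e * q * Q * B)) ≡⟨ l₆ z c c₂ e q Q K B (z * B * Φ) ⟩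
        z * (c * (e * (q * Q))) + 2 * K * (e * (q * Q) * B) + (z * (c₂ * (e * q * Q)) + z * B * Φ) ∎)
        where
        l₅ : ∀ a b c → a + (b + c) ≡ (a + c) + b
        l₅ = solve-∀
        l₆ : ∀ z c c₂ e q Q K B w → q * (z * ((c + c₂) * (e * Q)) + K * (e * Q * B)) + (w + K * (e * q * Q * B)) ≡ z * (c * (e * (q * Q))) + 2 * K * (e * (q * Q) * B) + (z * (c₂ * (e * q * Q)) + w)
        l₆ = solve-∀
      up : z * (c * (e * (q * Q))) ≤ z * B * ((q ∸ 1) * Φ) + 2 * K * (e * (q * Q) * B)
      up = ℕₚ.+-cancelʳ-≤ (z * (c₂ * (e * q * Q)) + z * B * Φ) _ _ (begin
        z * (c * (e * (q * Q))) + (z * (c₂ * (e * q * Q)) + z * B * Φ) ≡⟨ sym (ℕₚ.+-assoc (z * (c * (e * (q * Q)))) _ _) ⟩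
        z * (c * (e * (q * Q))) + z * (c₂ * (e * q * Q)) + z * B * Φ ≡⟨ cong (_+ z * B * Φ) (trans (l₁ z c c₂ e q Q) (cong (λ w → q * (z * (w * (e * Q)))) c+c₂)) ⟩
        q * (z * (c₁ * (e * Q))) + z * B * Φ ≤⟨ ℕₚ.+-mono-≤ (ℕₚ.*-monoʳ-≤ q up₁) lo₂ ⟩
        q * (z * B * Φ + K * (e * Q * B)) + (z * (c₂ * (e * q * Q)) + K * (e * q * Q * B)) ≡⟨ cong (_+ (z * (c₂ * (e * q * Q)) + K * (e * q * Q * B))) (trans (ℕₚ.*-distribˡ-+ q _ _) (cong (_+ q * (K * (e * Q * B))) (trans (main (z * B * Φ)) (cong (_+ z * B * Φ) (l₂ z B Φ (q ∸ 1)))))) ⟩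
        z * B * ((q ∸ 1) * Φ) + z * B * Φ + q * (K * (e * Q * B)) + (z * (c₂ * (e * q * Q)) + K * (e * q * Q * B)) ≡⟨ l₇ (z * B * ((q ∸ 1) * Φ)) (z * B * Φ) q K e Q B (z * (c₂ * (e * q * Q))) ⟩
        z * B * ((q ∸ 1) * Φ) + 2 * K * (e * (q * Q) * B) + (z * (c₂ * (e * q * Q)) + z * B * Φ) ∎)
        where
        l₇ : ∀ a w q K e Q B d → a + w + q * (K * (e * Q * B)) + (d + K * (e * q * Q * B)) ≡ a + 2 * K * (e * (q * Q) * B) + (d + w)
        l₇ = solve-∀

    totients-large : ∀ qs → Divisors qs → product qs ≤ 2 ^ length qs * totients qs × 0 < totients qs
    totients-large [] [] = ℕₚ.≤-refl , s≤s z≤n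
    totients-large (q ∷ qs) ((pq , _) ∷ ds) with totients-large qs ds
    ... | le , pos = ℕₚ.≤-trans (ℕₚ.*-mono-≤ (q≤ (prime>1 pq)) le) (ℕₚ.≤-reflexive (l₁ (q ∸ 1) (2 ^ length qs) (totients qs))) , ℕₚ.*-mono-< {0} {q ∸ 1} {0} {totients qs} (ℕₚ.∸-monoˡ-≤ 1 (prime>1 pq)) pos
      where
      l₁ : ∀ r k t → 2 * r * (k * t) ≡ 2 * k * (r * t)
      l₁ = solve-∀
      q≤ : ∀ {q} → 1 < q → q ≤ 2 * (q ∸ 1)
      q≤ {suc zero} (s≤s ())
      q≤ {suc (suc q)} _ = s≤s (ℕₚ.≤-trans (ℕₚ.≤-reflexive (ℕₚ.+-comm 1 q)) (ℕₚ.+-monoʳ-≤ q (s≤s z≤n)))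

    -- If nothing survived, the main term z B Φ would be at most the error 2^k Q B, where k is the
    -- number of primes. But q ≤ 2(q - 1) gives Q ≤ 2^k Φ, so z ≤ 4^k.
    avoiding-element : ∀ qs → Divisors qs → Independent qs → All (_∤ 1) qs → AllBalanced qs 1 → 0 < B → 4 ^ length qs < z →
      ∃ λ b → avoids qs (y b) ≡ true
    avoiding-element qs ds ind ∤1 bal 0<B 4^<z with Finₚ.any? (λ b → avoids qs (y b) Bool.≟ true)
    ... | yes w = w
    ... | no none = ⊥-elim (ℕₚ.<⇒≱ 4^<z (ℕₚ.*-cancelʳ-≤ z _ (B * Φ) {{ℕ.>-nonZero (ℕₚ.*-mono-< 0<B (proj₂ large))}} (begin
      z * (B * Φ) ≡⟨ sym (ℕₚ.*-assoc z B Φ) ⟩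
      z * B * Φ ≤⟨ proj₂ (sift qs 1 n ds ind ∤1 (ℕₚ.*-identityˡ n) bal) ⟩
      z * (count qs n * (1 * Q)) + K * (1 * Q * B) ≡⟨ cong (_+ K * (1 * Q * B)) (trans (cong (λ w → z * (w * (1 * Q))) zero-count) (ℕₚ.*-zeroʳ z)) ⟩
      K * (1 * Q * B) ≡⟨ cong (λ w → K * (w * B)) (ℕₚ.*-identityˡ Q) ⟩
      K * (Q * B) ≤⟨ ℕₚ.*-monoʳ-≤ K (ℕₚ.*-monoˡ-≤ B (proj₁ large)) ⟩
      K * (K * Φ * B) ≡⟨ l₁ K Φ B ⟩
      K * K * (B * Φ) ≡⟨ cong (_* (B * Φ)) (sym (^2 (length qs))) ⟩
      4 ^ length qs * (B * Φ) ∎)))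
      where
      open ℕₚ.≤-Reasoning
      Q = product qs
      Φ = totients qs
      K = 2 ^ length qs
      large = totients-large qs ds
      l₁ : ∀ K Φ B → K * (K * Φ * B) ≡ K * K * (B * Φ)
      l₁ = solve-∀
      ^2 : ∀ k → 4 ^ k ≡ 2 ^ k * 2 ^ k
      ^2 zero = refl
      ^2 (suc k) = trans (cong (4 *_) (^2 k)) (l (2 ^ k))
        where
        l : ∀ x → 4 * (x * x) ≡ (2 * x) * (2 * x)
        l = solve-∀
      zero-count : count qs n ≡ 0
      zero-count = trans (sum-cong-≗ pt) (∑-zero B)
        where
        pt : ∀ b → ⟦ isRoot n (y b) ∧ avoids qs (y b) ⟧ ≡ 0
        pt b with isRoot n (y b) | avoids qs (y b) in eq
        ... | false | _ = refl
        ... | true | false = refl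
        ... | true | true = ⊥-elim (none (b , eq))

  primeDivisors : ℕ → List ℕ
  primeDivisors zero = []
  primeDivisors (suc N) with prime? N ×-dec (N ∣? n)
  ... | yes _ = N ∷ primeDivisors N
  ... | no _ = primeDivisors N

  primeDivisors-bounded : ∀ N → All (λ q → Prime q × q ∣ n × q < N) (primeDivisors N)
  primeDivisors-bounded zero = []
  primeDivisors-bounded (suc N) with prime? N ×-dec (N ∣? n)
  ... | yes (pN , N∣n) = (pN , N∣n , ℕₚ.≤-refl) ∷ All.map (λ (a , b , c) → a , b , ℕₚ.<-trans c ℕₚ.≤-refl) (primeDivisors-bounded N)
  ... | no _ = All.map (λ (a , b , c) → a , b , ℕₚ.<-trans c ℕₚ.≤-refl) (primeDivisors-bounded N)

  primeDivisors-divisors : ∀ N → Divisors (primeDivisors N)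
  primeDivisors-divisors N = All.map (λ (a , b , _) → a , b) (primeDivisors-bounded N)

  -- The list is decreasing, and a smaller prime does not divide a larger one.
  primeDivisors-independent : ∀ N → Independent (primeDivisors N)
  primeDivisors-independent zero = []
  primeDivisors-independent (suc N) with prime? N ×-dec (N ∣? n)
  ... | no _ = primeDivisors-independent N
  ... | yes (pN , _) = All.map (λ (pq , _ , q<N) q∣N → no∣ pq q<N q∣N) (primeDivisors-bounded N) ∷ primeDivisors-independent N
    where
    no∣ : ∀ {q} → Prime q → q < N → q ∣ N → ⊥
    no∣ pq q<N q∣N with prime⇒irreducible pN q∣N
    ... | inj₁ refl = ¬prime[1] pq
    ... | inj₂ refl = ℕₚ.<-irrefl refl q<N

  primeDivisors-∤1 : ∀ N → All (_∤ 1) (primeDivisors N)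
  primeDivisors-∤1 N = All.map (λ (pq , _) q∣1 → ℕₚ.<⇒≱ (prime>1 pq) (∣⇒≤ q∣1)) (primeDivisors-bounded N)

  -- Primes below W contribute at most W of them; each larger one contributes a factor W to the product.
  primeDivisors-few : ∀ W → 1 ≤ W → ∀ N → W ^ length (primeDivisors N) ≤ product (primeDivisors N) * W ^ (N ℕ.⊓ W)
  primeDivisors-few W 1≤W zero = s≤s z≤n
  primeDivisors-few W 1≤W (suc N) with prime? N ×-dec (N ∣? n)
  ... | no _ = ℕₚ.≤-trans (primeDivisors-few W 1≤W N) (ℕₚ.*-monoʳ-≤ (product (primeDivisors N)) (ℕₚ.^-monoʳ-≤ W {{ℕ.>-nonZero 1≤W}} (ℕₚ.⊓-monoˡ-≤ W (ℕₚ.n≤1+n N))))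
  ... | yes (pN , _) with N ℕₚ.<? W
  ...   | yes N<W = begin
    W * W ^ length ps ≤⟨ ℕₚ.*-monoʳ-≤ W (primeDivisors-few W 1≤W N) ⟩
    W * (product ps * W ^ (N ℕ.⊓ W)) ≡⟨ l₁ W (product ps) (W ^ (N ℕ.⊓ W)) ⟩
    product ps * W ^ suc (N ℕ.⊓ W) ≡⟨ cong (λ k → product ps * W ^ k) (trans (cong suc (ℕₚ.m≤n⇒m⊓n≡m (ℕₚ.<⇒≤ N<W))) (sym (ℕₚ.m≤n⇒m⊓n≡m N<W))) ⟩
    product ps * W ^ (suc N ℕ.⊓ W) ≤⟨ ℕₚ.*-monoˡ-≤ (W ^ (suc N ℕ.⊓ W)) (ℕₚ.≤-trans (ℕₚ.≤-reflexive (sym (ℕₚ.*-identityˡ _))) (ℕₚ.*-monoˡ-≤ (product ps) (prime>0 pN))) ⟩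
    N * product ps * W ^ (suc N ℕ.⊓ W) ∎
    where
    open ℕₚ.≤-Reasoning
    ps = primeDivisors N
    l₁ : ∀ w a b → w * (a * b) ≡ a * (w * b)
    l₁ = solve-∀
  ...   | no N≮W = begin
    W * W ^ length ps ≤⟨ ℕₚ.*-mono-≤ (ℕₚ.≮⇒≥ N≮W) (primeDivisors-few W 1≤W N) ⟩
    N * (product ps * W ^ (N ℕ.⊓ W)) ≡⟨ sym (ℕₚ.*-assoc N _ _) ⟩
    N * product ps * W ^ (N ℕ.⊓ W) ≤⟨ ℕₚ.*-monoʳ-≤ (N * product ps) (ℕₚ.^-monoʳ-≤ W {{ℕ.>-nonZero 1≤W}} (ℕₚ.⊓-monoˡ-≤ W (ℕₚ.n≤1+n N))) ⟩
    N * product ps * W ^ (suc N ℕ.⊓ W) ∎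
    where
    open ℕₚ.≤-Reasoning
    ps = primeDivisors N

  0<n : 0 < n
  0<n = ℕₚ.≤-pred 1<p

  -- The product of the distinct prime divisors of `n` divides `n`. For a large constant `W` the
  -- bound reads ω ≤ log p / log W + W, so that 4^ω is a small power of p.
  omega-bound : ∀ W → 1 ≤ W → W ^ length (primeDivisors p) ≤ p * W ^ W
  omega-bound W 1≤W with product-divides (primeDivisors p) 1 n (primeDivisors-divisors p) (primeDivisors-independent p) (primeDivisors-∤1 p) (ℕₚ.*-identityˡ n)
  ... | m′ , eq = ℕₚ.≤-trans (primeDivisors-few W 1≤W p) (ℕₚ.*-mono-≤ prod≤p (ℕₚ.^-monoʳ-≤ W {{ℕ.>-nonZero 1≤W}} (ℕₚ.m⊓n≤n p W)))
    where
    prod≤p : product (primeDivisors p) ≤ p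
    prod≤p = ℕₚ.≤-trans (∣⇒≤ {{ℕ.>-nonZero 0<n}} (divides m′ (trans (sym eq) (trans (cong (_* m′) (ℕₚ.*-identityˡ (product (primeDivisors p)))) (ℕₚ.*-comm (product (primeDivisors p)) m′))))) (ℕₚ.n≤1+n n)

  avoids-primes : ∀ {B} (y : Fin B → F) z N x → Legendre.avoids B y z (primeDivisors N) x ≡ true → ∀ q → q < N → Prime q → q ∣ n → x ↑ cofactor q ≢ 𝟙
  avoids-primes y z (suc N) x h q q<N pq q∣n with prime? N ×-dec (N ∣? n) | q ℕₚ.≟ N
  ... | no ¬h | yes refl = ⊥-elim (¬h (pq , q∣n))
  ... | no _ | no q≢N = avoids-primes y z N x h q (ℕₚ.≤∧≢⇒< (ℕₚ.≤-pred q<N) q≢N) pq q∣n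
  ... | yes _ | yes refl = λ e → false≢true (trans (sym (cong not (dec-true (x ↑ cofactor N Finₚ.≟ 𝟙) e))) (left (not (does (x ↑ cofactor N Finₚ.≟ 𝟙))) h))
    where
    left : ∀ a {b} → a ∧ b ≡ true → a ≡ true
    left true _ = refl
  ... | yes _ | no q≢N = avoids-primes y z N x (right (not (does (x ↑ cofactor N Finₚ.≟ 𝟙))) h) q (ℕₚ.≤∧≢⇒< (ℕₚ.≤-pred q<N) q≢N) pq q∣n
    where
    right : ∀ a {b} → a ∧ b ≡ true → b ≡ true
    right true h = h

  prime-factor : ∀ c → 1 < c → ∃ λ q → Prime q × q ∣ c
  prime-factor c@(suc _) 1<c with factorise c
  ... | record { factors = [] ; isFactorisation = eq } = ⊥-elim (ℕₚ.<-irrefl (sym eq) 1<c)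
  ... | record { factors = q ∷ qs ; isFactorisation = eq ; factorsPrime = pq ∷ _ } = q , pq , divides (product qs) (trans eq (ℕₚ.*-comm q _))

  []-^ : ∀ a k → [ a ] ↑ k ≡ [ a ^ k ]
  []-^ a zero = refl
  []-^ a (suc k) = trans (cong ([ a ] ⊗_) ([]-^ a k)) (sym ([]-* a (a ^ k)))

  primitive-root : ∀ {g} → g ≢ 𝟘 → (∀ q → Prime q → q ∣ n → g ↑ cofactor q ≢ 𝟙) → IsPrimitiveRoot p (toℕ g)
  primitive-root {g} g≢0 h = ℕₚ.n≢0⇒n>0 (λ e → g≢0 (Finₚ.toℕ-injective e)) , Finₚ.toℕ<n g , generates
    where
    -- A period `t` may be replaced by d = gcd(t, n). A prime q dividing n/d has d ∣ n/q, which
    -- contradicts the hypothesis at q.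
    no-period : ∀ t → 0 < t → t < n → g ↑ t ≢ 𝟙
    no-period t 0<t t<n gt with gcd[m,n]∣n t n
    ... | divides c n≡cd with prime-factor c 1<c
      where
      d≤t : gcd t n ≤ t
      d≤t = ∣⇒≤ {{ℕ.>-nonZero 0<t}} (gcd[m,n]∣m t n)
      nontrivial : ∀ c → n ≡ c * gcd t n → 1 < c
      nontrivial zero e = ⊥-elim (ℕₚ.<-irrefl (sym e) 0<n)
      nontrivial (suc zero) e = ⊥-elim (ℕₚ.<-irrefl (trans (sym (ℕₚ.+-identityʳ _)) (sym e)) (ℕₚ.≤-<-trans d≤t t<n))
      nontrivial (suc (suc _)) _ = s≤s (s≤s z≤n)
      1<c : 1 < c
      1<c = nontrivial c n≡cd
    ...   | q , pq , divides k refl = h q pq q∣n (trans (cong (g ↑_) cof≡) (root-multiple k gd))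
      where
      l₁ : ∀ k q d → k * q * d ≡ q * (k * d)
      l₁ = solve-∀
      l₂ : ∀ k q d → k * q * d ≡ k * d * q
      l₂ = solve-∀
      gd : g ↑ gcd t n ≡ 𝟙
      gd = root-gcd (Bézout.identity (gcd-GCD t n)) gt (fermat g≢0)
      q∣n : q ∣ n
      q∣n = divides (k * gcd t n) (trans n≡cd (l₂ k q (gcd t n)))
      cof≡ : cofactor q ≡ k * gcd t n
      cof≡ = ℕₚ.*-cancelˡ-≡ _ _ q {{prime⇒nonZero pq}} (trans (cofactor-spec q (prime>0 pq) q∣n) (trans n≡cd (l₁ k q (gcd t n))))
    distinct : ∀ i j → i < j → j < n → g ↑ i ≢ g ↑ j
    distinct i j i<j j<n e with ℕₚ.m≤n⇒∃[o]m+o≡n i<j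
    ... | o , refl = no-period (suc o) (s≤s z≤n) (ℕₚ.≤-<-trans (ℕₚ.≤-trans (ℕₚ.m≤n+m (suc o) i) (ℕₚ.≤-reflexive (ℕₚ.+-suc i o))) j<n)
          (⊗-cancelˡ {g ↑ i} (↑-nonzero i g≢0) (trans (sym (↑-+ g i (suc o))) (trans (cong (g ↑_) (ℕₚ.+-suc i o)) (trans (sym e) (sym (⊗-identityʳ _))))))
    -- A residue x missed by the powers would give p + 1 distinct elements 0, x, g⁰, …, g^{n−1}.
    generates : ∀ x → 0 < x → x < p → ∃ λ k → toℕ g ^ k % p ≡ x
    generates x 0<x x<p with Finₚ.any? {n} (λ k → g ↑ toℕ k Finₚ.≟ [ x ])
    ... | yes (k , e) = toℕ k , trans (sym (toℕ[] _)) (trans (cong toℕ (trans (sym ([]-^ (toℕ g) (toℕ k))) (trans (cong (_↑ toℕ k) ([toℕ] g)) e))) (trans (toℕ[] x) (m<n⇒m%n≡m x<p)))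
    ... | no missed = ⊥-elim (ℕₚ.<-irrefl refl (Finₚ.injective⇒≤ {f = f} f-injective))
      where
      f : Fin (suc (suc n)) → F
      f zero = 𝟘
      f (suc zero) = [ x ]
      f (suc (suc k)) = g ↑ toℕ k
      [x]≢0 = []≢𝟘 0<x x<p
      f-injective : ∀ {i j} → f i ≡ f j → i ≡ j
      f-injective {zero} {zero} _ = refl
      f-injective {zero} {suc zero} e = ⊥-elim ([x]≢0 (sym e))
      f-injective {zero} {suc (suc k)} e = ⊥-elim (↑-nonzero (toℕ k) g≢0 (sym e))
      f-injective {suc zero} {zero} e = ⊥-elim ([x]≢0 e)
      f-injective {suc zero} {suc zero} _ = refl
      f-injective {suc zero} {suc (suc k)} e = ⊥-elim (missed (k , sym e))
      f-injective {suc (suc k)} {zero} e = ⊥-elim (↑-nonzero (toℕ k) g≢0 e)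
      f-injective {suc (suc k)} {suc zero} e = ⊥-elim (missed (k , e))
      f-injective {suc (suc k)} {suc (suc l)} e with ℕₚ.<-cmp (toℕ k) (toℕ l)
      ... | tri< lt _ _ = ⊥-elim (distinct (toℕ k) (toℕ l) lt (Finₚ.toℕ<n l) e)
      ... | tri≈ _ eq _ = cong (λ i → Fin.suc (Fin.suc i)) (Finₚ.toℕ-injective eq)
      ... | tri> _ _ gt = ⊥-elim (distinct (toℕ l) (toℕ k) gt (Finₚ.toℕ<n k) (sym e))

-- Exceptional elements and primitive roots in progressions.

module Exceptional (n : ℕ) (pr : Prime (suc n)) (B : ℕ) .{{B≢0 : NonZero B}} (B≤p : B ≤ suc n) where

  open import Data.Nat using () renaming (∣_-_∣ to dist)
  open import Data.List.Properties using (length-map; length-++)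
  open FiniteSums
  open Fp n pr
  open Sumset n pr using (FSet; ∣∣-∨; ∧-intro; ∧-elimˡ)
  open Sieve n pr
  open Moments n pr B {{B≢0}} B≤p

  nonZero-factors : ∀ {x m} → x * m ≡ n → NonZero x × NonZero m
  nonZero-factors {zero} e = ⊥-elim (ℕₚ.<-irrefl e 0<n)
  nonZero-factors {suc x} {zero} e = ⊥-elim (ℕₚ.<-irrefl (trans (sym (ℕₚ.*-zeroʳ x)) e) 0<n)
  nonZero-factors {suc x} {suc m} e = _ , _

  ∧-true : ∀ c → c ∧ true ≡ c
  ∧-true true = refl
  ∧-true false = refl

  module _ (z s h : ℕ) (0<h : 0 < h) (h²≤p : h * h ≤ p) (p≤h²z : p ≤ h * h * z) (p≤z·size : p ≤ z * size s) (few : 4 ^ length (primeDivisors p) < z) where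

    ps = primeDivisors p

    -- `Residues` requires a factorisation of `n`, found here by testing; numbers not dividing `n`
    -- get the empty set.
    exceptionalFor : ℕ → FSet
    exceptionalFor x u with x * cofactor x ℕₚ.≟ n
    ... | yes eq = Residues.exceptional x (cofactor x) {{proj₁ (nonZero-factors eq)}} {{proj₂ (nonZero-factors {x} eq)}} eq z s u
    ... | no _ = false

    bound : ℕ
    bound = sq z s * (B + h * z * (4 * 2 ^ suc s * 2 ^ suc s + 16 * 2 ^ suc s + 12) + (2 ^ suc s) ^ (2 ^ suc s) * z)

    ∣exceptionalFor∣ : ∀ x → ∣ exceptionalFor x ∣ ≤ bound
    ∣exceptionalFor∣ x with x * cofactor x ℕₚ.≟ n
    ... | yes eq = Residues.exceptional-count x (cofactor x) {{proj₁ (nonZero-factors eq)}} {{proj₂ (nonZero-factors {x} eq)}} eq h z 0<h h²≤p p≤h²z s p≤z·size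
    ... | no _ = ℕₚ.≤-trans (ℕₚ.≤-reflexive (∑-zero p)) z≤n

    exceptionalAny : List ℕ → FSet
    exceptionalAny [] u = false
    exceptionalAny (x ∷ xs) u = exceptionalFor x u ∨ exceptionalAny xs u

    ∣∨∣≤ : ∀ (A C : FSet) → ∣ (λ x → A x ∨ C x) ∣ ≤ ∣ A ∣ + ∣ C ∣
    ∣∨∣≤ A C = ℕₚ.≤-trans (ℕₚ.≤-reflexive (∣∣-∨ A C)) (ℕₚ.+-monoʳ-≤ ∣ A ∣ (∣∣-mono {A = λ x → C x ∧ not (A x)} (λ x → ∧-elimˡ)))

    ∣exceptionalAny∣ : ∀ xs → ∣ exceptionalAny xs ∣ ≤ length xs * bound
    ∣exceptionalAny∣ [] = ℕₚ.≤-reflexive (∑-zero p)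
    ∣exceptionalAny∣ (x ∷ xs) = ℕₚ.≤-trans (∣∨∣≤ (exceptionalFor x) (exceptionalAny xs)) (ℕₚ.+-mono-≤ (∣exceptionalFor∣ x) (∣exceptionalAny∣ xs))

    U : FSet
    U u = not (regular u) ∨ exceptionalAny (subproducts ps) u

    length-subproducts : ∀ qs → length (subproducts qs) ≡ 2 ^ length qs
    length-subproducts [] = refl
    length-subproducts (q ∷ qs) = trans (length-++ (subproducts qs)) (cong₂ _+_ (length-subproducts qs) (trans (length-map (q *_) (subproducts qs)) (trans (length-subproducts qs) (sym (ℕₚ.+-identityʳ _)))))

    irregular-count : ∣ (λ u → not (regular u)) ∣ ≤ B
    irregular-count = ℕₚ.+-cancelˡ-≤ ∣ regular ∣ _ _ (ℕₚ.≤-trans (ℕₚ.≤-reflexive (trans (sym (∑-distrib-+ (λ u → ⟦ regular u ⟧) (λ u → ⟦ not (regular u) ⟧))) (trans (sum-cong-≗ (λ u → one (regular u))) (trans (∑-const p 1) (ℕₚ.*-identityʳ p))))) regular-count)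
      where
      one : ∀ c → ⟦ c ⟧ + ⟦ not c ⟧ ≡ 1
      one true = refl
      one false = refl

    -- The factor `z` counts subproducts, of which there are 2^ω ≤ 4^ω < z; the irregular elements
    -- cost `B`.
    ∣U∣≤ : ∣ U ∣ ≤ B + z * bound
    ∣U∣≤ = ℕₚ.≤-trans (∣∨∣≤ (λ u → not (regular u)) (exceptionalAny (subproducts ps))) (ℕₚ.+-mono-≤ irregular-count
      (ℕₚ.≤-trans (∣exceptionalAny∣ (subproducts ps)) (ℕₚ.*-monoˡ-≤ bound (ℕₚ.≤-trans (ℕₚ.≤-reflexive (length-subproducts ps)) (ℕₚ.≤-trans (ℕₚ.^-monoˡ-≤ (length ps) (s≤s (s≤s z≤n))) (ℕₚ.<⇒≤ few))))))

    module _ (u a : F) (a≢𝟘 : a ≢ 𝟘) (u∉U : U u ≡ false) where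

      ∨-falseʳ : ∀ c {d} → c ∨ d ≡ false → d ≡ false
      ∨-falseʳ false h = h

      ∨-falseˡ : ∀ c {d} → c ∨ d ≡ false → c ≡ false
      ∨-falseˡ false h = refl

      reg : Regular u
      reg = regular⇒Regular u (unnot (regular u) (∨-falseˡ (not (regular u)) u∉U))
        where
        unnot : ∀ c → not c ≡ false → c ≡ true
        unnot true _ = refl

      y : Fin B → F
      y b = (u ⊕ val b) ⊗ a

      open Legendre B y z

      module _ (x m : ℕ) (eq : x * m ≡ n) where

        private
          instance
            nzx : NonZero x
            nzx = proj₁ (nonZero-factors eq)
            nzm : NonZero m
            nzm = proj₂ (nonZero-factors {x} eq)

        module R = Residues x m {{nzx}} {{nzm}} eq

        -- (u + b)a is an x-th power exactly when u + b lies in the coset labelled a^(-m). Dilation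
        -- by `a` only changes which coset is counted, which is why `U` does not depend on `a`.
        count≡hits : count [] m ≡ R.L.hits reg 0 (inv a ↑ m)
        count≡hits = sum-cong-≗ (λ b → cong ⟦_⟧ (trans (∧-true _) (does-⇔ (fw b) (bw b))))
          where
          cancel : a ↑ m ⊗ inv a ↑ m ≡ 𝟙
          cancel = trans (sym (↑-⊗ a (inv a) m)) (trans (cong (_↑ m) (inv-inverseʳ a≢𝟘)) (𝟙↑ m))
          fw : ∀ b → y b ↑ m ≡ 𝟙 → (u ⊕ val b) ↑ m ≡ inv a ↑ m
          fw b e = ⊗-cancelʳ (↑-nonzero m a≢𝟘) (trans (sym (↑-⊗ (u ⊕ val b) a m)) (trans e (sym (trans (⊗-comm _ _) cancel))))
          bw : ∀ b → (u ⊕ val b) ↑ m ≡ inv a ↑ m → y b ↑ m ≡ 𝟙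
          bw b e = trans (↑-⊗ (u ⊕ val b) a m) (trans (cong (_⊗ a ↑ m) e) (trans (⊗-comm _ _) cancel))

        balanced : R.exceptional z s u ≡ false → Balanced x m
        balanced notExc = subst (λ c → z * (c * x) ≤ z * B + x * B × z * B ≤ z * (c * x) + x * B) (sym count≡hits)
            (go (λ q → ℕₚ.m≤n+∣m-n∣ q B) (λ q → ℕₚ.m≤n+∣n-m∣ B q))
          where
          N : ℕ
          N = R.L.hits reg 0 (inv a ↑ m)
          small : z * dist (x * N) B ≤ x * B
          small with x * B ≤? z * dist (x * N) B
          ... | no ≰ = ℕₚ.<⇒≤ (ℕₚ.≰⇒> ≰)
          ... | yes big = ⊥-elim (false≢true (trans (sym notExc) (∧-intro (dec-true (Finₚ.all? _) reg) (dec-true (x * size (suc s) ≤? sq z s * R.dev u s) (R.deviation-propagates reg z (inv a ↑ m) (R.power∈μ (inv-nonzero a≢𝟘)) big s)))))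
          go : (∀ q → q ≤ B + dist q B) → (∀ q → B ≤ q + dist q B) → z * (N * x) ≤ z * B + x * B × z * B ≤ z * (N * x) + x * B
          go f g = ℕₚ.≤-trans (ℕₚ.≤-trans (ℕₚ.≤-reflexive (cong (z *_) (ℕₚ.*-comm N x))) (ℕₚ.*-monoʳ-≤ z (f (x * N)))) (ℕₚ.≤-trans (ℕₚ.≤-reflexive (ℕₚ.*-distribˡ-+ z B _)) (ℕₚ.+-monoʳ-≤ (z * B) small)) ,
            ℕₚ.≤-trans (ℕₚ.*-monoʳ-≤ z (g (x * N))) (ℕₚ.≤-trans (ℕₚ.≤-reflexive (trans (ℕₚ.*-distribˡ-+ z _ _) (cong (λ q → z * q + z * dist (x * N) B) (ℕₚ.*-comm x N)))) (ℕₚ.+-monoʳ-≤ (z * (N * x)) small))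

      -- `Residues` depends on the cofactor and on the proof of `x * m ≡ n`; the former is
      -- determined by `x`, and equality proofs in ℕ are unique.
      not-exceptional : ∀ x m (eq : x * m ≡ n) → exceptionalFor x u ≡ false → R.exceptional x m eq z s u ≡ false
      not-exceptional x m eq notExc with x * cofactor x ℕₚ.≟ n
      ... | no ne = ⊥-elim (ne (trans (cong (x *_) (sym m≡)) eq))
        where
        instance _ = proj₁ (nonZero-factors eq)
        open import Data.Nat.Divisibility using (divides)
        m≡ : m ≡ cofactor x
        m≡ = ℕₚ.*-cancelˡ-≡ _ _ x (trans eq (sym (cofactor-spec x (ℕ.>-nonZero⁻¹ x) (divides m (trans (sym eq) (ℕₚ.*-comm x m))))))
      ... | yes eq′ with ℕₚ.*-cancelˡ-≡ m (cofactor x) x {{proj₁ (nonZero-factors eq)}} (trans eq (sym eq′))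
      ...   | refl with ℕₚ.≡-irrelevant eq eq′
      ...     | refl = notExc

      all-not-exceptional : ∀ xs → exceptionalAny xs u ≡ false → All (λ x → exceptionalFor x u ≡ false) xs
      all-not-exceptional [] _ = []
      all-not-exceptional (x ∷ xs) h = ∨-falseˡ (exceptionalFor x u) h ∷ all-not-exceptional xs (∨-falseʳ (exceptionalFor x u) h)

      all-balanced : AllBalanced ps 1
      all-balanced = All.map (λ {x} notExc m eq → subst (λ w → Balanced w m) (sym (ℕₚ.*-identityˡ x)) (balanced x m (trans (cong (_* m) (sym (ℕₚ.*-identityˡ x))) eq) (not-exceptional x m (trans (cong (_* m) (sym (ℕₚ.*-identityˡ x))) eq) notExc)))
        (all-not-exceptional (subproducts ps) (∨-falseʳ (not (regular u)) u∉U))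

      primitive-root-in-progression : ∃ λ b → IsPrimitiveRoot p (toℕ ((u ⊕ val b) ⊗ a))
      primitive-root-in-progression with avoiding-element ps (primeDivisors-divisors p) (primeDivisors-independent p) (primeDivisors-∤1 p) all-balanced (ℕ.>-nonZero⁻¹ B) few
      ... | b , av = b , primitive-root (⊗-nonzero (reg b) a≢𝟘) (λ q pq q∣n → avoids-primes y z p (y b) av q (s≤s (∣⇒≤ {{ℕ.>-nonZero 0<n}} q∣n)) pq q∣n)
        where open import Data.Nat.Divisibility using (∣⇒≤)

-- Greedy construction of an almost invariant subset of the cube.

module Greedy (n : ℕ) (pr : Prime (suc n)) where

  open FiniteSums
  open Trees using (∑-pick′)
  open Fp n pr
  open Sumset n pr
  open AlmostInvariance n pr

  -- Bernoulli's inequality 1 + k/t ≤ (1 + 1/t)^k, denominators cleared.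
  bernoulli : ∀ t k → t ^ k * (t + k) ≤ suc t ^ k * t
  bernoulli t zero = ℕₚ.≤-reflexive (cong (_+ 0) (ℕₚ.+-identityʳ t))
  bernoulli t (suc k) = begin
    t * t ^ k * (t + suc k) ≤⟨ ℕₚ.m≤m+n _ (t ^ k * k) ⟩
    t * t ^ k * (t + suc k) + t ^ k * k ≡⟨ l₁ t k (t ^ k) ⟩
    suc t * (t ^ k * (t + k)) ≤⟨ ℕₚ.*-monoʳ-≤ (suc t) (bernoulli t k) ⟩
    suc t * (suc t ^ k * t) ≡⟨ sym (ℕₚ.*-assoc (suc t) (suc t ^ k) t) ⟩
    suc t ^ suc k * t ∎
    where
    open ℕₚ.≤-Reasoning
    l₁ : ∀ t k x → t * x * (t + suc k) + x * k ≡ suc t * (x * (t + k))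
    l₁ = solve-∀

  doubling-power : ∀ t → 0 < t → 2 * t ^ t ≤ suc t ^ t
  doubling-power t 0<t = ℕₚ.*-cancelʳ-≤ _ _ t {{ℕ.>-nonZero 0<t}} (ℕₚ.≤-trans (ℕₚ.≤-reflexive (l₁ t (t ^ t))) (bernoulli t t))
    where
    l₁ : ∀ t x → 2 * x * t ≡ x * (t + t)
    l₁ = solve-∀

  doubling-powers : ∀ t w → 0 < t → 2 ^ w * t ^ (t * w) ≤ suc t ^ (t * w)
  doubling-powers t w 0<t = begin
    2 ^ w * t ^ (t * w) ≡⟨ cong (2 ^ w *_) (sym (ℕₚ.^-*-assoc t t w)) ⟩
    2 ^ w * (t ^ t) ^ w ≡⟨ sym (^-distrib 2 (t ^ t) w) ⟩
    (2 * t ^ t) ^ w ≤⟨ ℕₚ.^-monoˡ-≤ w (doubling-power t 0<t) ⟩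
    (suc t ^ t) ^ w ≡⟨ ℕₚ.^-*-assoc (suc t) t w ⟩
    suc t ^ (t * w) ∎
    where
    open ℕₚ.≤-Reasoning
    ^-distrib : ∀ a b k → (a * b) ^ k ≡ a ^ k * b ^ k
    ^-distrib a b zero = refl
    ^-distrib a b (suc k) = trans (cong (a * b *_) (^-distrib a b k)) (l₁ a b (a ^ k) (b ^ k))
      where
      l₁ : ∀ a b c d → a * b * (c * d) ≡ a * c * (b * d)
      l₁ = solve-∀

  sumFin-cong : ∀ d {f g : Fin d → ℕ} → (∀ i → f i ≡ g i) → sumFin d f ≡ sumFin d g
  sumFin-cong zero h = refl
  sumFin-cong (suc d) h = cong₂ _+_ (h zero) (sumFin-cong d (h ∘ suc))

  update : ∀ {d} → (Fin d → Bool) → Fin d → Fin d → Bool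
  update f i j = f j ∨ does (j Finₚ.≟ i)

  ∨-false : ∀ c → c ∨ false ≡ c
  ∨-false true = refl
  ∨-false false = refl

  sumFin-update : ∀ d (a : Fin d → ℕ) f i → f i ≡ false →
    sumFin d (λ j → if update f i j then a j else 0) ≡ sumFin d (λ j → if f j then a j else 0) + a i
  sumFin-update (suc d) a f zero h rewrite h = trans (cong (a zero +_) (sumFin-cong d (λ j → cong (λ c → if c then a (suc j) else 0) (∨-false (f (suc j)))))) (ℕₚ.+-comm (a zero) _)
  sumFin-update (suc d) a f (suc i) h = trans (cong₂ _+_ (cong (λ c → if c then a zero else 0) (∨-false (f zero))) (trans (sumFin-cong d same) (sumFin-update d (a ∘ suc) (f ∘ suc) i h))) (sym (ℕₚ.+-assoc (if f zero then a zero else 0) (sumFin d (λ j → if f (suc j) then a (suc j) else 0)) (a (suc i))))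
    where
    same : ∀ j → (if update f (suc i) (suc j) then a (suc j) else 0) ≡ (if update (f ∘ suc) i j then a (suc j) else 0)
    same j with j Finₚ.≟ i
    ... | yes _ = refl
    ... | no _ = refl

  module _ (d : ℕ) (a₀ : ℕ) (a : Fin d → ℕ) (a<p : ∀ i → a i < p) (a-injective : Injective _≡_ _≡_ a) where

    point : (Fin d → Bool) → F
    point f = [ a₀ + sumFin d (λ i → if f i then a i else 0) ]

    point∈cube : ∀ f → InCube p d a₀ a (toℕ (point f))
    point∈cube f = f , toℕ[] _

    InSubcube : (Fin d → Bool) → F → Set
    InSubcube used x = ∃ λ f → (∀ i → f i ≡ true → used i ≡ true) × x ≡ point f

    extend : FSet → F → FSet
    extend S g x = S x ∨ S (x ⊕ ⊖ g)

    ∣extend∣ : ∀ S g → ∣ extend S g ∣ ≡ ∣ S ∣ + escape S g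
    ∣extend∣ S g = trans (∣∣-∨ S (λ x → S (x ⊕ ⊖ g))) (cong (∣ S ∣ +_) (trans (sym (∑-shift (λ x → ⟦ S (x ⊕ ⊖ g) ∧ not (S x) ⟧) g)) (sum-cong-≗ (λ x → cong (λ y → ⟦ S y ∧ not (S (x ⊕ g)) ⟧) (a⊕b⊖b x g)))))

    -- Cube coordinates are 0 or 1, so a generator can be added only if no representation uses it
    -- yet; this is what `used` records.
    extend-subcube : ∀ used S i → used i ≡ false → (∀ x → x ∈ S → InSubcube used x) →
      ∀ x → x ∈ extend S [ a i ] → InSubcube (update used i) x
    extend-subcube used S i i∉ h x x∈ with ∨-elim {S x} x∈
    ... | inj₁ x∈S with h x x∈S
    ...   | f , sub , eq = f , (λ j t → ∨-introˡ (sub j t)) , eq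
    extend-subcube used S i i∉ h x x∈ | inj₂ x∈S with h _ x∈S
    ...   | f , sub , eq = update f i , sub′ , trans (sym (a⊖b⊕b x [ a i ])) (trans (cong (_⊕ [ a i ]) eq) (trans (sym ([]-+ _ (a i))) (cong [_] (trans (ℕₚ.+-assoc a₀ _ (a i)) (cong (a₀ +_) (sym (sumFin-update d a f i fi)))))))
      where
      fi : f i ≡ false
      fi with f i in e
      ... | false = refl
      ... | true = trans (sym (sub i e)) i∉
      sub′ : ∀ j → update f i j ≡ true → update used i j ≡ true
      sub′ j t with ∨-elim {f j} t
      ... | inj₁ e = ∨-introˡ (sub j e)
      ... | inj₂ e = ∨-introʳ {used j} e

    ∣update∣ : ∀ (used : Fin d → Bool) i → used i ≡ false → ∣ update used i ∣ ≡ suc ∣ used ∣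
    ∣update∣ used i i∉ = trans (sum-cong-≗ pt) (trans (∑-distrib-+ (λ j → ⟦ does (j Finₚ.≟ i) ⟧) (λ j → ⟦ used j ⟧)) (cong (_+ ∣ used ∣) (∑-pick′ i)))
      where
      pt : ∀ j → ⟦ update used i j ⟧ ≡ ⟦ does (j Finₚ.≟ i) ⟧ + ⟦ used j ⟧
      pt j with j Finₚ.≟ i
      ... | yes refl rewrite i∉ = refl
      ... | no _ with used j
      ...   | true = refl
      ...   | false = refl

    module _ (t w : ℕ) (0<t : 0 < t) (p<2^w : p < 2 ^ w) where

      record Saturated : Set where
        field
          S : FSet
          used : Fin d → Bool
          used-few : ∣ used ∣ ≤ t * w
          subcube : ∀ x → x ∈ S → InSubcube used x
          nonempty : 0 < ∣ S ∣
          stable : ∀ i → used i ≡ false → t * escape S [ a i ] ≤ ∣ S ∣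

      -- The hypothesis gives (1 + 1/t)^T ≤ ∣S∣ ≤ p < 2^w, whereas T ≥ tw makes the left side at
      -- least 2^w.
      too-large : ∀ T → t * w ≤ T → ∀ (S : FSet) → suc t ^ T ≤ t ^ T * ∣ S ∣ → ⊥
      too-large T tw≤T S h with ℕₚ.m≤n⇒∃[o]m+o≡n tw≤T
      ... | o , refl = ℕₚ.<-irrefl refl (ℕₚ.<-≤-trans (ℕₚ.*-monoʳ-< (t ^ T) {{ℕ.>-nonZero (ℕₚ.m^n>0 t {{ℕ.>-nonZero 0<t}} T)}} p<2^w) (begin
        t ^ T * 2 ^ w ≡⟨ cong (_* 2 ^ w) (ℕₚ.^-distribˡ-+-* t (t * w) o) ⟩
        t ^ (t * w) * t ^ o * 2 ^ w ≡⟨ l₁ (t ^ (t * w)) (t ^ o) (2 ^ w) ⟩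
        2 ^ w * t ^ (t * w) * t ^ o ≤⟨ ℕₚ.*-mono-≤ (doubling-powers t w 0<t) (ℕₚ.^-monoˡ-≤ o (ℕₚ.n≤1+n t)) ⟩
        suc t ^ (t * w) * suc t ^ o ≡⟨ sym (ℕₚ.^-distribˡ-+-* (suc t) (t * w) o) ⟩
        suc t ^ T ≤⟨ h ⟩
        t ^ T * ∣ S ∣ ≤⟨ ℕₚ.*-monoʳ-≤ (t ^ T) (∣∣≤ S) ⟩
        t ^ T * p ∎))
        where
        open ℕₚ.≤-Reasoning
        l₁ : ∀ a b c → a * b * c ≡ c * a * b
        l₁ = solve-∀

      -- As long as an unused generator enlarges S by a factor above 1 + 1/t it is added; since |S| ≤ p this
      -- stops after at most tw steps, and then every remaining generator almost stabilises S.
      grow : ∀ fuel (S : FSet) used → ∣ used ∣ + fuel ≡ t * w → (∀ x → x ∈ S → InSubcube used x) → 0 < ∣ S ∣ →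
        suc t ^ ∣ used ∣ ≤ t ^ ∣ used ∣ * ∣ S ∣ → Saturated
      grow fuel S used eq sub ne large with Finₚ.any? (λ i → (used i Bool.≟ false) ×-dec (∣ S ∣ <? t * escape S [ a i ]))
      ... | no none = record { S = S ; used = used ; used-few = subst (∣ used ∣ ≤_) eq (ℕₚ.m≤m+n _ fuel) ; subcube = sub ; nonempty = ne
                             ; stable = λ i i∉ → ℕₚ.≮⇒≥ (λ lt → none (i , i∉ , lt)) }
      grow zero S used eq sub ne large | yes _ = ⊥-elim (too-large ∣ used ∣ (ℕₚ.≤-reflexive (trans (sym eq) (ℕₚ.+-identityʳ _))) S large)
      grow (suc fuel) S used eq sub ne large | yes (i , i∉ , lt) = grow fuel S′ used′
          (trans (cong (_+ fuel) (∣update∣ used i i∉)) (trans (sym (ℕₚ.+-suc _ fuel)) eq)) (extend-subcube used S i i∉ sub)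
          (ℕₚ.≤-trans ne (ℕₚ.≤-trans (ℕₚ.m≤m+n _ _) (ℕₚ.≤-reflexive (sym (∣extend∣ S [ a i ])))))
          (subst (λ T → suc t ^ T ≤ t ^ T * ∣ S′ ∣) (sym (∣update∣ used i i∉)) (begin
            suc t * suc t ^ ∣ used ∣ ≤⟨ ℕₚ.*-monoʳ-≤ (suc t) large ⟩
            suc t * (t ^ ∣ used ∣ * ∣ S ∣) ≡⟨ l₁ t (t ^ ∣ used ∣) ∣ S ∣ ⟩
            t ^ ∣ used ∣ * (t * ∣ S ∣ + ∣ S ∣) ≤⟨ ℕₚ.*-monoʳ-≤ (t ^ ∣ used ∣) (ℕₚ.+-monoʳ-≤ (t * ∣ S ∣) (ℕₚ.<⇒≤ lt)) ⟩
            t ^ ∣ used ∣ * (t * ∣ S ∣ + t * escape S [ a i ]) ≡⟨ l₂ t (t ^ ∣ used ∣) ∣ S ∣ (escape S [ a i ]) ⟩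
            t * t ^ ∣ used ∣ * (∣ S ∣ + escape S [ a i ]) ≡⟨ cong (t * t ^ ∣ used ∣ *_) (sym (∣extend∣ S [ a i ])) ⟩
            t * t ^ ∣ used ∣ * ∣ S′ ∣ ∎))
        where
        open ℕₚ.≤-Reasoning
        S′ = extend S [ a i ]
        used′ = update used i
        l₁ : ∀ t x s → suc t * (x * s) ≡ x * (t * s + s)
        l₁ = solve-∀
        l₂ : ∀ t x s e → x * (t * s + t * e) ≡ t * x * (s + e)
        l₂ = solve-∀

      saturated : Saturated
      saturated = grow (t * w) (λ x → does (x Finₚ.≟ [ a₀ + 0 ])) (λ _ → false) (cong (_+ t * w) (∑-zero d)) start
        (∣∣-pos {A = λ x → does (x Finₚ.≟ [ a₀ + 0 ])} [ a₀ + 0 ] (dec-true ([ a₀ + 0 ] Finₚ.≟ [ a₀ + 0 ]) refl))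
        (subst (λ T → suc t ^ T ≤ t ^ T * ∣ (λ x → does (x Finₚ.≟ [ a₀ + 0 ])) ∣) (sym (∑-zero d)) (ℕₚ.≤-reflexive (sym (trans (ℕₚ.+-identityʳ _) (∑-pick′ [ a₀ + 0 ])))))
        where
        sumFin-0 : ∀ d → sumFin d (λ _ → 0) ≡ 0
        sumFin-0 zero = refl
        sumFin-0 (suc d) = sumFin-0 d
        start : ∀ x → does (x Finₚ.≟ [ a₀ + 0 ]) ≡ true → InSubcube (λ _ → false) x
        start x h = (λ _ → false) , (λ i ()) , trans (true-dec (x Finₚ.≟ [ a₀ + 0 ]) h) (cong (λ q → [ a₀ + q ]) (sym (sumFin-0 d)))

      open Saturated saturated public

      -- 0 is included so that the sumsets of `X` increase with the number of summands.
      X : FSet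
      X x = does (x Finₚ.≟ 𝟘) ∨ does (Finₚ.any? (λ i → (used i Bool.≟ false) ×-dec ([ a i ] Finₚ.≟ x)))

      𝟘∈X : 𝟘 ∈ X
      𝟘∈X = refl

      X-stable : ∀ x → x ∈ X → t * escape S x ≤ ∣ S ∣
      X-stable x x∈ with ∨-elim {does (x Finₚ.≟ 𝟘)} x∈
      ... | inj₁ e = ℕₚ.≤-trans (ℕₚ.≤-reflexive (trans (cong (λ y → t * escape S y) (true-dec (x Finₚ.≟ 𝟘) e)) (trans (cong (t *_) (escape-𝟘 S)) (ℕₚ.*-zeroʳ t)))) z≤n
      ... | inj₂ e with true-dec (Finₚ.any? (λ i → (used i Bool.≟ false) ×-dec ([ a i ] Finₚ.≟ x))) e
      ...   | i , i∉ , refl = stable i i∉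

      X-large : d ≤ ∣ X ∣ + t * w
      X-large = begin
        d ≡⟨ sym (trans (∑-const d 1) (ℕₚ.*-identityʳ d)) ⟩
        sum {d} (λ _ → 1) ≡⟨ sum-cong-≗ (λ i → one (used i)) ⟩
        sum (λ i → ⟦ not (used i) ⟧ + ⟦ used i ⟧) ≡⟨ ∑-distrib-+ (λ i → ⟦ not (used i) ⟧) (λ i → ⟦ used i ⟧) ⟩
        ∣ (λ i → not (used i)) ∣ + ∣ used ∣ ≤⟨ ℕₚ.+-mono-≤ (∣∣-injection {A = λ i → not (used i)} {B = X} (λ i → [ a i ]) into inj) used-few ⟩
        ∣ X ∣ + t * w ∎
        where
        open ℕₚ.≤-Reasoning
        one : ∀ c → 1 ≡ ⟦ not c ⟧ + ⟦ c ⟧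
        one true = refl
        one false = refl
        unused : ∀ c → not c ≡ true → c ≡ false
        unused false _ = refl
        into : ∀ i → not (used i) ≡ true → [ a i ] ∈ X
        into i h = ∨-introʳ {does ([ a i ] Finₚ.≟ 𝟘)} (dec-true (Finₚ.any? (λ j → (used j Bool.≟ false) ×-dec ([ a j ] Finₚ.≟ [ a i ]))) (i , unused (used i) h , refl))
        inj : ∀ i j → not (used i) ≡ true → not (used j) ≡ true → [ a i ] ≡ [ a j ] → i ≡ j
        inj i j _ _ e = a-injective ([]-injective (a<p i) (a<p j) e)

      S⊆cube : ∀ x → x ∈ S → InCube p d a₀ a (toℕ x)
      S⊆cube x x∈ with subcube x x∈
      ... | f , _ , eq = subst (λ y → InCube p d a₀ a (toℕ y)) (sym eq) (point∈cube f)

-- Choice of the parameters and the resulting contradiction.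

module Contradiction where

  open import Data.Nat
  open import Data.Nat.Properties
  open import Data.Nat.DivMod using (m/n*n≤m; m%n<n; m≡m%n+[m/n]*n)
  open FiniteSums hiding (∣_∣)

  ^-+ : ∀ z i j → z ^ i * z ^ j ≡ z ^ (i + j)
  ^-+ z i j = sym (^-distribˡ-+-* z i j)

  n<2^n : ∀ n → n < 2 ^ n
  n<2^n zero = s≤s z≤n
  n<2^n (suc n) = +-mono-≤ (m^n>0 2 n) (≤-trans (n<2^n n) (≤-reflexive (sym (+-identityʳ _))))

  ^-cancelˡ-< : ∀ k x y → x ^ k < y ^ k → x < y
  ^-cancelˡ-< k x y h with x <? y
  ... | yes x<y = x<y
  ... | no x≮y = ⊥-elim (<⇒≱ h (^-monoˡ-≤ k (≮⇒≥ x≮y)))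

  ^-cancelˡ-≤ : ∀ k x y → .{{_ : NonZero k}} → x ^ k ≤ y ^ k → x ≤ y
  ^-cancelˡ-≤ k x y h with x ≤? y
  ... | yes x≤y = x≤y
  ... | no x≰y = ⊥-elim (<⇒≱ (^-monoˡ-< k (≰⇒> x≰y)) h)

  -- Growth by more than the factor `z` at every step would carry `f` past z^(J+1), hence past `P`.
  slow-growth : ∀ z P (f : ℕ → ℕ) → 1 ≤ f 0 → (∀ j → f j ≤ P) → ∀ J → P ≤ z ^ suc J → ∃ λ j → j ≤ J × f (suc j) ≤ z * f j
  slow-growth z P f 1≤f₀ f≤P J P≤ with run (suc J)
    where
    -- The strict half of the invariant, available after one step, covers the case of equality in
    -- `P ≤ z ^ suc J`.
    run : ∀ J → (∃ λ j → j < J × f (suc j) ≤ z * f j) ⊎ (z ^ J ≤ f J × (0 < J → z ^ J < f J))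
    run zero = inj₂ (1≤f₀ , λ ())
    run (suc J) with run J
    ... | inj₁ (j , j<J , h) = inj₁ (j , <-trans j<J ≤-refl , h)
    ... | inj₂ (h , _) with f (suc J) ≤? z * f J
    ...   | yes le = inj₁ (J , ≤-refl , le)
    ...   | no ≰ = inj₂ (<⇒≤ lt , λ _ → lt)
      where
      lt : z * z ^ J < f (suc J)
      lt = ≤-<-trans (*-monoʳ-≤ z h) (≰⇒> ≰)
  ... | inj₁ (j , j<J , h) = j , ≤-pred j<J , h
  ... | inj₂ (_ , h) = ⊥-elim (<⇒≱ (h (s≤s z≤n)) (≤-trans (f≤P (suc J)) P≤))

  not-false : ∀ b → (b ≡ false → ⊥) → b ≡ true
  not-false true _ = refl
  not-false false h = ⊥-elim (h refl)

  -- In terms of z: p ≈ z^N with N = R², √p ≈ h, B = z^R = p^{1/R}, and all losses are bounded powers of z.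
  module Parameters (n : ℕ) (pr : Prime (suc n)) (s : ℕ) (4≤H : 4 ≤ 2 ^ s) (z : ℕ) where

    private
      p = suc n
      H = 2 ^ s
      R = 2 ^ suc s
      N = R * R
      h = z ^ (R * H)
      ρ = 2 ^ suc (suc s)
      B = z ^ R

    module _ (64≤z : 64 ≤ z) (zᴺ≤p : z ^ N ≤ p) (p≤z·zᴺ : p ≤ z * z ^ N)
      (const : 1 + (4 * ρ * ρ + 16 * ρ + 12) + ρ ^ ρ ≤ z) (N<z : N < z) (12·2ᴺ≤z : 12 * 2 ^ suc N ≤ z)
      (few : 4 ^ length (Sieve.primeDivisors n pr p) < z)
      (d a₀ : ℕ) (a : Fin d → ℕ) (a<p : ∀ i → a i < p) (a-injective : Injective _≡_ _≡_ a)
      (noPR : ∀ x → InCube p d a₀ a x → ¬ IsPrimitiveRoot p x)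
      (large : h * z ^ (6 * R + 22) ≤ d ^ 4) where

      open Sumset n pr using (FSet; _·_; 𝟘∈·; iterated-growth; ⊞-identityʳ-⊆; 𝟘∈⁅𝟘⁆)
      open Fp n pr using (_⊕_; _⊗_; ⊗-distribʳ)
      open ≤-Reasoning

      instance
        z≢0 : NonZero z
        z≢0 = >-nonZero (≤-trans (s≤s z≤n) 64≤z)
        B≢0 : NonZero B
        B≢0 = m^n≢0 z R

      z^-mono : ∀ {i j} → i ≤ j → z ^ i ≤ z ^ j
      z^-mono = ^-monoʳ-≤ z

      2R+16≤RH : 2 * R + 16 ≤ R * H
      2R+16≤RH = begin
        2 * R + 16 ≤⟨ +-monoʳ-≤ (2 * R) (≤-trans (≤-reflexive {16} {2 * (2 * 4)} refl) (*-monoʳ-≤ 2 (*-monoʳ-≤ 2 4≤H))) ⟩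
        2 * R + 2 * R ≡⟨ l₁ R ⟩
        R * 4 ≤⟨ *-monoʳ-≤ R 4≤H ⟩
        R * H ∎
        where
        l₁ : ∀ R → 2 * R + 2 * R ≡ R * 4
        l₁ = solve-∀

      h²≡ : h * h ≡ z ^ N
      h²≡ = trans (^-+ z (R * H) (R * H)) (cong (z ^_) (trans (sym (*-distribˡ-+ R H H)) (cong (R *_) (cong (H +_) (sym (+-identityʳ H))))))

      h²≤p : h * h ≤ p
      h²≤p = ≤-trans (≤-reflexive h²≡) zᴺ≤p

      p≤h²z : p ≤ h * h * z
      p≤h²z = ≤-trans p≤z·zᴺ (≤-reflexive (trans (*-comm z _) (cong (_* z) (sym h²≡))))

      0<h : 0 < h
      0<h = m^n>0 z (R * H)

      z^≤h : ∀ {i} → i ≤ 2 * R + 16 → z ^ i ≤ h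
      z^≤h i≤ = z^-mono (≤-trans i≤ 2R+16≤RH)

      B≤h : B ≤ h
      B≤h = z^≤h (≤-trans (m≤m+n R (R + 0)) (m≤m+n (2 * R) 16))

      h≤p : h ≤ p
      h≤p = ≤-trans (m≤m*n h h {{>-nonZero 0<h}}) h²≤p

      B≤p : B ≤ p
      B≤p = ≤-trans B≤h h≤p

      open Exceptional n pr B {{B≢0}} B≤p hiding (ps)
      open Moments n pr B {{B≢0}} B≤p using (size; size≡; sq; sq≡; val)

      size-s : size (suc s) ≡ z ^ N
      size-s = trans (size≡ (suc s)) (^-*-assoc z R R)

      p≤z·size : p ≤ z * size (suc s)
      p≤z·size = ≤-trans p≤z·zᴺ (≤-reflexive (cong (z *_) (sym size-s)))

      V : FSet
      V = U z (suc s) h 0<h h²≤p p≤h²z p≤z·size few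

      -- z^(2R) is `sq z (suc s)`. Of the four further powers of z, two bound the bracket in `bound`
      -- by h z², one counts subproducts, and one absorbs the irregular elements.
      Z = h * z ^ (2 * R + 4)

      ∣V∣≤Z : FiniteSums.∣ V ∣ ≤ Z
      ∣V∣≤Z = begin
        FiniteSums.∣ V ∣ ≤⟨ ∣U∣≤ z (suc s) h 0<h h²≤p p≤h²z p≤z·size few ⟩
        B + z * (sq z (suc s) * (B + h * z * κ + L * z)) ≤⟨ +-mono-≤ B≤h (*-monoʳ-≤ z (*-monoʳ-≤ (sq z (suc s)) inner)) ⟩
        h + z * (sq z (suc s) * (h * z * z)) ≡⟨ cong (λ q → h + z * (q * (h * z * z))) (trans (sq≡ z (suc s)) refl) ⟩
        h + z * (z ^ (2 * R) * (h * z * z)) ≡⟨ cong (h +_) (l₁ z (z ^ (2 * R)) h) ⟩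
        h + h * (z * (z * (z * z ^ (2 * R)))) ≡⟨ cong (h +_) (cong (h *_) (cong (z ^_) (l₂ (2 * R)))) ⟩
        h + h * z ^ (2 * R + 3) ≤⟨ +-monoˡ-≤ _ (m≤m*n h (z ^ (2 * R + 3)) {{m^n≢0 z (2 * R + 3)}}) ⟩
        h * z ^ (2 * R + 3) + h * z ^ (2 * R + 3) ≡⟨ l₃ (h * z ^ (2 * R + 3)) ⟩
        2 * (h * z ^ (2 * R + 3)) ≤⟨ *-monoˡ-≤ _ (≤-trans (s≤s (s≤s z≤n)) 64≤z) ⟩
        z * (h * z ^ (2 * R + 3)) ≡⟨ l₄ z h (z ^ (2 * R + 3)) ⟩
        h * z ^ suc (2 * R + 3) ≡⟨ cong (λ q → h * z ^ q) (sym (+-suc (2 * R) 3)) ⟩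
        Z ∎
        where
        κ = 4 * ρ * ρ + 16 * ρ + 12
        L = ρ ^ ρ
        l₁ : ∀ z q h → z * (q * (h * z * z)) ≡ h * (z * (z * (z * q)))
        l₁ = solve-∀
        l₂ : ∀ q → suc (suc (suc q)) ≡ q + 3
        l₂ = solve-∀
        l₃ : ∀ q → q + q ≡ 2 * q
        l₃ = solve-∀
        l₄ : ∀ z h q → z * (h * q) ≡ h * (z * q)
        l₄ = solve-∀
        l₅ : ∀ h z k l → h * z + h * z * k + h * z * l ≡ h * z * (1 + k + l)
        l₅ = solve-∀
        l₆ : ∀ h z l → h * z * l ≡ h * (l * z)
        l₆ = solve-∀
        inner : B + h * z * κ + L * z ≤ h * z * z
        inner = begin
          B + h * z * κ + L * z ≤⟨ +-mono-≤ (+-monoˡ-≤ (h * z * κ) (≤-trans B≤h (m≤m*n h z))) (≤-trans (m≤n*m (L * z) h {{>-nonZero 0<h}}) (≤-reflexive (sym (l₆ h z L)))) ⟩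
          h * z + h * z * κ + h * z * L ≡⟨ l₅ h z κ L ⟩
          h * z * (1 + κ + L) ≤⟨ *-monoʳ-≤ (h * z) const ⟩
          h * z * z ∎

      -- `k` must reach 64z³. `w` satisfies p ≤ z^(N+1) < 2^w because z < 2^z. `Y` is such that i₀ =
      -- t / Y keeps the condition `small` at every scale i₀ 2^j with j ≤ N.
      k = z ^ 4
      w = z * suc N
      Y = 2 * (2 + B * B) * (k * 2 ^ suc N)

      p<2^w : p < 2 ^ w
      p<2^w = begin-strict
        p ≤⟨ p≤z·zᴺ ⟩
        z ^ suc N <⟨ ^-monoˡ-< (suc N) (n<2^n z) ⟩
        (2 ^ z) ^ suc N ≡⟨ ^-*-assoc 2 z (suc N) ⟩
        2 ^ w ∎

      Y≤ : Y ≤ z ^ (2 * R + 5)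
      Y≤ = begin
        2 * (2 + B * B) * (k * 2 ^ suc N) ≤⟨ *-monoˡ-≤ (k * 2 ^ suc N) (*-monoʳ-≤ 2 (+-monoˡ-≤ (B * B) (*-monoʳ-≤ 2 (>-nonZero⁻¹ (B * B) {{m*n≢0 B B}})))) ⟩
        2 * (2 * (B * B) + B * B) * (k * 2 ^ suc N) ≤⟨ ≤-trans (≤-reflexive (l₁ (B * B) k (2 ^ suc N))) (*-monoʳ-≤ (B * B * k) (≤-trans (*-monoˡ-≤ (2 ^ suc N) (m≤m+n 6 6)) 12·2ᴺ≤z)) ⟩
        B * B * k * z ≡⟨ cong (λ q → q * k * z) (^-+ z R R) ⟩
        z ^ (R + R) * z ^ 4 * z ≡⟨ cong (_* z) (^-+ z (R + R) 4) ⟩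
        z ^ (R + R + 4) * z ≡⟨ *-comm _ z ⟩
        z ^ suc (R + R + 4) ≡⟨ cong (z ^_) (l₂ R) ⟩
        z ^ (2 * R + 5) ∎
        where
        l₁ : ∀ b k q → 2 * (2 * b + b) * (k * q) ≡ b * k * (6 * q)
        l₁ = solve-∀
        l₂ : ∀ R → suc (R + R + 4) ≡ 2 * R + 5
        l₂ = solve-∀

      w≤z² : w ≤ z * z
      w≤z² = *-monoʳ-≤ z N<z

      4wY≤ : 4 * (w * Y) ≤ z ^ (2 * R + 8)
      4wY≤ = begin
        4 * (w * Y) ≤⟨ *-mono-≤ (≤-trans (m≤m+n 4 60) 64≤z) (*-mono-≤ w≤z² Y≤) ⟩
        z * (z * z * z ^ (2 * R + 5)) ≡⟨ l₁ z (z ^ (2 * R + 5)) ⟩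
        z * (z * (z * z ^ (2 * R + 5))) ≡⟨ cong (z ^_) (l₂ (2 * R)) ⟩
        z ^ (2 * R + 8) ∎
        where
        l₁ : ∀ z q → z * (z * z * q) ≡ z * (z * (z * q))
        l₁ = solve-∀
        l₂ : ∀ q → suc (suc (suc (q + 5))) ≡ q + 8
        l₂ = solve-∀

      d≥ : z ^ (2 * R + 8) ≤ d
      d≥ = ^-cancelˡ-≤ 4 _ _ (begin
        (z ^ (2 * R + 8)) ^ 4 ≡⟨ ^-*-assoc z (2 * R + 8) 4 ⟩
        z ^ ((2 * R + 8) * 4) ≡⟨ cong (z ^_) (l₁ R) ⟩
        z ^ (2 * R + 10 + (6 * R + 22)) ≡⟨ sym (^-+ z (2 * R + 10) (6 * R + 22)) ⟩
        z ^ (2 * R + 10) * z ^ (6 * R + 22) ≤⟨ *-monoˡ-≤ _ (z^≤h (+-monoʳ-≤ (2 * R) (m≤m+n 10 6))) ⟩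
        h * z ^ (6 * R + 22) ≤⟨ large ⟩
        d ^ 4 ∎)
        where
        l₁ : ∀ R → (2 * R + 8) * 4 ≡ 2 * R + 10 + (6 * R + 22)
        l₁ = solve-∀

      instance
        2w≢0 : NonZero (2 * w)
        2w≢0 = m*n≢0 2 w {{_}} {{m*n≢0 z (suc N)}}
        Y≢0 : NonZero Y
        Y≢0 = m*n≢0 (2 * (2 + B * B)) (k * 2 ^ suc N) {{_}} {{m*n≢0 k (2 ^ suc N) {{m^n≢0 z 4}} {{m^n≢0 2 (suc N)}}}}

      -- The greedy process uses at most tw ≤ d/2 generators, so half of them remain for `X`.
      t = d / (2 * w)
      i₀ = t / Y

      2wt≤d : t * (2 * w) ≤ d
      2wt≤d = m/n*n≤m d (2 * w)

      d<2w[t+1] : d < suc t * (2 * w)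
      d<2w[t+1] = subst (_< suc t * (2 * w)) (sym (m≡m%n+[m/n]*n d (2 * w))) (+-monoˡ-< (t * (2 * w)) (m%n<n d (2 * w)))

      Yi₀≤t : i₀ * Y ≤ t
      Yi₀≤t = m/n*n≤m t Y

      t<Y[i₀+1] : t < suc i₀ * Y
      t<Y[i₀+1] = subst (_< suc i₀ * Y) (sym (m≡m%n+[m/n]*n t Y)) (+-monoˡ-< (i₀ * Y) (m%n<n t Y))

      d≤ : d ≤ suc i₀ * (2 * (w * Y))
      d≤ = begin
        d ≤⟨ <⇒≤ d<2w[t+1] ⟩
        suc t * (2 * w) ≤⟨ *-monoˡ-≤ (2 * w) t<Y[i₀+1] ⟩
        suc i₀ * Y * (2 * w) ≡⟨ l₁ (suc i₀) Y w ⟩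
        suc i₀ * (2 * (w * Y)) ∎
        where
        l₁ : ∀ i y w → i * y * (2 * w) ≡ i * (2 * (w * y))
        l₁ = solve-∀

      1≤i₀ : 1 ≤ i₀
      1≤i₀ with i₀ in eq
      ... | suc _ = s≤s z≤n
      ... | zero = ⊥-elim (<⇒≱ {d} {d} (begin-strict
        d ≤⟨ subst (λ q → d ≤ suc q * (2 * (w * Y))) eq d≤ ⟩
        1 * (2 * (w * Y)) ≡⟨ *-identityˡ _ ⟩
        2 * (w * Y) <⟨ *-monoˡ-< (w * Y) {{m*n≢0 w Y {{m*n≢0 z (suc N)}}}} {2} {4} (s≤s (s≤s (s≤s z≤n))) ⟩
        4 * (w * Y) ≤⟨ 4wY≤ ⟩
        z ^ (2 * R + 8) ≤⟨ d≥ ⟩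
        d ∎) ≤-refl)

      d≤z^·i₀ : d ≤ z ^ (2 * R + 8) * i₀
      d≤z^·i₀ = begin
        d ≤⟨ d≤ ⟩
        suc i₀ * (2 * (w * Y)) ≤⟨ *-monoˡ-≤ (2 * (w * Y)) (+-monoˡ-≤ i₀ 1≤i₀) ⟩
        (i₀ + i₀) * (2 * (w * Y)) ≡⟨ l₁ i₀ (w * Y) ⟩
        4 * (w * Y) * i₀ ≤⟨ *-monoˡ-≤ i₀ 4wY≤ ⟩
        z ^ (2 * R + 8) * i₀ ∎
        where
        l₁ : ∀ i y → (i + i) * (2 * y) ≡ 4 * y * i
        l₁ = solve-∀

      0<t : 0 < t
      0<t = ≤-trans 1≤i₀ (≤-trans (m≤m*n i₀ Y) Yi₀≤t)

      module G = Greedy n pr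
      S X : FSet
      S = G.S d a₀ a a<p a-injective t w 0<t p<2^w
      X = G.X d a₀ a a<p a-injective t w 0<t p<2^w

      𝟘∈X : Fp.𝟘 n pr ∈ X
      𝟘∈X = G.𝟘∈X d a₀ a a<p a-injective t w 0<t p<2^w

      d≤2∣X∣ : d ≤ 2 * FiniteSums.∣ X ∣
      d≤2∣X∣ = +-cancelʳ-≤ d _ _ (begin
        d + d ≡⟨ l₁ d ⟩
        2 * d ≤⟨ *-monoʳ-≤ 2 (G.X-large d a₀ a a<p a-injective t w 0<t p<2^w) ⟩
        2 * (FiniteSums.∣ X ∣ + t * w) ≡⟨ l₂ FiniteSums.∣ X ∣ t w ⟩
        2 * FiniteSums.∣ X ∣ + t * (2 * w) ≤⟨ +-monoʳ-≤ (2 * FiniteSums.∣ X ∣) 2wt≤d ⟩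
        2 * FiniteSums.∣ X ∣ + d ∎)
        where
        l₁ : ∀ d → d + d ≡ 2 * d
        l₁ = solve-∀
        l₂ : ∀ x t w → 2 * (x + t * w) ≡ 2 * x + t * (2 * w)
        l₂ = solve-∀

      2≤∣X∣ : 2 ≤ FiniteSums.∣ X ∣
      2≤∣X∣ = *-cancelˡ-≤ 2 (begin
        4 ≤⟨ ≤-trans (m≤m+n 4 60) 64≤z ⟩
        z ≡⟨ sym (*-identityʳ z) ⟩
        z ^ 1 ≤⟨ z^-mono (≤-trans (m≤n+m 1 7) (≤-trans (≤-reflexive {8} refl) (m≤n+m 8 (2 * R)))) ⟩
        z ^ (2 * R + 8) ≤⟨ d≥ ⟩
        d ≤⟨ d≤2∣X∣ ⟩
        2 * FiniteSums.∣ X ∣ ∎)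

      ℓ : ℕ → ℕ
      ℓ j = k * (i₀ * 2 ^ j)

      -- The sumset sizes lie between 1 and p ≤ z^(N+1), so one of the N + 1 doublings of the scale
      -- enlarges the sumset at most z-fold.
      scale : ∃ λ j → j ≤ N × FiniteSums.∣ ℓ (suc j) · X ∣ ≤ z * FiniteSums.∣ ℓ j · X ∣
      scale = slow-growth z p (λ j → FiniteSums.∣ ℓ j · X ∣) (∣∣-pos {A = ℓ 0 · X} (Fp.𝟘 n pr) (𝟘∈· (ℓ 0) 𝟘∈X)) (λ j → ∣∣≤ (ℓ j · X)) N p≤z·zᴺ

      j = proj₁ scale
      i = i₀ * 2 ^ j

      i₀≤i : i₀ ≤ i
      i₀≤i = m≤m*n i₀ (2 ^ j) {{m^n≢0 2 j}}

      ℓ+ℓ : k * i + k * i ≡ ℓ (suc j)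
      ℓ+ℓ = l₁ k i₀ (2 ^ j)
        where
        l₁ : ∀ k i q → k * (i * q) + k * (i * q) ≡ k * (i * (2 * q))
        l₁ = solve-∀

      small : 2 * (2 + B * B) * (k * i) ≤ t
      small = begin
        2 * (2 + B * B) * (k * (i₀ * 2 ^ j)) ≤⟨ *-monoʳ-≤ (2 * (2 + B * B)) (*-monoʳ-≤ k (*-monoʳ-≤ i₀ (^-monoʳ-≤ 2 (≤-trans (proj₁ (proj₂ scale)) (n≤1+n N))))) ⟩
        2 * (2 + B * B) * (k * (i₀ * 2 ^ suc N)) ≡⟨ l₁ (2 * (2 + B * B)) k i₀ (2 ^ suc N) ⟩
        i₀ * Y ≤⟨ Yi₀≤t ⟩
        t ∎
        where
        l₁ : ∀ b k i q → b * (k * (i * q)) ≡ i * (b * (k * q))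
        l₁ = solve-∀

      αᵢ = FiniteSums.∣ i · X ∣

      X⊆iX : X ⊆ i · X
      X⊆iX x x∈ = AlmostInvariance.·-mono n pr {1} {i} {X} 𝟘∈X (≤-trans 1≤i₀ i₀≤i) x (⊞-identityʳ-⊆ {X} {0 · X} 𝟘∈⁅𝟘⁆ x x∈)

      2≤αᵢ : 2 ≤ αᵢ
      2≤αᵢ = ≤-trans 2≤∣X∣ (∣∣-mono {A = X} {B = i · X} X⊆iX)

      h·z^≤h² : ∀ {e} → e ≤ 2 * R + 16 → h * z ^ e ≤ p
      h·z^≤h² e≤ = ≤-trans (*-monoʳ-≤ h (z^≤h e≤)) h²≤p

      -- This is the source of the exponent 1/8. Since d ≤ z^(2R+8) i and d ≤ 2∣X∣, Cauchy-Davenport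
      -- gives d² ≤ z^(2R+9) αᵢ unless the sumset is everything, and αᵢ² has to reach Z, about √p.
      -- The exponent 6R + 22 in `large` is (2R + 4) + 2(2R + 9).
      Z≤αᵢ² : h * z ^ (2 * R + 4) ≤ αᵢ * αᵢ
      Z≤αᵢ² = Sum.[ saturated , grows ]′ (iterated-growth i X 𝟘∈X 2≤∣X∣)
        where
        saturated : p ≤ αᵢ → h * z ^ (2 * R + 4) ≤ αᵢ * αᵢ
        saturated p≤ = ≤-trans (h·z^≤h² (+-monoʳ-≤ (2 * R) (m≤m+n 4 12))) (≤-trans p≤ (m≤m*n αᵢ αᵢ {{>-nonZero (≤-trans (s≤s z≤n) 2≤αᵢ)}}))
        grows : i * FiniteSums.∣ X ∣ ≤ 2 * αᵢ → h * z ^ (2 * R + 4) ≤ αᵢ * αᵢ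
        grows grown = *-cancelʳ-≤ _ _ (z ^ (4 * R + 18)) {{m^n≢0 z (4 * R + 18)}} (begin
          h * z ^ (2 * R + 4) * z ^ (4 * R + 18) ≡⟨ trans (*-assoc h _ _) (cong (h *_) (trans (^-+ z (2 * R + 4) (4 * R + 18)) (cong (z ^_) (l₁ R)))) ⟩
          h * z ^ (6 * R + 22) ≤⟨ large ⟩
          d ^ 4 ≡⟨ l₂ d ⟩
          (d * d) * (d * d) ≤⟨ *-mono-≤ d²≤ d²≤ ⟩
          (z ^ (2 * R + 9) * αᵢ) * (z ^ (2 * R + 9) * αᵢ) ≡⟨ l₃ (z ^ (2 * R + 9)) αᵢ ⟩
          αᵢ * αᵢ * (z ^ (2 * R + 9) * z ^ (2 * R + 9)) ≡⟨ cong (αᵢ * αᵢ *_) (trans (^-+ z (2 * R + 9) (2 * R + 9)) (cong (z ^_) (l₄ R))) ⟩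
          αᵢ * αᵢ * z ^ (4 * R + 18) ∎)
          where
          l₁ : ∀ R → 2 * R + 4 + (4 * R + 18) ≡ 6 * R + 22
          l₁ = solve-∀
          l₂ : ∀ d → d * (d * (d * (d * 1))) ≡ (d * d) * (d * d)
          l₂ = solve-∀
          l₃ : ∀ q a → (q * a) * (q * a) ≡ a * a * (q * q)
          l₃ = solve-∀
          l₄ : ∀ R → 2 * R + 9 + (2 * R + 9) ≡ 4 * R + 18
          l₄ = solve-∀
          l₅ : ∀ q i x → q * i * (2 * x) ≡ 2 * q * (i * x)
          l₅ = solve-∀
          l₆ : ∀ q a → 2 * q * (2 * a) ≡ 4 * q * a
          l₆ = solve-∀
          d²≤ : d * d ≤ z ^ (2 * R + 9) * αᵢ
          d²≤ = begin
            d * d ≤⟨ *-mono-≤ (≤-trans d≤z^·i₀ (*-monoʳ-≤ (z ^ (2 * R + 8)) i₀≤i)) d≤2∣X∣ ⟩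
            z ^ (2 * R + 8) * i * (2 * FiniteSums.∣ X ∣) ≡⟨ l₅ (z ^ (2 * R + 8)) i FiniteSums.∣ X ∣ ⟩
            2 * z ^ (2 * R + 8) * (i * FiniteSums.∣ X ∣) ≤⟨ *-monoʳ-≤ (2 * z ^ (2 * R + 8)) grown ⟩
            2 * z ^ (2 * R + 8) * (2 * αᵢ) ≡⟨ l₆ (z ^ (2 * R + 8)) αᵢ ⟩
            4 * z ^ (2 * R + 8) * αᵢ ≤⟨ *-monoˡ-≤ αᵢ (*-monoˡ-≤ (z ^ (2 * R + 8)) (≤-trans (m≤m+n 4 60) 64≤z)) ⟩
            z * z ^ (2 * R + 8) * αᵢ ≡⟨ cong (λ e → z ^ e * αᵢ) (sym (+-suc (2 * R) 8)) ⟩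
            z ^ (2 * R + 9) * αᵢ ∎

      z³·c≤k : ∀ c → c ≤ z → c * (z * z * z) ≤ k
      z³·c≤k c c≤z = ≤-trans (*-monoˡ-≤ (z * z * z) c≤z) (≤-reflexive (l₁ z))
        where
        l₁ : ∀ z → z * (z * z * z) ≡ z * (z * (z * (z * 1)))
        l₁ = solve-∀

      cond₁ : 32 * (z * z * z) * Z ≤ p
      cond₁ = begin
        32 * (z * z * z) * (h * z ^ (2 * R + 4)) ≤⟨ *-monoˡ-≤ Z (z³·c≤k 32 (≤-trans (m≤m+n 32 32) 64≤z)) ⟩
        z ^ 4 * (h * z ^ (2 * R + 4)) ≡⟨ l₁ (z ^ 4) h (z ^ (2 * R + 4)) ⟩
        h * (z ^ 4 * z ^ (2 * R + 4)) ≡⟨ cong (h *_) (^-+ z 4 (2 * R + 4)) ⟩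
        h * z ^ (4 + (2 * R + 4)) ≤⟨ h·z^≤h² (≤-trans (≤-reflexive (l₂ (2 * R))) (+-monoʳ-≤ (2 * R) (m≤m+n 8 8))) ⟩
        p ∎
        where
        l₁ : ∀ a h b → a * (h * b) ≡ h * (a * b)
        l₁ = solve-∀
        l₂ : ∀ q → 4 + (q + 4) ≡ q + 8
        l₂ = solve-∀

      captures : ∀ u x → x ≢ Fp.𝟘 n pr → (∀ b → u ⊗ x ⊕ val b ⊗ x ∈ S) → u ∈ V
      captures u x x≢𝟘 inS = not-false (V u) λ u∉V →
        let b , isPR = primitive-root-in-progression z (suc s) h 0<h h²≤p p≤h²z p≤z·size few u x x≢𝟘 u∉V in
        noPR _ (G.S⊆cube d a₀ a a<p a-injective t w 0<t p<2^w _ (inS b)) (subst (λ y → IsPrimitiveRoot p (toℕ y)) (⊗-distribʳ x u (val b)) isPR)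

      impossible : ⊥
      impossible = AlmostInvariance.Ratios.contradiction n pr S X 𝟘∈X t 0<t (G.X-stable d a₀ a a<p a-injective t w 0<t p<2^w) (G.nonempty d a₀ a a<p a-injective t w 0<t p<2^w)
        B i k small 2≤αᵢ (m^n>0 z 4) V Z z captures ∣V∣≤Z
        (subst (λ q → FiniteSums.∣ q · X ∣ ≤ z * FiniteSums.∣ ℓ j · X ∣) (sym ℓ+ℓ) (proj₂ (proj₂ scale))) cond₁
        (*-mono-≤ (z³·c≤k 64 64≤z) Z≤αᵢ²) (z³·c≤k 64 64≤z)

-- From powers of z to powers of p.

open import Data.Nat
open import Data.Nat.Properties
open import Data.Nat.Primality using (Prime; ¬prime[0])
open Contradiction

integer-root : ∀ N p → .{{NonZero N}} → ∃ λ z → z ^ N ≤ p × p < suc z ^ N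
integer-root (suc N) zero = 0 , z≤n , m^n>0 1 (suc N)
integer-root N (suc p) with integer-root N p
... | z , le , lt with suc z ^ N ≤? suc p
...   | yes le′ = suc z , le′ , <-≤-trans (s≤s lt) (^-monoˡ-< N ≤-refl)
...   | no ≰ = z , m≤n⇒m≤1+n le , ≰⇒> ≰

^-distrib-* : ∀ x y k → (x * y) ^ k ≡ x ^ k * y ^ k
^-distrib-* x y zero = refl
^-distrib-* x y (suc k) = trans (cong (x * y *_) (^-distrib-* x y k)) (l₁ x y (x ^ k) (y ^ k))
  where
  l₁ : ∀ x y u v → x * y * (u * v) ≡ x * u * (y * v)
  l₁ = solve-∀

summands≤ : ∀ a b c d e f {z} → a + (b + (c + (d + (e + f)))) ≤ z → a ≤ z × b ≤ z × c ≤ z × d ≤ z × e ≤ z × f ≤ z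
summands≤ a b c d e f h = m+n≤o⇒m≤o a h , m+n≤o⇒m≤o b h₁ , m+n≤o⇒m≤o c h₂ , m+n≤o⇒m≤o d h₃ , m+n≤o⇒m≤o e h₄ , m+n≤o⇒n≤o e h₄
  where
  h₁ = m+n≤o⇒n≤o a h
  h₂ = m+n≤o⇒n≤o b h₁
  h₃ = m+n≤o⇒n≤o c h₂
  h₄ = m+n≤o⇒n≤o d h₃

module Exponents (a b s : ℕ) (0<a : 0 < a) (4≤H : 4 ≤ 2 ^ s) (6b≤R : 6 * b ≤ 2 ^ suc s) where

  H = 2 ^ s
  R = 2 ^ suc s
  N = R * R
  ρ = 2 ^ suc (suc s)
  -- With this `W`, `omega-bound` reads (4^ω)^(N+3) ≤ p W^W, which is below z^(N+3) once W^W ≤ z;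
  -- hence 4^ω < z.
  W = 4 ^ (N + 3)
  c₁ = 1 + (4 * ρ * ρ + 16 * ρ + 12) + ρ ^ ρ

  abstract
    -- The sum of all lower bounds that z has to satisfy, so each follows as a summand.
    z₀ : ℕ
    z₀ = W ^ W + (64 + (c₁ + (suc N + (12 * 2 ^ suc N + 2 ^ N))))

    z₀-large : ∀ {z} → z₀ ≤ z → W ^ W ≤ z × 64 ≤ z × c₁ ≤ z × suc N ≤ z × 12 * 2 ^ suc N ≤ z × 2 ^ N ≤ z
    z₀-large = summands≤ (W ^ W) 64 c₁ (suc N) (12 * 2 ^ suc N) (2 ^ N)

  8≤R : 8 ≤ R
  8≤R = *-monoʳ-≤ 2 4≤H

  instance
    N≢0 : NonZero N
    N≢0 = m*n≢0 R R {{m^n≢0 2 (suc s)}} {{m^n≢0 2 (suc s)}}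

  -- 6R + 22 ≤ 24R, so the loss in d itself is at most z^(6R), about p^(6/R). This is within p^(a/b)
  -- as soon as `6 * b ≤ R` and a ≥ 1.
  exponent : (6 * R + 22) * (2 * b) ≤ N * (8 * a)
  exponent = begin
    (6 * R + 22) * (2 * b) ≤⟨ *-monoˡ-≤ (2 * b) (+-monoʳ-≤ (6 * R) (≤-trans (≤-trans (m≤m+n 22 122) (≤-reflexive refl)) (*-monoʳ-≤ 18 8≤R))) ⟩
    (6 * R + 18 * R) * (2 * b) ≡⟨ l₁ R b ⟩
    R * (6 * b) * 8 ≤⟨ *-mono-≤ (*-monoʳ-≤ R 6b≤R) (*-monoʳ-≤ 8 0<a) ⟩
    R * R * (8 * a) ∎
    where
    open ≤-Reasoning
    l₁ : ∀ R b → (6 * R + 18 * R) * (2 * b) ≡ R * (6 * b) * 8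
    l₁ = solve-∀

  module _ (n : ℕ) (pp : Prime (suc n)) (d : ℕ) (cube : CubeWithoutPR (suc n) pp d) where

    private
      p = suc n
      a₀ = proj₁ cube
      g : Fin d → ℕ
      g = proj₁ (proj₂ cube)
      g<p : ∀ i → g i < p
      g<p = proj₁ (proj₂ (proj₂ (proj₂ cube)))
      g-injective : Injective _≡_ _≡_ g
      g-injective = proj₁ (proj₂ (proj₂ (proj₂ (proj₂ cube))))
      noPR : ∀ x → InCube p d a₀ g x → ¬ IsPrimitiveRoot p x
      noPR = proj₂ (proj₂ (proj₂ (proj₂ (proj₂ cube))))

    d≤p : d ≤ p
    d≤p = Finₚ.injective⇒≤ {f = λ i → fromℕ< (g<p i)} λ {i} {j} e →
      g-injective (trans (sym (Finₚ.toℕ-fromℕ< (g<p i))) (trans (cong toℕ e) (Finₚ.toℕ-fromℕ< (g<p j))))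

    module _ (z : ℕ) (zᴺ≤p : z ^ N ≤ p) (p<[z+1]ᴺ : p < suc z ^ N) where

      open ≤-Reasoning

      small-p : z < z₀ → d ≤ z₀ ^ N
      small-p z<z₀ = ≤-trans d≤p (≤-trans (<⇒≤ p<[z+1]ᴺ) (^-monoˡ-≤ N z<z₀))

      module _ (z₀≤z : z₀ ≤ z) where

        Wᵂ≤z : W ^ W ≤ z
        Wᵂ≤z = proj₁ (z₀-large z₀≤z)

        64≤z : 64 ≤ z
        64≤z = proj₁ (proj₂ (z₀-large z₀≤z))

        c₁≤z : c₁ ≤ z
        c₁≤z = proj₁ (proj₂ (proj₂ (z₀-large z₀≤z)))

        N<z : N < z
        N<z = proj₁ (proj₂ (proj₂ (proj₂ (z₀-large z₀≤z))))

        12·2ᴺ≤z : 12 * 2 ^ suc N ≤ z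
        12·2ᴺ≤z = proj₁ (proj₂ (proj₂ (proj₂ (proj₂ (z₀-large z₀≤z)))))

        2ᴺ≤z : 2 ^ N ≤ z
        2ᴺ≤z = proj₂ (proj₂ (proj₂ (proj₂ (proj₂ (z₀-large z₀≤z)))))

        instance
          z≢0 : NonZero z
          z≢0 = >-nonZero (≤-trans (s≤s z≤n) 64≤z)

        p≤z·zᴺ : p ≤ z * z ^ N
        p≤z·zᴺ = begin
          p ≤⟨ <⇒≤ p<[z+1]ᴺ ⟩
          suc z ^ N ≤⟨ ^-monoˡ-≤ N (+-mono-≤ (>-nonZero⁻¹ z) (≤-reflexive (sym (+-identityʳ z)))) ⟩
          (2 * z) ^ N ≡⟨ ^-distrib-* 2 z N ⟩
          2 ^ N * z ^ N ≤⟨ *-monoˡ-≤ (z ^ N) 2ᴺ≤z ⟩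
          z * z ^ N ∎

        few : 4 ^ length (Sieve.primeDivisors n pp p) < z
        few = ^-cancelˡ-< (N + 3) (4 ^ ω) z (begin-strict
          (4 ^ ω) ^ (N + 3) ≡⟨ trans (^-*-assoc 4 ω (N + 3)) (trans (cong (4 ^_) (*-comm ω (N + 3))) (sym (^-*-assoc 4 (N + 3) ω))) ⟩
          W ^ ω ≤⟨ Sieve.omega-bound n pp W (m^n>0 4 (N + 3)) ⟩
          p * W ^ W ≤⟨ *-mono-≤ p≤z·zᴺ Wᵂ≤z ⟩
          z * z ^ N * z ≡⟨ *-comm (z * z ^ N) z ⟩
          z ^ (2 + N) <⟨ ^-monoʳ-< z (≤-trans (s≤s (s≤s z≤n)) 64≤z) {2 + N} {3 + N} ≤-refl ⟩
          z ^ (3 + N) ≡⟨ cong (z ^_) (+-comm 3 N) ⟩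
          z ^ (N + 3) ∎)
          where ω = length (Sieve.primeDivisors n pp p)

        h = z ^ (R * H)

        d⁴≤ : d ^ 4 ≤ h * z ^ (6 * R + 22)
        d⁴≤ = ≮⇒≥ λ lt → Parameters.impossible n pp s 4≤H z 64≤z zᴺ≤p p≤z·zᴺ c₁≤z N<z 12·2ᴺ≤z few d a₀ g g<p g-injective noPR (<⇒≤ lt)

        h²≡ : h ^ 2 ≡ z ^ N
        h²≡ = trans (^-*-assoc z (R * H) 2) (cong (z ^_) (trans (*-assoc R H 2) (cong (R *_) (*-comm H 2))))

        large-p : d ^ (8 * b) ≤ p ^ (b + 8 * a)
        large-p = begin
          d ^ (8 * b) ≡⟨ trans (cong (d ^_) (l₁ b)) (sym (^-*-assoc d 4 (2 * b))) ⟩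
          (d ^ 4) ^ (2 * b) ≤⟨ ^-monoˡ-≤ (2 * b) d⁴≤ ⟩
          (h * z ^ (6 * R + 22)) ^ (2 * b) ≡⟨ ^-distrib-* h (z ^ (6 * R + 22)) (2 * b) ⟩
          h ^ (2 * b) * (z ^ (6 * R + 22)) ^ (2 * b) ≡⟨ cong₂ _*_ (trans (sym (^-*-assoc h 2 b)) (trans (cong (_^ b) h²≡) (^-*-assoc z N b))) (^-*-assoc z (6 * R + 22) (2 * b)) ⟩
          z ^ (N * b) * z ^ ((6 * R + 22) * (2 * b)) ≤⟨ *-monoʳ-≤ (z ^ (N * b)) (^-monoʳ-≤ z exponent) ⟩
          z ^ (N * b) * z ^ (N * (8 * a)) ≡⟨ trans (^-+ z (N * b) (N * (8 * a))) (cong (z ^_) (sym (*-distribˡ-+ N b (8 * a)))) ⟩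
          z ^ (N * (b + 8 * a)) ≡⟨ sym (^-*-assoc z N (b + 8 * a)) ⟩
          (z ^ N) ^ (b + 8 * a) ≤⟨ ^-monoˡ-≤ (b + 8 * a) zᴺ≤p ⟩
          p ^ (b + 8 * a) ∎
          where
          l₁ : ∀ b → 8 * b ≡ 4 * (2 * b)
          l₁ = solve-∀

-- The real ε is replaced by a rational a/b; the 8b-th power of d ≤ C p^(1/8 + a/b) involves natural
-- numbers only.
theorem1p2 : (a b : ℕ) → 0 < a → 0 < b →
    Σ ℕ λ C → (0 < C) × ((p : ℕ) → (pp : Prime p) → (d : ℕ) →
    CubeWithoutPR p pp d → d ^ (8 * b) ≤ C ^ (8 * b) * p ^ (b + 8 * a))
theorem1p2 a b 0<a 0<b = C , 0<C , bound
  where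
  s = 6 * b + 2
  4≤H : 4 ≤ 2 ^ s
  4≤H = ^-monoʳ-≤ 2 (m≤n+m 2 (6 * b))
  6b≤R : 6 * b ≤ 2 ^ suc s
  6b≤R = ≤-trans (m≤m+n (6 * b) 2) (≤-trans (<⇒≤ (n<2^n s)) (m≤m+n (2 ^ s) (2 ^ s + 0)))
  open Exponents a b s 0<a 4≤H 6b≤R
  C : ℕ
  C = z₀ ^ N
  0<C : 0 < C
  0<C = m^n>0 z₀ {{>-nonZero (≤-trans (s≤s z≤n) (proj₁ (proj₂ (z₀-large ≤-refl))))}} N
  bound : (p : ℕ) → (pp : Prime p) → (d : ℕ) → CubeWithoutPR p pp d → d ^ (8 * b) ≤ C ^ (8 * b) * p ^ (b + 8 * a)
  bound zero pp d _ = ⊥-elim (¬prime[0] pp)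
  bound (suc n) pp d cube with integer-root N (suc n)
  ... | z , zᴺ≤p , p<[z+1]ᴺ with z <? z₀
  -- Here p is bounded by z₀^N, so the trivial d ≤ p is absorbed by the constant.
  ...   | yes z<z₀ = ≤-trans (^-monoˡ-≤ (8 * b) (small-p n pp d cube z zᴺ≤p p<[z+1]ᴺ z<z₀)) (m≤m*n _ (suc n ^ (b + 8 * a)) {{m^n≢0 (suc n) (b + 8 * a)}})
  ...   | no z≮z₀ = ≤-trans (large-p n pp d cube z zᴺ≤p p<[z+1]ᴺ (≮⇒≥ z≮z₀)) (m≤n*m _ (C ^ (8 * b)) {{m^n≢0 C (8 * b) {{>-nonZero 0<C}}}})
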